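{- Let $q$ be a prime power of the form $q=12c^2+4c+3$ for some integer $c$, and let $n=q^2$. Then there exists a difference family with parameters $(2n;n,n,n,n-1;2n-2)$ in the additive abelian group $\mathbb{Z}_2\times(\mathbb{F}_{q^2},+)$.
   Context: Let $(G,+)$ be a finite abelian group. For subsets $B_1,\dots,B_\ell$ of $G$ with $|B_i|=k_i$, the collection $\{B_1,\dots,B_\ell\}$ is a difference family with parameters $(v;k_1,\dots,k_\ell;\lambda)$ in $G$ (where $v=|G|$) if the multiset of differences $x-y$ with $x,y\in B_i$, $x\neq y$, $i=1,\dots,\ell$, contains every nonzero element of $G$ exactly $\lambda$ times. -}

module Defs where

open import Data.Nat using (ℕ; zero; suc; _+_; _∸_)
open import Data.Nat.DivMod using (_mod_)
open import Data.Fin as Fin using (Fin; toℕ)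
open import Data.Fin.Properties renaming (_≟_ to _≟F_)
open import Data.Vec as Vec using (Vec)
import Data.Vec.Properties as VecP
import Data.Product.Properties as ProdP
open import Data.Product using (_×_; _,_; proj₁; proj₂)
open import Data.List using (List; length; filter; cartesianProduct; map)
open import Data.Nat.ListAction using (sum)
open import Data.List.Relation.Unary.All using (All)
import Data.Vec.Relation.Unary.All as VAll
open import Data.List.Relation.Unary.Unique.Propositional using (Unique)
open import Relation.Nullary using (¬_; ¬?)
open import Relation.Nullary.Decidable using (_×-dec_)
open import Relation.Binary.PropositionalEquality using (_≡_; _≢_)
open import Relation.Binary.Definitions using (DecidableEquality)

subℤₚ : ∀ {p} → Fin p → Fin p → Fin p
subℤₚ {suc k} x y = (toℕ x + (suc k ∸ toℕ y)) mod (suc k)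

-- The group Z_2 × (Z_p)^m.  For p prime and m = 2e this is (isomorphic to)
-- Z_2 × (F_{p^{2e}}, +), the additive group of F_{q^2} with q = p^e.
G : ℕ → ℕ → Set
G p m = Fin 2 × Vec (Fin p) m

_−G_ : ∀ {p m} → G p m → G p m → G p m
(a , u) −G (b , w) = subℤₚ a b , Vec.zipWith subℤₚ u w


isZero : ∀ {p m} → G p m → Set
isZero (a , u) = (toℕ a ≡ 0) × VAll.All (λ x → toℕ x ≡ 0) u

_≟G_ : ∀ {p m} → DecidableEquality (G p m)
_≟G_ = ProdP.≡-dec _≟F_ (VecP.≡-dec _≟F_)

countDiff : ∀ {p m} → List (G p m) → G p m → ℕ
countDiff B g =
  length (filter (λ xy → ¬? (proj₁ xy ≟G proj₂ xy) ×-dec ((proj₁ xy −G proj₂ xy) ≟G g))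
                 (cartesianProduct B B))

IsDifferenceFamily : ∀ {p m} → List (List (G p m)) → List ℕ → ℕ → Set
IsDifferenceFamily {p} {m} Bs ks λ' =
  All Unique Bs × map length Bs ≡ ks ×
  (∀ (g : G p m) → ¬ isZero g → sum (map (λ B → countDiff B g) Bs) ≡ λ')

{-# OPTIONS --safe #-}
-- Adjoin i to 𝔽_q, where q ≡ 3 (mod 8), to get 𝔽_{q²}, and let η be the quadratic character of 𝔽_q. A union of half-lines
-- {x u : η(x) = 1} is described by an even function t and an odd function s of u: t = ±1 where the whole line of u belongs
-- to the union or to its complement, s = ±1 where one half does. The symmetrised correlation of two such sets at g ≠ 0
-- depends on t(g) t′(g), on S(g) S′(g), where S(g) is the sum of s(u) η(det(u, g)) over the lines, and on constants.
--
-- If s is a function of the octic class of u, then on each octic class S is an integral linear combination of two integers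
-- α and β with β² + 2α² = q. By Lucas' theorem on binomial coefficients p does not divide both of them, and a prime power has
-- only one such representation up to signs. As q = (2c − 1)² + 2(2c + 1)², it follows that (β − σα)² = 4 for a sign σ, which
-- is what makes the correlations of eight suitable unions, paired off into four subsets of ℤ₂ × 𝔽_{q²}, sum to a constant.
module Submission where

open import Algebra.Bundles using (CommutativeMonoid; CommutativeRing)
import Algebra.Morphism.RingMonomorphism as RingMonomorphism
open import Algebra.Morphism.Structures using (IsRingMonomorphism)
import Algebra.Properties.AbelianGroup as AbelianGroupProperties
import Algebra.Properties.CommutativeMonoid.Mult as CMultProperties
import Algebra.Properties.CommutativeSemiring.Binomial as BinomialProperties
import Algebra.Properties.CommutativeSemiring.Exp as ExpProperties
import Algebra.Properties.Ring as RingProperties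
import Algebra.Properties.Semiring.Mult as MultProperties
import Algebra.Solver.Ring as RingSolver
open import Algebra.Solver.Ring.AlmostCommutativeRing using (fromCommutativeRing; _-Raw-AlmostCommutative⟶_)
open import Algebra.Structures using (IsCommutativeRing)
open import Data.Bool using (Bool; true; false; not; if_then_else_)
open import Data.Empty using (⊥; ⊥-elim)
open import Data.Fin as Fin using (Fin; toℕ)
open import Data.Fin.Patterns using (0F; 1F; 2F; 3F; 4F; 5F; 6F; 7F)
import Data.Fin.Properties as Fin
open import Data.Integer as ℤ using (ℤ; -[1+_]; +[1+_]; 0ℤ; 1ℤ)
import Data.Integer.DivMod as ℤ
import Data.Integer.Divisibility.Signed as ℤ
import Data.Integer.Properties as ℤ
open import Data.List using (List; []; _∷_; _++_; map; length; filter; cartesianProduct; cartesianProductWith; allFin; foldr; tabulate)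
open import Data.List.Membership.Propositional using (_∈_; _∉_; find; lose)
import Data.List.Membership.Propositional.Properties as Mem
import Data.List.Properties as List
open import Data.List.Relation.Unary.All as All using (All; []; _∷_)
import Data.List.Relation.Unary.All.Properties as All
open import Data.List.Relation.Unary.AllPairs using ([]; _∷_)
open import Data.List.Relation.Unary.Any as Any using (Any; here; there)
open import Data.List.Relation.Unary.Unique.Propositional using (Unique)
import Data.List.Relation.Unary.Unique.Propositional.Properties as Unique
open import Data.Maybe using (Maybe; just; nothing)
import Data.Maybe.Properties as Maybe
open import Data.Nat as ℕ using (ℕ; zero; suc; z≤n; s≤s)
open import Data.Nat.Combinatorics using (_C_; nC1≡n; nCn≡1; nCk+nC[k+1]≡[n+1]C[k+1])
open import Data.Nat.Coprimality using (prime⇒coprime; coprime-Bézout)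
import Data.Nat.DivMod as ℕ
import Data.Nat.Divisibility as ℕ
open import Data.Nat.GCD using (module Bézout)
import Data.Nat.ListAction as ListAction
open import Data.Nat.Primality using (Prime; euclidsLemma; prime⇒nonZero; prime⇒nonTrivial)
import Data.Nat.Properties as ℕ
import Data.Nat.Solver as ℕ
open import Data.Product using (Σ; ∃; ∃-syntax; _×_; _,_; proj₁; proj₂)
open import Data.Sum using (_⊎_; inj₁; inj₂; [_,_]′)
open import Data.Unit using (tt)
open import Data.Vec as Vec using (Vec; []; _∷_)
import Data.Vec.Properties as Vec
import Data.Vec.Relation.Unary.All as VecAll
open import Defs using (subℤₚ)
open import Function using (_∘_; id; _$_)
open import Level using (0ℓ)
open import Relation.Binary.Definitions using (DecidableEquality; tri<; tri≈; tri>)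
open import Relation.Binary.PropositionalEquality as ≡ using (_≡_; _≢_; refl; sym; trans; cong; cong₂; subst; subst₂)
open import Relation.Nullary using (¬_; Dec; yes; no; does; contradiction)
open import Relation.Nullary.Decidable using (dec-true; dec-false; map′; toWitness; _×-dec_; _⊎-dec_; _→-dec_; ¬?)

record Enumeration (A : Set) : Set where
  field
    elements : List A
    _≟_      : DecidableEquality A
    complete : ∀ x → x ∈ elements
    unique   : Unique elements

  if-≟-refl : ∀ {ℓ} {B : Set ℓ} x {y z : B} → (if does (x ≟ x) then y else z) ≡ y
  if-≟-refl x {y} {z} = cong (if_then y else z) (dec-true (x ≟ x) refl)

  if-≟-≢ : ∀ {ℓ} {B : Set ℓ} {x x′} {y z : B} → x ≢ x′ → (if does (x ≟ x′) then y else z) ≡ z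
  if-≟-≢ {x = x} {x′} {y} {z} x≢x′ = cong (if_then y else z) (dec-false (x ≟ x′) x≢x′)

×-enumeration : ∀ {A B} → Enumeration A → Enumeration B → Enumeration (A × B)
×-enumeration 𝔸 𝔹 = record
  { elements = cartesianProduct A.elements B.elements
  ; _≟_      = λ { (a , b) (a′ , b′) → map′ (λ { (refl , refl) → refl }) (λ { refl → refl , refl }) ((a A.≟ a′) ×-dec (b B.≟ b′)) }
  ; complete = λ (a , b) → Mem.∈-cartesianProduct⁺ (A.complete a) (B.complete b)
  ; unique   = Unique.cartesianProduct⁺ A.unique B.unique
  }
  where module A = Enumeration 𝔸
        module B = Enumeration 𝔹

Fin-enumeration : ∀ n → Enumeration (Fin n)
Fin-enumeration n = record
  { elements = allFin n
  ; _≟_      = Fin._≟_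
  ; complete = Mem.∈-allFin
  ; unique   = Unique.allFin⁺ n
  }

Vec-elements : ∀ {A : Set} → List A → ∀ n → List (Vec A n)
Vec-elements xs zero    = [] ∷ []
Vec-elements xs (suc n) = cartesianProductWith _∷_ xs (Vec-elements xs n)

Vec-enumeration : ∀ {A : Set} → Enumeration A → ∀ n → Enumeration (Vec A n)
Vec-enumeration {A} 𝔸 n = record
  { elements = Vec-elements A.elements n
  ; _≟_      = Vec.≡-dec A._≟_
  ; complete = complete n
  ; unique   = unique n
  }
  where
  module A = Enumeration 𝔸
  complete : ∀ n (v : Vec A n) → v ∈ Vec-elements A.elements n
  complete zero    []      = here refl
  complete (suc n) (x ∷ v) = Mem.∈-cartesianProductWith⁺ _∷_ (A.complete x) (complete n v)
  unique : ∀ n → Unique (Vec-elements A.elements n)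
  unique zero    = [] ∷ []
  unique (suc n) = Unique.cartesianProductWith⁺ _∷_ (λ { refl → refl , refl }) A.unique (unique n)

module BigSum {c ℓ} (M : CommutativeMonoid c ℓ) where
  open CommutativeMonoid M renaming (refl to ≈-refl; sym to ≈-sym; trans to ≈-trans)
  open import Relation.Binary.Reasoning.Setoid setoid

  ∑ : ∀ {a} {A : Set a} → List A → (A → Carrier) → Carrier
  ∑ []       f = ε
  ∑ (x ∷ xs) f = f x ∙ ∑ xs f

  interchange : ∀ w x y z → (w ∙ x) ∙ (y ∙ z) ≈ (w ∙ y) ∙ (x ∙ z)
  interchange w x y z = begin
    (w ∙ x) ∙ (y ∙ z) ≈⟨ assoc w x (y ∙ z) ⟩
    w ∙ (x ∙ (y ∙ z)) ≈⟨ ∙-congˡ (assoc x y z) ⟨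
    w ∙ ((x ∙ y) ∙ z) ≈⟨ ∙-congˡ (∙-congʳ (comm x y)) ⟩
    w ∙ ((y ∙ x) ∙ z) ≈⟨ ∙-congˡ (assoc y x z) ⟩
    w ∙ (y ∙ (x ∙ z)) ≈⟨ assoc w y (x ∙ z) ⟨
    (w ∙ y) ∙ (x ∙ z) ∎

  module _ {a} {A : Set a} where

    ∑-cong : ∀ (xs : List A) {f g} → (∀ x → f x ≈ g x) → ∑ xs f ≈ ∑ xs g
    ∑-cong []       f≈g = ≈-refl
    ∑-cong (x ∷ xs) f≈g = ∙-cong (f≈g x) (∑-cong xs f≈g)

    ∑-ε : ∀ (xs : List A) → ∑ xs (λ _ → ε) ≈ ε
    ∑-ε []       = ≈-refl
    ∑-ε (x ∷ xs) = ≈-trans (identityˡ _) (∑-ε xs)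

    ∑-∙ : ∀ (xs : List A) f g → ∑ xs (λ x → f x ∙ g x) ≈ ∑ xs f ∙ ∑ xs g
    ∑-∙ []       f g = ≈-sym (identityˡ ε)
    ∑-∙ (x ∷ xs) f g = begin
      (f x ∙ g x) ∙ ∑ xs (λ x → f x ∙ g x) ≈⟨ ∙-congˡ (∑-∙ xs f g) ⟩
      (f x ∙ g x) ∙ (∑ xs f ∙ ∑ xs g)      ≈⟨ interchange _ _ _ _ ⟩
      (f x ∙ ∑ xs f) ∙ (g x ∙ ∑ xs g)      ∎

    ∑-++ : ∀ (xs ys : List A) f → ∑ (xs ++ ys) f ≈ ∑ xs f ∙ ∑ ys f
    ∑-++ []       ys f = ≈-sym (identityˡ _)
    ∑-++ (x ∷ xs) ys f = ≈-trans (∙-congˡ (∑-++ xs ys f)) (≈-sym (assoc _ _ _))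

  ∑-map : ∀ {a b} {A : Set a} {B : Set b} (h : A → B) (xs : List A) f → ∑ (map h xs) f ≡ ∑ xs (f ∘ h)
  ∑-map h []       f = refl
  ∑-map h (x ∷ xs) f = cong (f (h x) ∙_) (∑-map h xs f)

  ∑-swap : ∀ {a b} {A : Set a} {B : Set b} (xs : List A) (ys : List B) (f : A → B → Carrier) →
           ∑ xs (λ x → ∑ ys (λ y → f x y)) ≈ ∑ ys (λ y → ∑ xs (λ x → f x y))
  ∑-swap []       ys f = ≈-sym (∑-ε ys)
  ∑-swap (x ∷ xs) ys f = ≈-trans (∙-congˡ (∑-swap xs ys f)) (≈-sym (∑-∙ ys (f x) (λ y → ∑ xs (λ x → f x y))))

  ∑-× : ∀ {a b} {A : Set a} {B : Set b} (xs : List A) (ys : List B) f →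
        ∑ (cartesianProduct xs ys) f ≈ ∑ xs (λ x → ∑ ys (λ y → f (x , y)))
  ∑-× []       ys f = ≈-refl
  ∑-× (x ∷ xs) ys f = begin
    ∑ (map (x ,_) ys ++ cartesianProduct xs ys) f          ≈⟨ ∑-++ (map (x ,_) ys) _ f ⟩
    ∑ (map (x ,_) ys) f ∙ ∑ (cartesianProduct xs ys) f     ≈⟨ ∙-cong (reflexive (∑-map (x ,_) ys f)) (∑-× xs ys f) ⟩
    ∑ ys (λ y → f (x , y)) ∙ ∑ xs (λ x → ∑ ys (λ y → f (x , y))) ∎

  module _ {A : Set} (𝔸 : Enumeration A) where
    open Enumeration 𝔸

    private
      at : A → (A → Carrier) → A → Carrier
      at a f x = if does (x ≟ a) then f x else ε

      ∑-∉ : ∀ {xs a} f → a ∉ xs → ∑ xs (at a f) ≈ ε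
      ∑-∉ {[]}     f a∉ = ≈-refl
      ∑-∉ {x ∷ xs} f a∉ = ≈-trans (∙-cong (reflexive (if-≟-≢ (λ x≡a → a∉ (here (sym x≡a))))) (∑-∉ f (a∉ ∘ there))) (identityˡ ε)

      ∑-∈ : ∀ {xs a} f → Unique xs → a ∈ xs → ∑ xs (at a f) ≈ f a
      ∑-∈ {x ∷ xs} f (x∉ ∷ _)  (here refl) = ≈-trans (∙-cong (reflexive (if-≟-refl x)) (∑-∉ f (λ x∈ → All.lookup x∉ x∈ refl))) (identityʳ _)
      ∑-∈ {x ∷ xs} f (x∉ ∷ un) (there a∈)  = ≈-trans (∙-cong (reflexive (if-≟-≢ (All.lookup x∉ a∈))) (∑-∈ f un a∈)) (identityˡ _)

    ∑-at : ∀ a f → ∑ elements (λ x → if does (x ≟ a) then f x else ε) ≈ f a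
    ∑-at a f = ∑-∈ f unique (complete a)

  ∑-bijection : ∀ {A B} (𝔸 : Enumeration A) (𝔹 : Enumeration B) (σ : A → B) (σ⁻¹ : B → A) →
                (∀ a → σ⁻¹ (σ a) ≡ a) → (∀ b → σ (σ⁻¹ b) ≡ b) → ∀ f →
                ∑ (Enumeration.elements 𝔹) f ≈ ∑ (Enumeration.elements 𝔸) (f ∘ σ)
  ∑-bijection 𝔸 𝔹 σ σ⁻¹ left right f = begin
    ∑ B.elements f                                                     ≈⟨ ∑-cong B.elements (λ b → ≈-sym (∑-at 𝔸 (σ⁻¹ b) (λ _ → f b))) ⟩
    ∑ B.elements (λ b → ∑ A.elements (λ a → at₁ a b))                  ≈⟨ ∑-swap B.elements A.elements (λ b a → at₁ a b) ⟩
    ∑ A.elements (λ a → ∑ B.elements (λ b → at₁ a b))                  ≈⟨ ∑-cong A.elements (λ a → ∑-cong B.elements (λ b → reflexive (at≡ a b))) ⟩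
    ∑ A.elements (λ a → ∑ B.elements (λ b → if does (b B.≟ σ a) then f b else ε)) ≈⟨ ∑-cong A.elements (λ a → ∑-at 𝔹 (σ a) f) ⟩
    ∑ A.elements (f ∘ σ)                                               ∎
    where
    module A = Enumeration 𝔸
    module B = Enumeration 𝔹
    at₁ : _ → _ → Carrier
    at₁ a b = if does (a A.≟ σ⁻¹ b) then f b else ε
    at≡ : ∀ a b → at₁ a b ≡ (if does (b B.≟ σ a) then f b else ε)
    at≡ a b with b B.≟ σ a
    ... | yes refl = trans (cong (λ c → if does (a A.≟ c) then f b else ε) (left a)) (A.if-≟-refl a)
    ... | no b≢σa  = A.if-≟-≢ (λ a≡σ⁻¹b → b≢σa (trans (sym (right b)) (cong σ (sym a≡σ⁻¹b))))

module RingKit {c ℓ} (R : CommutativeRing c ℓ) where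
  open CommutativeRing R renaming (refl to ≈-refl; sym to ≈-sym; trans to ≈-trans; zero to *-zero)
  open RingProperties ring using (-‿distribˡ-*; -‿distribʳ-*; -0#≈0#; -‿involutive; -‿+-comm) public
  open MultProperties semiring using (×-homo-+; ×1-homo-*; ×-assoc-*; ×-comm-*) renaming (_×_ to _·_; ×-congʳ to ·-congʳ) public
  open ExpProperties commutativeSemiring public
  open import Relation.Binary.Reasoning.Setoid setoid

  fromℤ : ℤ → Carrier
  fromℤ (ℤ.+ n)      = n · 1#
  fromℤ -[1+ n ]   = - (suc n · 1#)

  private
    cancel-suc : ∀ x y → (1# + x) - (1# + y) ≈ x - y
    cancel-suc x y = begin
      (1# + x) + - (1# + y)   ≈⟨ +-congˡ (-‿+-comm 1# y) ⟨
      (1# + x) + (- 1# + - y) ≈⟨ +-congʳ (+-comm 1# x) ⟩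
      (x + 1#) + (- 1# + - y) ≈⟨ +-assoc x 1# _ ⟩
      x + (1# + (- 1# + - y)) ≈⟨ +-congˡ (+-assoc 1# (- 1#) (- y)) ⟨
      x + ((1# - 1#) + - y)   ≈⟨ +-congˡ (+-congʳ (-‿inverseʳ 1#)) ⟩
      x + (0# + - y)          ≈⟨ +-congˡ (+-identityˡ _) ⟩
      x - y                   ∎

  fromℤ-⊖ : ∀ m n → fromℤ (m ℤ.⊖ n) ≈ m · 1# - n · 1#
  fromℤ-⊖ m       zero    = ≈-sym (≈-trans (+-congˡ -0#≈0#) (+-identityʳ _))
  fromℤ-⊖ zero    (suc n) = ≈-sym (+-identityˡ _)
  fromℤ-⊖ (suc m) (suc n) = begin
    fromℤ (suc m ℤ.⊖ suc n)     ≡⟨ cong fromℤ (ℤ.[1+m]⊖[1+n]≡m⊖n m n) ⟩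
    fromℤ (m ℤ.⊖ n)             ≈⟨ fromℤ-⊖ m n ⟩
    m · 1# - n · 1#             ≈⟨ cancel-suc _ _ ⟨
    suc m · 1# - suc n · 1#     ∎

  fromℤ-+ : ∀ i j → fromℤ (i ℤ.+ j) ≈ fromℤ i + fromℤ j
  fromℤ-+ (ℤ.+ m)    (ℤ.+ n)    = ×-homo-+ 1# m n
  fromℤ-+ (ℤ.+ m)    -[1+ n ] = fromℤ-⊖ m (suc n)
  fromℤ-+ -[1+ m ] (ℤ.+ n)    = ≈-trans (fromℤ-⊖ n (suc m)) (+-comm _ _)
  fromℤ-+ -[1+ m ] -[1+ n ] = begin
    - (suc (suc (m ℕ.+ n)) · 1#)     ≡⟨ cong (λ k → - (suc k · 1#)) (ℕ.+-suc m n) ⟨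
    - ((suc m ℕ.+ suc n) · 1#)       ≈⟨ -‿cong (×-homo-+ 1# (suc m) (suc n)) ⟩
    - (suc m · 1# + suc n · 1#)      ≈⟨ -‿+-comm _ _ ⟨
    - (suc m · 1#) - (suc n · 1#)    ∎

  fromℤ-neg : ∀ i → fromℤ (ℤ.- i) ≈ - fromℤ i
  fromℤ-neg (ℤ.+ zero)   = ≈-sym -0#≈0#
  fromℤ-neg +[1+ n ]   = ≈-refl
  fromℤ-neg -[1+ n ]   = ≈-sym (-‿involutive _)

  private
    fromℤ-*₊ : ∀ m j → fromℤ (ℤ.+ m ℤ.* j) ≈ fromℤ (ℤ.+ m) * fromℤ j
    fromℤ-*₊ zero    j = ≈-trans (reflexive (cong fromℤ (ℤ.*-zeroˡ j))) (≈-sym (zeroˡ _))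
    fromℤ-*₊ (suc m) j = begin
      fromℤ (ℤ.+ suc m ℤ.* j)                        ≡⟨ cong fromℤ (ℤ.suc-* (ℤ.+ m) j) ⟩
      fromℤ (j ℤ.+ ℤ.+ m ℤ.* j)                      ≈⟨ fromℤ-+ j (ℤ.+ m ℤ.* j) ⟩
      fromℤ j + fromℤ (ℤ.+ m ℤ.* j)                  ≈⟨ +-cong (≈-sym (*-identityˡ _)) (fromℤ-*₊ m j) ⟩
      1# * fromℤ j + fromℤ (ℤ.+ m) * fromℤ j         ≈⟨ distribʳ _ _ _ ⟨
      (1# + fromℤ (ℤ.+ m)) * fromℤ j                 ∎

  fromℤ-* : ∀ i j → fromℤ (i ℤ.* j) ≈ fromℤ i * fromℤ j
  fromℤ-* (ℤ.+ m)    j = fromℤ-*₊ m j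
  fromℤ-* -[1+ m ] j = begin
    fromℤ (ℤ.- (ℤ.+ suc m) ℤ.* j)      ≡⟨ cong fromℤ (ℤ.neg-distribˡ-* (ℤ.+ suc m) j) ⟨
    fromℤ (ℤ.- (ℤ.+ suc m ℤ.* j))      ≈⟨ fromℤ-neg (ℤ.+ suc m ℤ.* j) ⟩
    - fromℤ (ℤ.+ suc m ℤ.* j)          ≈⟨ -‿cong (fromℤ-*₊ (suc m) j) ⟩
    - (fromℤ (ℤ.+ suc m) * fromℤ j)    ≈⟨ -‿distribˡ-* _ _ ⟩
    - fromℤ (ℤ.+ suc m) * fromℤ j      ∎

  private
    coeffℕ : ℕ → Carrier
    coeffℕ zero          = 0#
    coeffℕ (suc zero)    = 1#
    coeffℕ (suc (suc n)) = 1# + coeffℕ (suc n)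

    coeffℕ≈ : ∀ n → coeffℕ n ≈ n · 1#
    coeffℕ≈ zero          = ≈-refl
    coeffℕ≈ (suc zero)    = ≈-sym (+-identityʳ 1#)
    coeffℕ≈ (suc (suc n)) = +-congˡ (coeffℕ≈ (suc n))

    -- Unlike fromℤ, this sends 1ℤ to 1# on the nose, so the solver's constants match 1#.
    coeff : ℤ → Carrier
    coeff (ℤ.+ n)  = coeffℕ n
    coeff -[1+ n ] = - coeffℕ (suc n)

    coeff≈ : ∀ i → coeff i ≈ fromℤ i
    coeff≈ (ℤ.+ n)  = coeffℕ≈ n
    coeff≈ -[1+ n ] = -‿cong (coeffℕ≈ (suc n))

    coeff-morphism : CommutativeRing.rawRing ℤ.+-*-commutativeRing -Raw-AlmostCommutative⟶ fromCommutativeRing R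
    coeff-morphism = record
      { ⟦_⟧ = coeff
      ; +-homo = λ i j → ≈-trans (coeff≈ (i ℤ.+ j)) (≈-trans (fromℤ-+ i j) (≈-sym (+-cong (coeff≈ i) (coeff≈ j))))
      ; *-homo = λ i j → ≈-trans (coeff≈ (i ℤ.* j)) (≈-trans (fromℤ-* i j) (≈-sym (*-cong (coeff≈ i) (coeff≈ j))))
      ; -‿homo = λ i → ≈-trans (coeff≈ (ℤ.- i)) (≈-trans (fromℤ-neg i) (≈-sym (-‿cong (coeff≈ i))))
      ; 0-homo = ≈-refl ; 1-homo = ≈-refl }

    _coeff≟_ : ∀ i j → _
    i coeff≟ j with i ℤ.≟ j
    ... | yes i≡j = just (reflexive (cong coeff i≡j))
    ... | no  _   = nothing

  module Solver = RingSolver _ (fromCommutativeRing R) coeff-morphism _coeff≟_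

nCk-absorption : ∀ n k → suc k ℕ.* (suc n C suc k) ≡ suc n ℕ.* (n C k)
nCk-absorption zero    zero    = refl
nCk-absorption zero    (suc k) = trans (ℕ.*-zeroʳ k) (sym (ℕ.*-zeroʳ 0))
nCk-absorption (suc n) zero    = begin
  1 ℕ.* (suc (suc n) C 1)  ≡⟨ ℕ.*-identityˡ _ ⟩
  suc (suc n) C 1          ≡⟨ nC1≡n (suc (suc n)) ⟩
  suc (suc n)              ≡⟨ ℕ.*-identityʳ _ ⟨
  suc (suc n) ℕ.* 1        ∎
  where open ≡.≡-Reasoning
nCk-absorption (suc n) (suc k) = begin
  suc (suc k) ℕ.* (suc (suc n) C suc (suc k))
    ≡⟨ cong (suc (suc k) ℕ.*_) (nCk+nC[k+1]≡[n+1]C[k+1] (suc n) (suc k)) ⟨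
  suc (suc k) ℕ.* (c ℕ.+ d)
    ≡⟨ ℕ.*-distribˡ-+ (suc (suc k)) c d ⟩
  (c ℕ.+ suc k ℕ.* c) ℕ.+ suc (suc k) ℕ.* d
    ≡⟨ cong₂ (λ x y → (c ℕ.+ x) ℕ.+ y) (nCk-absorption n k) (nCk-absorption n (suc k)) ⟩
  (c ℕ.+ suc n ℕ.* (n C k)) ℕ.+ suc n ℕ.* (n C suc k)
    ≡⟨ ℕ.+-assoc c _ _ ⟩
  c ℕ.+ (suc n ℕ.* (n C k) ℕ.+ suc n ℕ.* (n C suc k))
    ≡⟨ cong (c ℕ.+_) (ℕ.*-distribˡ-+ (suc n) (n C k) (n C suc k)) ⟨
  c ℕ.+ suc n ℕ.* (n C k ℕ.+ n C suc k)
    ≡⟨ cong (λ x → c ℕ.+ suc n ℕ.* x) (nCk+nC[k+1]≡[n+1]C[k+1] n k) ⟩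
  suc (suc n) ℕ.* (suc n C suc k) ∎
  where
  open ≡.≡-Reasoning
  c = suc n C suc k
  d = suc n C suc (suc k)

prime∣⇒∣ : ∀ {p} → Prime p → ∀ {m n} → 0 ℕ.< m → m ℕ.< p → p ℕ.∣ m ℕ.* n → p ℕ.∣ n
prime∣⇒∣ p-prime {suc m} {n} _ m<p p∣mn with euclidsLemma (suc m) n p-prime p∣mn
... | inj₁ p∣m = contradiction (ℕ.∣⇒≤ p∣m) (ℕ.<⇒≱ m<p)
... | inj₂ p∣n = p∣n

prime∣nCk : ∀ {p} → Prime p → ∀ {k} → 0 ℕ.< k → k ℕ.< p → p ℕ.∣ p C k
prime∣nCk {suc n} p-prime {suc k} 0<k k<p =
  prime∣⇒∣ p-prime 0<k k<p (subst (suc n ℕ.∣_) (sym (nCk-absorption n k)) (ℕ.m∣m*n (n C k)))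

prime∤nCk : ∀ {p} → Prime p → ∀ n k → k ℕ.≤ n → n ℕ.< p → ¬ p ℕ.∣ n C k
prime∤nCk p-prime n       zero    _         n<p p∣1 =
  contradiction (ℕ.∣1⇒≡1 p∣1) (ℕ.nonTrivial⇒≢1 {{prime⇒nonTrivial p-prime}})
prime∤nCk {p} p-prime (suc n) (suc k) (s≤s k≤n) n<p p∣C =
  prime∤nCk p-prime n k k≤n (ℕ.<-trans (ℕ.n<1+n n) n<p)
    (prime∣⇒∣ p-prime (s≤s z≤n) n<p (subst (p ℕ.∣_) (nCk-absorption n k) (ℕ.∣n⇒∣m*n (suc k) p∣C)))

module RingSums {c ℓ} (R : CommutativeRing c ℓ) where
  open CommutativeRing R renaming (refl to ≈-refl; sym to ≈-sym; trans to ≈-trans; zero to *-zero)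
  open RingKit R
  open BigSum +-commutativeMonoid public renaming (∑-ε to ∑-0; ∑-∙ to ∑-+)
  open import Relation.Binary.Reasoning.Setoid setoid

  ⟦_⟧ : ∀ {ℓ} {P : Set ℓ} → Dec P → Carrier
  ⟦ d ⟧ = if does d then 1# else 0#

  ∑-*ˡ : ∀ {a} {A : Set a} (xs : List A) r f → r * ∑ xs f ≈ ∑ xs (λ x → r * f x)
  ∑-*ˡ []       r f = zeroʳ r
  ∑-*ˡ (x ∷ xs) r f = ≈-trans (distribˡ r _ _) (+-congˡ (∑-*ˡ xs r f))

  ∑-*ʳ : ∀ {a} {A : Set a} (xs : List A) r f → ∑ xs f * r ≈ ∑ xs (λ x → f x * r)
  ∑-*ʳ xs r f = ≈-trans (*-comm _ r) (≈-trans (∑-*ˡ xs r f) (∑-cong xs (λ x → *-comm r (f x))))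

  ∑-*-∑ : ∀ {a b} {A : Set a} {B : Set b} (xs : List A) (ys : List B) f g →
          ∑ xs f * ∑ ys g ≈ ∑ xs (λ x → ∑ ys (λ y → f x * g y))
  ∑-*-∑ xs ys f g = ≈-trans (∑-*ʳ xs _ f) (∑-cong xs (λ x → ∑-*ˡ ys (f x) g))

  ∑-neg : ∀ {a} {A : Set a} (xs : List A) f → ∑ xs (λ x → - f x) ≈ - ∑ xs f
  ∑-neg []       f = ≈-sym -0#≈0#
  ∑-neg (x ∷ xs) f = ≈-trans (+-congˡ (∑-neg xs f)) (-‿+-comm _ _)

  ∑-const : ∀ {a} {A : Set a} (xs : List A) r → ∑ xs (λ _ → r) ≈ (length xs · 1#) * r
  ∑-const []       r = ≈-sym (zeroˡ r)
  ∑-const (x ∷ xs) r = begin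
    r + ∑ xs (λ _ → r)               ≈⟨ +-cong (≈-sym (*-identityˡ r)) (∑-const xs r) ⟩
    1# * r + (length xs · 1#) * r    ≈⟨ distribʳ _ _ _ ⟨
    (1# + length xs · 1#) * r        ∎

  ∑-⟦≟⟧ : ∀ {A} (𝔸 : Enumeration A) a f →
          ∑ (Enumeration.elements 𝔸) (λ x → ⟦ Enumeration._≟_ 𝔸 x a ⟧ * f x) ≈ f a
  ∑-⟦≟⟧ 𝔸 a f = ≈-trans (∑-cong A.elements (λ x → if-* (does (x A.≟ a)) (f x))) (∑-at 𝔸 a f)
    where
    module A = Enumeration 𝔸
    if-* : ∀ b y → (if b then 1# else 0#) * y ≈ (if b then y else 0#)
    if-* true  y = *-identityˡ y
    if-* false y = zeroˡ y

module Characteristic {c ℓ} (R : CommutativeRing c ℓ) (p : ℕ) (p-prime : Prime p)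
                      (p≈0 : CommutativeRing._≈_ R (RingKit._·_ R p (CommutativeRing.1# R)) (CommutativeRing.0# R)) where
  open CommutativeRing R renaming (refl to ≈-refl; sym to ≈-sym; trans to ≈-trans; zero to *-zero)
  open RingKit R
  open import Relation.Binary.Reasoning.Setoid setoid
  open import Algebra.Properties.Semiring.Sum semiring using (sum; sum-cong-≋; sum-replicate-zero; sum-init-last)
  open BinomialProperties commutativeSemiring using (binomialTerm) renaming (theorem to binomial-theorem)

  ·≈·1* : ∀ n x → n · x ≈ (n · 1#) * x
  ·≈·1* n x = ≈-trans (·-congʳ n (≈-sym (*-identityˡ x))) (≈-sym (×-assoc-* n 1# x))

  ∣⇒≈0 : ∀ {n} → p ℕ.∣ n → n · 1# ≈ 0#
  ∣⇒≈0 {n} (ℕ.divides d refl) = ≈-trans (×1-homo-* d p) (≈-trans (*-congˡ p≈0) (zeroʳ _))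

  ∣⇒·≈0 : ∀ {n} x → p ℕ.∣ n → n · x ≈ 0#
  ∣⇒·≈0 {n} x p∣n = ≈-trans (·≈·1* n x) (≈-trans (*-congʳ (∣⇒≈0 p∣n)) (zeroˡ x))

  frobenius : ∀ x y → (x + y) ^ p ≈ x ^ p + y ^ p
  frobenius x y = go p refl
    where
    go : ∀ n → n ≡ p → (x + y) ^ n ≈ x ^ n + y ^ n
    go zero    0≡p   = contradiction (sym 0≡p) (ℕ.≢-nonZero⁻¹ p {{prime⇒nonZero p-prime}})
    go (suc n) n≡p = begin
      (x + y) ^ suc n                                  ≈⟨ binomial-theorem (suc n) x y ⟩
      term Fin.zero + sum (term ∘ Fin.suc)             ≈⟨ +-cong first≈ (sum-init-last (term ∘ Fin.suc)) ⟩
      y ^ suc n + (sum middle + term (Fin.suc (Fin.fromℕ n))) ≈⟨ +-congˡ (+-cong (≈-trans (sum-cong-≋ middle≈0) (sum-replicate-zero n)) last≈) ⟩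
      y ^ suc n + (0# + x ^ suc n)                     ≈⟨ +-congˡ (+-identityˡ _) ⟩
      y ^ suc n + x ^ suc n                            ≈⟨ +-comm _ _ ⟩
      x ^ suc n + y ^ suc n                            ∎
      where
      term = binomialTerm x y (suc n)
      middle : Fin n → Carrier
      middle i = term (Fin.suc (Fin.inject₁ i))
      first≈ : term Fin.zero ≈ y ^ suc n
      first≈ = ≈-trans (+-identityʳ _) (*-identityˡ _)
      middle≈0 : ∀ i → middle i ≈ 0#
      middle≈0 i = ∣⇒·≈0 _ (subst (ℕ._∣ suc n C suc (toℕ (Fin.inject₁ i))) n≡p
        (prime∣nCk (subst Prime (sym n≡p) p-prime) (s≤s z≤n)
          (s≤s (subst (ℕ._< n) (sym (Fin.toℕ-inject₁ i)) (Fin.toℕ<n i)))))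
      last≈ : term (Fin.suc (Fin.fromℕ n)) ≈ x ^ suc n
      last≈ rewrite Fin.toℕ-fromℕ n | nCn≡1 (suc n) | ℕ.n∸n≡0 n = ≈-trans (+-identityʳ _) (*-identityʳ _)

  frobenius^ : ∀ e x y → (x + y) ^ (p ℕ.^ e) ≈ x ^ (p ℕ.^ e) + y ^ (p ℕ.^ e)
  frobenius^ zero    x y = ≈-trans (*-identityʳ _) (≈-sym (+-cong (*-identityʳ x) (*-identityʳ y)))
  frobenius^ (suc e) x y = begin
    (x + y) ^ (p ℕ.* p ℕ.^ e)                          ≈⟨ ^-assocʳ _ p _ ⟨
    ((x + y) ^ p) ^ (p ℕ.^ e)                          ≈⟨ ^-congˡ (p ℕ.^ e) (frobenius x y) ⟩
    (x ^ p + y ^ p) ^ (p ℕ.^ e)                        ≈⟨ frobenius^ e _ _ ⟩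
    (x ^ p) ^ (p ℕ.^ e) + (y ^ p) ^ (p ℕ.^ e)          ≈⟨ +-cong (^-assocʳ x p _) (^-assocʳ y p _) ⟩
    x ^ (p ℕ.* p ℕ.^ e) + y ^ (p ℕ.* p ℕ.^ e)          ∎

  private
    choose : ℕ → ℕ → Carrier
    choose n k = (n C k) · 1#

    choose-suc : ∀ n k → choose (suc n) (suc k) ≈ choose n k + choose n (suc k)
    choose-suc n k = ≈-trans (reflexive (cong (_· 1#) (sym (nCk+nC[k+1]≡[n+1]C[k+1] n k)))) (×-homo-+ 1# (n C k) (n C suc k))


    choose-< : ∀ n k → n ℕ.< k → choose n k ≈ 0#
    choose-< zero    (suc k) _         = ≈-refl
    choose-< (suc n) (suc k) (s≤s n<k) = ≈-trans (choose-suc n k)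
      (≈-trans (+-cong (choose-< n k n<k) (choose-< n (suc k) (ℕ.m<n⇒m<1+n n<k))) (+-identityˡ 0#))

    choose-+p-low : ∀ n k → k ℕ.< p → choose (p ℕ.+ n) k ≈ choose n k
    choose-+p-low n       zero    k<p = ≈-refl
    choose-+p-low zero    (suc k) k<p rewrite ℕ.+-identityʳ p = ∣⇒≈0 (prime∣nCk p-prime (s≤s z≤n) k<p)
    choose-+p-low (suc n) (suc k) k<p rewrite ℕ.+-suc p n = ≈-trans (choose-suc (p ℕ.+ n) k)
      (≈-trans (+-cong (choose-+p-low n k (ℕ.<-trans (ℕ.n<1+n k) k<p)) (choose-+p-low n (suc k) k<p)) (≈-sym (choose-suc n k)))

    choose-+p-high : ∀ n k → choose (p ℕ.+ n) (p ℕ.+ k) ≈ choose n (p ℕ.+ k) + choose n k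
    choose-+p-high zero zero = ≈-trans (reflexive (cong (_· 1#) (trans (cong₂ _C_ (ℕ.+-identityʳ p) (ℕ.+-identityʳ p)) (nCn≡1 p))))
      (≈-sym (≈-trans (+-congʳ (choose-< 0 (p ℕ.+ 0) (ℕ.<-≤-trans (ℕ.>-nonZero⁻¹ p {{prime⇒nonZero p-prime}}) (ℕ.m≤m+n p 0)))) (+-identityˡ _)))
    choose-+p-high zero (suc k) = ≈-trans (choose-< (p ℕ.+ 0) (p ℕ.+ suc k) (ℕ.+-monoʳ-< p (s≤s z≤n)))
      (≈-sym (≈-trans (+-cong (choose-< 0 (p ℕ.+ suc k) (ℕ.<-≤-trans (s≤s z≤n) (ℕ.m≤n+m (suc k) p))) ≈-refl) (+-identityˡ _)))
    choose-+p-high (suc n) zero = go p refl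
      where
      go : ∀ p′ → p′ ≡ p → choose (p ℕ.+ suc n) (p ℕ.+ 0) ≈ choose (suc n) (p ℕ.+ 0) + choose (suc n) 0
      go zero     0≡p  = contradiction (sym 0≡p) (ℕ.≢-nonZero⁻¹ p {{prime⇒nonZero p-prime}})
      go (suc p′) refl rewrite ℕ.+-suc p′ n | ℕ.+-identityʳ p′ = begin
        choose (suc (suc (p′ ℕ.+ n))) (suc p′)                    ≈⟨ choose-suc (suc (p′ ℕ.+ n)) p′ ⟩
        choose (suc (p′ ℕ.+ n)) p′ + choose (suc (p′ ℕ.+ n)) (suc p′)
          ≈⟨ +-cong (choose-+p-low n p′ (ℕ.n<1+n p′)) (≈-trans (reflexive (cong (choose (suc (p′ ℕ.+ n)) ∘ suc) (sym (ℕ.+-identityʳ p′)))) (choose-+p-high n 0)) ⟩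
        choose n p′ + (choose n (suc (p′ ℕ.+ 0)) + choose n 0)    ≡⟨ cong (λ t → choose n p′ + (choose n (suc t) + choose n 0)) (ℕ.+-identityʳ p′) ⟩
        choose n p′ + (choose n (suc p′) + choose n 0)            ≈⟨ +-assoc _ _ _ ⟨
        (choose n p′ + choose n (suc p′)) + choose n 0            ≈⟨ +-congʳ (choose-suc n p′) ⟨
        choose (suc n) (suc p′) + choose (suc n) 0                ∎
    choose-+p-high (suc n) (suc k) rewrite ℕ.+-suc p n | ℕ.+-suc p k = begin
      choose (suc (p ℕ.+ n)) (suc (p ℕ.+ k))                                  ≈⟨ choose-suc (p ℕ.+ n) (p ℕ.+ k) ⟩
      choose (p ℕ.+ n) (p ℕ.+ k) + choose (p ℕ.+ n) (suc (p ℕ.+ k))           ≈⟨ +-cong (choose-+p-high n k) (≈-trans (reflexive (cong (choose (p ℕ.+ n)) (sym (ℕ.+-suc p k)))) (choose-+p-high n (suc k))) ⟩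
      (choose n (p ℕ.+ k) + choose n k) + (choose n (p ℕ.+ suc k) + choose n (suc k)) ≡⟨ cong (λ t → (choose n (p ℕ.+ k) + choose n k) + (choose n t + choose n (suc k))) (ℕ.+-suc p k) ⟩
      (choose n (p ℕ.+ k) + choose n k) + (choose n (suc (p ℕ.+ k)) + choose n (suc k)) ≈⟨ BigSum.interchange +-commutativeMonoid _ _ _ _ ⟩
      (choose n (p ℕ.+ k) + choose n (suc (p ℕ.+ k))) + (choose n k + choose n (suc k)) ≈⟨ +-cong (choose-suc n (p ℕ.+ k)) (choose-suc n k) ⟨
      choose (suc n) (suc (p ℕ.+ k)) + choose (suc n) (suc k)                 ∎

  lucas : ∀ m k {n l} → n ℕ.< p → l ℕ.< p → ((m ℕ.* p ℕ.+ n) C (k ℕ.* p ℕ.+ l)) · 1# ≈ ((m C k) · 1#) * ((n C l) · 1#)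
  lucas zero zero {n} {l} n<p l<p = ≈-sym (≈-trans (*-congʳ (+-identityʳ 1#)) (*-identityˡ _))
  lucas zero (suc k) {n} {l} n<p l<p = ≈-trans
    (choose-< n _ (ℕ.<-≤-trans n<p (ℕ.≤-trans (ℕ.m≤m+n p (k ℕ.* p)) (ℕ.m≤m+n _ l)))) (≈-sym (zeroˡ _))
  lucas (suc m) zero {n} {l} n<p l<p rewrite ℕ.+-assoc p (m ℕ.* p) n =
    ≈-trans (choose-+p-low (m ℕ.* p ℕ.+ n) l l<p) (lucas m zero n<p l<p)
  lucas (suc m) (suc k) {n} {l} n<p l<p rewrite ℕ.+-assoc p (m ℕ.* p) n | ℕ.+-assoc p (k ℕ.* p) l = begin
    choose (p ℕ.+ (m ℕ.* p ℕ.+ n)) (p ℕ.+ (k ℕ.* p ℕ.+ l))                    ≈⟨ choose-+p-high _ _ ⟩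
    choose (m ℕ.* p ℕ.+ n) (p ℕ.+ (k ℕ.* p ℕ.+ l)) + choose (m ℕ.* p ℕ.+ n) (k ℕ.* p ℕ.+ l)
      ≈⟨ +-cong (≈-trans (reflexive (cong (choose (m ℕ.* p ℕ.+ n)) (sym (ℕ.+-assoc p (k ℕ.* p) l)))) (lucas m (suc k) n<p l<p)) (lucas m k n<p l<p) ⟩
    choose m (suc k) * choose n l + choose m k * choose n l                   ≈⟨ distribʳ _ _ _ ⟨
    (choose m (suc k) + choose m k) * choose n l                              ≈⟨ *-congʳ (+-comm _ _) ⟩
    (choose m k + choose m (suc k)) * choose n l                              ≈⟨ *-congʳ (choose-suc m k) ⟨
    choose (suc m) (suc k) * choose n l                                       ∎

record Field (K : Set) : Set where
  infixl 6 _+_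
  infixl 7 _*_
  infix  8 -_ _⁻¹
  field
    _+_ _*_ : K → K → K
    -_ _⁻¹  : K → K
    0# 1#   : K
    isCommutativeRing : IsCommutativeRing _≡_ _+_ _*_ -_ 0# 1#
    0≢1      : 0# ≢ 1#
    *-inverse : ∀ {x} → x ≢ 0# → x * x ⁻¹ ≡ 1#

  commutativeRing : CommutativeRing 0ℓ 0ℓ
  commutativeRing = record { isCommutativeRing = isCommutativeRing }

module FieldKit {K : Set} (F : Field K) (𝕂 : Enumeration K) where
  open Field F using (_⁻¹; 0≢1; *-inverse)
  open CommutativeRing (Field.commutativeRing F) hiding (refl; sym; trans; zero)
  open RingKit (Field.commutativeRing F)
  open AbelianGroupProperties +-abelianGroup using (x∙y⁻¹≈ε⇒x≈y)
  open Enumeration 𝕂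
  open ≡.≡-Reasoning

  *-cancelˡ : ∀ {x y z} → x ≢ 0# → x * y ≡ x * z → y ≡ z
  *-cancelˡ {x} {y} {z} x≢0 xy≡xz = begin
    y                ≡⟨ undo y ⟨
    x ⁻¹ * (x * y)   ≡⟨ cong (x ⁻¹ *_) xy≡xz ⟩
    x ⁻¹ * (x * z)   ≡⟨ undo z ⟩
    z                ∎
    where
    undo : ∀ y → x ⁻¹ * (x * y) ≡ y
    undo y = trans (sym (*-assoc (x ⁻¹) x y)) (trans (cong (_* y) (trans (*-comm (x ⁻¹) x) (*-inverse x≢0))) (*-identityˡ y))

  *≡0 : ∀ {x y} → x * y ≡ 0# → x ≡ 0# ⊎ y ≡ 0#
  *≡0 {x} {y} xy≡0 with x ≟ 0#
  ... | yes x≡0 = inj₁ x≡0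
  ... | no  x≢0 = inj₂ (*-cancelˡ x≢0 (trans xy≡0 (sym (zeroʳ x))))

  *-≢0 : ∀ {x y} → x ≢ 0# → y ≢ 0# → x * y ≢ 0#
  *-≢0 x≢0 y≢0 xy≡0 with *≡0 xy≡0
  ... | inj₁ x≡0 = x≢0 x≡0
  ... | inj₂ y≡0 = y≢0 y≡0

  ^-≢0 : ∀ {x} n → x ≢ 0# → x ^ n ≢ 0#
  ^-≢0 zero    x≢0 = 0≢1 ∘ sym
  ^-≢0 (suc n) x≢0 = *-≢0 x≢0 (^-≢0 n x≢0)

  ⁻¹-≢0 : ∀ {x} → x ≢ 0# → x ⁻¹ ≢ 0#
  ⁻¹-≢0 {x} x≢0 x⁻¹≡0 = 0≢1 (trans (sym (zeroʳ x)) (trans (cong (x *_) (sym x⁻¹≡0)) (*-inverse x≢0)))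

  x-y≡0⇒x≡y : ∀ {x y} → x - y ≡ 0# → x ≡ y
  x-y≡0⇒x≡y {x} {y} = x∙y⁻¹≈ε⇒x≈y x y

  eval : List K → K → K
  eval []       x = 0#
  eval (c ∷ cs) x = c + x * eval cs x

  private
    quotient : K → List K → List K
    quotient a []       = []
    quotient a (d ∷ ds) = eval (d ∷ ds) a ∷ quotient a ds

    length-quotient : ∀ a cs → length (quotient a cs) ≡ length cs
    length-quotient a []       = refl
    length-quotient a (c ∷ cs) = cong suc (length-quotient a cs)

    quotient-eval : ∀ a cs x → x * eval cs x - a * eval cs a ≡ (x - a) * eval (quotient a cs) x
    quotient-eval a []       x = solve 2 (λ x a → x :* con 0ℤ :- a :* con 0ℤ := (x :- a) :* con 0ℤ) refl x a
      where open Solver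
    quotient-eval a (d ∷ ds) x = begin
      x * (d + x * f x) - a * (d + a * f a)                     ≡⟨ solve 5 (λ x a d u v → x :* (d :+ x :* u) :- a :* (d :+ a :* v)
                                                                       := x :* (x :* u :- a :* v) :+ (x :- a) :* (d :+ a :* v)) refl x a d (f x) (f a) ⟩
      x * (x * f x - a * f a) + (x - a) * (d + a * f a)         ≡⟨ cong (λ t → x * t + (x - a) * (d + a * f a)) (quotient-eval a ds x) ⟩
      x * ((x - a) * eval (quotient a ds) x) + (x - a) * (d + a * f a) ≡⟨ solve 4 (λ x a g h → x :* ((x :- a) :* g) :+ (x :- a) :* h := (x :- a) :* (h :+ x :* g))
                                                                       refl x a (eval (quotient a ds) x) (d + a * f a) ⟩
      (x - a) * (d + a * f a + x * eval (quotient a ds) x)      ∎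
      where
      open Solver
      f = eval ds

    eval-0 : ∀ {cs} x → All (_≡ 0#) cs → eval cs x ≡ 0#
    eval-0 x []               = refl
    eval-0 x (refl ∷ cs≡0) = trans (+-identityˡ _) (trans (cong (x *_) (eval-0 x cs≡0)) (zeroʳ x))

    quotient≡0 : ∀ a cs → All (_≡ 0#) (quotient a cs) → All (_≡ 0#) cs
    quotient≡0 a []       []            = []
    quotient≡0 a (d ∷ ds) (d≡0 ∷ q≡0) = trans (sym (trans (cong (d +_) (trans (cong (a *_) (eval-0 a ds≡0)) (zeroʳ a))) (+-identityʳ d))) d≡0 ∷ ds≡0
      where ds≡0 = quotient≡0 a ds q≡0

  roots-bound : ∀ cs xs → Unique xs → length cs ℕ.≤ length xs → (∀ {x} → x ∈ xs → eval cs x ≡ 0#) → All (_≡ 0#) cs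
  roots-bound []       xs       _           _         _     = []
  roots-bound (c ∷ cs) (a ∷ xs) (a∉xs ∷ un) (s≤s len) roots = c≡0 ∷ cs≡0
    where
    other : ∀ {x} → x ∈ xs → eval (quotient a cs) x ≡ 0#
    other {x} x∈xs with *≡0 (trans (sym (quotient-eval a cs x)) (begin
      x * eval cs x - a * eval cs a                   ≡⟨ solve 3 (λ u v c → u :- v := (c :+ u) :- (c :+ v)) refl (x * eval cs x) (a * eval cs a) c ⟩
      eval (c ∷ cs) x - eval (c ∷ cs) a               ≡⟨ cong₂ _-_ (roots (there x∈xs)) (roots (here refl)) ⟩
      0# - 0#                                         ≡⟨ -‿inverseʳ 0# ⟩
      0#                                              ∎))
      where open Solver
    ... | inj₁ x-a≡0 = contradiction (sym (x-y≡0⇒x≡y x-a≡0)) (All.lookup a∉xs x∈xs)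
    ... | inj₂ e≡0   = e≡0
    cs≡0 : All (_≡ 0#) cs
    cs≡0 = quotient≡0 a cs (roots-bound (quotient a cs) xs un (subst (ℕ._≤ length xs) (sym (length-quotient a cs)) len) other)
    c≡0 : c ≡ 0#
    c≡0 = trans (sym (trans (cong (c +_) (trans (cong (a *_) (eval-0 a cs≡0)) (zeroʳ a))) (+-identityʳ c))) (roots (here refl))

  private
    module Π = BigSum *-commutativeMonoid

    nonzero-part : K → K → K
    nonzero-part y z = if does (y ≟ 0#) then 1# else z

    Π-const : ∀ xs a → Π.∑ xs (λ (_ : K) → a) ≡ a ^ length xs
    Π-const []       a = refl
    Π-const (x ∷ xs) a = cong (a *_) (Π-const xs a)

    Π-≢0 : ∀ (xs : List K) f → (∀ x → f x ≢ 0#) → Π.∑ xs f ≢ 0#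
    Π-≢0 []       f f≢0 = 0≢1 ∘ sym
    Π-≢0 (x ∷ xs) f f≢0 = *-≢0 (f≢0 x) (Π-≢0 xs f f≢0)

    nonzero-part-≢0 : ∀ y → nonzero-part y y ≢ 0#
    nonzero-part-≢0 y with y ≟ 0#
    ... | yes _  = 0≢1 ∘ sym
    ... | no y≢0 = y≢0

  fermat : ∀ a → a ^ length elements ≡ a
  fermat a with a ≟ 0#
  ... | yes refl = 0^ elements (complete 0#)
    where
    0^ : ∀ xs → 0# ∈ xs → 0# ^ length xs ≡ 0#
    0^ (x ∷ xs) _ = zeroˡ _
  ... | no a≢0 = *-cancelˡ P≢0 (begin
    P * a ^ length elements                       ≡⟨ cong (P *_) (Π-const elements a) ⟨
    P * Π.∑ elements (λ _ → a)                    ≡⟨ cong (P *_) (trans (Π.∑-cong elements split) (Π.∑-∙ elements _ _)) ⟩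
    P * (Π.∑ elements (λ y → if does (y ≟ 0#) then a else 1#) * Q)
                                                  ≡⟨ cong (λ t → P * (t * Q)) (Π.∑-at 𝕂 0# (λ _ → a)) ⟩
    P * (a * Q)                                   ≡⟨ solve 3 (λ p a q → p :* (a :* q) := (q :* p) :* a) refl P a Q ⟩
    (Q * P) * a                                   ≡⟨ cong (_* a) (Π.∑-∙ elements (λ y → nonzero-part y a) (λ y → nonzero-part y y)) ⟨
    Π.∑ elements (λ y → nonzero-part y a * nonzero-part y y) * a
                                                  ≡⟨ cong (_* a) (Π.∑-cong elements scaled) ⟨
    Π.∑ elements (λ y → nonzero-part (a * y) (a * y)) * a
                                                  ≡⟨ cong (_* a) (Π.∑-bijection 𝕂 𝕂 (a *_) (a ⁻¹ *_) left right (λ y → nonzero-part y y)) ⟨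
    P * a                                         ∎)
    where
    open Solver
    P Q : K
    P = Π.∑ elements (λ y → nonzero-part y y)
    Q = Π.∑ elements (λ y → nonzero-part y a)
    P≢0 : P ≢ 0#
    P≢0 = Π-≢0 elements (λ y → nonzero-part y y) nonzero-part-≢0
    left : ∀ y → a ⁻¹ * (a * y) ≡ y
    left y = trans (sym (*-assoc _ _ _)) (trans (cong (_* y) (trans (*-comm _ _) (*-inverse a≢0))) (*-identityˡ y))
    right : ∀ y → a * (a ⁻¹ * y) ≡ y
    right y = trans (sym (*-assoc _ _ _)) (trans (cong (_* y) (*-inverse a≢0)) (*-identityˡ y))
    split : ∀ y → a ≡ (if does (y ≟ 0#) then a else 1#) * nonzero-part y a
    split y with does (y ≟ 0#)
    ... | true  = sym (*-identityʳ a)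
    ... | false = sym (*-identityˡ a)
    scaled : ∀ y → nonzero-part (a * y) (a * y) ≡ nonzero-part y a * nonzero-part y y
    scaled y with y ≟ 0#
    ... | yes refl = trans (cong (if_then 1# else (a * 0#)) (dec-true ((a * 0#) ≟ 0#) (zeroʳ a))) (sym (*-identityˡ 1#))
    ... | no  y≢0  = cong (if_then 1# else (a * y)) (dec-false ((a * y) ≟ 0#) (*-≢0 a≢0 y≢0))

module Localisation (R : CommutativeRing 0ℓ 0ℓ) (r : ℕ)
  (pow-q   : ∀ y → CommutativeRing._≈_ R (RingKit._^_ R y (suc (suc r))) y)
  (_≈?_    : ∀ x y → Dec (CommutativeRing._≈_ R x y)) where
  open CommutativeRing R renaming (refl to ≈-refl; sym to ≈-sym; trans to ≈-trans; zero to *-zero)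
  open RingKit R
  open import Relation.Binary.Reasoning.Setoid setoid

  support : Carrier → Carrier
  support y = y ^ suc r

  support-absorb : ∀ y → support y * y ≈ y
  support-absorb y = ≈-trans (*-comm _ y) (pow-q y)

  support-idempotent : ∀ y → support y * support y ≈ support y
  support-idempotent y = begin
    support y * (y * y ^ r)  ≈⟨ *-assoc _ _ _ ⟨
    (support y * y) * y ^ r  ≈⟨ *-congʳ (support-absorb y) ⟩
    support y                ∎

  refine : List Carrier → Carrier → Carrier
  refine []       ε = ε
  refine (y ∷ ys) ε with (ε * support y) ≈? 0#
  ... | yes _ = refine ys ε
  ... | no  _ = refine ys (ε * support y)

  refine-≉0 : ∀ ys {ε} → ¬ ε ≈ 0# → ¬ refine ys ε ≈ 0#
  refine-≉0 []       ε≉0 = ε≉0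
  refine-≉0 (y ∷ ys) {ε} ε≉0 with (ε * support y) ≈? 0#
  ... | yes _ = refine-≉0 ys ε≉0
  ... | no ≉0 = refine-≉0 ys ≉0

  refine-absorb : ∀ ys {ε} → ε * ε ≈ ε → refine ys ε * ε ≈ refine ys ε
  refine-absorb []       εε≈ε = εε≈ε
  refine-absorb (y ∷ ys) {ε} εε≈ε with (ε * support y) ≈? 0#
  ... | yes _ = refine-absorb ys εε≈ε
  ... | no  _ = begin
    δ * ε                    ≈⟨ *-congʳ (≈-sym δ≈) ⟩
    (δ * (ε * support y)) * ε ≈⟨ solve 3 (λ d e s → (d :* (e :* s)) :* e := d :* ((e :* e) :* s)) ≈-refl δ ε (support y) ⟩
    δ * ((ε * ε) * support y) ≈⟨ *-congˡ (*-congʳ εε≈ε) ⟩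
    δ * (ε * support y)      ≈⟨ δ≈ ⟩
    δ                        ∎
    where
    open Solver
    δ = refine ys (ε * support y)
    δ≈ : δ * (ε * support y) ≈ δ
    δ≈ = refine-absorb ys (begin
      (ε * support y) * (ε * support y)  ≈⟨ solve 2 (λ e s → (e :* s) :* (e :* s) := (e :* e) :* (s :* s)) ≈-refl ε (support y) ⟩
      (ε * ε) * (support y * support y)  ≈⟨ *-cong εε≈ε (support-idempotent y) ⟩
      ε * support y                      ∎)

  *-idempotent : ∀ y {ε} → ε * ε ≈ ε → (ε * support y) * (ε * support y) ≈ ε * support y
  *-idempotent y {ε} εε≈ε = begin
      (ε * support y) * (ε * support y)  ≈⟨ solve 2 (λ e s → (e :* s) :* (e :* s) := (e :* e) :* (s :* s)) ≈-refl ε (support y) ⟩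
      (ε * ε) * (support y * support y)  ≈⟨ *-cong εε≈ε (support-idempotent y) ⟩
      ε * support y                      ∎
    where open Solver

  refine-minimal : ∀ ys {ε} → ε * ε ≈ ε → ∀ {y} → y ∈ ys →
                   refine ys ε * support y ≈ 0# ⊎ refine ys ε * support y ≈ refine ys ε
  refine-minimal (y ∷ ys) {ε} εε≈ε (there y∈) with (ε * support y) ≈? 0#
  ... | yes _ = refine-minimal ys εε≈ε y∈
  ... | no  _ = refine-minimal ys (*-idempotent y εε≈ε) y∈
  refine-minimal (y ∷ ys) {ε} εε≈ε (here refl) with (ε * support y) ≈? 0#
  ... | yes εs≈0 = inj₁ (begin
    δ * support y          ≈⟨ *-congʳ (refine-absorb ys εε≈ε) ⟨
    (δ * ε) * support y    ≈⟨ *-assoc _ _ _ ⟩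
    δ * (ε * support y)    ≈⟨ *-congˡ εs≈0 ⟩
    δ * 0#                 ≈⟨ zeroʳ δ ⟩
    0#                     ∎)
    where δ = refine ys ε
  ... | no _ = inj₂ (begin
    δ * support y                            ≈⟨ *-congʳ (refine-absorb ys (*-idempotent y εε≈ε)) ⟨
    (δ * (ε * support y)) * support y        ≈⟨ solve 3 (λ d e s → (d :* (e :* s)) :* s := d :* (e :* (s :* s))) ≈-refl δ ε (support y) ⟩
    δ * (ε * (support y * support y))        ≈⟨ *-congˡ (*-congˡ (support-idempotent y)) ⟩
    δ * (ε * support y)                      ≈⟨ refine-absorb ys (*-idempotent y εε≈ε) ⟩
    δ                                        ∎)
    where
    open Solver
    δ = refine ys (ε * support y)

  localise : Carrier → CommutativeRing 0ℓ 0ℓ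
  localise ε = record
    { _≈_ = λ x y → ε * x ≈ ε * y
    ; _+_ = _+_ ; _*_ = _*_ ; -_ = -_ ; 0# = 0# ; 1# = 1#
    ; isCommutativeRing = record
      { isRing = record
        { +-isAbelianGroup = record
          { isGroup = record
            { isMonoid = record
              { isSemigroup = record
                { isMagma = record
                  { isEquivalence = record { refl = ≈-refl ; sym = ≈-sym ; trans = ≈-trans }
                  ; ∙-cong = λ x≈ y≈ → ≈-trans (distribˡ ε _ _) (≈-trans (+-cong x≈ y≈) (≈-sym (distribˡ ε _ _))) }
                ; assoc = λ x y z → *-congˡ (+-assoc x y z) }
              ; identity = (λ x → *-congˡ (+-identityˡ x)) , (λ x → *-congˡ (+-identityʳ x)) }
            ; inverse = (λ x → *-congˡ (-‿inverseˡ x)) , (λ x → *-congˡ (-‿inverseʳ x))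
            ; ⁻¹-cong = λ x≈ → ≈-trans (≈-sym (-‿distribʳ-* ε _)) (≈-trans (-‿cong x≈) (-‿distribʳ-* ε _)) }
          ; comm = λ x y → *-congˡ (+-comm x y) }
        ; *-cong = λ {x} {x′} {y} {y′} x≈ y≈ → begin
            ε * (x * y)    ≈⟨ *-assoc _ _ _ ⟨
            (ε * x) * y    ≈⟨ *-congʳ x≈ ⟩
            (ε * x′) * y   ≈⟨ solve 3 (λ e x y → (e :* x) :* y := x :* (e :* y)) ≈-refl ε x′ y ⟩
            x′ * (ε * y)   ≈⟨ *-congˡ y≈ ⟩
            x′ * (ε * y′)  ≈⟨ solve 3 (λ e x y → x :* (e :* y) := e :* (x :* y)) ≈-refl ε x′ y′ ⟩
            ε * (x′ * y′)  ∎
        ; *-assoc = λ x y z → *-congˡ (*-assoc x y z)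
        ; *-identity = (λ x → *-congˡ (*-identityˡ x)) , (λ x → *-congˡ (*-identityʳ x))
        ; distrib = (λ x y z → *-congˡ (distribˡ x y z)) , (λ x y z → *-congˡ (distribʳ x y z)) }
      ; *-comm = λ x y → *-congˡ (*-comm x y) } }
    where open Solver

  -- Every element is a unit multiple of its support, so inverting u and then splitting
  -- along supports until nothing changes leaves a field.
  module _ (reps : List Carrier) (cover : ∀ y → ∃ λ z → z ∈ reps × y ≈ z) (u : Carrier) (u≉0 : ¬ u ≈ 0#) where

    ε : Carrier
    ε = refine reps (support u)

    residueField : CommutativeRing 0ℓ 0ℓ
    residueField = localise ε

    private module L = CommutativeRing residueField

    residueField-u≉0 : ¬ u L.≈ 0#
    residueField-u≉0 εu≈ε0 = refine-≉0 reps support-u≉0 (begin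
      ε                  ≈⟨ refine-absorb reps (support-idempotent u) ⟨
      ε * (u * u ^ r)    ≈⟨ *-assoc _ _ _ ⟨
      (ε * u) * u ^ r    ≈⟨ *-congʳ (≈-trans εu≈ε0 (zeroʳ ε)) ⟩
      0# * u ^ r         ≈⟨ zeroˡ _ ⟩
      0#                 ∎)
      where
      support-u≉0 : ¬ support u ≈ 0#
      support-u≉0 s≈0 = u≉0 (≈-trans (≈-sym (support-absorb u)) (≈-trans (*-congʳ s≈0) (zeroˡ u)))

    residueField-inverse : ∀ y → y L.≈ 0# ⊎ y * y ^ r L.≈ 1#
    residueField-inverse y with cover y
    ... | z , z∈ , y≈z with refine-minimal reps (support-idempotent u) z∈
    ...   | inj₁ ≈0 = inj₁ (begin
      ε * y                    ≈⟨ *-congˡ (≈-trans y≈z (≈-sym (support-absorb z))) ⟩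
      ε * (support z * z)      ≈⟨ *-assoc _ _ _ ⟨
      (ε * support z) * z      ≈⟨ *-congʳ ≈0 ⟩
      0# * z                   ≈⟨ zeroˡ z ⟩
      0#                       ≈⟨ zeroʳ ε ⟨
      ε * 0#                   ∎)
    ...   | inj₂ ≈ε = inj₂ (≈-trans (*-congˡ (^-congˡ (suc r) y≈z)) (≈-trans ≈ε (≈-sym (*-identityʳ ε))))

module Basis (p₁ : ℕ) (R : CommutativeRing 0ℓ 0ℓ) (p-prime : Prime (suc p₁))
  (p≈0  : CommutativeRing._≈_ R (RingKit._·_ R (suc p₁) (CommutativeRing.1# R)) (CommutativeRing.0# R))
  (_≈?_ : ∀ x y → Dec (CommutativeRing._≈_ R x y)) where
  open CommutativeRing R renaming (refl to ≈-refl; sym to ≈-sym; trans to ≈-trans; zero to *-zero)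
  open RingKit R
  open Characteristic R (suc p₁) p-prime p≈0 using (·≈·1*; ∣⇒·≈0)
  open import Relation.Binary.Reasoning.Setoid setoid

  private
    p : ℕ
    p = suc p₁

    subℤₚ-· : ∀ (a b : Fin p) x → toℕ (subℤₚ a b) · x ≈ toℕ a · x - toℕ b · x
    subℤₚ-· a b x = begin
      toℕ (subℤₚ a b) · x                                    ≡⟨ cong (_· x) (Fin.toℕ-fromℕ< (ℕ.m%n<n s p)) ⟩
      (s ℕ.% p) · x                                          ≈⟨ +-identityʳ _ ⟨
      (s ℕ.% p) · x + 0#                                     ≈⟨ +-congˡ (∣⇒·≈0 {s ℕ./ p ℕ.* p} x (ℕ.divides (s ℕ./ p) refl)) ⟨
      (s ℕ.% p) · x + (s ℕ./ p ℕ.* p) · x                    ≈⟨ ×-homo-+ x (s ℕ.% p) (s ℕ./ p ℕ.* p) ⟨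
      (s ℕ.% p ℕ.+ s ℕ./ p ℕ.* p) · x                        ≡⟨ cong (_· x) (ℕ.m≡m%n+[m/n]*n s p) ⟨
      s · x                                                  ≈⟨ ×-homo-+ x (toℕ a) (p ℕ.∸ toℕ b) ⟩
      toℕ a · x + (p ℕ.∸ toℕ b) · x                          ≈⟨ solve 3 (λ u v w → u :+ v := (u :+ (v :+ w)) :- w) ≈-refl _ _ (toℕ b · x) ⟩
      toℕ a · x + ((p ℕ.∸ toℕ b) · x + toℕ b · x) - toℕ b · x ≈⟨ +-congʳ (+-congˡ (×-homo-+ x (p ℕ.∸ toℕ b) (toℕ b))) ⟨
      toℕ a · x + (p ℕ.∸ toℕ b ℕ.+ toℕ b) · x - toℕ b · x    ≡⟨ cong (λ n → toℕ a · x + n · x - toℕ b · x) (ℕ.m∸n+n≡m (ℕ.<⇒≤ (Fin.toℕ<n b))) ⟩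
      toℕ a · x + p · x - toℕ b · x                          ≈⟨ +-congʳ (+-congˡ (∣⇒·≈0 x ℕ.∣-refl)) ⟩
      toℕ a · x + 0# - toℕ b · x                             ≈⟨ +-congʳ (+-identityʳ _) ⟩
      toℕ a · x - toℕ b · x                                  ∎
      where
      open Solver
      s = toℕ a ℕ.+ (p ℕ.∸ toℕ b)

  combine : ∀ {k} → Vec Carrier k → Vec (Fin p) k → Carrier
  combine []       []       = 0#
  combine (b ∷ bs) (a ∷ as) = toℕ a · b + combine bs as

  combine-sub : ∀ {k} (bs : Vec Carrier k) u w → combine bs (Vec.zipWith subℤₚ u w) ≈ combine bs u - combine bs w
  combine-sub []       []      []      = ≈-sym (-‿inverseʳ 0#)
  combine-sub (b ∷ bs) (x ∷ u) (y ∷ w) = begin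
    toℕ (subℤₚ x y) · b + combine bs (Vec.zipWith subℤₚ u w)            ≈⟨ +-cong (subℤₚ-· x y b) (combine-sub bs u w) ⟩
    (toℕ x · b - toℕ y · b) + (combine bs u - combine bs w)             ≈⟨ solve 4 (λ a b c d → (a :- b) :+ (c :- d) := (a :+ c) :- (b :+ d)) ≈-refl _ _ _ _ ⟩
    (toℕ x · b + combine bs u) - (toℕ y · b + combine bs w)             ∎
    where open Solver

  Independent : ∀ {k} → Vec Carrier k → Set _
  Independent bs = ∀ u w → combine bs u ≈ combine bs w → u ≡ w

  _∈Span_ : ∀ {k} → Carrier → Vec Carrier k → Set _
  x ∈Span bs = ∃ λ v → combine bs v ≈ x

  _∈Span?_ : ∀ {k} x (bs : Vec Carrier k) → Dec (x ∈Span bs)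
  _∈Span?_ {k} x bs = map′ (λ any → let v , _ , eq = find any in v , eq)
                           (λ (v , eq) → lose (V.complete v) eq)
                           (Any.any? (λ v → combine bs v ≈? x) V.elements)
    where module V = Enumeration (Vec-enumeration (Fin-enumeration p) k)

  module _ {k} (bs : Vec Carrier k) where

    ∈Span-resp : ∀ {x y} → x ≈ y → x ∈Span bs → y ∈Span bs
    ∈Span-resp x≈y (v , eq) = v , ≈-trans eq x≈y

    ∈Span-sub : ∀ {x y} → x ∈Span bs → y ∈Span bs → (x - y) ∈Span bs
    ∈Span-sub (u , eq) (w , eq′) = Vec.zipWith subℤₚ u w , ≈-trans (combine-sub bs u w) (+-cong eq (-‿cong eq′))

    ∈Span-0 : 0# ∈Span bs
    ∈Span-0 = ∈Span-resp (-‿inverseʳ (combine bs v)) (∈Span-sub (v , ≈-refl) (v , ≈-refl))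
      where v = Vec.replicate k Fin.zero

    ∈Span-neg : ∀ {x} → x ∈Span bs → (- x) ∈Span bs
    ∈Span-neg x∈ = ∈Span-resp (+-identityˡ _) (∈Span-sub ∈Span-0 x∈)

    ∈Span-· : ∀ n {x} → x ∈Span bs → (n · x) ∈Span bs
    ∈Span-· zero    x∈ = ∈Span-0
    ∈Span-· (suc n) x∈ = ∈Span-resp (+-congˡ (-‿involutive _)) (∈Span-sub x∈ (∈Span-neg (∈Span-· n x∈)))

    ∈Span-divide : ∀ {d x} → 0 ℕ.< d → d ℕ.< p → (d · x) ∈Span bs → x ∈Span bs
    ∈Span-divide {d} {x} 0<d d<p dx∈ with coprime-Bézout (prime⇒coprime p-prime {{ℕ.>-nonZero 0<d}} d<p)
    ... | Bézout.+- s t 1+td≡sp = ∈Span-resp (begin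
      - (t · (d · x))                      ≈⟨ -‿cong (MultProperties.×-assocˡ semiring x t d) ⟩
      - ((t ℕ.* d) · x)                    ≈⟨ solve 2 (λ x y → :- y := x :- (x :+ y)) ≈-refl x _ ⟩
      x - (1 ℕ.+ t ℕ.* d) · x              ≈⟨ +-congˡ (-‿cong (≈-trans (reflexive (cong (_· x) 1+td≡sp)) (∣⇒·≈0 x (ℕ.divides s refl)))) ⟩
      x - 0#                               ≈⟨ solve 1 (λ x → x :- con 0ℤ := x) ≈-refl x ⟩
      x                                    ∎) (∈Span-neg (∈Span-· t dx∈))
      where open Solver
    ... | Bézout.-+ s t 1+sp≡td = ∈Span-resp (begin
      t · (d · x)                          ≈⟨ MultProperties.×-assocˡ semiring x t d ⟩
      (t ℕ.* d) · x                        ≡⟨ cong (_· x) 1+sp≡td ⟨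
      (1 ℕ.+ s ℕ.* p) · x                  ≈⟨ +-congˡ (∣⇒·≈0 x (ℕ.divides s refl)) ⟩
      x + 0#                               ≈⟨ +-identityʳ x ⟩
      x                                    ∎) (∈Span-· t dx∈)

    private
      solve-for : ∀ {a b x u w} → a ℕ.< b → b ℕ.< p → a · x + combine bs u ≈ b · x + combine bs w → x ∈Span bs
      solve-for {a} {b} {x} {u} {w} a<b b<p eq = ∈Span-divide (ℕ.m<n⇒0<n∸m a<b) (ℕ.≤-<-trans (ℕ.m∸n≤m b a) b<p)
        (∈Span-resp (begin
          combine bs u - combine bs w                                ≈⟨ solve 3 (λ u w ax → u :- w := ((ax :+ u) :- w) :- ax) ≈-refl _ _ (a · x) ⟩
          ((a · x + combine bs u) - combine bs w) - a · x            ≈⟨ +-congʳ (+-congʳ eq) ⟩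
          ((b · x + combine bs w) - combine bs w) - a · x            ≡⟨ cong (λ n → ((n · x + combine bs w) - combine bs w) - a · x) (ℕ.m∸n+n≡m (ℕ.<⇒≤ a<b)) ⟨
          (((b ℕ.∸ a ℕ.+ a) · x + combine bs w) - combine bs w) - a · x ≈⟨ +-congʳ (+-congʳ (+-congʳ (×-homo-+ x (b ℕ.∸ a) a))) ⟩
          (((b ℕ.∸ a) · x + a · x + combine bs w) - combine bs w) - a · x ≈⟨ solve 3 (λ d ax w → ((d :+ ax :+ w) :- w) :- ax := d) ≈-refl _ _ _ ⟩
          (b ℕ.∸ a) · x                                              ∎)
          (∈Span-sub (u , ≈-refl) (w , ≈-refl)))
        where open Solver

    extend : ∀ {x} → Independent bs → ¬ x ∈Span bs → Independent (x ∷ bs)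
    extend {x} ind x∉ (a ∷ u) (b ∷ w) eq with ℕ.<-cmp (toℕ a) (toℕ b)
    ... | tri< a<b _ _ = contradiction (solve-for a<b (Fin.toℕ<n b) eq) x∉
    ... | tri> _ _ b<a = contradiction (solve-for b<a (Fin.toℕ<n a) (≈-sym eq)) x∉
    ... | tri≈ _ a≡b _ with Fin.toℕ-injective a≡b
    ...   | refl = cong (a ∷_) (ind u w (AbelianGroupProperties.∙-cancelˡ +-abelianGroup _ _ _ eq))

  basis : ∀ ys → ∃ λ k → Σ (Vec Carrier k) λ bs → Independent bs × (∀ {y} → y ∈ ys → y ∈Span bs)
  basis []       = 0 , [] , (λ { [] [] _ → refl }) , (λ ())
  basis (y ∷ ys) with basis ys
  ... | k , bs , ind , spans with y ∈Span? bs
  ...   | yes y∈ = k , bs , ind , λ { (here refl) → y∈ ; (there y∈ys) → spans y∈ys }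
  ...   | no  y∉ = suc k , y ∷ bs , extend bs ind y∉ , λ
    { (here refl)  → let v , eq = ∈Span-0 bs in Fin.fromℕ< 1<p ∷ v , (begin
        toℕ (Fin.fromℕ< 1<p) · y + combine bs v  ≡⟨ cong (λ n → n · y + combine bs v) (Fin.toℕ-fromℕ< 1<p) ⟩
        (y + 0#) + combine bs v                  ≈⟨ +-cong (+-identityʳ y) eq ⟩
        y + 0#                                   ≈⟨ +-identityʳ y ⟩
        y                                        ∎)
    ; (there y∈ys) → let v , eq = spans y∈ys in Fin.zero ∷ v , ≈-trans (+-identityˡ _) eq }
    where
    1<p : 1 ℕ.< p
    1<p = ℕ.nonTrivial⇒n>1 p {{prime⇒nonTrivial p-prime}}

record GaloisField (p n : ℕ) : Set where
  field
    baseField      : Field (Vec (Fin p) n)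
    zipWith-subℤₚ  : ∀ u w → Vec.zipWith subℤₚ u w ≡ Field._+_ baseField u (Field.-_ baseField w)
    characteristic : RingKit._·_ (Field.commutativeRing baseField) p (Field.1# baseField) ≡ Field.0# baseField

length-Vec-elements : ∀ {A : Set} (xs : List A) n → length (Vec-elements xs n) ≡ length xs ℕ.^ n
length-Vec-elements xs zero    = refl
length-Vec-elements xs (suc n) = trans (go xs) (cong (length xs ℕ.*_) (length-Vec-elements xs n))
  where
  go : ∀ ys → length (cartesianProductWith Vec._∷_ ys (Vec-elements xs n)) ≡ length ys ℕ.* length (Vec-elements xs n)
  go []       = refl
  go (y ∷ ys) = trans (List.length-++ (map (y ∷_) (Vec-elements xs n))) (cong₂ ℕ._+_ (List.length-map (y ∷_) (Vec-elements xs n)) (go ys))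

-- The polynomials over ℤ/p modulo X^q − X, acting on the sequences annihilated by X^q − X with X as the shift.
module ShiftRing (p₁ r : ℕ) where

  p q : ℕ
  p = suc p₁
  q = suc (suc r)

  data Expr : Set where
    𝟘 𝟙 X : Expr
    _⊕_ _⊗_ : Expr → Expr → Expr
    ⊖_ : Expr → Expr

  Sequence : Set
  Sequence = ℕ → ℤ

  act : Expr → Sequence → Sequence
  act 𝟘       w n = 0ℤ
  act 𝟙       w n = w n
  act X       w n = w (suc n)
  act (E ⊕ F) w n = act E w n ℤ.+ act F w n
  act (E ⊗ F) w n = act E (act F w) n
  act (⊖ E)   w n = ℤ.- act E w n

  open RingKit ℤ.+-*-commutativeRing using (module Solver)
  open Solver
  open ≡.≡-Reasoning

  act-cong : ∀ E {w w′} → (∀ n → w n ≡ w′ n) → ∀ n → act E w n ≡ act E w′ n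
  act-cong 𝟘       eq n = refl
  act-cong 𝟙       eq n = eq n
  act-cong X       eq n = eq (suc n)
  act-cong (E ⊕ F) eq n = cong₂ ℤ._+_ (act-cong E eq n) (act-cong F eq n)
  act-cong (E ⊗ F) eq n = act-cong E (act-cong F eq) n
  act-cong (⊖ E)   eq n = cong ℤ.-_ (act-cong E eq n)

  act-+ : ∀ E w w′ n → act E (λ n → w n ℤ.+ w′ n) n ≡ act E w n ℤ.+ act E w′ n
  act-+ 𝟘       w w′ n = refl
  act-+ 𝟙       w w′ n = refl
  act-+ X       w w′ n = refl
  act-+ (E ⊕ F) w w′ n = trans (cong₂ ℤ._+_ (act-+ E w w′ n) (act-+ F w w′ n))
    (solve 4 (λ a b c d → (a :+ b) :+ (c :+ d) := (a :+ c) :+ (b :+ d)) refl (act E w n) (act E w′ n) (act F w n) (act F w′ n))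
  act-+ (E ⊗ F) w w′ n = trans (act-cong E (act-+ F w w′) n) (act-+ E _ _ n)
  act-+ (⊖ E)   w w′ n = trans (cong ℤ.-_ (act-+ E w w′ n)) (ℤ.neg-distrib-+ (act E w n) (act E w′ n))

  act-* : ∀ E w c n → act E (λ n → w n ℤ.* c) n ≡ act E w n ℤ.* c
  act-* 𝟘       w c n = sym (ℤ.*-zeroˡ c)
  act-* 𝟙       w c n = refl
  act-* X       w c n = refl
  act-* (E ⊕ F) w c n = trans (cong₂ ℤ._+_ (act-* E w c n) (act-* F w c n)) (sym (ℤ.*-distribʳ-+ c (act E w n) (act F w n)))
  act-* (E ⊗ F) w c n = trans (act-cong E (act-* F w c) n) (act-* E _ c n)
  act-* (⊖ E)   w c n = trans (cong ℤ.-_ (act-* E w c n)) (ℤ.neg-distribˡ-* (act E w n) c)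

  act-0 : ∀ E n → act E (λ _ → 0ℤ) n ≡ 0ℤ
  act-0 E n = trans (act-* E (λ _ → 0ℤ) 0ℤ n) (ℤ.*-zeroʳ (act E (λ _ → 0ℤ) n))

  act-neg : ∀ E w n → act E (λ n → ℤ.- w n) n ≡ ℤ.- act E w n
  act-neg E w n = begin
    act E (λ n → ℤ.- w n) n           ≡⟨ act-cong E (λ n → solve 1 (λ x → :- x := x :* con ℤ.-1ℤ) refl (w n)) n ⟩
    act E (λ n → w n ℤ.* ℤ.-1ℤ) n     ≡⟨ act-* E w ℤ.-1ℤ n ⟩
    act E w n ℤ.* ℤ.-1ℤ               ≡⟨ solve 1 (λ x → x :* con ℤ.-1ℤ := :- x) refl (act E w n) ⟩
    ℤ.- act E w n                     ∎

  act-shift : ∀ E w n → act E (w ∘ suc) n ≡ act E w (suc n)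
  act-shift 𝟘       w n = refl
  act-shift 𝟙       w n = refl
  act-shift X       w n = refl
  act-shift (E ⊕ F) w n = cong₂ ℤ._+_ (act-shift E w n) (act-shift F w n)
  act-shift (E ⊗ F) w n = trans (act-cong E (act-shift F w) n) (act-shift E (act F w) n)
  act-shift (⊖ E)   w n = cong ℤ.-_ (act-shift E w n)

  act-comm : ∀ E F w n → act E (act F w) n ≡ act F (act E w) n
  act-comm 𝟘       F w n = sym (act-0 F n)
  act-comm 𝟙       F w n = refl
  act-comm X       F w n = sym (act-shift F w n)
  act-comm (E ⊕ E′) F w n = trans (cong₂ ℤ._+_ (act-comm E F w n) (act-comm E′ F w n)) (sym (act-+ F _ _ n))
  act-comm (E ⊗ E′) F w n = trans (act-cong E (act-comm E′ F w) n) (act-comm E F (act E′ w) n)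
  act-comm (⊖ E)   F w n = trans (cong ℤ.-_ (act-comm E F w n)) (sym (act-neg F _ n))

  Periodic : Sequence → Set
  Periodic w = ∀ n → w (q ℕ.+ n) ≡ w (suc n)

  act-shift-q : ∀ E w n → act E (λ m → w (q ℕ.+ m)) n ≡ act E w (q ℕ.+ n)
  act-shift-q E w n = go q w n
    where
    go : ∀ k w n → act E (λ m → w (k ℕ.+ m)) n ≡ act E w (k ℕ.+ n)
    go zero    w n = refl
    go (suc k) w n = trans (go k (w ∘ suc) n) (act-shift E w (k ℕ.+ n))

  act-periodic : ∀ E {w} → Periodic w → Periodic (act E w)
  act-periodic E {w} per n = trans (sym (act-shift-q E w n)) (trans (act-cong E per n) (act-shift E w n))

  infix 4 _≡ₚ_ _≈_
  record _≡ₚ_ (a b : ℤ) : Set where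
    constructor mod-p
    field divides-difference : ℤ.+ p ℤ.∣ a ℤ.- b
  open _≡ₚ_

  ≡ₚ-reflexive : ∀ {a b} → a ≡ b → a ≡ₚ b
  ≡ₚ-reflexive {a} refl = mod-p $ ℤ.divides 0ℤ (ℤ.+-inverseʳ a)

  ≡ₚ-sym : ∀ {a b} → a ≡ₚ b → b ≡ₚ a
  ≡ₚ-sym {a} {b} a≡b = mod-p $ subst (ℤ.+ p ℤ.∣_) (solve 2 (λ a b → :- (a :- b) := b :- a) refl a b) (ℤ.∣m⇒∣-m (divides-difference a≡b))

  ≡ₚ-trans : ∀ {a b c} → a ≡ₚ b → b ≡ₚ c → a ≡ₚ c
  ≡ₚ-trans {a} {b} {c} a≡b b≡c = mod-p $ subst (ℤ.+ p ℤ.∣_) (solve 3 (λ a b c → (a :- b) :+ (b :- c) := a :- c) refl a b c) (ℤ.∣m∣n⇒∣m+n (divides-difference a≡b) (divides-difference b≡c))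

  ≡ₚ-+ : ∀ {a b c d} → a ≡ₚ b → c ≡ₚ d → a ℤ.+ c ≡ₚ b ℤ.+ d
  ≡ₚ-+ {a} {b} {c} {d} a≡b c≡d = mod-p $ subst (ℤ.+ p ℤ.∣_) (solve 4 (λ a b c d → (a :- b) :+ (c :- d) := (a :+ c) :- (b :+ d)) refl a b c d) (ℤ.∣m∣n⇒∣m+n (divides-difference a≡b) (divides-difference c≡d))

  ≡ₚ-neg : ∀ {a b} → a ≡ₚ b → ℤ.- a ≡ₚ ℤ.- b
  ≡ₚ-neg {a} {b} a≡b = mod-p $ subst (ℤ.+ p ℤ.∣_) (solve 2 (λ a b → :- (a :- b) := :- a :- :- b) refl a b) (ℤ.∣m⇒∣-m (divides-difference a≡b))

  ≡ₚ-*ʳ : ∀ {a b} c → a ≡ₚ b → a ℤ.* c ≡ₚ b ℤ.* c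
  ≡ₚ-*ʳ {a} {b} c a≡b = mod-p $ subst (ℤ.+ p ℤ.∣_) (solve 3 (λ a b c → (a :- b) :* c := a :* c :- b :* c) refl a b c) (ℤ.∣m⇒∣m*n c (divides-difference a≡b))

  act-≡ₚ : ∀ E {w w′} → (∀ n → w n ≡ₚ w′ n) → ∀ n → act E w n ≡ₚ act E w′ n
  act-≡ₚ 𝟘       eq n = ≡ₚ-reflexive refl
  act-≡ₚ 𝟙       eq n = eq n
  act-≡ₚ X       eq n = eq (suc n)
  act-≡ₚ (E ⊕ F) eq n = ≡ₚ-+ (act-≡ₚ E eq n) (act-≡ₚ F eq n)
  act-≡ₚ (E ⊗ F) eq n = act-≡ₚ E (act-≡ₚ F eq) n
  act-≡ₚ (⊖ E)   eq n = ≡ₚ-neg (act-≡ₚ E eq n)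

  record _≈_ (E F : Expr) : Set where
    constructor mk≈
    field at : ∀ {w} → Periodic w → ∀ n → act E w n ≡ₚ act F w n
  open _≈_

  ≡⇒≈ : ∀ {E F} → (∀ w n → act E w n ≡ act F w n) → E ≈ F
  ≡⇒≈ eq = mk≈ λ {w} _ n → ≡ₚ-reflexive (eq w n)

  ring : CommutativeRing 0ℓ 0ℓ
  ring = record
    { Carrier = Expr ; _≈_ = _≈_
    ; _+_ = _⊕_ ; _*_ = _⊗_ ; -_ = ⊖_ ; 0# = 𝟘 ; 1# = 𝟙
    ; isCommutativeRing = record
      { isRing = record
        { +-isAbelianGroup = record
          { isGroup = record
            { isMonoid = record
              { isSemigroup = record
                { isMagma = record
                  { isEquivalence = record
                    { refl  = ≡⇒≈ λ _ _ → refl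
                    ; sym   = λ E≈F → mk≈ λ per n → ≡ₚ-sym (at E≈F per n)
                    ; trans = λ E≈F F≈G → mk≈ λ per n → ≡ₚ-trans (at E≈F per n) (at F≈G per n) }
                  ; ∙-cong = λ E≈ F≈ → mk≈ λ per n → ≡ₚ-+ (at E≈ per n) (at F≈ per n) }
                ; assoc = λ E F G → ≡⇒≈ λ w n → ℤ.+-assoc (act E w n) (act F w n) (act G w n) }
              ; identity = (λ E → ≡⇒≈ λ w n → ℤ.+-identityˡ (act E w n)) , (λ E → ≡⇒≈ λ w n → ℤ.+-identityʳ (act E w n)) }
            ; inverse = (λ E → ≡⇒≈ λ w n → ℤ.+-inverseˡ (act E w n)) , (λ E → ≡⇒≈ λ w n → ℤ.+-inverseʳ (act E w n))
            ; ⁻¹-cong = λ E≈ → mk≈ λ per n → ≡ₚ-neg (at E≈ per n) }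
          ; comm = λ E F → ≡⇒≈ λ w n → ℤ.+-comm (act E w n) (act F w n) }
        ; *-cong = λ {E} {E′} {F} {F′} E≈ F≈ → mk≈ λ per n →
            ≡ₚ-trans (act-≡ₚ E (at F≈ per) n) (at E≈ (act-periodic F′ per) n)
        ; *-assoc = λ E F G → ≡⇒≈ λ w n → refl
        ; *-identity = (λ E → ≡⇒≈ λ w n → refl) , (λ E → ≡⇒≈ λ w n → refl)
        ; distrib = (λ E F G → ≡⇒≈ λ w n → act-+ E _ _ n) , (λ E F G → ≡⇒≈ λ w n → refl) }
      ; *-comm = λ E F → ≡⇒≈ λ w n → act-comm E F w n } }

  open RingKit ring using (_·_; _^_; ^-distrib-*)
  module Σℤ = RingSums ℤ.+-*-commutativeRing
  module ΣE = RingSums ring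

  act-· : ∀ k E w n → act (k · E) w n ≡ ℤ.+ k ℤ.* act E w n
  act-· zero    E w n = sym (ℤ.*-zeroˡ (act E w n))
  act-· (suc k) E w n = trans (cong (λ t → act E w n ℤ.+ t) (act-· k E w n)) (sym (ℤ.suc-* (ℤ.+ k) (act E w n)))

  act-X^ : ∀ k w n → act (X ^ k) w n ≡ w (k ℕ.+ n)
  act-X^ zero    w n = refl
  act-X^ (suc k) w n = trans (act-X^ k w (suc n)) (cong w (ℕ.+-suc k n))

  act-∑ : ∀ {A : Set} (xs : List A) E (f : A → Sequence) n → act E (λ n → Σℤ.∑ xs (λ x → f x n)) n ≡ Σℤ.∑ xs (λ x → act E (f x) n)
  act-∑ []       E f n = act-0 E n
  act-∑ (x ∷ xs) E f n = trans (act-+ E (f x) _ n) (cong (λ t → act E (f x) n ℤ.+ t) (act-∑ xs E f n))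

  ∑-act : ∀ {A : Set} (xs : List A) (f : A → Expr) w n → act (ΣE.∑ xs f) w n ≡ Σℤ.∑ xs (λ x → act (f x) w n)
  ∑-act []       f w n = refl
  ∑-act (x ∷ xs) f w n = cong (λ t → act (f x) w n ℤ.+ t) (∑-act xs f w n)

  from-0 : ∀ {E F} → (∀ {w} → Periodic w → act E w 0 ≡ₚ act F w 0) → E ≈ F
  from-0 {E} {F} eq = mk≈ λ {w} per n →
    ≡ₚ-trans (≡ₚ-reflexive (sym (to-0 E w n))) (≡ₚ-trans (eq (act-periodic (X ^ n) per)) (≡ₚ-reflexive (to-0 F w n)))
    where
    to-0 : ∀ E w n → act E (act (X ^ n) w) 0 ≡ act E w n
    to-0 E w n = trans (act-comm E (X ^ n) w 0) (trans (act-X^ n (act E w) 0) (cong (act E w) (ℕ.+-identityʳ n)))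

  next : Fin q → Fin q
  next j with suc (toℕ j) ℕ.<? q
  ... | yes j<q = Fin.fromℕ< j<q
  ... | no  _   = Fin.suc Fin.zero

  reduce : ℕ → Fin q
  reduce zero    = Fin.zero
  reduce (suc n) = next (reduce n)

  reduce-< : ∀ n → n ℕ.< q → toℕ (reduce n) ≡ n
  reduce-< zero    _   = refl
  reduce-< (suc n) n<q with suc (toℕ (reduce n)) ℕ.<? q
  ... | yes j<q = trans (Fin.toℕ-fromℕ< j<q) (cong suc (reduce-< n (ℕ.<-trans (ℕ.n<1+n n) n<q)))
  ... | no  j≮q = contradiction (subst (ℕ._< q) (cong suc (sym (reduce-< n (ℕ.<-trans (ℕ.n<1+n n) n<q)))) n<q) j≮q

  reduce-periodic : ∀ n → reduce (q ℕ.+ n) ≡ reduce (suc n)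
  reduce-periodic zero    = Fin.toℕ-injective (trans reduce-q (sym (reduce-< 1 (s≤s (s≤s z≤n)))))
    where
    reduce-q : toℕ (reduce (q ℕ.+ 0)) ≡ 1
    reduce-q with suc (toℕ (reduce (suc r ℕ.+ 0))) ℕ.<? q
    ... | yes j<q = contradiction (trans (cong (toℕ ∘ reduce) (ℕ.+-identityʳ (suc r))) (reduce-< (suc r) (ℕ.n<1+n (suc r)))) (ℕ.<⇒≢ (ℕ.s≤s⁻¹ j<q))
    ... | no  _   = refl
  reduce-periodic (suc n) = trans (cong reduce (ℕ.+-suc q n)) (cong next (reduce-periodic n))

  periodic-reduce : ∀ {w} → Periodic w → ∀ n k → w (toℕ (reduce n) ℕ.+ k) ≡ w (n ℕ.+ k)
  periodic-reduce {w} per zero    k = refl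
  periodic-reduce {w} per (suc n) k = trans (step (reduce n)) (trans (periodic-reduce {w} per n (suc k)) (cong w (ℕ.+-suc n k)))
    where
    step : ∀ j → w (toℕ (next j) ℕ.+ k) ≡ w (toℕ j ℕ.+ suc k)
    step j with suc (toℕ j) ℕ.<? q
    ... | yes j<q = trans (cong (λ i → w (i ℕ.+ k)) (Fin.toℕ-fromℕ< j<q)) (cong w (sym (ℕ.+-suc (toℕ j) k)))
    ... | no  j≮q = trans (sym (per k)) (trans (cong (λ i → w (i ℕ.+ k)) (ℕ.≤-antisym (ℕ.≮⇒≥ j≮q) (Fin.toℕ<n j))) (cong w (sym (ℕ.+-suc (toℕ j) k))))

  δ : Fin q → Sequence
  δ j n = Σℤ.⟦ j Fin.≟ reduce n ⟧

  δ-periodic : ∀ j → Periodic (δ j)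
  δ-periodic j n = cong (λ i → Σℤ.⟦ j Fin.≟ i ⟧) (reduce-periodic n)

  act-δ : ∀ E {w} → Periodic w → act E w 0 ≡ Σℤ.∑ (allFin q) (λ j → act E (δ j) 0 ℤ.* w (toℕ j))
  act-δ E {w} per = begin
    act E w 0                                                       ≡⟨ act-cong E (λ n → expand n) 0 ⟩
    act E (λ n → Σℤ.∑ (allFin q) (λ j → δ j n ℤ.* w (toℕ j))) 0     ≡⟨ act-∑ (allFin q) E (λ j n → δ j n ℤ.* w (toℕ j)) 0 ⟩
    Σℤ.∑ (allFin q) (λ j → act E (λ n → δ j n ℤ.* w (toℕ j)) 0)     ≡⟨ Σℤ.∑-cong (allFin q) (λ j → act-* E (δ j) (w (toℕ j)) 0) ⟩
    Σℤ.∑ (allFin q) (λ j → act E (δ j) 0 ℤ.* w (toℕ j))             ∎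
    where
    expand : ∀ n → w n ≡ Σℤ.∑ (allFin q) (λ j → δ j n ℤ.* w (toℕ j))
    expand n = begin
      w n                        ≡⟨ cong w (ℕ.+-identityʳ n) ⟨
      w (n ℕ.+ 0)                ≡⟨ periodic-reduce {w} per n 0 ⟨
      w (toℕ (reduce n) ℕ.+ 0)   ≡⟨ cong w (ℕ.+-identityʳ _) ⟩
      w (toℕ (reduce n))         ≡⟨ Σℤ.∑-⟦≟⟧ (Fin-enumeration q) (reduce n) (w ∘ toℕ) ⟨
      Σℤ.∑ (allFin q) (λ j → δ j n ℤ.* w (toℕ j)) ∎

  ∑-≡ₚ : ∀ {A : Set} (xs : List A) {f g : A → ℤ} → (∀ x → f x ≡ₚ g x) → Σℤ.∑ xs f ≡ₚ Σℤ.∑ xs g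
  ∑-≡ₚ []       eq = ≡ₚ-reflexive refl
  ∑-≡ₚ (x ∷ xs) eq = ≡ₚ-+ (eq x) (∑-≡ₚ xs eq)

  from-δ : ∀ {E F} → (∀ j → act E (δ j) 0 ≡ₚ act F (δ j) 0) → E ≈ F
  from-δ {E} {F} eq = from-0 λ {w} per → ≡ₚ-trans (≡ₚ-reflexive (act-δ E per))
    (≡ₚ-trans (∑-≡ₚ (allFin q) (λ j → ≡ₚ-*ʳ (w (toℕ j)) (eq j))) (≡ₚ-reflexive (sym (act-δ F per))))

  _≈?_ : ∀ E F → Dec (E ≈ F)
  E ≈? F = map′ (λ all → from-δ (λ j → mod-p (all j))) (λ E≈F j → divides-difference (at E≈F (δ-periodic j) 0))
                (Fin.all? (λ j → (ℤ.+ p) ℤ.∣? (act E (δ j) 0 ℤ.- act F (δ j) 0)))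

  polynomial : Vec (Fin p) q → Expr
  polynomial v = ΣE.∑ (allFin q) (λ j → toℕ (Vec.lookup v j) · (X ^ toℕ j))

  representatives : List Expr
  representatives = map polynomial (Vec-elements (allFin p) q)

  cover : ∀ E → ∃ λ F → F ∈ representatives × E ≈ F
  cover E = polynomial v , Mem.∈-map⁺ polynomial (Enumeration.complete (Vec-enumeration (Fin-enumeration p) q) v) , from-0 λ {w} per →
    ≡ₚ-trans (≡ₚ-reflexive (act-δ E per)) (≡ₚ-trans (∑-≡ₚ (allFin q) (λ j → ≡ₚ-*ʳ (w (toℕ j)) (coeff-≡ₚ j))) (≡ₚ-reflexive (sym (act-v w))))
    where
    c : Fin q → ℤ
    c j = act E (δ j) 0
    digit : Fin q → Fin p
    digit j = Fin.fromℕ< (ℤ.n%ℕd<d (c j) p)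
    v : Vec (Fin p) q
    v = Vec.tabulate digit
    coeff : ∀ j → toℕ (Vec.lookup v j) ≡ c j ℤ.%ℕ p
    coeff j = trans (cong toℕ (Vec.lookup∘tabulate digit j)) (Fin.toℕ-fromℕ< (ℤ.n%ℕd<d (c j) p))
    coeff-≡ₚ : ∀ j → c j ≡ₚ ℤ.+ toℕ (Vec.lookup v j)
    coeff-≡ₚ j = mod-p $ ℤ.divides (c j ℤ./ℕ p) (begin
      c j ℤ.- ℤ.+ toℕ (Vec.lookup v j)                              ≡⟨ cong₂ (λ a b → a ℤ.- ℤ.+ b) (ℤ.a≡a%ℕn+[a/ℕn]*n (c j) p) (coeff j) ⟩
      (ℤ.+ (c j ℤ.%ℕ p) ℤ.+ (c j ℤ./ℕ p) ℤ.* ℤ.+ p) ℤ.- ℤ.+ (c j ℤ.%ℕ p) ≡⟨ solve 2 (λ a b → (a :+ b) :- a := b) refl (ℤ.+ (c j ℤ.%ℕ p)) _ ⟩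
      (c j ℤ./ℕ p) ℤ.* ℤ.+ p                                        ∎)
    act-v : ∀ w → act (polynomial v) w 0 ≡ Σℤ.∑ (allFin q) (λ j → ℤ.+ toℕ (Vec.lookup v j) ℤ.* w (toℕ j))
    act-v w = trans (∑-act (allFin q) (λ j → toℕ (Vec.lookup v j) · (X ^ toℕ j)) w 0) (Σℤ.∑-cong (allFin q) (λ j →
      trans (act-· (toℕ (Vec.lookup v j)) (X ^ toℕ j) w 0)
            (cong (λ t → ℤ.+ toℕ (Vec.lookup v j) ℤ.* t) (trans (act-X^ (toℕ j) w 0) (cong w (ℕ.+-identityʳ (toℕ j)))))))

  characteristic : p · 𝟙 ≈ 𝟘
  characteristic = mk≈ λ {w} per n → subst (λ t → t ≡ₚ 0ℤ) (sym (act-· p 𝟙 w n))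
    (mod-p $ ℤ.divides (w n) (solve 2 (λ p w → p :* w :- con 0ℤ := w :* p) refl (ℤ.+ p) (w n)))

  module _ (p-prime : Prime p) {e} (q≡p^e : q ≡ p ℕ.^ e) where
    open CommutativeRing ring using (+-cong; *-cong; zeroˡ; *-identityˡ; -‿inverseʳ; -‿cong; setoid; reflexive; +-abelianGroup) renaming (sym to ≈-sym; trans to ≈-trans)
    open RingKit ring using (^-congˡ)
    open Characteristic ring p p-prime characteristic using (frobenius^)

    frobenius-q : ∀ E F → (E ⊕ F) ^ q ≈ (E ^ q) ⊕ (F ^ q)
    frobenius-q E F = subst (λ n → (E ⊕ F) ^ n ≈ (E ^ n) ⊕ (F ^ n)) (sym q≡p^e) (frobenius^ e E F)

    𝟙^ : ∀ n → 𝟙 ^ n ≈ 𝟙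
    𝟙^ zero    = ≡⇒≈ λ _ _ → refl
    𝟙^ (suc n) = ≈-trans (*-identityˡ (𝟙 ^ n)) (𝟙^ n)

    pow-q : ∀ E → E ^ q ≈ E
    pow-q 𝟘       = zeroˡ _
    pow-q 𝟙       = 𝟙^ q
    pow-q X       = mk≈ λ {w} per n → ≡ₚ-reflexive (trans (act-X^ q w n) (per n))
    pow-q (E ⊕ F) = ≈-trans (frobenius-q E F) (+-cong (pow-q E) (pow-q F))
    pow-q (E ⊗ F) = ≈-trans (^-distrib-* E F q) (*-cong (pow-q E) (pow-q F))
    pow-q (⊖ E)   = ≈-trans (AbelianGroupProperties.inverseʳ-unique +-abelianGroup (E ^ q) ((⊖ E) ^ q)
      (≈-trans (≈-sym (frobenius-q E (⊖ E))) (≈-trans (^-congˡ q (-‿inverseʳ E)) (zeroˡ _)))) (-‿cong (pow-q E))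

  difference : ℕ → Expr
  difference a = (X ^ a) ⊕ (⊖ X)

  differences : List ℕ → Expr
  differences []       = 𝟙
  differences (a ∷ as) = differences as ⊗ difference a

  total-degree : List ℕ → ℕ
  total-degree = foldr ℕ._+_ 0

  act-differences : ∀ as → All (2 ℕ.≤_) as → ∀ w → (∀ i → i ℕ.< total-degree as → w i ≡ 0ℤ) → w (total-degree as) ≡ 1ℤ → act (differences as) w 0 ≡ 1ℤ
  act-differences []       []         w zeros top = top
  act-differences (a ∷ as) (2≤a ∷ 2≤) w zeros top = act-differences as 2≤ (act (difference a) w)
    (λ i i<s → trans (act-difference i) (cong₂ ℤ._-_ (zeros (a ℕ.+ i) (ℕ.+-monoʳ-< a i<s)) (zeros (suc i) (ℕ.≤-trans (s≤s i<s) (ℕ.+-monoˡ-≤ s (ℕ.<⇒≤ 2≤a))))))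
    (trans (act-difference s) (cong₂ ℤ._-_ top (zeros (suc s) (ℕ.+-monoˡ-≤ s 2≤a))))
    where
    s = total-degree as
    act-difference : ∀ i → act (difference a) w i ≡ w (a ℕ.+ i) ℤ.- w (suc i)
    act-difference i = cong (λ t → t ℤ.- w (suc i)) (act-X^ a w i)

  differences-≉0 : ∀ as → All (2 ℕ.≤_) as → total-degree as ℕ.< q → 1 ℕ.< p → ¬ differences as ≈ 𝟘
  differences-≉0 as 2≤ s<q 1<p ≈0 = ℕ.<⇒≱ 1<p (ℕ.∣⇒≤ (ℤ.∣⇒∣ᵤ (subst (λ t → ℤ.+ p ℤ.∣ t ℤ.- 0ℤ)
    (act-differences as 2≤ (δ d) zeros top) (divides-difference (at ≈0 (δ-periodic d) 0)))))
    where
    d : Fin q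
    d = reduce (total-degree as)
    zeros : ∀ i → i ℕ.< total-degree as → δ d i ≡ 0ℤ
    zeros i i<s = Enumeration.if-≟-≢ (Fin-enumeration q) (λ d≡ → ℕ.<⇒≢ i<s
      (trans (sym (reduce-< i (ℕ.<-trans i<s s<q))) (trans (cong toℕ (sym d≡)) (reduce-< (total-degree as) s<q))))
    top : δ d (total-degree as) ≡ 1ℤ
    top = Enumeration.if-≟-refl (Fin-enumeration q) d

module Coordinates (p₁ : ℕ) (R : CommutativeRing 0ℓ 0ℓ) (p-prime : Prime (suc p₁))
  (p≈0  : CommutativeRing._≈_ R (RingKit._·_ R (suc p₁) (CommutativeRing.1# R)) (CommutativeRing.0# R))
  (_≈?_ : ∀ x y → Dec (CommutativeRing._≈_ R x y))
  (0≉1  : ¬ CommutativeRing._≈_ R (CommutativeRing.0# R) (CommutativeRing.1# R))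
  (inv  : CommutativeRing.Carrier R → CommutativeRing.Carrier R)
  (inverse : ∀ y → CommutativeRing._≈_ R y (CommutativeRing.0# R) ⊎ CommutativeRing._≈_ R (CommutativeRing._*_ R y (inv y)) (CommutativeRing.1# R))
  {k : ℕ} (bs : Vec (CommutativeRing.Carrier R) k)
  (independent : Basis.Independent p₁ R p-prime p≈0 _≈?_ bs)
  (spans : ∀ x → Basis._∈Span_ p₁ R p-prime p≈0 _≈?_ x bs) where
  open CommutativeRing R renaming (refl to ≈-refl; sym to ≈-sym; trans to ≈-trans; zero to *-zero)
  open Basis p₁ R p-prime p≈0 _≈?_
  open RingKit R

  private
    p : ℕ
    p = suc p₁

  K : Set
  K = Vec (Fin p) k

  ψ : K → Carrier
  ψ = combine bs

  coordinates : Carrier → K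
  coordinates x = proj₁ (spans x)

  ψ-coordinates : ∀ x → ψ (coordinates x) ≈ x
  ψ-coordinates x = proj₂ (spans x)

  monomorphism : IsRingMonomorphism
    (record { _≈_ = _≡_ {A = K} ; _+_ = λ u w → coordinates (ψ u + ψ w) ; _*_ = λ u w → coordinates (ψ u * ψ w)
            ; -_ = λ u → coordinates (- ψ u) ; 0# = coordinates 0# ; 1# = coordinates 1# })
    rawRing ψ
  monomorphism = record
    { isRingHomomorphism = record
      { isSemiringHomomorphism = record
        { isNearSemiringHomomorphism = record
          { +-isMonoidHomomorphism = record
            { isMagmaHomomorphism = record
              { isRelHomomorphism = record { cong = reflexive ∘ cong ψ }
              ; homo = λ u w → ψ-coordinates _ }
            ; ε-homo = ψ-coordinates 0# }
          ; *-homo = λ u w → ψ-coordinates _ }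
        ; 1#-homo = ψ-coordinates 1# }
      ; -‿homo = λ u → ψ-coordinates _ }
    ; injective = λ {u} {w} → independent u w }

  field-structure : Field K
  field-structure = record
    { _+_ = λ u w → coordinates (ψ u + ψ w) ; _*_ = λ u w → coordinates (ψ u * ψ w)
    ; -_ = λ u → coordinates (- ψ u) ; _⁻¹ = λ u → coordinates (inv (ψ u)) ; 0# = coordinates 0# ; 1# = coordinates 1#
    ; isCommutativeRing = RingMonomorphism.isCommutativeRing monomorphism isCommutativeRing
    ; 0≢1 = λ 0≡1 → 0≉1 (≈-trans (≈-sym (ψ-coordinates 0#)) (≈-trans (reflexive (cong ψ 0≡1)) (ψ-coordinates 1#)))
    ; *-inverse = *-inverse }
    where
    *-inverse : ∀ {u} → u ≢ coordinates 0# → coordinates (ψ u * ψ (coordinates (inv (ψ u)))) ≡ coordinates 1#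
    *-inverse {u} u≢0 with inverse (ψ u)
    ... | inj₁ ≈0 = contradiction (independent _ _ (≈-trans ≈0 (≈-sym (ψ-coordinates 0#)))) u≢0
    ... | inj₂ ≈1 = independent _ _ (≈-trans (ψ-coordinates _) (≈-trans (*-congˡ (ψ-coordinates _)) (≈-trans ≈1 (≈-sym (ψ-coordinates 1#)))))

  private
    module F = RingKit (Field.commutativeRing field-structure)

  ψ-· : ∀ n u → ψ (n F.· u) ≈ n · ψ u
  ψ-· zero    u = ψ-coordinates 0#
  ψ-· (suc n) u = ≈-trans (ψ-coordinates _) (+-congˡ (ψ-· n u))

  ψ-^ : ∀ n u → ψ (u F.^ n) ≈ ψ u ^ n
  ψ-^ zero    u = ψ-coordinates 1#
  ψ-^ (suc n) u = ≈-trans (ψ-coordinates _) (*-congˡ (ψ-^ n u))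

  galoisField : GaloisField p k
  galoisField = record
    { baseField = field-structure
    ; zipWith-subℤₚ = λ u w → independent _ _ (≈-trans (combine-sub bs u w) (≈-sym (≈-trans (ψ-coordinates _) (+-congˡ (ψ-coordinates _)))))
    ; characteristic = independent _ _ (≈-trans (ψ-· p (coordinates 1#)) (≈-trans (·-congʳ p (ψ-coordinates 1#)) (≈-trans p≈0 (≈-sym (ψ-coordinates 0#))))) }

module _ {K : Set} (F : Field K) (𝕂 : Enumeration K) where
  open FieldKit F 𝕂
  open CommutativeRing (Field.commutativeRing F) hiding (refl; sym; trans; zero)
  open RingKit (Field.commutativeRing F)
  open Enumeration 𝕂

  size-bound : ∀ r → (∀ y → y ^ suc (suc r) ≡ y) → length elements ℕ.≤ suc (suc r)
  size-bound r pow-q = ℕ.≮⇒≥ λ q<size → All-last r (roots-bound coefficients elements unique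
      (subst (ℕ._≤ length elements) (sym (cong (suc ∘ suc) length-tail)) q<size) (λ {x} _ → root x))
    where
    open Solver
    tail : ℕ → List K
    tail zero    = 1# ∷ []
    tail (suc n) = 0# ∷ tail n
    coefficients : List K
    coefficients = 0# ∷ (- 1#) ∷ tail r
    length-tail : length (tail r) ≡ suc r
    length-tail = go r where
      go : ∀ n → length (tail n) ≡ suc n
      go zero    = refl
      go (suc n) = cong suc (go n)
    eval-tail : ∀ n x → eval (tail n) x ≡ x ^ n
    eval-tail zero    x = solve 1 (λ x → con 1ℤ :+ x :* con 0ℤ := con 1ℤ) refl x
    eval-tail (suc n) x = trans (+-identityˡ _) (cong (x *_) (eval-tail n x))
    root : ∀ x → eval coefficients x ≡ 0#
    root x = trans (cong (λ t → 0# + x * (- 1# + x * t)) (eval-tail r x))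
      (trans (solve 2 (λ x y → con 0ℤ :+ x :* (:- con 1ℤ :+ x :* y) := x :* (x :* y) :- x) refl x (x ^ r))
             (trans (cong (_- x) (pow-q x)) (-‿inverseʳ x)))
    All-last : ∀ n {cs} → All (_≡ 0#) (0# ∷ cs ∷ tail n) → ⊥
    All-last n (_ ∷ _ ∷ all) = go n all where
      go : ∀ n → All (_≡ 0#) (tail n) → ⊥
      go zero    (1≡0 ∷ []) = Field.0≢1 F (sym 1≡0)
      go (suc n) (_ ∷ all)  = go n all

-- The residue field of the ring of polynomials modulo X^q − X at which the class of X is fixed by no
-- smaller power of Frobenius: all its elements satisfy y^q = y, so it has at most q elements,
-- and fewer than q would contradict Fermat.
module Existence (p₁ : ℕ) (p-prime : Prime (suc p₁)) (n r : ℕ) (q≡p^e : suc (suc r) ≡ suc p₁ ℕ.^ suc n) where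
  open ShiftRing p₁ r
  open RingKit ring using (_^_; _·_)

  private
    2≤p : 2 ℕ.≤ p
    2≤p = ℕ.nonTrivial⇒n>1 p {{prime⇒nonTrivial p-prime}}

  powers : ℕ → List ℕ
  powers zero    = []
  powers (suc d) = p ℕ.^ suc d ∷ powers d

  powers-sum : ∀ d → total-degree (powers d) ℕ.< p ℕ.^ suc d
  powers-sum zero    = ℕ.<-≤-trans (s≤s z≤n) (ℕ.≤-trans 2≤p (ℕ.≤-reflexive (sym (ℕ.*-identityʳ p))))
  powers-sum (suc d) = begin-strict
    p ℕ.^ suc d ℕ.+ total-degree (powers d)         <⟨ ℕ.+-monoʳ-< (p ℕ.^ suc d) (powers-sum d) ⟩
    p ℕ.^ suc d ℕ.+ p ℕ.^ suc d            ≡⟨ cong (p ℕ.^ suc d ℕ.+_) (ℕ.+-identityʳ _) ⟨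
    2 ℕ.* p ℕ.^ suc d                      ≤⟨ ℕ.*-monoˡ-≤ (p ℕ.^ suc d) 2≤p ⟩
    p ℕ.^ suc (suc d)                      ∎
    where open ℕ.≤-Reasoning

  powers-≥2 : ∀ d → All (2 ℕ.≤_) (powers d)
  powers-≥2 zero    = []
  powers-≥2 (suc d) = ℕ.≤-trans 2≤p (ℕ.m≤m*n p (p ℕ.^ d) {{ℕ.m^n≢0 p d}}) ∷ powers-≥2 d

  ∈-powers : ∀ {k} d → 1 ℕ.≤ k → k ℕ.≤ d → p ℕ.^ k ∈ powers d
  ∈-powers (suc d) 1≤k k≤1+d with ℕ.m≤n⇒m<n∨m≡n k≤1+d
  ... | inj₁ (s≤s k≤d) = there (∈-powers d 1≤k k≤d)
  ... | inj₂ refl      = here refl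
  ∈-powers {suc k} zero 1≤k ()

  u : Expr
  u = differences (powers n)

  u≉0 : ¬ u ≈ 𝟘
  u≉0 = differences-≉0 (powers n) (powers-≥2 n) (subst (total-degree (powers n) ℕ.<_) (sym q≡p^e) (powers-sum n)) 2≤p

  open Localisation ring r (pow-q p-prime {suc n} q≡p^e) _≈?_

  L : CommutativeRing 0ℓ 0ℓ
  L = residueField representatives cover u u≉0
  module L = CommutativeRing L
  module Lₖ = RingKit L

  ≈⇒≈L : ∀ {x y} → x ≈ y → x L.≈ y
  ≈⇒≈L = CommutativeRing.*-congˡ ring

  u≉L0 : ¬ u L.≈ 𝟘
  u≉L0 = residueField-u≉0 representatives cover u u≉0

  L-· : ∀ m x → m Lₖ.· x ≡ m · x
  L-· zero    x = refl
  L-· (suc m) x = cong (x ⊕_) (L-· m x)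

  L-^ : ∀ x m → x Lₖ.^ m ≡ x ^ m
  L-^ x zero    = refl
  L-^ x (suc m) = cong (x ⊗_) (L-^ x m)

  L-characteristic : (p Lₖ.· 𝟙) L.≈ 𝟘
  L-characteristic = L.trans (L.reflexive (L-· p 𝟙)) (≈⇒≈L characteristic)

  _≈L?_ : ∀ x y → Dec (x L.≈ y)
  x ≈L? y = (ε representatives cover u u≉0 ⊗ x) ≈? (ε representatives cover u u≉0 ⊗ y)

  module B = Basis p₁ L p-prime L-characteristic _≈L?_

  0≉1 : ¬ 𝟘 L.≈ 𝟙
  0≉1 0≈1 = u≉L0 (L.trans (L.sym (L.*-identityˡ u)) (L.trans (L.*-congʳ (L.sym 0≈1)) (L.zeroˡ u)))

  factor≈0 : ∀ {a} as → a ∈ as → difference a L.≈ 𝟘 → differences as L.≈ 𝟘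
  factor≈0 (a ∷ as) (here refl) ≈0 = L.trans (L.*-congˡ ≈0) (L.zeroʳ (differences as))
  factor≈0 (b ∷ as) (there a∈) ≈0 = L.trans (L.*-congʳ (factor≈0 as a∈ ≈0)) (L.zeroˡ (difference b))

  X-moves : ∀ {k} → 1 ℕ.≤ k → k ℕ.≤ n → ¬ (X ^ (p ℕ.^ k)) L.≈ X
  X-moves {k} 1≤k k≤n fixed = u≉L0 (factor≈0 (powers n) (∈-powers n 1≤k k≤n)
    (L.trans (L.+-congʳ {⊖ X} fixed) (L.-‿inverseʳ X)))

  abstract
    basis-data : ∃ λ k → Σ (Vec Expr k) λ bs → B.Independent bs × (∀ {y} → y ∈ representatives → y B.∈Span bs)
    basis-data = B.basis representatives

  dimension : ℕ
  dimension = proj₁ basis-data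

  bs : Vec Expr dimension
  bs = proj₁ (proj₂ basis-data)

  spans : ∀ x → x B.∈Span bs
  spans x = let y , y∈ , x≈y = cover x in
    B.∈Span-resp bs {y} {x} (≈⇒≈L (CommutativeRing.sym ring x≈y)) (proj₂ (proj₂ (proj₂ basis-data)) y∈)

  open Coordinates p₁ L p-prime L-characteristic _≈L?_ 0≉1 (_^ r) (residueField-inverse representatives cover u u≉0) bs
    (proj₁ (proj₂ (proj₂ basis-data))) spans

  private
    𝕂 : Enumeration K
    𝕂 = Vec-enumeration (Fin-enumeration p) dimension
    module F = Field field-structure
    module Fₖ = RingKit F.commutativeRing

    size : length (Enumeration.elements 𝕂) ≡ p ℕ.^ dimension
    size = trans (length-Vec-elements (allFin p) dimension) (cong (ℕ._^ dimension) (List.length-tabulate id))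

  K-pow-q : ∀ y → y Fₖ.^ q ≡ y
  K-pow-q y = proj₁ (proj₂ (proj₂ basis-data)) _ _ (L.trans (ψ-^ q y) (L.trans (L.reflexive (L-^ (ψ y) q)) (≈⇒≈L (pow-q p-prime {suc n} q≡p^e (ψ y)))))

  dimension≤e : dimension ℕ.≤ suc n
  dimension≤e = ℕ.≮⇒≥ λ e<k → ℕ.<⇒≱ (ℕ.^-monoʳ-< p 2≤p e<k)
    (subst (ℕ._≤ p ℕ.^ suc n) size (subst (length (Enumeration.elements 𝕂) ℕ.≤_) q≡p^e (size-bound field-structure 𝕂 r K-pow-q)))

  X-fixed : (X ^ (p ℕ.^ dimension)) L.≈ X
  X-fixed = L.trans (L.reflexive (sym (L-^ X (p ℕ.^ dimension)))) $ L.trans (Lₖ.^-congˡ (p ℕ.^ dimension) (L.sym (ψ-coordinates X)))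
    (L.trans (L.sym (ψ-^ (p ℕ.^ dimension) (coordinates X)))
    (L.trans (L.reflexive (cong ψ (subst (λ N → coordinates X Fₖ.^ N ≡ coordinates X) size (FieldKit.fermat field-structure 𝕂 (coordinates X)))))
             (ψ-coordinates X)))

  dimension≥1 : 1 ℕ.≤ dimension
  dimension≥1 = go dimension refl
    where
    go : ∀ k → k ≡ dimension → 1 ℕ.≤ k
    go (suc k) _   = s≤s z≤n
    go zero    0≡k = ⊥-elim (F.0≢1 (collapse 0≡k F.0# F.1#))
      where
      collapse : ∀ {m} → 0 ≡ m → (x y : Vec (Fin p) m) → x ≡ y
      collapse refl [] [] = refl

  dimension≡e : dimension ≡ suc n
  dimension≡e = ℕ.≤-antisym dimension≤e (ℕ.≮⇒≥ λ { (s≤s k≤n) → X-moves dimension≥1 k≤n X-fixed })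

  existence : GaloisField p (suc n)
  existence = subst (GaloisField p) dimension≡e galoisField

galois-field : ∀ {p e} → Prime p → 1 ℕ.≤ e → GaloisField p e
galois-field {zero} p-prime _ = contradiction refl (ℕ.≢-nonZero⁻¹ 0 {{prime⇒nonZero p-prime}})
galois-field {suc p₁} {suc n} p-prime _ = go (suc p₁ ℕ.^ suc n) refl
  where
  2≤p : 2 ℕ.≤ suc p₁
  2≤p = ℕ.nonTrivial⇒n>1 (suc p₁) {{prime⇒nonTrivial p-prime}}
  2≤q : 2 ℕ.≤ suc p₁ ℕ.^ suc n
  2≤q = ℕ.≤-trans 2≤p (ℕ.m≤m*n (suc p₁) (suc p₁ ℕ.^ n) {{ℕ.m^n≢0 (suc p₁) n}})
  go : ∀ q → q ≡ suc p₁ ℕ.^ suc n → GaloisField (suc p₁) (suc n)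
  go zero          eq = contradiction (subst (2 ℕ.≤_) (sym eq) 2≤q) λ ()
  go (suc zero)    eq = contradiction (subst (2 ℕ.≤_) (sym eq) 2≤q) λ { (s≤s ()) }
  go (suc (suc r)) eq = Existence.existence p₁ p-prime n r eq

module QuadraticCharacter {K : Set} (F : Field K) (𝕂 : Enumeration K) (h : ℕ)
  (size : length (Enumeration.elements 𝕂) ≡ suc ((1 ℕ.+ 4 ℕ.* h) ℕ.+ (1 ℕ.+ 4 ℕ.* h)))
  (q≡0  : RingKit._·_ (Field.commutativeRing F) (suc ((1 ℕ.+ 4 ℕ.* h) ℕ.+ (1 ℕ.+ 4 ℕ.* h))) (Field.1# F) ≡ Field.0# F) where
  open Field F using (_⁻¹; 0≢1; *-inverse)
  open CommutativeRing (Field.commutativeRing F) hiding (refl; sym; trans; zero)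
  open RingKit (Field.commutativeRing F)
  open FieldKit F 𝕂
  open Enumeration 𝕂
  open ≡.≡-Reasoning
  module Σℤ = RingSums ℤ.+-*-commutativeRing
  module ℤSolver = RingKit.Solver ℤ.+-*-commutativeRing
  open Solver

  M q : ℕ
  M = 1 ℕ.+ 4 ℕ.* h
  q = suc (M ℕ.+ M)

  pow-q : ∀ x → x ^ q ≡ x
  pow-q x = subst (λ n → x ^ n ≡ x) size (fermat x)

  1^ : ∀ n → 1# ^ n ≡ 1#
  1^ zero    = refl
  1^ (suc n) = trans (*-identityˡ _) (1^ n)

  1+1≢0 : 1# + 1# ≢ 0#
  1+1≢0 2≡0 = 0≢1 (begin
    0#                        ≡⟨ q≡0 ⟨
    1# + (M ℕ.+ M) · 1#       ≡⟨ cong (1# +_) (×-homo-+ 1# M M) ⟩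
    1# + (M · 1# + M · 1#)    ≡⟨ solve 1 (λ x → con 1ℤ :+ (x :+ x) := con 1ℤ :+ (con 1ℤ :+ con 1ℤ) :* x) refl (M · 1#) ⟩
    1# + (1# + 1#) * (M · 1#) ≡⟨ cong (λ t → 1# + t * (M · 1#)) 2≡0 ⟩
    1# + 0# * (M · 1#)        ≡⟨ solve 1 (λ x → con 1ℤ :+ con 0ℤ :* x := con 1ℤ) refl (M · 1#) ⟩
    1#                        ∎)

  1≢-1 : 1# ≢ - 1#
  1≢-1 1≡-1 = 1+1≢0 (trans (cong (1# +_) 1≡-1) (-‿inverseʳ 1#))

  -1≢0 : - 1# ≢ 0#
  -1≢0 -1≡0 = 0≢1 (trans (sym (-‿inverseʳ 1#)) (trans (cong (1# +_) -1≡0) (+-identityʳ 1#)))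

  square≡1 : ∀ {x} → x * x ≡ 1# → x ≡ 1# ⊎ x ≡ - 1#
  square≡1 {x} xx≡1 with *≡0 (trans (solve 1 (λ x → (x :- con 1ℤ) :* (x :+ con 1ℤ) := x :* x :- con 1ℤ) refl x) (trans (cong (_- 1#) xx≡1) (-‿inverseʳ 1#)))
  ... | inj₁ x-1≡0 = inj₁ (x-y≡0⇒x≡y x-1≡0)
  ... | inj₂ x+1≡0 = inj₂ (x-y≡0⇒x≡y (trans (solve 1 (λ x → x :- (:- con 1ℤ) := x :+ con 1ℤ) refl x) x+1≡0))

  ^M-square : ∀ {x} → x ≢ 0# → x ^ M * x ^ M ≡ 1#
  ^M-square {x} x≢0 = *-cancelˡ x≢0 (begin
    x * (x ^ M * x ^ M)  ≡⟨ cong (x *_) (^-homo-* x M M) ⟨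
    x ^ q                ≡⟨ pow-q x ⟩
    x                    ≡⟨ *-identityʳ x ⟨
    x * 1#               ∎)

  data Sign : ℤ → Set where
    s0 : Sign 0ℤ
    s+ : Sign 1ℤ
    s- : Sign ℤ.-1ℤ

  sign-* : ∀ {i j} → Sign i → Sign j → Sign (i ℤ.* j)
  sign-* s0 s0 = s0
  sign-* s0 s+ = s0
  sign-* s0 s- = s0
  sign-* s+ s0 = s0
  sign-* s+ s+ = s+
  sign-* s+ s- = s-
  sign-* s- s0 = s0
  sign-* s- s+ = s-
  sign-* s- s- = s+

  fromℤ-1 : fromℤ 1ℤ ≡ 1#
  fromℤ-1 = +-identityʳ 1#

  fromℤ--1 : fromℤ ℤ.-1ℤ ≡ - 1#
  fromℤ--1 = cong -_ (+-identityʳ 1#)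

  private
    unit : ∀ {i} → Sign i → K
    unit s0 = 0#
    unit s+ = 1#
    unit s- = - 1#

    unit≡ : ∀ {i} (s : Sign i) → fromℤ i ≡ unit s
    unit≡ s0 = refl
    unit≡ s+ = fromℤ-1
    unit≡ s- = fromℤ--1

  fromℤ-injective : ∀ {i j} → Sign i → Sign j → fromℤ i ≡ fromℤ j → i ≡ j
  fromℤ-injective s t eq = go s t (trans (sym (unit≡ s)) (trans eq (unit≡ t)))
    where
    go : ∀ {i j} (s : Sign i) (t : Sign j) → unit s ≡ unit t → i ≡ j
    go s0 s0 _  = refl
    go s0 s+ eq = contradiction eq 0≢1
    go s0 s- eq = contradiction (sym eq) -1≢0
    go s+ s0 eq = contradiction (sym eq) 0≢1
    go s+ s+ _  = refl
    go s+ s- eq = contradiction eq 1≢-1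
    go s- s0 eq = contradiction eq -1≢0
    go s- s+ eq = contradiction (sym eq) 1≢-1
    go s- s- _  = refl

  abstract
    character : ∀ x → ∃ λ i → Sign i × fromℤ i ≡ x ^ M
    character x with x ≟ 0#
    ... | yes refl = 0ℤ , s0 , sym (zeroˡ _)
    ... | no  x≢0 with square≡1 (^M-square x≢0)
    ...   | inj₁ ≡1  = 1ℤ , s+ , trans fromℤ-1 (sym ≡1)
    ...   | inj₂ ≡-1 = ℤ.-1ℤ , s- , trans fromℤ--1 (sym ≡-1)

  η : K → ℤ
  η x = proj₁ (character x)

  η-sign : ∀ x → Sign (η x)
  η-sign x = proj₁ (proj₂ (character x))

  fromℤ-η : ∀ x → fromℤ (η x) ≡ x ^ M
  fromℤ-η x = proj₂ (proj₂ (character x))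

  η-unique : ∀ {x i} → Sign i → x ^ M ≡ fromℤ i → η x ≡ i
  η-unique {x} s eq = fromℤ-injective (η-sign x) s (trans (fromℤ-η x) eq)

  η-* : ∀ x y → η (x * y) ≡ η x ℤ.* η y
  η-* x y = η-unique (sign-* (η-sign x) (η-sign y)) (begin
    (x * y) ^ M                  ≡⟨ ^-distrib-* x y M ⟩
    x ^ M * y ^ M                ≡⟨ cong₂ _*_ (fromℤ-η x) (fromℤ-η y) ⟨
    fromℤ (η x) * fromℤ (η y)    ≡⟨ fromℤ-* (η x) (η y) ⟨
    fromℤ (η x ℤ.* η y)          ∎)

  η-0 : η 0# ≡ 0ℤ
  η-0 = η-unique s0 (zeroˡ _)

  η-1 : η 1# ≡ 1ℤ
  η-1 = η-unique s+ (trans (1^ M) (sym fromℤ-1))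

  -1^[4*n] : ∀ n → (- 1#) ^ (4 ℕ.* n) ≡ 1#
  -1^[4*n] n = trans (sym (^-assocʳ (- 1#) 4 n)) (trans (cong (_^ n) (solve 0 ((:- con 1ℤ) :^ 4 := con 1ℤ) refl)) (1^ n))

  η--1 : η (- 1#) ≡ ℤ.-1ℤ
  η--1 = η-unique s- (begin
    - 1# * (- 1#) ^ (4 ℕ.* h)  ≡⟨ cong (- 1# *_) (-1^[4*n] h) ⟩
    - 1# * 1#                  ≡⟨ *-identityʳ _ ⟩
    - 1#                       ≡⟨ fromℤ--1 ⟨
    fromℤ ℤ.-1ℤ                ∎)

  η-neg : ∀ x → η (- x) ≡ ℤ.- η x
  η-neg x = begin
    η (- x)             ≡⟨ cong η (solve 1 (λ x → :- x := (:- con 1ℤ) :* x) refl x) ⟩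
    η (- 1# * x)        ≡⟨ η-* (- 1#) x ⟩
    η (- 1#) ℤ.* η x    ≡⟨ cong (ℤ._* η x) η--1 ⟩
    ℤ.-1ℤ ℤ.* η x       ≡⟨ ℤ.-1*i≡-i (η x) ⟩
    ℤ.- η x             ∎

  η-square : ∀ {x} → x ≢ 0# → η x ℤ.* η x ≡ 1ℤ
  η-square {x} x≢0 = trans (sym (η-* x x)) (η-unique s+ (trans (^-distrib-* x x M) (trans (^M-square x≢0) (sym fromℤ-1))))

  η-sq : ∀ {x} → x ≢ 0# → η (x * x) ≡ 1ℤ
  η-sq {x} x≢0 = trans (η-* x x) (η-square x≢0)

  η-≢0 : ∀ {x} → x ≢ 0# → η x ≡ 1ℤ ⊎ η x ≡ ℤ.-1ℤ
  η-≢0 {x} x≢0 = go (η-sign x) refl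
    where
    go : ∀ {i} → Sign i → η x ≡ i → i ≡ 1ℤ ⊎ i ≡ ℤ.-1ℤ
    go s0 ηx≡0 = contradiction (trans (sym (η-square x≢0)) (cong (λ i → i ℤ.* i) ηx≡0)) λ ()
    go s+ _    = inj₁ refl
    go s- _    = inj₂ refl

  η-⁻¹ : ∀ {x} → x ≢ 0# → η (x ⁻¹) ≡ η x
  η-⁻¹ {x} x≢0 = begin
    η (x ⁻¹)                       ≡⟨ ℤ.*-identityˡ _ ⟨
    1ℤ ℤ.* η (x ⁻¹)                ≡⟨ cong (ℤ._* η (x ⁻¹)) (η-square x≢0) ⟨
    η x ℤ.* η x ℤ.* η (x ⁻¹)       ≡⟨ ℤ.*-assoc (η x) (η x) _ ⟩
    η x ℤ.* (η x ℤ.* η (x ⁻¹))     ≡⟨ cong (η x ℤ.*_) (η-* x (x ⁻¹)) ⟨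
    η x ℤ.* η (x * x ⁻¹)           ≡⟨ cong (λ y → η x ℤ.* η y) (*-inverse x≢0) ⟩
    η x ℤ.* η 1#                   ≡⟨ cong (η x ℤ.*_) η-1 ⟩
    η x ℤ.* 1ℤ                     ≡⟨ ℤ.*-identityʳ _ ⟩
    η x                            ∎

  self-negative : ∀ {i} → i ≡ ℤ.- i → i ≡ 0ℤ
  self-negative {ℤ.+ zero} _ = refl

  neg-involutive : ∀ x → - (- x) ≡ x
  neg-involutive x = solve 1 (λ x → :- (:- x) := x) refl x

  ∑-odd : ∀ f → (∀ x → f (- x) ≡ ℤ.- f x) → Σℤ.∑ elements f ≡ 0ℤ
  ∑-odd f odd = self-negative (begin
    Σℤ.∑ elements f                  ≡⟨ Σℤ.∑-bijection 𝕂 𝕂 -_ -_ neg-involutive neg-involutive f ⟩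
    Σℤ.∑ elements (λ x → f (- x))    ≡⟨ Σℤ.∑-cong elements odd ⟩
    Σℤ.∑ elements (λ x → ℤ.- f x)    ≡⟨ Σℤ.∑-neg elements f ⟩
    ℤ.- Σℤ.∑ elements f              ∎)

  ∑-η : Σℤ.∑ elements η ≡ 0ℤ
  ∑-η = ∑-odd η η-neg

  a⁻¹[ay]≡y : ∀ {a} → a ≢ 0# → ∀ y → a ⁻¹ * (a * y) ≡ y
  a⁻¹[ay]≡y {a} a≢0 y = trans (sym (*-assoc _ _ _)) (trans (cong (_* y) (trans (*-comm _ _) (*-inverse a≢0))) (*-identityˡ y))

  a[a⁻¹y]≡y : ∀ {a} → a ≢ 0# → ∀ y → a * (a ⁻¹ * y) ≡ y
  a[a⁻¹y]≡y {a} a≢0 y = trans (sym (*-assoc _ _ _)) (trans (cong (_* y) (*-inverse a≢0)) (*-identityˡ y))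

  ∑-affine : ∀ {a} b → a ≢ 0# → ∀ f → Σℤ.∑ elements f ≡ Σℤ.∑ elements (λ x → f (b + a * x))
  ∑-affine {a} b a≢0 f = Σℤ.∑-bijection 𝕂 𝕂 (λ x → b + a * x) (λ y → a ⁻¹ * (y - b))
    (λ x → trans (cong (a ⁻¹ *_) (solve 2 (λ b y → (b :+ y) :- b := y) refl b (a * x))) (a⁻¹[ay]≡y a≢0 x))
    (λ y → trans (cong (b +_) (a[a⁻¹y]≡y a≢0 (y - b))) (solve 2 (λ b y → b :+ (y :- b) := y) refl b y)) f

  private
    inv₀ : K → K
    inv₀ x = if does (x ≟ 0#) then 0# else x ⁻¹

    inv₀-0 : inv₀ 0# ≡ 0#
    inv₀-0 = if-≟-refl 0#

    inv₀-≢0 : ∀ {x} → x ≢ 0# → inv₀ x ≡ x ⁻¹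
    inv₀-≢0 x≢0 = if-≟-≢ x≢0

    inv₀-involutive : ∀ x → inv₀ (inv₀ x) ≡ x
    inv₀-involutive x = go (x ≟ 0#)
      where
      go : Dec (x ≡ 0#) → inv₀ (inv₀ x) ≡ x
      go (yes x≡0) = trans (cong (inv₀ ∘ inv₀) x≡0) (trans (cong inv₀ inv₀-0) (trans inv₀-0 (sym x≡0)))
      go (no  x≢0) = begin
        inv₀ (inv₀ x)          ≡⟨ cong inv₀ (inv₀-≢0 x≢0) ⟩
        inv₀ (x ⁻¹)            ≡⟨ inv₀-≢0 (⁻¹-≢0 x≢0) ⟩
        (x ⁻¹) ⁻¹              ≡⟨ *-cancelˡ (⁻¹-≢0 x≢0) (trans (*-inverse (⁻¹-≢0 x≢0)) (sym (trans (*-comm _ _) (*-inverse x≢0)))) ⟩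
        x                      ∎

  jacobi : ∀ {γ} → γ ≢ 0# → Σℤ.∑ elements (λ x → η x ℤ.* η (x + γ)) ≡ ℤ.-1ℤ
  jacobi {γ} γ≢0 = begin
    Σℤ.∑ elements (λ x → η x ℤ.* η (x + γ))
      ≡⟨ Σℤ.∑-cong elements (λ x → term x (x ≟ 0#)) ⟩
    Σℤ.∑ elements (λ x → η (1# + γ * inv₀ x) ℤ.+ Σℤ.⟦ x ≟ 0# ⟧ ℤ.* ℤ.-1ℤ)
      ≡⟨ Σℤ.∑-+ elements _ _ ⟩
    Σℤ.∑ elements (λ x → η (1# + γ * inv₀ x)) ℤ.+ Σℤ.∑ elements (λ x → Σℤ.⟦ x ≟ 0# ⟧ ℤ.* ℤ.-1ℤ)
      ≡⟨ cong₂ ℤ._+_ (sym (Σℤ.∑-bijection 𝕂 𝕂 inv₀ inv₀ inv₀-involutive inv₀-involutive (λ x → η (1# + γ * x)))) (Σℤ.∑-⟦≟⟧ 𝕂 0# (λ _ → ℤ.-1ℤ)) ⟩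
    Σℤ.∑ elements (λ x → η (1# + γ * x)) ℤ.+ ℤ.-1ℤ
      ≡⟨ cong (ℤ._+ ℤ.-1ℤ) (trans (sym (∑-affine 1# γ≢0 η)) ∑-η) ⟩
    ℤ.-1ℤ ∎
    where
    term : ∀ x → Dec (x ≡ 0#) → η x ℤ.* η (x + γ) ≡ η (1# + γ * inv₀ x) ℤ.+ Σℤ.⟦ x ≟ 0# ⟧ ℤ.* ℤ.-1ℤ
    term x (yes refl) = trans (cong (ℤ._* η (0# + γ)) η-0) (sym (begin
      η (1# + γ * inv₀ 0#) ℤ.+ Σℤ.⟦ 0# ≟ 0# ⟧ ℤ.* ℤ.-1ℤ  ≡⟨ cong₂ (λ a b → η (1# + γ * a) ℤ.+ b ℤ.* ℤ.-1ℤ) inv₀-0 (if-≟-refl 0#) ⟩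
      η (1# + γ * 0#) ℤ.+ ℤ.-1ℤ                          ≡⟨ cong (λ a → η a ℤ.+ ℤ.-1ℤ) (solve 1 (λ g → con 1ℤ :+ g :* con 0ℤ := con 1ℤ) refl γ) ⟩
      η 1# ℤ.+ ℤ.-1ℤ                                     ≡⟨ cong (ℤ._+ ℤ.-1ℤ) η-1 ⟩
      0ℤ                                                 ∎))
    term x (no x≢0) = begin
      η x ℤ.* η (x + γ)                           ≡⟨ cong (ℤ._* η (x + γ)) (η-⁻¹ x≢0) ⟨
      η (x ⁻¹) ℤ.* η (x + γ)                      ≡⟨ η-* (x ⁻¹) (x + γ) ⟨
      η (x ⁻¹ * (x + γ))                          ≡⟨ cong η (solve 3 (λ i x g → i :* (x :+ g) := x :* i :+ g :* i) refl (x ⁻¹) x γ) ⟩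
      η (x * x ⁻¹ + γ * x ⁻¹)                     ≡⟨ cong (λ t → η (t + γ * x ⁻¹)) (*-inverse x≢0) ⟩
      η (1# + γ * x ⁻¹)                           ≡⟨ cong (λ t → η (1# + γ * t)) (inv₀-≢0 x≢0) ⟨
      η (1# + γ * inv₀ x)                         ≡⟨ ℤ.+-identityʳ _ ⟨
      η (1# + γ * inv₀ x) ℤ.+ 0ℤ ℤ.* ℤ.-1ℤ        ≡⟨ cong (λ t → η (1# + γ * inv₀ x) ℤ.+ t ℤ.* ℤ.-1ℤ) (if-≟-≢ x≢0) ⟨
      η (1# + γ * inv₀ x) ℤ.+ Σℤ.⟦ x ≟ 0# ⟧ ℤ.* ℤ.-1ℤ ∎

record Setting : Set₁ where
  field
    {K}     : Set
    F       : Field K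
    𝕂       : Enumeration K
    h       : ℕ
    size    : length (Enumeration.elements 𝕂) ≡ suc ((1 ℕ.+ 4 ℕ.* h) ℕ.+ (1 ℕ.+ 4 ℕ.* h))
    q≡0     : RingKit._·_ (Field.commutativeRing F) (suc ((1 ℕ.+ 4 ℕ.* h) ℕ.+ (1 ℕ.+ 4 ℕ.* h))) (Field.1# F) ≡ Field.0# F
    p       : ℕ
    p-prime : Prime p
    p≡0     : RingKit._·_ (Field.commutativeRing F) p (Field.1# F) ≡ Field.0# F
    e       : ℕ
    q≡p^e   : suc ((1 ℕ.+ 4 ℕ.* h) ℕ.+ (1 ℕ.+ 4 ℕ.* h)) ≡ p ℕ.^ e

module Octic (𝕊 : Setting) where
  open Setting 𝕊
  open Field F using (_⁻¹; 0≢1; *-inverse)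
  open CommutativeRing (Field.commutativeRing F) hiding (refl; sym; trans; zero)
  open RingKit (Field.commutativeRing F)
  open FieldKit F 𝕂
  open Enumeration 𝕂
  open QuadraticCharacter F 𝕂 h size q≡0 public
  open ≡.≡-Reasoning
  private module KS = Solver

  L : Set
  L = K × K

  norm : L → K
  norm (a , b) = a * a + b * b

  conjugate : L → L
  conjugate (a , b) = a , - b

  det : L → L → K
  det (a , b) (c , d) = a * d - b * c

  ι : K → L
  ι x = x , 0#

  𝕃 : Enumeration L
  𝕃 = ×-enumeration 𝕂 𝕂

  module 𝕃 = Enumeration 𝕃

  norm≡0 : ∀ z → norm z ≡ 0# → z ≡ (0# , 0#)
  norm≡0 (a , b) N≡0 with b ≟ 0#
  ... | yes refl with *≡0 (trans (KS.solve 1 (λ a → let open KS in a :* a := a :* a :+ con 0ℤ :* con 0ℤ) refl a) N≡0)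
  ...   | inj₁ refl = refl
  ...   | inj₂ refl = refl
  norm≡0 (a , b) N≡0 | no b≢0 = contradiction (begin
    1ℤ                 ≡⟨ square-sign (a ≟ 0#) ⟨
    η (- (b * b))      ≡⟨ η-neg (b * b) ⟩
    ℤ.- η (b * b)      ≡⟨ cong ℤ.-_ (η-sq b≢0) ⟩
    ℤ.-1ℤ              ∎) λ ()
    where
    aa≡-bb : a * a ≡ - (b * b)
    aa≡-bb = trans (KS.solve 2 (λ a b → let open KS in a :* a := (a :* a :+ b :* b) :- b :* b) refl a b) (trans (cong (_- (b * b)) N≡0) (+-identityˡ _))
    square-sign : Dec (a ≡ 0#) → η (- (b * b)) ≡ 1ℤ
    square-sign (no a≢0)   = trans (cong η (sym aa≡-bb)) (η-sq a≢0)
    square-sign (yes refl) = contradiction (begin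
      b * b             ≡⟨ neg-involutive (b * b) ⟨
      - (- (b * b))     ≡⟨ cong -_ aa≡-bb ⟨
      - (0# * 0#)       ≡⟨ KS.solve 0 (let open KS in :- (con 0ℤ :* con 0ℤ) := con 0ℤ) refl ⟩
      0#                ∎) (*-≢0 b≢0 b≢0)

  L-field : Field L
  L-field = record
    { _+_ = λ (a , b) (c , d) → a + c , b + d
    ; _*_ = λ (a , b) (c , d) → a * c - b * d , a * d + b * c
    ; -_  = λ (a , b) → - a , - b
    ; _⁻¹ = λ z → proj₁ z * norm z ⁻¹ , - (proj₂ z * norm z ⁻¹)
    ; 0# = 0# , 0# ; 1# = 1# , 0#
    ; isCommutativeRing = record
      { isRing = record
        { +-isAbelianGroup = record
          { isGroup = record
            { isMonoid = record
              { isSemigroup = record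
                { isMagma = record { isEquivalence = ≡.isEquivalence ; ∙-cong = λ { refl refl → refl } }
                ; assoc = λ (a , b) (c , d) (e , f) → cong₂ _,_ (+-assoc a c e) (+-assoc b d f) }
              ; identity = (λ (a , b) → cong₂ _,_ (+-identityˡ a) (+-identityˡ b)) , (λ (a , b) → cong₂ _,_ (+-identityʳ a) (+-identityʳ b)) }
            ; inverse = (λ (a , b) → cong₂ _,_ (-‿inverseˡ a) (-‿inverseˡ b)) , (λ (a , b) → cong₂ _,_ (-‿inverseʳ a) (-‿inverseʳ b))
            ; ⁻¹-cong = λ { refl → refl } }
          ; comm = λ (a , b) (c , d) → cong₂ _,_ (+-comm a c) (+-comm b d) }
        ; *-cong = λ { refl refl → refl }
        ; *-assoc = λ (a , b) (c , d) (e , f) → cong₂ _,_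
            (solve 6 (λ a b c d e f → (a :* c :- b :* d) :* e :- (a :* d :+ b :* c) :* f := a :* (c :* e :- d :* f) :- b :* (c :* f :+ d :* e)) refl a b c d e f)
            (solve 6 (λ a b c d e f → (a :* c :- b :* d) :* f :+ (a :* d :+ b :* c) :* e := a :* (c :* f :+ d :* e) :+ b :* (c :* e :- d :* f)) refl a b c d e f)
        ; *-identity = (λ (a , b) → cong₂ _,_ (solve 2 (λ a b → con 1ℤ :* a :- con 0ℤ :* b := a) refl a b) (solve 2 (λ a b → con 1ℤ :* b :+ con 0ℤ :* a := b) refl a b))
                     , (λ (a , b) → cong₂ _,_ (solve 2 (λ a b → a :* con 1ℤ :- b :* con 0ℤ := a) refl a b) (solve 2 (λ a b → a :* con 0ℤ :+ b :* con 1ℤ := b) refl a b))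
        ; distrib = (λ (a , b) (c , d) (e , f) → cong₂ _,_
              (solve 6 (λ a b c d e f → a :* (c :+ e) :- b :* (d :+ f) := (a :* c :- b :* d) :+ (a :* e :- b :* f)) refl a b c d e f)
              (solve 6 (λ a b c d e f → a :* (d :+ f) :+ b :* (c :+ e) := (a :* d :+ b :* c) :+ (a :* f :+ b :* e)) refl a b c d e f))
            , (λ (a , b) (c , d) (e , f) → cong₂ _,_
              (solve 6 (λ a b c d e f → (c :+ e) :* a :- (d :+ f) :* b := (c :* a :- d :* b) :+ (e :* a :- f :* b)) refl a b c d e f)
              (solve 6 (λ a b c d e f → (c :+ e) :* b :+ (d :+ f) :* a := (c :* b :+ d :* a) :+ (e :* b :+ f :* a)) refl a b c d e f)) }
      ; *-comm = λ (a , b) (c , d) → cong₂ _,_ (solve 4 (λ a b c d → a :* c :- b :* d := c :* a :- d :* b) refl a b c d)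
                                              (solve 4 (λ a b c d → a :* d :+ b :* c := c :* b :+ d :* a) refl a b c d) }
    ; 0≢1 = λ eq → 0≢1 (cong proj₁ eq)
    ; *-inverse = λ {z} z≢0 → cong₂ _,_
        (trans (solve 3 (λ a b i → a :* (a :* i) :- b :* (:- (b :* i)) := (a :* a :+ b :* b) :* i) refl (proj₁ z) (proj₂ z) (norm z ⁻¹)) (*-inverse (z≢0 ∘ norm≡0 z)))
        (solve 3 (λ a b i → a :* (:- (b :* i)) :+ b :* (a :* i) := con 0ℤ) refl (proj₁ z) (proj₂ z) (norm z ⁻¹)) }
    where open KS

  module L = CommutativeRing (Field.commutativeRing L-field)
  module Lₖ = RingKit (Field.commutativeRing L-field)
  module L-field = Field L-field
  module Lf = FieldKit L-field 𝕃
  private module LS = Lₖ.Solver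

  norm-≢0 : ∀ {z} → z ≢ L.0# → norm z ≢ 0#
  norm-≢0 {z} z≢0 = z≢0 ∘ norm≡0 z

  det-* : ∀ z u w → det (z L.* u) (z L.* w) ≡ norm z * det u w
  det-* (a , b) (c , d) (e , f) = solve 6 (λ a b c d e f →
    (a :* c :- b :* d) :* (a :* f :+ b :* e) :- (a :* d :+ b :* c) :* (a :* e :- b :* f) := (a :* a :+ b :* b) :* (c :* f :- d :* e)) refl a b c d e f
    where open KS

  ι-* : ∀ x y → ι (x * y) ≡ ι x L.* ι y
  ι-* x y = cong₂ _,_ (solve 2 (λ x y → x :* y := x :* y :- con 0ℤ :* con 0ℤ) refl x y) (solve 2 (λ x y → con 0ℤ := x :* con 0ℤ :+ con 0ℤ :* y) refl x y)
    where open KS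

  ι-^ : ∀ x n → ι x Lₖ.^ n ≡ ι (x ^ n)
  ι-^ x zero    = refl
  ι-^ x (suc n) = trans (cong (ι x L.*_) (ι-^ x n)) (sym (ι-* x (x ^ n)))

  ι-neg : ∀ x → ι (- x) ≡ L.- ι x
  ι-neg x = cong (- x ,_) (sym -0#≈0#)

  ι-scale : ∀ x u → ι x L.* u ≡ (x * proj₁ u , x * proj₂ u)
  ι-scale x (a , b) = cong₂ _,_ (solve 3 (λ x a b → x :* a :- con 0ℤ :* b := x :* a) refl x a b) (solve 3 (λ x a b → x :* b :+ con 0ℤ :* a := x :* b) refl x a b)
    where open KS

  norm-conjugate : ∀ z → z L.* conjugate z ≡ ι (norm z)
  norm-conjugate (a , b) = cong₂ _,_ (solve 2 (λ a b → a :* a :- b :* (:- b) := a :* a :+ b :* b) refl a b) (solve 2 (λ a b → a :* (:- b) :+ b :* a := con 0ℤ) refl a b)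
    where open KS

  private
    L-· : ∀ n x y → n Lₖ.· (x , y) ≡ (n · x , n · y)
    L-· zero    x y = refl
    L-· (suc n) x y = cong ((x , y) L.+_) (L-· n x y)

    L-p≡0 : p Lₖ.· L.1# ≡ L.0#
    L-p≡0 = trans (L-· p 1# 0#) (cong₂ _,_ p≡0 (n·0 p))
      where
      n·0 : ∀ n → n · 0# ≡ 0#
      n·0 zero    = refl
      n·0 (suc n) = trans (+-identityˡ _) (n·0 n)

  i : L
  i = 0# , 1#

  i*i : i L.* i ≡ L.- L.1#
  i*i = cong₂ _,_ (solve 0 (con 0ℤ :* con 0ℤ :- con 1ℤ :* con 1ℤ := :- con 1ℤ) refl) (solve 0 (con 0ℤ :* con 1ℤ :+ con 1ℤ :* con 0ℤ := :- con 0ℤ) refl)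
    where open KS

  L-1^ : ∀ n → L.1# Lₖ.^ n ≡ L.1#
  L-1^ zero    = refl
  L-1^ (suc n) = trans (L.*-identityˡ _) (L-1^ n)

  i^q : i Lₖ.^ q ≡ L.- i
  i^q = begin
    i Lₖ.^ q                               ≡⟨ cong (i Lₖ.^_) (ℕ.+-*-Solver.solve 1 (λ h → let open ℕ.+-*-Solver in con 1 :+ ((con 1 :+ con 4 :* h) :+ (con 1 :+ con 4 :* h)) := con 3 :+ con 8 :* h) refl h) ⟩
    i Lₖ.^ (3 ℕ.+ 8 ℕ.* h)                 ≡⟨ Lₖ.^-homo-* i 3 (8 ℕ.* h) ⟩
    i Lₖ.^ 3 L.* i Lₖ.^ (8 ℕ.* h)          ≡⟨ cong (i Lₖ.^ 3 L.*_) (trans (sym (Lₖ.^-assocʳ i 8 h)) (trans (cong (Lₖ._^ h) i^8) (L-1^ h))) ⟩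
    i Lₖ.^ 3 L.* L.1#                      ≡⟨ LS.solve 1 (λ i → let open LS in i :^ 3 :* con 1ℤ := i :* (i :* i)) refl i ⟩
    i L.* (i L.* i)                        ≡⟨ cong (i L.*_) i*i ⟩
    i L.* (L.- L.1#)                       ≡⟨ LS.solve 1 (λ i → let open LS in i :* (:- con 1ℤ) := :- i) refl i ⟩
    L.- i                                  ∎
    where
    i^8 : i Lₖ.^ 8 ≡ L.1#
    i^8 = trans (LS.solve 1 (λ i → let open LS in i :^ 8 := (i :* i) :^ 4) refl i) (trans (cong (Lₖ._^ 4) i*i) (LS.solve 0 (let open LS in (:- con 1ℤ) :^ 4 := con 1ℤ) refl))

  frobenius-conjugate : ∀ z → z Lₖ.^ q ≡ conjugate z
  frobenius-conjugate (x , y) = begin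
    (x , y) Lₖ.^ q                                ≡⟨ cong (Lₖ._^ q) split ⟩
    (ι x L.+ ι y L.* i) Lₖ.^ q                    ≡⟨ subst (λ n → (ι x L.+ ι y L.* i) Lₖ.^ n ≡ ι x Lₖ.^ n L.+ (ι y L.* i) Lₖ.^ n) (sym q≡p^e)
                                                      (Characteristic.frobenius^ (Field.commutativeRing L-field) p p-prime L-p≡0 e (ι x) (ι y L.* i)) ⟩
    ι x Lₖ.^ q L.+ (ι y L.* i) Lₖ.^ q             ≡⟨ cong (ι x Lₖ.^ q L.+_) (Lₖ.^-distrib-* (ι y) i q) ⟩
    ι x Lₖ.^ q L.+ ι y Lₖ.^ q L.* i Lₖ.^ q        ≡⟨ cong₂ L._+_ (fixed x) (cong₂ L._*_ (fixed y) i^q) ⟩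
    ι x L.+ ι y L.* (L.- i)                       ≡⟨ cong₂ _,_ (solve 2 (λ x y → x :+ (y :* (:- con 0ℤ) :- con 0ℤ :* (:- con 1ℤ)) := x) refl x y)
                                                               (solve 2 (λ x y → con 0ℤ :+ (y :* (:- con 1ℤ) :+ con 0ℤ :* (:- con 0ℤ)) := :- y) refl x y) ⟩
    (x , - y)                                     ∎
    where
    open KS
    fixed : ∀ x → ι x Lₖ.^ q ≡ ι x
    fixed x = trans (ι-^ x q) (cong ι (pow-q x))
    split : (x , y) ≡ ι x L.+ ι y L.* i
    split = cong₂ _,_ (solve 2 (λ x y → x := x :+ (y :* con 0ℤ :- con 0ℤ :* con 1ℤ)) refl x y) (solve 2 (λ x y → y := con 0ℤ :+ (y :* con 1ℤ :+ con 0ℤ :* con 0ℤ)) refl x y)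

  m k : ℕ
  m = 1 ℕ.+ 2 ℕ.* h
  k = M ℕ.* m

  4k≡ : k ℕ.* 4 ≡ suc q ℕ.* M
  4k≡ = ℕ.+-*-Solver.solve 1 (λ h → let open ℕ.+-*-Solver in
    ((con 1 :+ con 4 :* h) :* (con 1 :+ con 2 :* h)) :* con 4 := (con 2 :+ ((con 1 :+ con 4 :* h) :+ (con 1 :+ con 4 :* h))) :* (con 1 :+ con 4 :* h)) refl h

  ^k^4 : ∀ z → (z Lₖ.^ k) Lₖ.^ 4 ≡ ι (fromℤ (η (norm z)))
  ^k^4 z = begin
    (z Lₖ.^ k) Lₖ.^ 4               ≡⟨ Lₖ.^-assocʳ z k 4 ⟩
    z Lₖ.^ (k ℕ.* 4)                ≡⟨ cong (z Lₖ.^_) 4k≡ ⟩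
    z Lₖ.^ (suc q ℕ.* M)            ≡⟨ Lₖ.^-assocʳ z (suc q) M ⟨
    (z L.* z Lₖ.^ q) Lₖ.^ M         ≡⟨ cong (Lₖ._^ M) (trans (cong (z L.*_) (frobenius-conjugate z)) (norm-conjugate z)) ⟩
    ι (norm z) Lₖ.^ M               ≡⟨ ι-^ (norm z) M ⟩
    ι (norm z ^ M)                  ≡⟨ cong ι (fromℤ-η (norm z)) ⟨
    ι (fromℤ (η (norm z)))          ∎

  ζ : L
  ζ = 1# , 1#

  ζ≢0 : ζ ≢ L.0#
  ζ≢0 eq = 0≢1 (sym (cong proj₁ eq))

  -1L : L
  -1L = L.- L.1#

  -1L^odd : ∀ n → -1L Lₖ.^ (1 ℕ.+ 2 ℕ.* n) ≡ -1L
  -1L^odd n = begin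
    -1L L.* -1L Lₖ.^ (2 ℕ.* n)       ≡⟨ cong (-1L L.*_) (Lₖ.^-assocʳ -1L 2 n) ⟨
    -1L L.* (-1L Lₖ.^ 2) Lₖ.^ n      ≡⟨ cong (λ t → -1L L.* t Lₖ.^ n) (LS.solve 0 (let open LS in (:- con 1ℤ) :^ 2 := con 1ℤ) refl) ⟩
    -1L L.* L.1# Lₖ.^ n              ≡⟨ cong (-1L L.*_) (L-1^ n) ⟩
    -1L L.* L.1#                     ≡⟨ L.*-identityʳ -1L ⟩
    -1L                              ∎

  abstract
    ω : L
    ω = ζ Lₖ.^ k

    ω≡ζ^k : ω ≡ ζ Lₖ.^ k
    ω≡ζ^k = refl

    ω^4 : ω Lₖ.^ 4 ≡ -1L
    ω^4 = begin
      (ζ Lₖ.^ k) Lₖ.^ 4              ≡⟨ Lₖ.^-assocʳ ζ k 4 ⟩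
      ζ Lₖ.^ (k ℕ.* 4)               ≡⟨ cong (ζ Lₖ.^_) (ℕ.+-*-Solver.solve 2 (λ M m → let open ℕ.+-*-Solver in (M :* m) :* con 4 := (M :+ M) :* con 2 :* m) refl M m) ⟩
      ζ Lₖ.^ ((M ℕ.+ M) ℕ.* 2 ℕ.* m) ≡⟨ Lₖ.^-assocʳ ζ ((M ℕ.+ M) ℕ.* 2) m ⟨
      (ζ Lₖ.^ ((M ℕ.+ M) ℕ.* 2)) Lₖ.^ m ≡⟨ cong (Lₖ._^ m) (Lₖ.^-assocʳ ζ (M ℕ.+ M) 2) ⟨
      ((ζ Lₖ.^ (M ℕ.+ M)) Lₖ.^ 2) Lₖ.^ m ≡⟨ cong (λ t → (t Lₖ.^ 2) Lₖ.^ m) ζ^[q-1] ⟩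
      ((L.- i) Lₖ.^ 2) Lₖ.^ m        ≡⟨ cong (Lₖ._^ m) (trans (LS.solve 1 (λ i → let open LS in (:- i) :^ 2 := i :* i) refl i) i*i) ⟩
      -1L Lₖ.^ m                     ≡⟨ -1L^odd h ⟩
      -1L                            ∎
      where
      ζ^[q-1] : ζ Lₖ.^ (M ℕ.+ M) ≡ L.- i
      ζ^[q-1] = Lf.*-cancelˡ ζ≢0 (trans (frobenius-conjugate ζ) (cong₂ _,_
        (solve 0 (con 1ℤ := con 1ℤ :* (:- con 0ℤ) :- con 1ℤ :* (:- con 1ℤ)) refl) (solve 0 (:- con 1ℤ := con 1ℤ :* (:- con 1ℤ) :+ con 1ℤ :* (:- con 0ℤ)) refl)))
        where open KS

    ω≢0 : ω ≢ L.0#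
    ω≢0 = Lf.^-≢0 k ζ≢0

  1≢-1L : L.1# ≢ -1L
  1≢-1L eq = 1≢-1 (cong proj₁ eq)

  ω^[4*n] : ∀ n → ω Lₖ.^ (4 ℕ.* n) ≡ -1L Lₖ.^ n
  ω^[4*n] n = trans (sym (Lₖ.^-assocʳ ω 4 n)) (cong (Lₖ._^ n) ω^4)

  ω^8 : ω Lₖ.^ 8 ≡ L.1#
  ω^8 = trans (ω^[4*n] 2) (LS.solve 0 (let open LS in (:- con 1ℤ) :^ 2 := con 1ℤ) refl)

  ω^-% : ∀ n → ω Lₖ.^ (n ℕ.% 8) ≡ ω Lₖ.^ n
  ω^-% n = begin
    ω Lₖ.^ (n ℕ.% 8)                                   ≡⟨ L.*-identityʳ _ ⟨
    ω Lₖ.^ (n ℕ.% 8) L.* L.1#                          ≡⟨ cong (ω Lₖ.^ (n ℕ.% 8) L.*_) (trans (cong (Lₖ._^ (n ℕ./ 8)) ω^8) (L-1^ (n ℕ./ 8))) ⟨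
    ω Lₖ.^ (n ℕ.% 8) L.* (ω Lₖ.^ 8) Lₖ.^ (n ℕ./ 8)     ≡⟨ cong (ω Lₖ.^ (n ℕ.% 8) L.*_) (trans (Lₖ.^-assocʳ ω 8 (n ℕ./ 8)) (cong (ω Lₖ.^_) (ℕ.*-comm 8 (n ℕ./ 8)))) ⟩
    ω Lₖ.^ (n ℕ.% 8) L.* ω Lₖ.^ (n ℕ./ 8 ℕ.* 8)        ≡⟨ Lₖ.^-homo-* ω (n ℕ.% 8) (n ℕ./ 8 ℕ.* 8) ⟨
    ω Lₖ.^ (n ℕ.% 8 ℕ.+ n ℕ./ 8 ℕ.* 8)                 ≡⟨ cong (ω Lₖ.^_) (ℕ.m≡m%n+[m/n]*n n 8) ⟨
    ω Lₖ.^ n                                           ∎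

  private
    ω^d≢1 : ∀ d t n → d ℕ.* t ≡ 4 ℕ.* (1 ℕ.+ 2 ℕ.* n) → ω Lₖ.^ d ≢ L.1#
    ω^d≢1 d t n eq ω^d≡1 = 1≢-1L (begin
      L.1#                              ≡⟨ L-1^ t ⟨
      L.1# Lₖ.^ t                       ≡⟨ cong (Lₖ._^ t) ω^d≡1 ⟨
      (ω Lₖ.^ d) Lₖ.^ t                 ≡⟨ Lₖ.^-assocʳ ω d t ⟩
      ω Lₖ.^ (d ℕ.* t)                  ≡⟨ cong (ω Lₖ.^_) eq ⟩
      ω Lₖ.^ (4 ℕ.* (1 ℕ.+ 2 ℕ.* n))    ≡⟨ ω^[4*n] (1 ℕ.+ 2 ℕ.* n) ⟩
      -1L Lₖ.^ (1 ℕ.+ 2 ℕ.* n)          ≡⟨ -1L^odd n ⟩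
      -1L                               ∎)

    ω^≢1 : ∀ d → 0 ℕ.< d → d ℕ.< 8 → ω Lₖ.^ d ≢ L.1#
    ω^≢1 1 _ _ = ω^d≢1 1 4 0 refl
    ω^≢1 2 _ _ = ω^d≢1 2 2 0 refl
    ω^≢1 3 _ _ = ω^d≢1 3 4 1 refl
    ω^≢1 4 _ _ = ω^d≢1 4 1 0 refl
    ω^≢1 5 _ _ = ω^d≢1 5 4 2 refl
    ω^≢1 6 _ _ = ω^d≢1 6 2 1 refl
    ω^≢1 7 _ _ = ω^d≢1 7 4 3 refl
    ω^≢1 (suc (suc (suc (suc (suc (suc (suc (suc _)))))))) _ (s≤s (s≤s (s≤s (s≤s (s≤s (s≤s (s≤s (s≤s ()))))))))

    ω^-distinct : ∀ {a b} → a ℕ.< b → b ℕ.< 8 → ω Lₖ.^ a ≢ ω Lₖ.^ b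
    ω^-distinct {a} {b} a<b b<8 eq = ω^≢1 (b ℕ.∸ a) (ℕ.m<n⇒0<n∸m a<b) (ℕ.≤-<-trans (ℕ.m∸n≤m b a) b<8)
      (Lf.*-cancelˡ (Lf.^-≢0 a ω≢0) (begin
        ω Lₖ.^ a L.* ω Lₖ.^ (b ℕ.∸ a)   ≡⟨ Lₖ.^-homo-* ω a (b ℕ.∸ a) ⟨
        ω Lₖ.^ (a ℕ.+ (b ℕ.∸ a))        ≡⟨ cong (ω Lₖ.^_) (ℕ.m+[n∸m]≡n (ℕ.<⇒≤ a<b)) ⟩
        ω Lₖ.^ b                        ≡⟨ eq ⟨
        ω Lₖ.^ a                        ≡⟨ L.*-identityʳ _ ⟨
        ω Lₖ.^ a L.* L.1#               ∎))

  ω^-injective : ∀ {a b : Fin 8} → ω Lₖ.^ toℕ a ≡ ω Lₖ.^ toℕ b → a ≡ b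
  ω^-injective {a} {b} eq = Fin.toℕ-injective (ℕ.≤-antisym
    (ℕ.≮⇒≥ λ b<a → ω^-distinct b<a (Fin.toℕ<n a) (sym eq)) (ℕ.≮⇒≥ λ a<b → ω^-distinct a<b (Fin.toℕ<n b) eq))

  private
    difference-of-squares : ∀ {a b} → a L.* a ≡ b L.* b → a ≡ b ⊎ a ≡ L.- b
    difference-of-squares {a} {b} eq = [ inj₁ ∘ Lf.x-y≡0⇒x≡y , (λ a+b≡0 → inj₂ (Lf.x-y≡0⇒x≡y (trans (LS.solve 2 (λ a b → let open LS in a :- (:- b) := a :+ b) refl a b) a+b≡0))) ]′
      (Lf.*≡0 (trans (LS.solve 2 (λ a b → let open LS in (a :- b) :* (a :+ b) := a :* a :- b :* b) refl a b) (trans (cong (L._- (b L.* b)) eq) (L.-‿inverseʳ _))))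

    negate : ∀ n {w} → w ≡ L.- (ω Lₖ.^ n) → ω Lₖ.^ (4 ℕ.+ n) ≡ w
    negate n {w} eq = trans (Lₖ.^-homo-* ω 4 n) (trans (cong (L._* (ω Lₖ.^ n)) ω^4) (trans (LS.solve 1 (λ x → let open LS in (:- con 1ℤ) :* x := :- x) refl (ω Lₖ.^ n)) (sym eq)))

    roots± : ∀ n {w} → w L.* w ≡ ω Lₖ.^ (n ℕ.+ n) → ω Lₖ.^ n ≡ w ⊎ ω Lₖ.^ (4 ℕ.+ n) ≡ w
    roots± n {w} eq = [ inj₁ ∘ sym , inj₂ ∘ negate n ]′ (difference-of-squares (trans eq (Lₖ.^-homo-* ω n n)))

    w^4 : ∀ w → (w L.* w) L.* (w L.* w) ≡ w Lₖ.^ 4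
    w^4 = LS.solve 1 (λ w → let open LS in (w :* w) :* (w :* w) := w :^ 4) refl

    choose : ∀ {w} (a b : Fin 8) → toℕ b ≡ 4 ℕ.+ toℕ a → ω Lₖ.^ (toℕ a ℕ.+ toℕ a) ≡ w L.* w → ∃ λ (j : Fin 8) → ω Lₖ.^ toℕ j ≡ w
    choose a b b≡4+a eq = [ (a ,_) , (λ eq′ → b , trans (cong (ω Lₖ.^_) b≡4+a) eq′) ]′ (roots± (toℕ a) (sym eq))

    classify : ∀ w → w Lₖ.^ 4 ≡ L.1# ⊎ w Lₖ.^ 4 ≡ -1L → ∃ λ (j : Fin 8) → ω Lₖ.^ toℕ j ≡ w
    classify w (inj₁ ≡1) = [ choose 0F 4F refl , choose 2F 6F refl ]′ (roots± 0 (trans (w^4 w) ≡1))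
    classify w (inj₂ ≡-1) = [ choose 1F 5F refl , choose 3F 7F refl ]′ (roots± 2 (trans (w^4 w) (trans ≡-1 (sym ω^4))))

  abstract
    class? : ∀ z → Dec (∃ λ (j : Fin 8) → ω Lₖ.^ toℕ j ≡ z Lₖ.^ k)
    class? z = Fin.any? (λ j → (ω Lₖ.^ toℕ j) 𝕃.≟ (z Lₖ.^ k))

    class-exists : ∀ {z} → z ≢ L.0# → ∃ λ (j : Fin 8) → ω Lₖ.^ toℕ j ≡ z Lₖ.^ k
    class-exists {z} z≢0 = [ (λ ≡1  → classify (z Lₖ.^ k) (inj₁ (trans (^k^4 z) (cong ι (trans (cong fromℤ ≡1) fromℤ-1)))))
                           , (λ ≡-1 → classify (z Lₖ.^ k) (inj₂ (trans (^k^4 z) (trans (cong ι (trans (cong fromℤ ≡-1) fromℤ--1)) (ι-neg 1#))))) ]′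
                           (η-≢0 (norm-≢0 z≢0))

    decided-class : ∀ {z} → Dec (∃ λ (j : Fin 8) → ω Lₖ.^ toℕ j ≡ z Lₖ.^ k) → Fin 8
    decided-class (yes (j , _)) = j
    decided-class (no _)        = Fin.zero

    cl : L → Fin 8
    cl z = decided-class (class? z)

    ω^cl : ∀ {z} → z ≢ L.0# → ω Lₖ.^ toℕ (cl z) ≡ z Lₖ.^ k
    ω^cl {z} z≢0 = go (class? z)
      where
      go : ∀ (d : Dec (∃ λ (j : Fin 8) → ω Lₖ.^ toℕ j ≡ z Lₖ.^ k)) → ω Lₖ.^ toℕ (decided-class d) ≡ z Lₖ.^ k
      go (yes (_ , eq)) = eq
      go (no ¬∃)        = contradiction (class-exists z≢0) ¬∃

  cl-unique : ∀ {z} n → z ≢ L.0# → ω Lₖ.^ n ≡ z Lₖ.^ k → cl z ≡ n ℕ.mod 8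
  cl-unique {z} n z≢0 eq = ω^-injective (trans (ω^cl z≢0) (trans (sym eq) (trans (sym (ω^-% n)) (cong (ω Lₖ.^_) (sym (Fin.toℕ-fromℕ< (ℕ.m%n<n n 8)))))))

  infixl 6 _⊞_
  _⊞_ : Fin 8 → Fin 8 → Fin 8
  a ⊞ b = (toℕ a ℕ.+ toℕ b) ℕ.mod 8

  cl-* : ∀ {z w} → z ≢ L.0# → w ≢ L.0# → cl (z L.* w) ≡ cl z ⊞ cl w
  cl-* {z} {w} z≢0 w≢0 = cl-unique (toℕ (cl z) ℕ.+ toℕ (cl w)) (Lf.*-≢0 z≢0 w≢0) (begin
    ω Lₖ.^ (toℕ (cl z) ℕ.+ toℕ (cl w))            ≡⟨ Lₖ.^-homo-* ω (toℕ (cl z)) (toℕ (cl w)) ⟩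
    ω Lₖ.^ toℕ (cl z) L.* ω Lₖ.^ toℕ (cl w)       ≡⟨ cong₂ L._*_ (ω^cl z≢0) (ω^cl w≢0) ⟩
    z Lₖ.^ k L.* w Lₖ.^ k                         ≡⟨ Lₖ.^-distrib-* z w k ⟨
    (z L.* w) Lₖ.^ k                              ∎)

  cl-ζ : cl ζ ≡ 1F
  cl-ζ = cl-unique 1 ζ≢0 (trans (L.*-identityʳ ω) ω≡ζ^k)

  conjugate-≢0 : ∀ {z} → z ≢ L.0# → conjugate z ≢ L.0#
  conjugate-≢0 {a , b} z≢0 eq = z≢0 (cong₂ _,_ (cong proj₁ eq) (trans (sym (neg-involutive b)) (trans (cong -_ (cong proj₂ eq)) -0#≈0#)))

  cl-conjugate : ∀ {z} → z ≢ L.0# → cl (conjugate z) ≡ (toℕ (cl z) ℕ.* 3) ℕ.mod 8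
  cl-conjugate {z} z≢0 = cl-unique (j ℕ.* 3) (conjugate-≢0 z≢0) (begin
    ω Lₖ.^ (j ℕ.* 3)                       ≡⟨ L.*-identityʳ _ ⟨
    ω Lₖ.^ (j ℕ.* 3) L.* L.1#              ≡⟨ cong (ω Lₖ.^ (j ℕ.* 3) L.*_) (trans (sym (Lₖ.^-assocʳ ω 8 (j ℕ.* h))) (trans (cong (Lₖ._^ (j ℕ.* h)) ω^8) (L-1^ (j ℕ.* h)))) ⟨
    ω Lₖ.^ (j ℕ.* 3) L.* ω Lₖ.^ (8 ℕ.* (j ℕ.* h)) ≡⟨ Lₖ.^-homo-* ω (j ℕ.* 3) _ ⟨
    ω Lₖ.^ (j ℕ.* 3 ℕ.+ 8 ℕ.* (j ℕ.* h))   ≡⟨ cong (ω Lₖ.^_) (ℕ.+-*-Solver.solve 2 (λ j h → let open ℕ.+-*-Solver in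
                                                 j :* con 3 :+ con 8 :* (j :* h) := j :* (con 1 :+ ((con 1 :+ con 4 :* h) :+ (con 1 :+ con 4 :* h)))) refl j h) ⟩
    ω Lₖ.^ (j ℕ.* q)                       ≡⟨ Lₖ.^-assocʳ ω j q ⟨
    (ω Lₖ.^ j) Lₖ.^ q                      ≡⟨ cong (Lₖ._^ q) (ω^cl z≢0) ⟩
    (z Lₖ.^ k) Lₖ.^ q                      ≡⟨ Lₖ.^-assocʳ z k q ⟩
    z Lₖ.^ (k ℕ.* q)                       ≡⟨ cong (z Lₖ.^_) (ℕ.*-comm k q) ⟩
    z Lₖ.^ (q ℕ.* k)                       ≡⟨ Lₖ.^-assocʳ z q k ⟨
    (z Lₖ.^ q) Lₖ.^ k                      ≡⟨ cong (Lₖ._^ k) (frobenius-conjugate z) ⟩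
    conjugate z Lₖ.^ k                     ∎)
    where j = toℕ (cl z)

  ι-≢0 : ∀ {x} → x ≢ 0# → ι x ≢ L.0#
  ι-≢0 x≢0 = x≢0 ∘ cong proj₁

  private
    ι^k : ∀ {x j} → η x ≡ j → ι x Lₖ.^ k ≡ ι (fromℤ j ^ m)
    ι^k {x} refl = trans (ι-^ x k) (cong ι (trans (sym (^-assocʳ x M m)) (cong (_^ m) (sym (fromℤ-η x)))))

  cl-ι+ : ∀ {x} → x ≢ 0# → η x ≡ 1ℤ → cl (ι x) ≡ 0F
  cl-ι+ x≢0 ηx = cl-unique 0 (ι-≢0 x≢0) (sym (trans (ι^k ηx) (cong ι (trans (cong (_^ m) fromℤ-1) (1^ m)))))

  cl-ι- : ∀ {x} → x ≢ 0# → η x ≡ ℤ.-1ℤ → cl (ι x) ≡ 4F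
  cl-ι- {x} x≢0 ηx = cl-unique 4 (ι-≢0 x≢0) (trans ω^4 (sym (begin
    ι x Lₖ.^ k               ≡⟨ ι^k ηx ⟩
    ι (fromℤ ℤ.-1ℤ ^ m)      ≡⟨ ι-^ _ m ⟨
    ι (fromℤ ℤ.-1ℤ) Lₖ.^ m   ≡⟨ cong (Lₖ._^ m) (trans (cong ι fromℤ--1) (ι-neg 1#)) ⟩
    -1L Lₖ.^ m               ≡⟨ -1L^odd h ⟩
    -1L                      ∎)))

  parity : Fin 8 → ℤ
  parity j = ℤ.-1ℤ ℤ.^ toℕ j

  η-norm : ∀ {z} → z ≢ L.0# → η (norm z) ≡ parity (cl z)
  η-norm {z} z≢0 = fromℤ-injective (η-sign (norm z)) (sign-parity (toℕ (cl z))) (cong proj₁ (begin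
    ι (fromℤ (η (norm z)))                ≡⟨ ^k^4 z ⟨
    (z Lₖ.^ k) Lₖ.^ 4                     ≡⟨ cong (Lₖ._^ 4) (ω^cl z≢0) ⟨
    (ω Lₖ.^ toℕ (cl z)) Lₖ.^ 4            ≡⟨ Lₖ.^-assocʳ ω (toℕ (cl z)) 4 ⟩
    ω Lₖ.^ (toℕ (cl z) ℕ.* 4)             ≡⟨ cong (ω Lₖ.^_) (ℕ.*-comm (toℕ (cl z)) 4) ⟩
    ω Lₖ.^ (4 ℕ.* toℕ (cl z))             ≡⟨ ω^[4*n] (toℕ (cl z)) ⟩
    -1L Lₖ.^ toℕ (cl z)                   ≡⟨ -1L^ (toℕ (cl z)) ⟩
    ι (fromℤ (ℤ.-1ℤ ℤ.^ toℕ (cl z)))      ∎))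
    where
    sign-parity : ∀ n → Sign (ℤ.-1ℤ ℤ.^ n)
    sign-parity zero    = s+
    sign-parity (suc n) = sign-* s- (sign-parity n)
    -1L^ : ∀ n → -1L Lₖ.^ n ≡ ι (fromℤ (ℤ.-1ℤ ℤ.^ n))
    -1L^ zero    = cong ι (sym fromℤ-1)
    -1L^ (suc n) = begin
      -1L L.* -1L Lₖ.^ n                            ≡⟨ cong₂ L._*_ (trans (sym (ι-neg 1#)) (cong ι (sym fromℤ--1))) (-1L^ n) ⟩
      ι (fromℤ ℤ.-1ℤ) L.* ι (fromℤ (ℤ.-1ℤ ℤ.^ n))   ≡⟨ ι-* (fromℤ ℤ.-1ℤ) _ ⟨
      ι (fromℤ ℤ.-1ℤ * fromℤ (ℤ.-1ℤ ℤ.^ n))         ≡⟨ cong ι (fromℤ-* ℤ.-1ℤ (ℤ.-1ℤ ℤ.^ n)) ⟨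
      ι (fromℤ (ℤ.-1ℤ ℤ.* ℤ.-1ℤ ℤ.^ n))             ∎

  cl-imaginary : ∀ {y} → y ≢ 0# → cl (0# , y) ⊞ cl (0# , y) ≡ 4F
  cl-imaginary {y} y≢0 = begin
    cl (0# , y) ⊞ cl (0# , y)     ≡⟨ cl-* z≢0 z≢0 ⟨
    cl ((0# , y) L.* (0# , y))    ≡⟨ cong cl (cong₂ _,_ (solve 1 (λ y → con 0ℤ :* con 0ℤ :- y :* y := :- (y :* y)) refl y) (solve 1 (λ y → con 0ℤ :* y :+ y :* con 0ℤ := con 0ℤ) refl y)) ⟩
    cl (ι (- (y * y)))            ≡⟨ cl-ι- (λ eq → *-≢0 y≢0 y≢0 (trans (sym (neg-involutive (y * y))) (trans (cong -_ eq) -0#≈0#))) (trans (η-neg (y * y)) (cong ℤ.-_ (η-sq y≢0))) ⟩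
    4F                       ∎
    where
    open KS
    z≢0 : (0# , y) ≢ L.0#
    z≢0 = y≢0 ∘ cong proj₂

Maybe-enumeration : ∀ {A : Set} → Enumeration A → Enumeration (Maybe A)
Maybe-enumeration 𝔸 = record
  { elements = nothing ∷ map just A.elements
  ; _≟_      = Maybe.≡-dec A._≟_
  ; complete = λ { nothing → here refl ; (just x) → there (Mem.∈-map⁺ just (A.complete x)) }
  ; unique   = All.tabulate (λ y∈ → nothing≢ y∈) ∷ Unique.map⁺ Maybe.just-injective A.unique
  }
  where
  module A = Enumeration 𝔸
  nothing≢ : ∀ {y} → y ∈ map just A.elements → nothing ≢ y
  nothing≢ y∈ refl with Mem.∈-map⁻ just y∈
  ... | _ , _ , ()

module Lines (𝕊 : Setting) where
  open Setting 𝕊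
  open Octic 𝕊 public
  open Field F using (_⁻¹; 0≢1; *-inverse)
  open CommutativeRing (Field.commutativeRing F) hiding (refl; sym; trans; zero)
  open RingKit (Field.commutativeRing F)
  open FieldKit F 𝕂
  open Enumeration 𝕂
  open ≡.≡-Reasoning
  private
    module KS = Solver
    module ZS = ℤSolver

  Line : Set
  Line = Maybe K

  ℙ : Enumeration Line
  ℙ = Maybe-enumeration 𝕂

  module ℙ = Enumeration ℙ

  point : Line → L
  point nothing  = 0# , 1#
  point (just x) = 1# , x

  ∑K : (K → ℤ) → ℤ
  ∑K = Σℤ.∑ elements

  ∑L : (L → ℤ) → ℤ
  ∑L = Σℤ.∑ 𝕃.elements

  ∑P : (Line → ℤ) → ℤ
  ∑P = Σℤ.∑ ℙ.elements

  infixr 7 _•_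
  _•_ : K → L → L
  x • (a , b) = x * a , x * b

  point≢0 : ∀ ℓ → point ℓ ≢ L.0#
  point≢0 nothing  eq = 0≢1 (sym (cong proj₂ eq))
  point≢0 (just x) eq = 0≢1 (sym (cong proj₁ eq))

  •-≢0 : ∀ {x u} → x ≢ 0# → u ≢ L.0# → x • u ≢ L.0#
  •-≢0 {x} {u} x≢0 u≢0 eq = Lf.*-≢0 (ι-≢0 x≢0) u≢0 (trans (ι-scale x u) eq)

  det-•ˡ : ∀ x u w → det (x • u) w ≡ x * det u w
  det-•ˡ x (a , b) (c , d) = solve 5 (λ x a b c d → (x :* a) :* d :- (x :* b) :* c := x :* (a :* d :- b :* c)) refl x a b c d
    where open KS

  det-•ʳ : ∀ x u w → det u (x • w) ≡ x * det u w
  det-•ʳ x (a , b) (c , d) = solve 5 (λ x a b c d → a :* (x :* d) :- b :* (x :* c) := x :* (a :* d :- b :* c)) refl x a b c d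
    where open KS

  det-self : ∀ u → det u u ≡ 0#
  det-self (a , b) = solve 2 (λ a b → a :* b :- b :* a := con 0ℤ) refl a b
    where open KS

  det-swap : ∀ u w → det u w ≡ - det w u
  det-swap (a , b) (c , d) = solve 4 (λ a b c d → a :* d :- b :* c := :- (c :* b :- d :* a)) refl a b c d
    where open KS

  det-point : ∀ {ℓ ℓ′} → ℓ ≢ ℓ′ → det (point ℓ) (point ℓ′) ≢ 0#
  det-point {nothing} {nothing} ℓ≢ _  = ℓ≢ refl
  det-point {nothing} {just y}  ℓ≢ eq = -1≢0 (trans (solve 1 (λ y → :- con 1ℤ := con 0ℤ :* y :- con 1ℤ :* con 1ℤ) refl y) eq)
    where open KS
  det-point {just x}  {nothing} ℓ≢ eq = 0≢1 (trans (sym eq) (solve 1 (λ x → con 1ℤ :* con 1ℤ :- x :* con 0ℤ := con 1ℤ) refl x))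
    where open KS
  det-point {just x}  {just y}  ℓ≢ eq = ℓ≢ (cong just (sym (x-y≡0⇒x≡y (trans (solve 2 (λ x y → y :- x := con 1ℤ :* y :- x :* con 1ℤ) refl x y) eq))))
    where open KS

  module _ (u v : L) (D≢0 : det u v ≢ 0#) where
    private D⁻¹ = det u v ⁻¹

    combination : L → L
    combination (α , β) = α • u L.- β • v

    coefficients : L → L
    coefficients g = det g v * D⁻¹ , det g u * D⁻¹

    coefficients-combination : ∀ c → coefficients (combination c) ≡ c
    coefficients-combination (α , β) = cong₂ _,_
      (trans (solve 7 (λ α β a b c d i → ((α :* a :- β :* c) :* d :- (α :* b :- β :* d) :* c) :* i := α :* ((a :* d :- b :* c) :* i)) refl α β (proj₁ u) (proj₂ u) (proj₁ v) (proj₂ v) D⁻¹)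
             (trans (cong (α *_) (*-inverse D≢0)) (*-identityʳ α)))
      (trans (solve 7 (λ α β a b c d i → ((α :* a :- β :* c) :* b :- (α :* b :- β :* d) :* a) :* i := β :* ((a :* d :- b :* c) :* i)) refl α β (proj₁ u) (proj₂ u) (proj₁ v) (proj₂ v) D⁻¹)
             (trans (cong (β *_) (*-inverse D≢0)) (*-identityʳ β)))
      where open KS

    combination-coefficients : ∀ g → combination (coefficients g) ≡ g
    combination-coefficients (x , y) = cong₂ _,_
      (trans (solve 7 (λ x y a b c d i → ((x :* d :- y :* c) :* i) :* a :- ((x :* b :- y :* a) :* i) :* c := x :* ((a :* d :- b :* c) :* i)) refl x y (proj₁ u) (proj₂ u) (proj₁ v) (proj₂ v) D⁻¹)
             (trans (cong (x *_) (*-inverse D≢0)) (*-identityʳ x)))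
      (trans (solve 7 (λ x y a b c d i → ((x :* d :- y :* c) :* i) :* b :- ((x :* b :- y :* a) :* i) :* d := y :* ((a :* d :- b :* c) :* i)) refl x y (proj₁ u) (proj₂ u) (proj₁ v) (proj₂ v) D⁻¹)
             (trans (cong (y *_) (*-inverse D≢0)) (*-identityʳ y)))
      where open KS

    ∑L-combination : ∀ f → ∑L f ≡ ∑L (f ∘ combination)
    ∑L-combination = Σℤ.∑-bijection 𝕃 𝕃 combination coefficients coefficients-combination combination-coefficients

  ∑L≡∑K∑K : ∀ f → ∑L f ≡ ∑K (λ a → ∑K (λ b → f (a , b)))
  ∑L≡∑K∑K = Σℤ.∑-× elements elements

  ∑P≡ : ∀ f → ∑P f ≡ f nothing ℤ.+ ∑K (f ∘ just)
  ∑P≡ f = cong (λ t → f nothing ℤ.+ t) (Σℤ.∑-map just elements f)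

  nonzero : K → ℤ
  nonzero x = if does (x ≟ 0#) then 0ℤ else 1ℤ

  nonzero-0 : nonzero 0# ≡ 0ℤ
  nonzero-0 = if-≟-refl 0#

  nonzero-≢0 : ∀ {x} → x ≢ 0# → nonzero x ≡ 1ℤ
  nonzero-≢0 = if-≟-≢

  nonzero-cong : ∀ {x i j} → (x ≢ 0# → i ≡ j) → nonzero x ℤ.* i ≡ nonzero x ℤ.* j
  nonzero-cong {x} {i} {j} eq = go (x ≟ 0#)
    where
    go : Dec (x ≡ 0#) → nonzero x ℤ.* i ≡ nonzero x ℤ.* j
    go (yes x≡0) = trans (cong (ℤ._* i) n≡0) (trans (ℤ.*-zeroˡ i) (sym (trans (cong (ℤ._* j) n≡0) (ℤ.*-zeroˡ j))))
      where n≡0 = trans (cong nonzero x≡0) nonzero-0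
    go (no x≢0) = cong (nonzero x ℤ.*_) (eq x≢0)

  split-0 : ∀ x i → i ≡ Σℤ.⟦ x ≟ 0# ⟧ ℤ.* i ℤ.+ nonzero x ℤ.* i
  split-0 x i = go (does (x ≟ 0#))
    where
    go : ∀ b → i ≡ (if b then 1ℤ else 0ℤ) ℤ.* i ℤ.+ (if b then 0ℤ else 1ℤ) ℤ.* i
    go true  = ZS.solve 1 (λ i → let open ZS in i := con 1ℤ :* i :+ con 0ℤ :* i) refl i
    go false = ZS.solve 1 (λ i → let open ZS in i := con 0ℤ :* i :+ con 1ℤ :* i) refl i

  ∑K-split-0 : ∀ f → ∑K f ≡ f 0# ℤ.+ ∑K (λ x → nonzero x ℤ.* f x)
  ∑K-split-0 f = begin
    ∑K f                                                           ≡⟨ Σℤ.∑-cong elements (λ x → split-0 x (f x)) ⟩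
    ∑K (λ x → Σℤ.⟦ x ≟ 0# ⟧ ℤ.* f x ℤ.+ nonzero x ℤ.* f x)         ≡⟨ Σℤ.∑-+ elements _ _ ⟩
    ∑K (λ x → Σℤ.⟦ x ≟ 0# ⟧ ℤ.* f x) ℤ.+ ∑K (λ x → nonzero x ℤ.* f x) ≡⟨ cong (ℤ._+ ∑K (λ x → nonzero x ℤ.* f x)) (Σℤ.∑-⟦≟⟧ 𝕂 0# f) ⟩
    f 0# ℤ.+ ∑K (λ x → nonzero x ℤ.* f x)                          ∎

  ·1≡+ : ∀ n → RingKit._·_ ℤ.+-*-commutativeRing n 1ℤ ≡ ℤ.+ n
  ·1≡+ zero    = refl
  ·1≡+ (suc n) = cong (λ t → 1ℤ ℤ.+ t) (·1≡+ n)

  ∑-constant : ∀ {A : Set} (xs : List A) i → Σℤ.∑ xs (λ _ → i) ≡ ℤ.+ length xs ℤ.* i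
  ∑-constant xs i = trans (Σℤ.∑-const xs i) (cong (ℤ._* i) (·1≡+ (length xs)))

  q-1 : ℤ
  q-1 = ℤ.+ (M ℕ.+ M)

  ∑K-constant : ∀ i → ∑K (λ _ → i) ≡ ℤ.+ q ℤ.* i
  ∑K-constant i = trans (∑-constant elements i) (cong (λ n → ℤ.+ n ℤ.* i) size)

  ∑K-nonzero : ∑K nonzero ≡ q-1
  ∑K-nonzero = AbelianGroupProperties.∙-cancelˡ ℤ.+-0-abelianGroup 1ℤ (∑K nonzero) q-1 (begin
    1ℤ ℤ.+ ∑K nonzero                     ≡⟨ cong (λ t → 1ℤ ℤ.+ t) (Σℤ.∑-cong elements (λ x → ℤ.*-identityʳ (nonzero x))) ⟨
    1ℤ ℤ.+ ∑K (λ x → nonzero x ℤ.* 1ℤ)    ≡⟨ ∑K-split-0 (λ _ → 1ℤ) ⟨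
    ∑K (λ _ → 1ℤ)                         ≡⟨ ∑K-constant 1ℤ ⟩
    ℤ.+ q ℤ.* 1ℤ                          ≡⟨ ℤ.*-identityʳ (ℤ.+ q) ⟩
    1ℤ ℤ.+ q-1                            ∎)

  q-1-cancel : ∀ {i j} → q-1 ℤ.* i ≡ q-1 ℤ.* j → i ≡ j
  q-1-cancel {i} {j} = ℤ.*-cancelˡ-≡ q-1 i j

  ∑P-constant : ∀ i → ∑P (λ _ → i) ≡ ℤ.+ 4 ℤ.* (ℤ.+ m ℤ.* i)
  ∑P-constant i = begin
    ∑P (λ _ → i)                 ≡⟨ ∑P≡ (λ _ → i) ⟩
    i ℤ.+ ∑K (λ _ → i)           ≡⟨ cong (λ t → i ℤ.+ t) (∑K-constant i) ⟩
    i ℤ.+ ℤ.+ q ℤ.* i            ≡⟨ ℤ.suc-* (ℤ.+ q) i ⟨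
    ℤ.+ suc q ℤ.* i              ≡⟨ cong (λ n → ℤ.+ n ℤ.* i) (ℕ.+-*-Solver.solve 1 (λ h → let open ℕ.+-*-Solver in
                                      con 2 :+ ((con 1 :+ con 4 :* h) :+ (con 1 :+ con 4 :* h)) := con 4 :* (con 1 :+ con 2 :* h)) refl h) ⟩
    ℤ.+ (4 ℕ.* m) ℤ.* i          ≡⟨ cong (ℤ._* i) (ℤ.pos-* 4 m) ⟩
    ℤ.+ 4 ℤ.* ℤ.+ m ℤ.* i        ≡⟨ ℤ.*-assoc (ℤ.+ 4) (ℤ.+ m) i ⟩
    ℤ.+ 4 ℤ.* (ℤ.+ m ℤ.* i)      ∎

  ∑L-polar : ∀ f → f L.0# ≡ 0ℤ → ∑L f ≡ ∑P (λ ℓ → ∑K (λ x → nonzero x ℤ.* f (x • point ℓ)))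
  ∑L-polar f f0≡0 = begin
    ∑L f
      ≡⟨ ∑L≡∑K∑K f ⟩
    ∑K (λ a → ∑K (λ b → f (a , b)))
      ≡⟨ ∑K-split-0 (λ a → ∑K (λ b → f (a , b))) ⟩
    ∑K (λ b → f (0# , b)) ℤ.+ ∑K (λ a → nonzero a ℤ.* ∑K (λ b → f (a , b)))
      ≡⟨ cong₂ ℤ._+_ vertical (Σℤ.∑-cong elements (λ a → trans (nonzero-cong (slope a)) (Σℤ.∑-*ˡ elements (nonzero a) _))) ⟩
    ∑K (λ x → nonzero x ℤ.* f (x • point nothing)) ℤ.+ ∑K (λ a → ∑K (λ b → nonzero a ℤ.* f (a • point (just b))))
      ≡⟨ cong (λ t → ∑K (λ x → nonzero x ℤ.* f (x • point nothing)) ℤ.+ t) (Σℤ.∑-swap elements elements (λ a b → nonzero a ℤ.* f (a • point (just b)))) ⟩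
    ∑K (λ x → nonzero x ℤ.* f (x • point nothing)) ℤ.+ ∑K (λ b → ∑K (λ a → nonzero a ℤ.* f (a • point (just b))))
      ≡⟨ ∑P≡ (λ ℓ → ∑K (λ x → nonzero x ℤ.* f (x • point ℓ))) ⟨
    ∑P (λ ℓ → ∑K (λ x → nonzero x ℤ.* f (x • point ℓ))) ∎
    where
    vertical : ∑K (λ b → f (0# , b)) ≡ ∑K (λ x → nonzero x ℤ.* f (x • point nothing))
    vertical = trans (∑K-split-0 (λ b → f (0# , b))) (trans (cong (ℤ._+ ∑K (λ x → nonzero x ℤ.* f (0# , x))) f0≡0) (trans (ℤ.+-identityˡ _)
      (Σℤ.∑-cong elements (λ x → cong (λ z → nonzero x ℤ.* f z) (cong₂ _,_ (sym (zeroʳ x)) (sym (*-identityʳ x)))))))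
    slope : ∀ a → a ≢ 0# → ∑K (λ b → f (a , b)) ≡ ∑K (λ b → f (a • point (just b)))
    slope a a≢0 = trans (∑-affine 0# a≢0 (λ b → f (a , b))) (Σℤ.∑-cong elements (λ b → cong f (cong₂ _,_ (sym (*-identityʳ a)) (+-identityˡ (a * b)))))

  Homogeneous : (L → ℤ) → Set
  Homogeneous f = ∀ {x u} → x ≢ 0# → f (x • u) ≡ f u

  ∑L-homogeneous : ∀ f → f L.0# ≡ 0ℤ → Homogeneous f → ∑L f ≡ q-1 ℤ.* ∑P (f ∘ point)
  ∑L-homogeneous f f0≡0 hom = begin
    ∑L f                                                       ≡⟨ ∑L-polar f f0≡0 ⟩
    ∑P (λ ℓ → ∑K (λ x → nonzero x ℤ.* f (x • point ℓ)))        ≡⟨ Σℤ.∑-cong ℙ.elements (λ ℓ → trans (Σℤ.∑-cong elements (λ x → nonzero-cong (λ x≢0 → hom x≢0)))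
                                                                   (trans (sym (Σℤ.∑-*ʳ elements (f (point ℓ)) nonzero)) (cong (ℤ._* f (point ℓ)) ∑K-nonzero))) ⟩
    ∑P (λ ℓ → q-1 ℤ.* f (point ℓ))                             ≡⟨ Σℤ.∑-*ˡ ℙ.elements q-1 (f ∘ point) ⟨
    q-1 ℤ.* ∑P (f ∘ point)                                     ∎

  ∑L-rotate : ∀ {z} → z ≢ L.0# → ∀ f → ∑L f ≡ ∑L (λ u → f (z L.* u))
  ∑L-rotate {z} z≢0 = Σℤ.∑-bijection 𝕃 𝕃 (z L.*_) (z L-field.⁻¹ L.*_)
    (λ u → trans (sym (L.*-assoc _ z u)) (trans (cong (L._* u) (trans (L.*-comm _ z) (L-field.*-inverse z≢0))) (L.*-identityˡ u)))
    (λ u → trans (sym (L.*-assoc z _ u)) (trans (cong (L._* u) (L-field.*-inverse z≢0)) (L.*-identityˡ u)))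

  *-• : ∀ z x u → z L.* (x • u) ≡ x • (z L.* u)
  *-• (a , b) x (c , d) = cong₂ _,_ (solve 5 (λ a b x c d → a :* (x :* c) :- b :* (x :* d) := x :* (a :* c :- b :* d)) refl a b x c d)
                                    (solve 5 (λ a b x c d → a :* (x :* d) :+ b :* (x :* c) := x :* (a :* d :+ b :* c)) refl a b x c d)
    where open KS

  ∑P-rotate : ∀ {z} → z ≢ L.0# → ∀ f → f L.0# ≡ 0ℤ → Homogeneous f → ∑P (f ∘ point) ≡ ∑P (λ ℓ → f (z L.* point ℓ))
  ∑P-rotate {z} z≢0 f f0≡0 hom = q-1-cancel (begin
    q-1 ℤ.* ∑P (f ∘ point)                        ≡⟨ ∑L-homogeneous f f0≡0 hom ⟨
    ∑L f                                          ≡⟨ ∑L-rotate z≢0 f ⟩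
    ∑L (λ u → f (z L.* u))                        ≡⟨ ∑L-homogeneous (λ u → f (z L.* u)) (trans (cong f (L.zeroʳ z)) f0≡0) (λ {x} {u} x≢0 → trans (cong f (*-• z x u)) (hom x≢0)) ⟩
    q-1 ℤ.* ∑P (λ ℓ → f (z L.* point ℓ))          ∎)

  onClass : (Fin 8 → ℤ) → L → ℤ
  onClass φ u = if does (u 𝕃.≟ L.0#) then 0ℤ else φ (cl u)

  onClass-0 : ∀ φ → onClass φ L.0# ≡ 0ℤ
  onClass-0 φ = 𝕃.if-≟-refl L.0#

  onClass-≢0 : ∀ φ {u} → u ≢ L.0# → onClass φ u ≡ φ (cl u)
  onClass-≢0 φ = 𝕃.if-≟-≢

  Even Odd : (Fin 8 → ℤ) → Set
  Even φ = ∀ j → φ (4F ⊞ j) ≡ φ j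
  Odd φ  = ∀ j → φ (4F ⊞ j) ≡ ℤ.- φ j

  0⊞ : ∀ j → 0F ⊞ j ≡ j
  0⊞ j = Fin.toℕ-injective (trans (Fin.toℕ-fromℕ< (ℕ.m%n<n (toℕ j) 8)) (ℕ.m<n⇒m%n≡m (Fin.toℕ<n j)))

  cl-• : ∀ {x u} → x ≢ 0# → u ≢ L.0# → (η x ≡ 1ℤ × cl (x • u) ≡ cl u) ⊎ (η x ≡ ℤ.-1ℤ × cl (x • u) ≡ 4F ⊞ cl u)
  cl-• {x} {u} x≢0 u≢0 = [ (λ ηx → inj₁ (ηx , trans cl-ι* (trans (cong (_⊞ cl u) (cl-ι+ x≢0 ηx)) (0⊞ (cl u)))))
                         , (λ ηx → inj₂ (ηx , trans cl-ι* (cong (_⊞ cl u) (cl-ι- x≢0 ηx)))) ]′ (η-≢0 x≢0)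
    where
    cl-ι* : cl (x • u) ≡ cl (ι x) ⊞ cl u
    cl-ι* = trans (cong cl (sym (ι-scale x u))) (cl-* (ι-≢0 x≢0) u≢0)

  •-0 : ∀ x → x • L.0# ≡ L.0#
  •-0 x = cong₂ _,_ (zeroʳ x) (zeroʳ x)

  onClass-even : ∀ {φ} → Even φ → Homogeneous (onClass φ)
  onClass-even {φ} even {x} {u} x≢0 = go (u 𝕃.≟ L.0#)
    where
    go : Dec (u ≡ L.0#) → onClass φ (x • u) ≡ onClass φ u
    go (yes refl) = cong (onClass φ) (•-0 x)
    go (no u≢0) = begin
      onClass φ (x • u)   ≡⟨ onClass-≢0 φ (•-≢0 x≢0 u≢0) ⟩
      φ (cl (x • u))      ≡⟨ [ cong φ ∘ proj₂ , (λ (_ , eq) → trans (cong φ eq) (even (cl u))) ]′ (cl-• x≢0 u≢0) ⟩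
      φ (cl u)            ≡⟨ onClass-≢0 φ u≢0 ⟨
      onClass φ u         ∎

  onClass-odd : ∀ {φ} → Odd φ → ∀ {x u} → x ≢ 0# → onClass φ (x • u) ≡ η x ℤ.* onClass φ u
  onClass-odd {φ} odd {x} {u} x≢0 = go (u 𝕃.≟ L.0#)
    where
    go : Dec (u ≡ L.0#) → onClass φ (x • u) ≡ η x ℤ.* onClass φ u
    go (yes refl) = trans (trans (cong (onClass φ) (•-0 x)) (onClass-0 φ)) (sym (trans (cong (η x ℤ.*_) (onClass-0 φ)) (ℤ.*-zeroʳ (η x))))
    go (no u≢0) = begin
      onClass φ (x • u)     ≡⟨ onClass-≢0 φ (•-≢0 x≢0 u≢0) ⟩
      φ (cl (x • u))        ≡⟨ [ (λ (ηx , eq) → trans (cong φ eq) (sym (trans (cong (ℤ._* φ (cl u)) ηx) (ℤ.*-identityˡ _))))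
                             , (λ (ηx , eq) → trans (cong φ eq) (trans (odd (cl u)) (sym (trans (cong (ℤ._* φ (cl u)) ηx) (ℤ.-1*i≡-i _))))) ]′ (cl-• x≢0 u≢0) ⟩
      η x ℤ.* φ (cl u)      ≡⟨ cong (η x ℤ.*_) (onClass-≢0 φ u≢0) ⟨
      η x ℤ.* onClass φ u   ∎

  ∑P-class : ∀ φ → ∑P (onClass φ ∘ point) ≡ ∑P (λ ℓ → φ (cl (point ℓ)))
  ∑P-class φ = Σℤ.∑-cong ℙ.elements (λ ℓ → onClass-≢0 φ (point≢0 ℓ))

  ⊞4 : ∀ j → 1F ⊞ (4F ⊞ j) ≡ 4F ⊞ (1F ⊞ j)
  ⊞4 = λ { 0F → refl ; 1F → refl ; 2F → refl ; 3F → refl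
         ; 4F → refl ; 5F → refl
         ; 6F → refl ; 7F → refl }

  -- Multiplication by ζ permutes the lines and shifts classes by one, so the four classes of lines are equally large.
  ∑P-class-average : ∀ φ → Even φ → ∑P (λ ℓ → φ (cl (point ℓ))) ≡ ℤ.+ m ℤ.* (φ 0F ℤ.+ φ 1F ℤ.+ φ 2F ℤ.+ φ 3F)
  ∑P-class-average φ even = ℤ.*-cancelˡ-≡ (ℤ.+ 4) _ _ (begin
    ℤ.+ 4 ℤ.* S φ                              ≡⟨ ZS.solve 1 (λ s → let open ZS in con (ℤ.+ 4) :* s := s :+ s :+ s :+ s) refl (S φ) ⟩
    S φ ℤ.+ S φ ℤ.+ S φ ℤ.+ S φ                ≡⟨ cong₂ ℤ._+_ (cong₂ ℤ._+_ (cong (λ t → S φ ℤ.+ t) S1) S2) S3 ⟩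
    S φ ℤ.+ S φ₁ ℤ.+ S φ₂ ℤ.+ S φ₃             ≡⟨ cong (ℤ._+ S φ₃) (trans (Σℤ.∑-+ ℙ.elements (λ ℓ → c φ ℓ ℤ.+ c φ₁ ℓ) (c φ₂)) (cong (ℤ._+ S φ₂) (Σℤ.∑-+ ℙ.elements (c φ) (c φ₁)))) ⟨
    ∑P (λ ℓ → c φ ℓ ℤ.+ c φ₁ ℓ ℤ.+ c φ₂ ℓ) ℤ.+ S φ₃ ≡⟨ Σℤ.∑-+ ℙ.elements (λ ℓ → c φ ℓ ℤ.+ c φ₁ ℓ ℤ.+ c φ₂ ℓ) (c φ₃) ⟨
    ∑P (λ ℓ → c φ ℓ ℤ.+ c φ₁ ℓ ℤ.+ c φ₂ ℓ ℤ.+ c φ₃ ℓ) ≡⟨ Σℤ.∑-cong ℙ.elements (λ ℓ → total (cl (point ℓ))) ⟩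
    ∑P (λ _ → T)                               ≡⟨ ∑P-constant T ⟩
    ℤ.+ 4 ℤ.* (ℤ.+ m ℤ.* T)                    ∎)
    where
    T : ℤ
    T = φ 0F ℤ.+ φ 1F ℤ.+ φ 2F ℤ.+ φ 3F
    shift : (Fin 8 → ℤ) → Fin 8 → ℤ
    shift ψ j = ψ (1F ⊞ j)
    φ₁ φ₂ φ₃ : Fin 8 → ℤ
    φ₁ = shift φ
    φ₂ = shift φ₁
    φ₃ = shift φ₂
    c : (Fin 8 → ℤ) → Line → ℤ
    c ψ ℓ = ψ (cl (point ℓ))
    S : (Fin 8 → ℤ) → ℤ
    S ψ = ∑P (c ψ)
    shift-even : ∀ ψ → Even ψ → Even (shift ψ)
    shift-even ψ ev j = trans (cong ψ (⊞4 j)) (ev (1F ⊞ j))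
    S-shift : ∀ ψ → Even ψ → S ψ ≡ S (shift ψ)
    S-shift ψ ev = begin
      S ψ                                      ≡⟨ ∑P-class ψ ⟨
      ∑P (onClass ψ ∘ point)                   ≡⟨ ∑P-rotate ζ≢0 (onClass ψ) (onClass-0 ψ) (onClass-even ev) ⟩
      ∑P (λ ℓ → onClass ψ (ζ L.* point ℓ))     ≡⟨ Σℤ.∑-cong ℙ.elements (λ ℓ → trans (onClass-≢0 ψ (Lf.*-≢0 ζ≢0 (point≢0 ℓ)))
                                                    (cong ψ (trans (cl-* ζ≢0 (point≢0 ℓ)) (cong (_⊞ cl (point ℓ)) cl-ζ)))) ⟩
      S (shift ψ)                              ∎
    S1 : S φ ≡ S φ₁
    S1 = S-shift φ even
    S2 : S φ ≡ S φ₂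
    S2 = trans S1 (S-shift φ₁ (shift-even φ even))
    S3 : S φ ≡ S φ₃
    S3 = trans S2 (S-shift φ₂ (shift-even φ₁ (shift-even φ even)))
    total : ∀ j → φ j ℤ.+ φ₁ j ℤ.+ φ₂ j ℤ.+ φ₃ j ≡ T
    total = λ
      { 0F → refl
      ; 1F → trans (cong (λ t → φ 1F ℤ.+ φ 2F ℤ.+ φ 3F ℤ.+ t) (even 0F)) rot1
      ; 2F → trans (cong₂ (λ a b → φ 2F ℤ.+ φ 3F ℤ.+ a ℤ.+ b) (even 0F) (even 1F)) rot2
      ; 3F → trans (cong₂ (λ a b → φ 3F ℤ.+ a ℤ.+ b ℤ.+ φ 6F) (even 0F) (even 1F)) (trans (cong (λ t → φ 3F ℤ.+ φ 0F ℤ.+ φ 1F ℤ.+ t) (even 2F)) rot3)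
      ; 4F → cong₂ ℤ._+_ (cong₂ ℤ._+_ (cong₂ ℤ._+_ (even 0F) (even 1F)) (even 2F)) (even 3F)
      ; 5F → trans (cong₂ ℤ._+_ (cong₂ ℤ._+_ (cong₂ ℤ._+_ (even 1F) (even 2F)) (even 3F)) refl) rot1
      ; 6F → trans (cong₂ ℤ._+_ (cong₂ ℤ._+_ (cong₂ ℤ._+_ (even 2F) (even 3F)) refl) refl) rot2
      ; 7F → trans (cong (λ t → t ℤ.+ φ 0F ℤ.+ φ 1F ℤ.+ φ 2F) (even 3F)) rot3 }
      where
      open ZS
      rot1 : φ 1F ℤ.+ φ 2F ℤ.+ φ 3F ℤ.+ φ 0F ≡ T
      rot1 = solve 4 (λ a b c d → b :+ c :+ d :+ a := a :+ b :+ c :+ d) refl (φ 0F) (φ 1F) (φ 2F) (φ 3F)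
      rot2 : φ 2F ℤ.+ φ 3F ℤ.+ φ 0F ℤ.+ φ 1F ≡ T
      rot2 = solve 4 (λ a b c d → c :+ d :+ a :+ b := a :+ b :+ c :+ d) refl (φ 0F) (φ 1F) (φ 2F) (φ 3F)
      rot3 : φ 3F ℤ.+ φ 0F ℤ.+ φ 1F ℤ.+ φ 2F ≡ T
      rot3 = solve 4 (λ a b c d → d :+ a :+ b :+ c := a :+ b :+ c :+ d) refl (φ 0F) (φ 1F) (φ 2F) (φ 3F)

∀8 : ∀ {P : Fin 8 → Set} → P 0F → P 1F → P 2F → P 3F → P 4F → P 5F → P 6F → P 7F → ∀ j → P j
∀8 a b c d e f g h = λ { 0F → a ; 1F → b ; 2F → c ; 3F → d ; 4F → e ; 5F → f ; 6F → g ; 7F → h }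

module CharacterSums (𝕊 : Setting) where
  open Setting 𝕊
  open Lines 𝕊 public
  open Field F using (_⁻¹; 0≢1; *-inverse)
  open CommutativeRing (Field.commutativeRing F) hiding (refl; sym; trans; zero)
  open RingKit (Field.commutativeRing F)
  open FieldKit F 𝕂
  open Enumeration 𝕂
  open ≡.≡-Reasoning
  private
    module KS = Solver
    module ZS = ℤSolver

  charSum : (L → ℤ) → L → ℤ
  charSum s g = ∑P (λ ℓ → s (point ℓ) ℤ.* η (det (point ℓ) g))

  charSum-• : ∀ s x g → charSum s (x • g) ≡ η x ℤ.* charSum s g
  charSum-• s x g = trans (Σℤ.∑-cong ℙ.elements (λ ℓ → begin
    s (point ℓ) ℤ.* η (det (point ℓ) (x • g))          ≡⟨ cong (λ t → s (point ℓ) ℤ.* t) (trans (cong η (det-•ʳ x (point ℓ) g)) (η-* x _)) ⟩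
    s (point ℓ) ℤ.* (η x ℤ.* η (det (point ℓ) g))      ≡⟨ ZS.solve 3 (λ a b c → let open ZS in a :* (b :* c) := b :* (a :* c)) refl (s (point ℓ)) (η x) (η (det (point ℓ) g)) ⟩
    η x ℤ.* (s (point ℓ) ℤ.* η (det (point ℓ) g))      ∎)) (sym (Σℤ.∑-*ˡ ℙ.elements (η x) (λ ℓ → s (point ℓ) ℤ.* η (det (point ℓ) g))))

  charSum-0 : ∀ s → charSum s L.0# ≡ 0ℤ
  charSum-0 s = trans (Σℤ.∑-cong ℙ.elements (λ ℓ → trans (cong (λ t → s (point ℓ) ℤ.* t) (trans (cong η (det-0 (point ℓ))) η-0)) (ℤ.*-zeroʳ (s (point ℓ))))) (Σℤ.∑-0 ℙ.elements)
    where
    det-0 : ∀ u → det u L.0# ≡ 0#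
    det-0 (a , b) = solve 2 (λ a b → a :* con 0ℤ :- b :* con 0ℤ := con 0ℤ) refl a b
      where open KS

  private
    square-cancel : ∀ {x} a b → x ≢ 0# → (η x ℤ.* a) ℤ.* (η x ℤ.* b) ≡ a ℤ.* b
    square-cancel {x} a b x≢0 = trans (ZS.solve 3 (λ x a b → let open ZS in (x :* a) :* (x :* b) := (x :* x) :* (a :* b)) refl (η x) a b)
      (trans (cong (ℤ._* (a ℤ.* b)) (η-square x≢0)) (ℤ.*-identityˡ _))

  charSum-∑L : ∀ {φ} → Odd φ → ∀ g → q-1 ℤ.* charSum (onClass φ) g ≡ ∑L (λ u → onClass φ u ℤ.* η (det u g))
  charSum-∑L {φ} odd g = sym (∑L-homogeneous (λ u → onClass φ u ℤ.* η (det u g))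
    (trans (cong (ℤ._* η (det L.0# g)) (onClass-0 φ)) (ℤ.*-zeroˡ (η (det L.0# g))))
    (λ {x} {u} x≢0 → trans (cong₂ ℤ._*_ (onClass-odd odd x≢0) (trans (cong η (det-•ˡ x u g)) (η-* x (det u g)))) (square-cancel (onClass φ u) (η (det u g)) x≢0)))

  functional : (Fin 8 → ℤ) → ℤ
  functional φ = ∑L (λ u → onClass φ u ℤ.* η (det u L.1#))

  onClass-cong : ∀ {φ ψ} → (∀ j → φ j ≡ ψ j) → ∀ u → onClass φ u ≡ onClass ψ u
  onClass-cong eq u = cong (if does (u 𝕃.≟ L.0#) then 0ℤ else_) (eq (cl u))

  functional-cong : ∀ {φ ψ} → (∀ j → φ j ≡ ψ j) → functional φ ≡ functional ψ
  functional-cong eq = Σℤ.∑-cong 𝕃.elements (λ u → cong (ℤ._* η (det u L.1#)) (onClass-cong eq u))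

  onClass-map : ∀ φ (f : Fin 8 → Fin 8) {u v} → (u ≢ L.0# → v ≢ L.0#) → (u ≡ L.0# → v ≡ L.0#) → (u ≢ L.0# → cl v ≡ f (cl u)) → onClass φ v ≡ onClass (φ ∘ f) u
  onClass-map φ f {u} {v} ≢0 ≡0 cl-v = go (u 𝕃.≟ L.0#)
    where
    go : Dec (u ≡ L.0#) → onClass φ v ≡ onClass (φ ∘ f) u
    go (yes u≡0) = trans (trans (cong (onClass φ) (≡0 u≡0)) (onClass-0 φ)) (sym (trans (cong (onClass (φ ∘ f)) u≡0) (onClass-0 (φ ∘ f))))
    go (no  u≢0) = trans (onClass-≢0 φ (≢0 u≢0)) (trans (cong φ (cl-v u≢0)) (sym (onClass-≢0 (φ ∘ f) u≢0)))

  functional-neg : ∀ φ → functional (φ ∘ (4F ⊞_)) ≡ ℤ.- functional φ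
  functional-neg φ = begin
    functional (φ ∘ (4F ⊞_))                                          ≡⟨ Σℤ.∑-cong 𝕃.elements (λ u → trans
                                                                           (cong (ℤ._* η (det u L.1#)) (sym (onClass-map φ (4F ⊞_) {u} {_•_ (- 1#) u} (•-≢0 -1≢0) (λ u≡0 → trans (cong (- 1# •_) u≡0) (•-0 (- 1#))) (cl-neg u))))
                                                                           (trans (cong (λ t → onClass φ (- 1# • u) ℤ.* t) (η-det u)) (sym (ℤ.neg-distribʳ-* (onClass φ (- 1# • u)) _)))) ⟩
    ∑L (λ u → ℤ.- (onClass φ (- 1# • u) ℤ.* η (det (- 1# • u) L.1#))) ≡⟨ Σℤ.∑-neg 𝕃.elements (λ u → onClass φ (- 1# • u) ℤ.* η (det (- 1# • u) L.1#)) ⟩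
    ℤ.- ∑L (λ u → onClass φ (- 1# • u) ℤ.* η (det (- 1# • u) L.1#))   ≡⟨ cong ℤ.-_ (Σℤ.∑-bijection 𝕃 𝕃 (- 1# •_) (- 1# •_) involutive involutive (λ u → onClass φ u ℤ.* η (det u L.1#))) ⟨
    ℤ.- functional φ                                                  ∎
    where
    involutive : ∀ u → - 1# • - 1# • u ≡ u
    involutive (a , b) = cong₂ _,_ (go a) (go b)
      where
      go : ∀ a → - 1# * (- 1# * a) ≡ a
      go = KS.solve 1 (λ a → let open KS in (:- con 1ℤ) :* ((:- con 1ℤ) :* a) := a) refl
    cl-neg : ∀ u → u ≢ L.0# → cl (- 1# • u) ≡ 4F ⊞ cl u
    cl-neg u u≢0 = [ (λ (η≡1 , _) → contradiction (trans (sym η--1) η≡1) λ ()) , proj₂ ]′ (cl-• -1≢0 u≢0)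
    η-det : ∀ u → η (det u L.1#) ≡ ℤ.- η (det (- 1# • u) L.1#)
    η-det u = sym (trans (cong ℤ.-_ (trans (cong η (det-•ˡ (- 1#) u L.1#)) (trans (η-* (- 1#) _) (cong (ℤ._* η (det u L.1#)) η--1))))
      (ZS.solve 1 (λ x → let open ZS in :- ((:- con 1ℤ) :* x) := x) refl (η (det u L.1#))))

  triple : Fin 8 → Fin 8
  triple j = (toℕ j ℕ.* 3) ℕ.mod 8

  functional-conjugate : ∀ φ → functional (φ ∘ triple) ≡ ℤ.- functional φ
  functional-conjugate φ = begin
    functional (φ ∘ triple)                                           ≡⟨ Σℤ.∑-cong 𝕃.elements (λ u → trans
                                                                           (cong (ℤ._* η (det u L.1#)) (sym (onClass-map φ triple {u} {conjugate u} conjugate-≢0 (λ u≡0 → trans (cong conjugate u≡0) conjugate-0) cl-conjugate)))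
                                                                           (trans (cong (λ t → onClass φ (conjugate u) ℤ.* t) (η-det u)) (sym (ℤ.neg-distribʳ-* (onClass φ (conjugate u)) _)))) ⟩
    ∑L (λ u → ℤ.- (onClass φ (conjugate u) ℤ.* η (det (conjugate u) L.1#))) ≡⟨ Σℤ.∑-neg 𝕃.elements (λ u → onClass φ (conjugate u) ℤ.* η (det (conjugate u) L.1#)) ⟩
    ℤ.- ∑L (λ u → onClass φ (conjugate u) ℤ.* η (det (conjugate u) L.1#))   ≡⟨ cong ℤ.-_ (Σℤ.∑-bijection 𝕃 𝕃 conjugate conjugate involutive involutive (λ u → onClass φ u ℤ.* η (det u L.1#))) ⟨
    ℤ.- functional φ                                                  ∎
    where
    conjugate-0 : conjugate L.0# ≡ L.0#
    conjugate-0 = cong (0# ,_) -0#≈0#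
    involutive : ∀ u → conjugate (conjugate u) ≡ u
    involutive (a , b) = cong (a ,_) (neg-involutive b)
    η-det : ∀ u → η (det u L.1#) ≡ ℤ.- η (det (conjugate u) L.1#)
    η-det (a , b) = trans (cong η (KS.solve 2 (λ a b → let open KS in a :* con 0ℤ :- b :* con 1ℤ := :- (a :* con 0ℤ :- (:- b) :* con 1ℤ)) refl a b)) (η-neg _)

  indicator : Fin 8 → Fin 8 → ℤ
  indicator l j = Σℤ.⟦ l Fin.≟ j ⟧

  A : Fin 8 → ℤ
  A l = functional (indicator l)

  functional-expand : ∀ φ → functional φ ≡ Σℤ.∑ (allFin 8) (λ l → A l ℤ.* φ l)
  functional-expand φ = begin
    functional φ
      ≡⟨ Σℤ.∑-cong 𝕃.elements (λ u → trans (cong (ℤ._* η (det u L.1#)) (expand u)) (Σℤ.∑-*ʳ (allFin 8) (η (det u L.1#)) (λ l → onClass (indicator l) u ℤ.* φ l))) ⟩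
    ∑L (λ u → Σℤ.∑ (allFin 8) (λ l → onClass (indicator l) u ℤ.* φ l ℤ.* η (det u L.1#)))
      ≡⟨ Σℤ.∑-swap 𝕃.elements (allFin 8) (λ u l → onClass (indicator l) u ℤ.* φ l ℤ.* η (det u L.1#)) ⟩
    Σℤ.∑ (allFin 8) (λ l → ∑L (λ u → onClass (indicator l) u ℤ.* φ l ℤ.* η (det u L.1#)))
      ≡⟨ Σℤ.∑-cong (allFin 8) (λ l → trans (Σℤ.∑-cong 𝕃.elements (λ u → ZS.solve 3 (λ a b c → let open ZS in a :* b :* c := (a :* c) :* b) refl (onClass (indicator l) u) (φ l) (η (det u L.1#))))
           (sym (Σℤ.∑-*ʳ 𝕃.elements (φ l) (λ u → onClass (indicator l) u ℤ.* η (det u L.1#))))) ⟩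
    Σℤ.∑ (allFin 8) (λ l → A l ℤ.* φ l) ∎
    where
    expand : ∀ u → onClass φ u ≡ Σℤ.∑ (allFin 8) (λ l → onClass (indicator l) u ℤ.* φ l)
    expand u = go (u 𝕃.≟ L.0#)
      where
      go : Dec (u ≡ L.0#) → onClass φ u ≡ Σℤ.∑ (allFin 8) (λ l → onClass (indicator l) u ℤ.* φ l)
      go (yes refl) = trans (onClass-0 φ) (sym (trans (Σℤ.∑-cong (allFin 8) (λ l → trans (cong (ℤ._* φ l) (onClass-0 (indicator l))) (ℤ.*-zeroˡ (φ l)))) (Σℤ.∑-0 (allFin 8))))
      go (no u≢0)   = trans (onClass-≢0 φ u≢0) (sym (trans (Σℤ.∑-cong (allFin 8) (λ l → cong (ℤ._* φ l) (onClass-≢0 (indicator l) u≢0))) (Σℤ.∑-⟦≟⟧ (Fin-enumeration 8) (cl u) φ)))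

  A-odd : ∀ l → A (4F ⊞ l) ≡ ℤ.- A l
  A-odd l = trans (sym (ℤ.neg-involutive _)) (cong ℤ.-_ (trans (sym (functional-neg (indicator (4F ⊞ l)))) (functional-cong (λ j → same l j))))
    where
    same : ∀ l j → indicator (4F ⊞ l) (4F ⊞ j) ≡ indicator l j
    same = toWitness {a? = Fin.all? λ l → Fin.all? λ j → indicator (4F ⊞ l) (4F ⊞ j) ℤ.≟ indicator l j} tt

  A-triple : ∀ l → A l ≡ ℤ.- A (triple l)
  A-triple l = trans (functional-cong (λ j → sym (same l j))) (functional-conjugate (indicator (triple l)))
    where
    same : ∀ l j → indicator (triple l) (triple j) ≡ indicator l j
    same = toWitness {a? = Fin.all? λ l → Fin.all? λ j → indicator (triple l) (triple j) ℤ.≟ indicator l j} tt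

  A0≡0 : A 0F ≡ 0ℤ
  A0≡0 = self-negative (A-triple 0F)

  functional-odd : ∀ {φ} → Odd φ → functional φ ≡ (A 1F ℤ.+ A 1F) ℤ.* (φ 1F ℤ.- φ 3F) ℤ.+ (A 2F ℤ.+ A 2F) ℤ.* φ 2F
  functional-odd {φ} odd = trans (functional-expand φ) (trans
    (cong₂ ℤ._+_ (cong (ℤ._* φ 0F) A0≡0) (cong (λ t → A 1F ℤ.* φ 1F ℤ.+ (A 2F ℤ.* φ 2F ℤ.+ t))
      (cong₂ ℤ._+_ (cong (ℤ._* φ 3F) A3) (cong₂ ℤ._+_ (cong (ℤ._* φ 4F) A4)
        (cong₂ ℤ._+_ (cong₂ ℤ._*_ (A-odd 1F) (odd 1F)) (cong₂ ℤ._+_ (cong₂ ℤ._*_ (A-odd 2F) (odd 2F)) (cong (ℤ._+ 0ℤ) (cong₂ ℤ._*_ (trans (A-odd 3F) (cong ℤ.-_ A3)) (odd 3F)))))))))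
    (solve 7 (λ a b f0 f1 f2 f3 f4 → con 0ℤ :* f0 :+ (a :* f1 :+ (b :* f2 :+ (:- a :* f3 :+ (con 0ℤ :* f4 :+ (:- a :* :- f1 :+ (:- b :* :- f2 :+ (:- (:- a) :* :- f3 :+ con 0ℤ)))))))
      := (a :+ a) :* (f1 :- f3) :+ (b :+ b) :* f2) refl (A 1F) (A 2F) (φ 0F) (φ 1F) (φ 2F) (φ 3F) (φ 4F)))
    where
    open ZS
    A3 : A 3F ≡ ℤ.- A 1F
    A3 = trans (sym (ℤ.neg-involutive _)) (cong ℤ.-_ (sym (A-triple 1F)))
    A4 : A 4F ≡ 0ℤ
    A4 = trans (A-odd 0F) (cong ℤ.-_ A0≡0)

  odd-shift : ∀ {φ} → Odd φ → ∀ j → Odd (λ l → φ (j ⊞ l))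
  odd-shift {φ} odd j l = trans (cong φ (commute j l)) (odd (j ⊞ l))
    where
    commute : ∀ j l → j ⊞ (4F ⊞ l) ≡ 4F ⊞ (j ⊞ l)
    commute = toWitness {a? = Fin.all? λ j → Fin.all? λ l → (j ⊞ (4F ⊞ l)) Fin.≟ (4F ⊞ (j ⊞ l))} tt

  charSum-functional : ∀ {φ} → Odd φ → ∀ {g} → g ≢ L.0# → q-1 ℤ.* charSum (onClass φ) g ≡ parity (cl g) ℤ.* functional (λ l → φ (cl g ⊞ l))
  charSum-functional {φ} odd {g} g≢0 = begin
    q-1 ℤ.* charSum (onClass φ) g                                     ≡⟨ charSum-∑L odd g ⟩
    ∑L (λ u → onClass φ u ℤ.* η (det u g))                            ≡⟨ ∑L-rotate g≢0 (λ u → onClass φ u ℤ.* η (det u g)) ⟩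
    ∑L (λ u → onClass φ (g L.* u) ℤ.* η (det (g L.* u) g))            ≡⟨ Σℤ.∑-cong 𝕃.elements (λ u → trans (cong₂ ℤ._*_
                                                                           (onClass-map φ (cl g ⊞_) {u} {g L.* u} (Lf.*-≢0 g≢0) (λ u≡0 → trans (cong (g L.*_) u≡0) (L.zeroʳ g)) (cl-* g≢0))
                                                                           (η-det u))
                                                                           (ZS.solve 3 (λ a b c → let open ZS in a :* (b :* c) := b :* (a :* c)) refl (onClass (λ l → φ (cl g ⊞ l)) u) (parity (cl g)) (η (det u L.1#)))) ⟩
    ∑L (λ u → parity (cl g) ℤ.* (onClass (λ l → φ (cl g ⊞ l)) u ℤ.* η (det u L.1#))) ≡⟨ Σℤ.∑-*ˡ 𝕃.elements (parity (cl g)) (λ u → onClass (λ l → φ (cl g ⊞ l)) u ℤ.* η (det u L.1#)) ⟨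
    parity (cl g) ℤ.* functional (λ l → φ (cl g ⊞ l))                 ∎
    where
    η-det : ∀ u → η (det (g L.* u) g) ≡ parity (cl g) ℤ.* η (det u L.1#)
    η-det u = trans (cong η (trans (cong (det (g L.* u)) (sym (L.*-identityʳ g))) (det-* g u L.1#)))
      (trans (η-* (norm g) (det u L.1#)) (cong (ℤ._* η (det u L.1#)) (η-norm g≢0)))

  oddClass : ℤ → ℤ → ℤ → ℤ → Fin 8 → ℤ
  oddClass a b c d = ∀8 a b c d (ℤ.- a) (ℤ.- b) (ℤ.- c) (ℤ.- d)

  oddClass-odd : ∀ a b c d → Odd (oddClass a b c d)
  oddClass-odd a b c d = ∀8 refl refl refl refl (sym (ℤ.neg-involutive a)) (sym (ℤ.neg-involutive b)) (sym (ℤ.neg-involutive c)) (sym (ℤ.neg-involutive d))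

  private
    δ₀ : Fin 8 → ℤ
    δ₀ = oddClass 1ℤ 0ℤ 0ℤ 0ℤ

    δ₀-odd : Odd δ₀
    δ₀-odd = oddClass-odd 1ℤ 0ℤ 0ℤ 0ℤ

    ζ^≢0 : ∀ n → ζ Lₖ.^ n ≢ L.0#
    ζ^≢0 n = Lf.^-≢0 n ζ≢0

  cl-ζ^ : ∀ n → cl (ζ Lₖ.^ n) ≡ n ℕ.mod 8
  cl-ζ^ n = cl-unique n (ζ^≢0 n) (begin
    ω Lₖ.^ n                  ≡⟨ cong (Lₖ._^ n) ω≡ζ^k ⟩
    (ζ Lₖ.^ k) Lₖ.^ n         ≡⟨ Lₖ.^-assocʳ ζ k n ⟩
    ζ Lₖ.^ (k ℕ.* n)          ≡⟨ cong (ζ Lₖ.^_) (ℕ.*-comm k n) ⟩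
    ζ Lₖ.^ (n ℕ.* k)          ≡⟨ Lₖ.^-assocʳ ζ n k ⟨
    (ζ Lₖ.^ n) Lₖ.^ k         ∎)

  abstract
    α β : ℤ
    α = ℤ.- charSum (onClass δ₀) (ζ Lₖ.^ 7)
    β = charSum (onClass δ₀) (ζ Lₖ.^ 6)

    q-1*α : q-1 ℤ.* α ≡ A 1F ℤ.+ A 1F
    q-1*α = begin
      q-1 ℤ.* (ℤ.- charSum (onClass δ₀) (ζ Lₖ.^ 7))     ≡⟨ ℤ.neg-distribʳ-* q-1 _ ⟨
      ℤ.- (q-1 ℤ.* charSum (onClass δ₀) (ζ Lₖ.^ 7))     ≡⟨ cong ℤ.-_ (charSum-functional δ₀-odd (ζ^≢0 7)) ⟩
      ℤ.- (parity (cl (ζ Lₖ.^ 7)) ℤ.* functional (λ l → δ₀ (cl (ζ Lₖ.^ 7) ⊞ l))) ≡⟨ cong (λ j → ℤ.- (parity j ℤ.* functional (λ l → δ₀ (j ⊞ l)))) (cl-ζ^ 7) ⟩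
      ℤ.- (ℤ.-1ℤ ℤ.* functional (λ l → δ₀ (7F ⊞ l)))   ≡⟨ cong (λ t → ℤ.- (ℤ.-1ℤ ℤ.* t)) (functional-odd {λ l → δ₀ (7F ⊞ l)} (odd-shift {δ₀} δ₀-odd 7F)) ⟩
      ℤ.- (ℤ.-1ℤ ℤ.* ((A 1F ℤ.+ A 1F) ℤ.* 1ℤ ℤ.+ (A 2F ℤ.+ A 2F) ℤ.* 0ℤ)) ≡⟨ ZS.solve 2 (λ a b → let open ZS in :- ((:- con 1ℤ) :* (a :* con 1ℤ :+ b :* con 0ℤ)) := a) refl (A 1F ℤ.+ A 1F) (A 2F ℤ.+ A 2F) ⟩
      A 1F ℤ.+ A 1F                                     ∎

    q-1*β : q-1 ℤ.* β ≡ A 2F ℤ.+ A 2F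
    q-1*β = begin
      q-1 ℤ.* charSum (onClass δ₀) (ζ Lₖ.^ 6)           ≡⟨ charSum-functional δ₀-odd (ζ^≢0 6) ⟩
      parity (cl (ζ Lₖ.^ 6)) ℤ.* functional (λ l → δ₀ (cl (ζ Lₖ.^ 6) ⊞ l)) ≡⟨ cong (λ j → parity j ℤ.* functional (λ l → δ₀ (j ⊞ l))) (cl-ζ^ 6) ⟩
      1ℤ ℤ.* functional (λ l → δ₀ (6F ⊞ l))             ≡⟨ cong (1ℤ ℤ.*_) (functional-odd {λ l → δ₀ (6F ⊞ l)} (odd-shift {δ₀} δ₀-odd 6F)) ⟩
      1ℤ ℤ.* ((A 1F ℤ.+ A 1F) ℤ.* 0ℤ ℤ.+ (A 2F ℤ.+ A 2F) ℤ.* 1ℤ) ≡⟨ ZS.solve 2 (λ a b → let open ZS in con 1ℤ :* (a :* con 0ℤ :+ b :* con 1ℤ) := b) refl (A 1F ℤ.+ A 1F) (A 2F ℤ.+ A 2F) ⟩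
      A 2F ℤ.+ A 2F                                     ∎

  charValue : (Fin 8 → ℤ) → Fin 8 → ℤ
  charValue φ j = parity j ℤ.* (α ℤ.* (φ (j ⊞ 1F) ℤ.- φ (j ⊞ 3F)) ℤ.+ β ℤ.* φ (j ⊞ 2F))

  charSum≡ : ∀ {φ} → Odd φ → ∀ {g} → g ≢ L.0# → charSum (onClass φ) g ≡ charValue φ (cl g)
  charSum≡ {φ} odd {g} g≢0 = q-1-cancel (begin
    q-1 ℤ.* charSum (onClass φ) g                     ≡⟨ charSum-functional odd g≢0 ⟩
    s ℤ.* functional (λ l → φ (j ⊞ l))                ≡⟨ cong (λ t → s ℤ.* t) (functional-odd {λ l → φ (j ⊞ l)} (odd-shift {φ} odd j)) ⟩
    s ℤ.* ((A 1F ℤ.+ A 1F) ℤ.* x ℤ.+ (A 2F ℤ.+ A 2F) ℤ.* y) ≡⟨ cong₂ (λ a b → s ℤ.* (a ℤ.* x ℤ.+ b ℤ.* y)) q-1*α q-1*β ⟨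
    s ℤ.* (q-1 ℤ.* α ℤ.* x ℤ.+ q-1 ℤ.* β ℤ.* y)       ≡⟨ ZS.solve 6 (λ s r a b x y → let open ZS in s :* (r :* a :* x :+ r :* b :* y) := r :* (s :* (a :* x :+ b :* y))) refl s q-1 α β x y ⟩
    q-1 ℤ.* charValue φ j                             ∎)
    where
    j = cl g
    s = parity j
    x = φ (j ⊞ 1F) ℤ.- φ (j ⊞ 3F)
    y = φ (j ⊞ 2F)

  correlation : L → L → ℤ
  correlation u v = ∑L (λ g → η (det u g) ℤ.* η (det v g))

  correlation-independent : ∀ {u v} → det u v ≢ 0# → correlation u v ≡ 0ℤ
  correlation-independent {u} {v} D≢0 = begin
    correlation u v
      ≡⟨ ∑L-combination u v D≢0 (λ g → η (det u g) ℤ.* η (det v g)) ⟩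
    ∑L (λ c → η (det u (combination u v D≢0 c)) ℤ.* η (det v (combination u v D≢0 c)))
      ≡⟨ ∑L≡∑K∑K (λ c → η (det u (combination u v D≢0 c)) ℤ.* η (det v (combination u v D≢0 c))) ⟩
    ∑K (λ x → ∑K (λ y → η (det u (combination u v D≢0 (x , y))) ℤ.* η (det v (combination u v D≢0 (x , y)))))
      ≡⟨ Σℤ.∑-cong elements (λ x → trans (Σℤ.∑-cong elements (λ y → trans (cong₂ ℤ._*_ (η-u x y) (η-v x y))
           (ZS.solve 4 (λ x y d d′ → let open ZS in (y :* d) :* (x :* d′) := (x :* (d :* d′)) :* y) refl (η x) (η y) _ _)))
           (trans (sym (Σℤ.∑-*ˡ elements (η x ℤ.* (η (- det u v) ℤ.* η (- det u v))) η)) (trans (cong (λ t → (η x ℤ.* (η (- det u v) ℤ.* η (- det u v))) ℤ.* t) ∑-η) (ℤ.*-zeroʳ (η x ℤ.* (η (- det u v) ℤ.* η (- det u v))))))) ⟩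
    ∑K (λ _ → 0ℤ)
      ≡⟨ Σℤ.∑-0 elements ⟩
    0ℤ ∎
    where
    η-u : ∀ x y → η (det u (combination u v D≢0 (x , y))) ≡ η y ℤ.* η (- det u v)
    η-u x y = trans (cong η (solve 6 (λ x y a b c d → a :* (x :* b :- y :* d) :- b :* (x :* a :- y :* c) := y :* (:- (a :* d :- b :* c))) refl x y (proj₁ u) (proj₂ u) (proj₁ v) (proj₂ v))) (η-* y _)
      where open KS
    η-v : ∀ x y → η (det v (combination u v D≢0 (x , y))) ≡ η x ℤ.* η (- det u v)
    η-v x y = trans (cong η (solve 6 (λ x y a b c d → c :* (x :* b :- y :* d) :- d :* (x :* a :- y :* c) := x :* (:- (a :* d :- b :* c))) refl x y (proj₁ u) (proj₂ u) (proj₁ v) (proj₂ v))) (η-* x _)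
      where open KS

  ∑K-η² : ∑K (λ x → η x ℤ.* η x) ≡ q-1
  ∑K-η² = trans (Σℤ.∑-cong elements (λ x → go x (x ≟ 0#))) ∑K-nonzero
    where
    go : ∀ x → Dec (x ≡ 0#) → η x ℤ.* η x ≡ nonzero x
    go x (yes refl) = trans (cong (λ i → i ℤ.* i) η-0) (sym nonzero-0)
    go x (no x≢0)   = trans (η-square x≢0) (sym (nonzero-≢0 x≢0))

  correlation-self : ∀ ℓ → correlation (point ℓ) (point ℓ) ≡ ℤ.+ q ℤ.* q-1
  correlation-self nothing = begin
    correlation (0# , 1#) (0# , 1#)                          ≡⟨ ∑L≡∑K∑K (λ { (c , d) → ev c d ℤ.* ev c d }) ⟩
    ∑K (λ c → ∑K (λ d → ev c d ℤ.* ev c d))                    ≡⟨ Σℤ.∑-cong elements (λ c → trans (Σℤ.∑-cong elements (λ d → cong (λ t → t ℤ.* t) (e≡ c d))) (∑K-constant (η (- c) ℤ.* η (- c)))) ⟩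
    ∑K (λ c → ℤ.+ q ℤ.* (η (- c) ℤ.* η (- c)))               ≡⟨ Σℤ.∑-*ˡ elements (ℤ.+ q) (λ c → η (- c) ℤ.* η (- c)) ⟨
    ℤ.+ q ℤ.* ∑K (λ c → η (- c) ℤ.* η (- c))                 ≡⟨ cong (λ t → ℤ.+ q ℤ.* t) (Σℤ.∑-bijection 𝕂 𝕂 -_ -_ neg-involutive neg-involutive (λ c → η c ℤ.* η c)) ⟨
    ℤ.+ q ℤ.* ∑K (λ c → η c ℤ.* η c)                         ≡⟨ cong (λ t → ℤ.+ q ℤ.* t) ∑K-η² ⟩
    ℤ.+ q ℤ.* q-1                                            ∎
    where
    ev : K → K → ℤ
    ev c d = η (det (0# , 1#) (c , d))
    e≡ : ∀ c d → ev c d ≡ η (- c)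
    e≡ c d = cong η (solve 2 (λ c d → con 0ℤ :* d :- con 1ℤ :* c := :- c) refl c d)
      where open KS
  correlation-self (just x) = begin
    correlation (1# , x) (1# , x)                            ≡⟨ ∑L≡∑K∑K (λ { (c , d) → ev c d ℤ.* ev c d }) ⟩
    ∑K (λ c → ∑K (λ d → ev c d ℤ.* ev c d))                    ≡⟨ Σℤ.∑-cong elements (λ c → trans (∑-affine (x * c) 1≢0 (λ d → ev c d ℤ.* ev c d)) (trans (Σℤ.∑-cong elements (λ d → cong (λ t → t ℤ.* t) (e≡ c d))) ∑K-η²)) ⟩
    ∑K (λ c → q-1)                                           ≡⟨ ∑K-constant q-1 ⟩
    ℤ.+ q ℤ.* q-1                                            ∎
    where
    1≢0 : 1# ≢ 0#
    1≢0 = 0≢1 ∘ sym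
    ev : K → K → ℤ
    ev c d = η (det (1# , x) (c , d))
    e≡ : ∀ c d → ev c (x * c + 1# * d) ≡ η d
    e≡ c d = cong η (solve 3 (λ x c d → con 1ℤ :* (x :* c :+ con 1ℤ :* d) :- x :* c := d) refl x c d)
      where open KS

  ∑P-charSum² : ∀ s → ∑P (λ ℓ → charSum s (point ℓ) ℤ.* charSum s (point ℓ)) ≡ ℤ.+ q ℤ.* ∑P (λ ℓ → s (point ℓ) ℤ.* s (point ℓ))
  ∑P-charSum² s = q-1-cancel (begin
    q-1 ℤ.* ∑P (λ ℓ → charSum s (point ℓ) ℤ.* charSum s (point ℓ))
      ≡⟨ ∑L-homogeneous (λ g → charSum s g ℤ.* charSum s g) (cong (λ t → t ℤ.* t) (charSum-0 s))
           (λ {x} {g} x≢0 → trans (cong₂ ℤ._*_ (charSum-• s x g) (charSum-• s x g)) (square-cancel (charSum s g) (charSum s g) x≢0)) ⟨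
    ∑L (λ g → charSum s g ℤ.* charSum s g)
      ≡⟨ Σℤ.∑-cong 𝕃.elements (λ g → Σℤ.∑-*-∑ ℙ.elements ℙ.elements (λ ℓ → s (point ℓ) ℤ.* η (det (point ℓ) g)) (λ ℓ → s (point ℓ) ℤ.* η (det (point ℓ) g))) ⟩
    ∑L (λ g → ∑P (λ ℓ → ∑P (λ ℓ′ → term ℓ ℓ′ g)))
      ≡⟨ Σℤ.∑-swap 𝕃.elements ℙ.elements (λ g ℓ → ∑P (λ ℓ′ → term ℓ ℓ′ g)) ⟩
    ∑P (λ ℓ → ∑L (λ g → ∑P (λ ℓ′ → term ℓ ℓ′ g)))
      ≡⟨ Σℤ.∑-cong ℙ.elements (λ ℓ → Σℤ.∑-swap 𝕃.elements ℙ.elements (λ g ℓ′ → term ℓ ℓ′ g)) ⟩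
    ∑P (λ ℓ → ∑P (λ ℓ′ → ∑L (term ℓ ℓ′)))
      ≡⟨ Σℤ.∑-cong ℙ.elements (λ ℓ → trans (Σℤ.∑-cong ℙ.elements (λ ℓ′ → inner ℓ ℓ′ (ℓ′ ℙ.≟ ℓ))) (Σℤ.∑-⟦≟⟧ ℙ ℓ (λ ℓ′ → s (point ℓ) ℤ.* s (point ℓ′) ℤ.* (ℤ.+ q ℤ.* q-1)))) ⟩
    ∑P (λ ℓ → s (point ℓ) ℤ.* s (point ℓ) ℤ.* (ℤ.+ q ℤ.* q-1))
      ≡⟨ Σℤ.∑-*ʳ ℙ.elements (ℤ.+ q ℤ.* q-1) (λ ℓ → s (point ℓ) ℤ.* s (point ℓ)) ⟨
    T ℤ.* (ℤ.+ q ℤ.* q-1)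
      ≡⟨ ZS.solve 3 (λ t q r → let open ZS in t :* (q :* r) := r :* (q :* t)) refl T (ℤ.+ q) q-1 ⟩
    q-1 ℤ.* (ℤ.+ q ℤ.* T) ∎)
    where
    T = ∑P (λ ℓ → s (point ℓ) ℤ.* s (point ℓ))
    term : Line → Line → L → ℤ
    term ℓ ℓ′ g = (s (point ℓ) ℤ.* η (det (point ℓ) g)) ℤ.* (s (point ℓ′) ℤ.* η (det (point ℓ′) g))
    pull : ∀ ℓ ℓ′ → ∑L (term ℓ ℓ′) ≡ s (point ℓ) ℤ.* s (point ℓ′) ℤ.* correlation (point ℓ) (point ℓ′)
    pull ℓ ℓ′ = trans (Σℤ.∑-cong 𝕃.elements (λ g → ZS.solve 4 (λ a b c d → let open ZS in (a :* b) :* (c :* d) := (a :* c) :* (b :* d)) refl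
      (s (point ℓ)) (η (det (point ℓ) g)) (s (point ℓ′)) (η (det (point ℓ′) g)))) (sym (Σℤ.∑-*ˡ 𝕃.elements (s (point ℓ) ℤ.* s (point ℓ′)) (λ g → η (det (point ℓ) g) ℤ.* η (det (point ℓ′) g))))
    inner : ∀ ℓ ℓ′ → Dec (ℓ′ ≡ ℓ) → ∑L (term ℓ ℓ′) ≡ Σℤ.⟦ ℓ′ ℙ.≟ ℓ ⟧ ℤ.* (s (point ℓ) ℤ.* s (point ℓ′) ℤ.* (ℤ.+ q ℤ.* q-1))
    inner ℓ ℓ′ (yes refl) = trans (pull ℓ ℓ) (trans (cong (λ t → s (point ℓ) ℤ.* s (point ℓ) ℤ.* t) (correlation-self ℓ))
      (sym (trans (cong (ℤ._* (s (point ℓ) ℤ.* s (point ℓ) ℤ.* (ℤ.+ q ℤ.* q-1))) (ℙ.if-≟-refl ℓ)) (ℤ.*-identityˡ _))))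
    inner ℓ ℓ′ (no ℓ′≢ℓ) = trans (pull ℓ ℓ′) (trans (cong (λ t → s (point ℓ) ℤ.* s (point ℓ′) ℤ.* t) (correlation-independent (det-point (ℓ′≢ℓ ∘ sym))))
      (trans (ℤ.*-zeroʳ (s (point ℓ) ℤ.* s (point ℓ′))) (sym (trans (cong (ℤ._* (s (point ℓ) ℤ.* s (point ℓ′) ℤ.* (ℤ.+ q ℤ.* q-1))) (ℙ.if-≟-≢ ℓ′≢ℓ)) (ℤ.*-zeroˡ (s (point ℓ) ℤ.* s (point ℓ′) ℤ.* (ℤ.+ q ℤ.* q-1)))))))

  q≡β²+2α² : ℤ.+ q ≡ β ℤ.* β ℤ.+ ℤ.+ 2 ℤ.* (α ℤ.* α)
  q≡β²+2α² = ℤ.*-cancelˡ-≡ (ℤ.+ m) _ _ (begin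
    ℤ.+ m ℤ.* ℤ.+ q
      ≡⟨ ZS.solve 2 (λ m q → let open ZS in m :* q := q :* (m :* (con 1ℤ))) refl (ℤ.+ m) (ℤ.+ q) ⟩
    ℤ.+ q ℤ.* (ℤ.+ m ℤ.* 1ℤ)
      ≡⟨ cong (λ t → ℤ.+ q ℤ.* t) (∑P-class-average (λ j → δ₀ j ℤ.* δ₀ j) (∀8 refl refl refl refl refl refl refl refl)) ⟨
    ℤ.+ q ℤ.* ∑P (λ ℓ → δ₀ (cl (point ℓ)) ℤ.* δ₀ (cl (point ℓ)))
      ≡⟨ cong (λ t → ℤ.+ q ℤ.* t) (Σℤ.∑-cong ℙ.elements (λ ℓ → cong (λ t → t ℤ.* t) (onClass-≢0 δ₀ (point≢0 ℓ)))) ⟨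
    ℤ.+ q ℤ.* ∑P (λ ℓ → onClass δ₀ (point ℓ) ℤ.* onClass δ₀ (point ℓ))
      ≡⟨ ∑P-charSum² (onClass δ₀) ⟨
    ∑P (λ ℓ → charSum (onClass δ₀) (point ℓ) ℤ.* charSum (onClass δ₀) (point ℓ))
      ≡⟨ Σℤ.∑-cong ℙ.elements (λ ℓ → cong (λ t → t ℤ.* t) (charSum≡ δ₀-odd (point≢0 ℓ))) ⟩
    ∑P (λ ℓ → V (cl (point ℓ)) ℤ.* V (cl (point ℓ)))
      ≡⟨ ∑P-class-average (λ j → V j ℤ.* V j) V²-even ⟩
    ℤ.+ m ℤ.* (V 0F ℤ.* V 0F ℤ.+ V 1F ℤ.* V 1F ℤ.+ V 2F ℤ.* V 2F ℤ.+ V 3F ℤ.* V 3F)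
      ≡⟨ cong (λ t → ℤ.+ m ℤ.* t) (solve 2 (λ a b → let v0 = con 1ℤ :* (a :* con 0ℤ :+ b :* con 0ℤ)
                                                        v1 = con ℤ.-1ℤ :* (a :* con 1ℤ :+ b :* con 0ℤ)
                                                        v2 = con 1ℤ :* (a :* con 0ℤ :+ b :* con ℤ.-1ℤ)
                                                        v3 = con ℤ.-1ℤ :* (a :* con ℤ.-1ℤ :+ b :* con 0ℤ) in
           v0 :* v0 :+ v1 :* v1 :+ v2 :* v2 :+ v3 :* v3 := b :* b :+ con (ℤ.+ 2) :* (a :* a)) refl α β) ⟩
    ℤ.+ m ℤ.* (β ℤ.* β ℤ.+ ℤ.+ 2 ℤ.* (α ℤ.* α)) ∎)
    where
    open ZS
    V : Fin 8 → ℤ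
    V = charValue δ₀
    V²-even : Even (λ j → V j ℤ.* V j)
    V²-even j = trans (cong (λ t → t ℤ.* t) (V-odd j)) (solve 1 (λ v → :- v :* :- v := v :* v) refl (V j))
      where
      V-odd : Odd V
      V-odd = ∀8 (flip 0F refl refl refl refl) (flip 1F refl refl refl refl) (flip 2F refl refl refl refl) (flip 3F refl refl refl refl)
                 (flip 4F refl refl refl refl) (flip 5F refl refl refl refl) (flip 6F refl refl refl refl) (flip 7F refl refl refl refl)
        where
        flip : ∀ j → parity (4F ⊞ j) ≡ parity j → δ₀ ((4F ⊞ j) ⊞ 1F) ≡ ℤ.- δ₀ (j ⊞ 1F) → δ₀ ((4F ⊞ j) ⊞ 3F) ≡ ℤ.- δ₀ (j ⊞ 3F) → δ₀ ((4F ⊞ j) ⊞ 2F) ≡ ℤ.- δ₀ (j ⊞ 2F) → V (4F ⊞ j) ≡ ℤ.- V j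
        flip j p₁ e₁ e₃ e₂ = trans (cong₂ ℤ._*_ p₁ (cong₂ ℤ._+_ (cong (λ t → α ℤ.* t) (cong₂ ℤ._-_ e₁ e₃)) (cong (λ t → β ℤ.* t) e₂)))
          (solve 6 (λ s a b x y z → s :* (a :* (:- x :- :- y) :+ b :* :- z) := :- (s :* (a :* (x :- y) :+ b :* z))) refl (parity j) α β (δ₀ (j ⊞ 1F)) (δ₀ (j ⊞ 3F)) (δ₀ (j ⊞ 2F)))

powers-mod-8 : ∀ p n → (p ℕ.^ n) ℕ.% 8 ≡ 3 → p ℕ.% 8 ≡ 3
powers-mod-8 p n eq = trans (sym (Fin.toℕ-fromℕ< r<8)) (trans (cong toℕ (closed-3 r (subst (Orbit r) x≡3 (orbit n)))) refl)
  where
  r<8 : p ℕ.% 8 ℕ.< 8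
  r<8 = ℕ.m%n<n p 8
  r : Fin 8
  r = Fin.fromℕ< r<8
  residue : ℕ → Fin 8
  residue m = m ℕ.mod 8
  times : Fin 8 → Fin 8 → Fin 8
  times a b = (toℕ a ℕ.* toℕ b) ℕ.mod 8
  Orbit : Fin 8 → Fin 8 → Set
  Orbit r x = x ≡ 1F ⊎ x ≡ r ⊎ x ≡ times r r ⊎ x ≡ times r (times r r)
  orbit? : ∀ r x → Dec (Orbit r x)
  orbit? r x = (x Fin.≟ 1F) ⊎-dec ((x Fin.≟ r) ⊎-dec ((x Fin.≟ times r r) ⊎-dec (x Fin.≟ times r (times r r))))
  step : ∀ r x → Orbit r x → Orbit r (times r x)
  step = toWitness {a? = Fin.all? λ r → Fin.all? λ x → orbit? r x →-dec orbit? r (times r x)} tt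
  closed-3 : ∀ r → Orbit r 3F → r ≡ 3F
  closed-3 = toWitness {a? = Fin.all? λ r → orbit? r 3F →-dec (r Fin.≟ 3F)} tt
  residue-* : ∀ m → residue (p ℕ.* m) ≡ times r (residue m)
  residue-* m = Fin.toℕ-injective (begin
    toℕ (residue (p ℕ.* m))                      ≡⟨ Fin.toℕ-fromℕ< (ℕ.m%n<n (p ℕ.* m) 8) ⟩
    (p ℕ.* m) ℕ.% 8                              ≡⟨ ℕ.%-distribˡ-* p m 8 ⟩
    ((p ℕ.% 8) ℕ.* (m ℕ.% 8)) ℕ.% 8              ≡⟨ cong₂ (λ a b → (a ℕ.* b) ℕ.% 8) (Fin.toℕ-fromℕ< r<8) (Fin.toℕ-fromℕ< (ℕ.m%n<n m 8)) ⟨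
    (toℕ r ℕ.* toℕ (residue m)) ℕ.% 8            ≡⟨ Fin.toℕ-fromℕ< (ℕ.m%n<n (toℕ r ℕ.* toℕ (residue m)) 8) ⟨
    toℕ (times r (residue m))                    ∎)
    where open ≡.≡-Reasoning
  orbit : ∀ n → Orbit r (residue (p ℕ.^ n))
  orbit zero    = inj₁ refl
  orbit (suc n) = subst (Orbit r) (sym (residue-* (p ℕ.^ n))) (step r _ (orbit n))
  x≡3 : residue (p ℕ.^ n) ≡ 3F
  x≡3 = Fin.toℕ-injective (trans (Fin.toℕ-fromℕ< (ℕ.m%n<n (p ℕ.^ n) 8)) eq)

prime-power-∣ : ∀ {p} → Prime p → ∀ n {x y} → ¬ p ℕ.∣ x → p ℕ.^ n ℕ.∣ x ℕ.* y → p ℕ.^ n ℕ.∣ y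
prime-power-∣ p-prime zero    p∤x _ = ℕ.1∣ _
prime-power-∣ {p} p-prime (suc n) {x} {y} p∤x pⁿ∣xy with euclidsLemma x y p-prime (ℕ.∣-trans (ℕ.m∣m*n (p ℕ.^ n)) pⁿ∣xy)
... | inj₁ p∣x = contradiction p∣x p∤x
... | inj₂ (ℕ.divides y′ refl) = subst (p ℕ.* p ℕ.^ n ℕ.∣_) (ℕ.*-comm p y′) (ℕ.*-monoʳ-∣ p (prime-power-∣ p-prime n p∤x
  (ℕ.*-cancelˡ-∣ p {{prime⇒nonZero p-prime}} (subst (p ℕ.* p ℕ.^ n ℕ.∣_) (trans (sym (ℕ.*-assoc x y′ p)) (ℕ.*-comm (x ℕ.* y′) p)) pⁿ∣xy))))

-- Uniqueness of the primitive representation of a prime power by x² + 2y².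
module PrimitiveRepresentation (p e : ℕ) (p-prime : Prime p) (p∤2 : ¬ p ℕ.∣ 2) (1≤e : 1 ℕ.≤ e) where
  open RingKit.Solver ℤ.+-*-commutativeRing
  open ≡.≡-Reasoning

  private
    q : ℤ
    q = ℤ.+ (p ℕ.^ e)

    _∣p : ℤ → Set
    i ∣p = ℤ.+ p ℤ.∣ i

    q∣p : q ∣p
    q∣p = ℤ.∣ᵤ⇒∣ (go e 1≤e)
      where
      go : ∀ e → 1 ℕ.≤ e → p ℕ.∣ p ℕ.^ e
      go (suc e) _ = ℕ.m∣m*n (p ℕ.^ e)

    euclid : ∀ i j → (i ℤ.* j) ∣p → i ∣p ⊎ j ∣p
    euclid i j p∣ij = [ inj₁ ∘ ℤ.∣ᵤ⇒∣ , inj₂ ∘ ℤ.∣ᵤ⇒∣ ]′ (euclidsLemma ℤ.∣ i ∣ ℤ.∣ j ∣ p-prime (subst (p ℕ.∣_) (ℤ.abs-* i j) (ℤ.∣⇒∣ᵤ p∣ij)))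

    euclid² : ∀ i → (i ℤ.* i) ∣p → i ∣p
    euclid² i p∣ii = [ id , id ]′ (euclid i i p∣ii)

    ¬2∣p : ¬ (ℤ.+ 2) ∣p
    ¬2∣p = p∤2 ∘ ℤ.∣⇒∣ᵤ

    euclid-2 : ∀ i → (ℤ.+ 2 ℤ.* i) ∣p → i ∣p
    euclid-2 i p∣2i = [ (λ p∣2 → contradiction p∣2 ¬2∣p) , id ]′ (euclid (ℤ.+ 2) i p∣2i)

    square-abs : ∀ i → i ℤ.* i ≡ ℤ.+ (ℤ.∣ i ∣ ℕ.* ℤ.∣ i ∣)
    square-abs (ℤ.+ n)  = sym (ℤ.pos-* n n)
    square-abs -[1+ n ] = refl

    small : ∀ {z x} → z ℤ.* z ℤ.+ ℤ.+ 2 ℤ.* (x ℤ.* x) ≡ q ℤ.* q → q ℤ.∣ x → x ≡ 0ℤ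
    small {z} {x} eq q∣x = go ℤ.∣ x ∣ refl (ℤ.∣⇒∣ᵤ q∣x)
      where
      Q = p ℕ.^ e
      eqℕ : ℤ.∣ z ∣ ℕ.* ℤ.∣ z ∣ ℕ.+ 2 ℕ.* (ℤ.∣ x ∣ ℕ.* ℤ.∣ x ∣) ≡ Q ℕ.* Q
      eqℕ = ℤ.+-injective (begin
        ℤ.+ (ℤ.∣ z ∣ ℕ.* ℤ.∣ z ∣) ℤ.+ ℤ.+ (2 ℕ.* (ℤ.∣ x ∣ ℕ.* ℤ.∣ x ∣))   ≡⟨ cong₂ ℤ._+_ (sym (square-abs z)) (trans (ℤ.pos-* 2 (ℤ.∣ x ∣ ℕ.* ℤ.∣ x ∣)) (cong (ℤ.+ 2 ℤ.*_) (sym (square-abs x)))) ⟩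
        z ℤ.* z ℤ.+ ℤ.+ 2 ℤ.* (x ℤ.* x)                                   ≡⟨ eq ⟩
        q ℤ.* q                                                           ≡⟨ ℤ.pos-* Q Q ⟨
        ℤ.+ (Q ℕ.* Q)                                                     ∎)
      instance
        Q≢0 : ℕ.NonZero Q
        Q≢0 = ℕ.m^n≢0 p e {{prime⇒nonZero p-prime}}
      go : ∀ n → ℤ.∣ x ∣ ≡ n → Q ℕ.∣ n → x ≡ 0ℤ
      go zero    ∣x∣≡0 _    = ℤ.∣i∣≡0⇒i≡0 ∣x∣≡0
      go (suc n) ∣x∣≡ Q∣x = contradiction (ℕ.≤-reflexive eqℕ) (ℕ.<⇒≱ (ℕ.<-≤-trans Q²<2Q² (ℕ.≤-trans (ℕ.*-monoʳ-≤ 2 (ℕ.*-mono-≤ Q≤x Q≤x)) (ℕ.m≤n+m _ (ℤ.∣ z ∣ ℕ.* ℤ.∣ z ∣)))))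
        where
        Q≤x : Q ℕ.≤ ℤ.∣ x ∣
        Q≤x = subst (Q ℕ.≤_) (sym ∣x∣≡) (ℕ.∣⇒≤ Q∣x)
        Q²<2Q² : Q ℕ.* Q ℕ.< 2 ℕ.* (Q ℕ.* Q)
        Q²<2Q² = ℕ.<-≤-trans (ℕ.m<m+n (Q ℕ.* Q) (ℕ.>-nonZero⁻¹ (Q ℕ.* Q) {{ℕ.m*n≢0 Q Q}})) (ℕ.≤-reflexive (cong (λ t → Q ℕ.* Q ℕ.+ t) (sym (ℕ.+-identityʳ (Q ℕ.* Q)))))

    squares-equal : ∀ {a b} → a ℤ.* a ≡ b ℤ.* b → a ≡ b ⊎ a ≡ ℤ.- b
    squares-equal {a} {b} eq = [ (λ a-b≡0 → inj₁ (ℤ.i-j≡0⇒i≡j a b a-b≡0)) , (λ a+b≡0 → inj₂ (ℤ.i-j≡0⇒i≡j a (ℤ.- b) (trans (solve 2 (λ a b → a :- :- b := a :+ b) refl a b) a+b≡0))) ]′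
      (ℤ.i*j≡0⇒i≡0∨j≡0 (a ℤ.- b) (trans (solve 2 (λ a b → (a :- b) :* (a :+ b) := a :* a :- b :* b) refl a b) (ℤ.i≡j⇒i-j≡0 eq)))

  module _ {a b A B : ℤ} (rep : q ≡ a ℤ.* a ℤ.+ ℤ.+ 2 ℤ.* (b ℤ.* b)) (rep′ : q ≡ A ℤ.* A ℤ.+ ℤ.+ 2 ℤ.* (B ℤ.* B))
           (coprime : ¬ ((ℤ.+ p ℤ.∣ a) × (ℤ.+ p ℤ.∣ b))) (B-A≡2 : B ℤ.- A ≡ ℤ.+ 2) where

    private
      X Y : ℤ
      X = a ℤ.* B ℤ.- b ℤ.* A
      Y = a ℤ.* B ℤ.+ b ℤ.* A

      ¬both : ¬ (A ∣p × B ∣p)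
      ¬both (p∣A , p∣B) = ¬2∣p (subst _∣p B-A≡2 (ℤ.∣m∣n⇒∣m-n p∣B p∣A))

      A∤p : ¬ A ∣p
      A∤p p∣A = ¬both (p∣A , euclid² B (euclid-2 (B ℤ.* B) (subst _∣p (trans (cong (ℤ._- A ℤ.* A) rep′) (solve 2 (λ A B → (A :* A :+ con (ℤ.+ 2) :* (B :* B)) :- A :* A := con (ℤ.+ 2) :* (B :* B)) refl A B))
        (ℤ.∣m∣n⇒∣m-n q∣p (ℤ.∣m⇒∣m*n A p∣A)))))

      B∤p : ¬ B ∣p
      B∤p p∣B = ¬both (euclid² A (subst _∣p (trans (cong (ℤ._- ℤ.+ 2 ℤ.* (B ℤ.* B)) rep′) (solve 2 (λ A B → (A :* A :+ con (ℤ.+ 2) :* (B :* B)) :- con (ℤ.+ 2) :* (B :* B) := A :* A) refl A B))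
        (ℤ.∣m∣n⇒∣m-n q∣p (ℤ.∣n⇒∣m*n (ℤ.+ 2) (ℤ.∣m⇒∣m*n B p∣B)))) , p∣B)

      ¬XY : ¬ (X ∣p × Y ∣p)
      ¬XY (p∣X , p∣Y) = coprime
        ( [ id , (λ p∣B → contradiction p∣B B∤p) ]′ (euclid a B (euclid-2 (a ℤ.* B) (subst _∣p (solve 4 (λ a b A B → (a :* B :- b :* A) :+ (a :* B :+ b :* A) := con (ℤ.+ 2) :* (a :* B)) refl a b A B) (ℤ.∣m∣n⇒∣m+n p∣X p∣Y))))
        , [ id , (λ p∣A → contradiction p∣A A∤p) ]′ (euclid b A (euclid-2 (b ℤ.* A) (subst _∣p (solve 4 (λ a b A B → (a :* B :+ b :* A) :- (a :* B :- b :* A) := con (ℤ.+ 2) :* (b :* A)) refl a b A B) (ℤ.∣m∣n⇒∣m-n p∣Y p∣X)))))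

      XY : X ℤ.* Y ≡ q ℤ.* (B ℤ.* B ℤ.- b ℤ.* b)
      XY = begin
        X ℤ.* Y                                                ≡⟨ solve 4 (λ a b A B → (a :* B :- b :* A) :* (a :* B :+ b :* A) := (a :* a :+ con (ℤ.+ 2) :* (b :* b)) :* (B :* B) :- (A :* A :+ con (ℤ.+ 2) :* (B :* B)) :* (b :* b)) refl a b A B ⟩
        (a ℤ.* a ℤ.+ ℤ.+ 2 ℤ.* (b ℤ.* b)) ℤ.* (B ℤ.* B) ℤ.- (A ℤ.* A ℤ.+ ℤ.+ 2 ℤ.* (B ℤ.* B)) ℤ.* (b ℤ.* b) ≡⟨ cong₂ (λ s t → s ℤ.* (B ℤ.* B) ℤ.- t ℤ.* (b ℤ.* b)) rep rep′ ⟨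
        q ℤ.* (B ℤ.* B) ℤ.- q ℤ.* (b ℤ.* b)                    ≡⟨ solve 3 (λ q x y → q :* x :- q :* y := q :* (x :- y)) refl q (B ℤ.* B) (b ℤ.* b) ⟩
        q ℤ.* (B ℤ.* B ℤ.- b ℤ.* b)                            ∎

      q∣XY : p ℕ.^ e ℕ.∣ ℤ.∣ X ∣ ℕ.* ℤ.∣ Y ∣
      q∣XY = subst (p ℕ.^ e ℕ.∣_) (ℤ.abs-* X Y) (ℤ.∣⇒∣ᵤ {q} {X ℤ.* Y} (ℤ.divides (B ℤ.* B ℤ.- b ℤ.* b) (trans XY (ℤ.*-comm q _))))

      q² : ∀ s t → (a ℤ.* a ℤ.+ ℤ.+ 2 ℤ.* (b ℤ.* b)) ℤ.* (A ℤ.* A ℤ.+ ℤ.+ 2 ℤ.* (B ℤ.* B)) ≡ s ℤ.* s ℤ.+ ℤ.+ 2 ℤ.* (t ℤ.* t) → s ℤ.* s ℤ.+ ℤ.+ 2 ℤ.* (t ℤ.* t) ≡ q ℤ.* q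
      q² s t eq = trans (sym eq) (sym (cong₂ ℤ._*_ rep rep′))

      XY≡0 : X ℤ.* Y ≡ 0ℤ
      XY≡0 = go ((ℤ.+ p) ℤ.∣? X)
        where
        go : Dec (X ∣p) → X ℤ.* Y ≡ 0ℤ
        go (no p∤X)  = trans (cong (X ℤ.*_) (small {a ℤ.* A ℤ.- ℤ.+ 2 ℤ.* (b ℤ.* B)} {Y}
          (q² (a ℤ.* A ℤ.- ℤ.+ 2 ℤ.* (b ℤ.* B)) Y (solve 4 (λ a b A B → (a :* a :+ con (ℤ.+ 2) :* (b :* b)) :* (A :* A :+ con (ℤ.+ 2) :* (B :* B)) := (a :* A :- con (ℤ.+ 2) :* (b :* B)) :* (a :* A :- con (ℤ.+ 2) :* (b :* B)) :+ con (ℤ.+ 2) :* ((a :* B :+ b :* A) :* (a :* B :+ b :* A))) refl a b A B))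
          (ℤ.∣ᵤ⇒∣ (prime-power-∣ p-prime e (p∤X ∘ ℤ.∣ᵤ⇒∣) q∣XY)))) (ℤ.*-zeroʳ X)
        go (yes p∣X) = trans (cong (ℤ._* Y) (small {a ℤ.* A ℤ.+ ℤ.+ 2 ℤ.* (b ℤ.* B)} {X}
          (q² (a ℤ.* A ℤ.+ ℤ.+ 2 ℤ.* (b ℤ.* B)) X (solve 4 (λ a b A B → (a :* a :+ con (ℤ.+ 2) :* (b :* b)) :* (A :* A :+ con (ℤ.+ 2) :* (B :* B)) := (a :* A :+ con (ℤ.+ 2) :* (b :* B)) :* (a :* A :+ con (ℤ.+ 2) :* (b :* B)) :+ con (ℤ.+ 2) :* ((a :* B :- b :* A) :* (a :* B :- b :* A))) refl a b A B))
          (ℤ.∣ᵤ⇒∣ (prime-power-∣ p-prime e (λ p∣Y → ¬XY (p∣X , ℤ.∣ᵤ⇒∣ p∣Y)) (subst (p ℕ.^ e ℕ.∣_) (ℕ.*-comm ℤ.∣ X ∣ ℤ.∣ Y ∣) q∣XY))))) (ℤ.*-zeroˡ Y)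

      b² : b ℤ.* b ≡ B ℤ.* B
      b² = [ (λ q≡0 → contradiction (ℤ.+-injective q≡0) (ℕ.≢-nonZero⁻¹ (p ℕ.^ e) {{ℕ.m^n≢0 p e {{prime⇒nonZero p-prime}}}})) , (λ d≡0 → sym (ℤ.i-j≡0⇒i≡j _ _ d≡0)) ]′
        (ℤ.i*j≡0⇒i≡0∨j≡0 q (trans (sym XY) XY≡0))

      a² : a ℤ.* a ≡ A ℤ.* A
      a² = begin
        a ℤ.* a                                                    ≡⟨ solve 2 (λ a b → a :* a := (a :* a :+ con (ℤ.+ 2) :* (b :* b)) :- con (ℤ.+ 2) :* (b :* b)) refl a b ⟩
        (a ℤ.* a ℤ.+ ℤ.+ 2 ℤ.* (b ℤ.* b)) ℤ.- ℤ.+ 2 ℤ.* (b ℤ.* b)  ≡⟨ cong₂ (λ s t → s ℤ.- ℤ.+ 2 ℤ.* t) (trans (sym rep) rep′) b² ⟩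
        (A ℤ.* A ℤ.+ ℤ.+ 2 ℤ.* (B ℤ.* B)) ℤ.- ℤ.+ 2 ℤ.* (B ℤ.* B)  ≡⟨ solve 2 (λ a b → (a :* a :+ con (ℤ.+ 2) :* (b :* b)) :- con (ℤ.+ 2) :* (b :* b) := a :* a) refl A B ⟩
        A ℤ.* A                                                    ∎

      four : (B ℤ.- A) ℤ.* (B ℤ.- A) ≡ ℤ.+ 4
      four = cong (λ t → t ℤ.* t) B-A≡2

    difference-or-sum : (b ℤ.- a) ℤ.* (b ℤ.- a) ≡ ℤ.+ 4 ⊎ (b ℤ.+ a) ℤ.* (b ℤ.+ a) ≡ ℤ.+ 4
    difference-or-sum = go (squares-equal a²) (squares-equal b²)
      where
      go : a ≡ A ⊎ a ≡ ℤ.- A → b ≡ B ⊎ b ≡ ℤ.- B → _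
      go (inj₁ refl) (inj₁ refl) = inj₁ four
      go (inj₁ refl) (inj₂ refl) = inj₂ (trans (solve 2 (λ A B → (:- B :+ A) :* (:- B :+ A) := (B :- A) :* (B :- A)) refl A B) four)
      go (inj₂ refl) (inj₁ refl) = inj₂ four
      go (inj₂ refl) (inj₂ refl) = inj₁ (trans (solve 2 (λ A B → (:- B :- :- A) :* (:- B :- :- A) := (B :- A) :* (B :- A)) refl A B) four)

module Primitivity (𝕊 : Setting) where
  open Setting 𝕊
  open CharacterSums 𝕊
  open Field F using (_⁻¹; 0≢1; *-inverse)
  open CommutativeRing (Field.commutativeRing F) hiding (refl; sym; trans; zero)
  open RingKit (Field.commutativeRing F)
  open FieldKit F 𝕂
  open Enumeration 𝕂
  open ≡.≡-Reasoning
  open Characteristic (Field.commutativeRing F) p p-prime p≡0 using (∣⇒≈0; lucas)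
  private
    module KS = Solver
    module ZS = ℤSolver
    module LS = Lₖ.Solver
    module NS = ℕ.+-*-Solver
    module ΣL = RingSums (Field.commutativeRing L-field)

  p%8≡3 : p ℕ.% 8 ≡ 3
  p%8≡3 = powers-mod-8 p e (trans (cong (ℕ._% 8) (sym q≡p^e)) (trans
    (cong (ℕ._% 8) (NS.solve 1 (λ h → let open NS in con 1 :+ ((con 1 :+ con 4 :* h) :+ (con 1 :+ con 4 :* h)) := con 3 :+ h :* con 8) refl h)) (ℕ.[m+kn]%n≡m%n 3 h 8)))

  private
    t : ℕ
    t = p ℕ./ 8

    p≡ : p ≡ 3 ℕ.+ t ℕ.* 8
    p≡ = trans (ℕ.m≡m%n+[m/n]*n p 8) (cong (ℕ._+ t ℕ.* 8) p%8≡3)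

  p∤2 : ¬ p ℕ.∣ 2
  p∤2 p∣2 = ℕ.<⇒≱ (s≤s (s≤s (s≤s z≤n))) (ℕ.≤-trans (ℕ.≤-reflexive (sym p≡)) (ℕ.∣⇒≤ p∣2))

  ·1≢0 : ∀ {n} → ¬ p ℕ.∣ n → n · 1# ≢ 0#
  ·1≢0 {n} p∤n n≡0 = go (n ℕ.% p) refl
    where
    instance
      p≢0 : ℕ.NonZero p
      p≢0 = prime⇒nonZero p-prime
    n%p≡0 : (n ℕ.% p) · 1# ≡ 0#
    n%p≡0 = begin
      (n ℕ.% p) · 1#                                     ≡⟨ +-identityʳ _ ⟨
      (n ℕ.% p) · 1# + 0#                                ≡⟨ cong (λ s → (n ℕ.% p) · 1# + s) (∣⇒≈0 (ℕ.divides (n ℕ./ p) refl)) ⟨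
      (n ℕ.% p) · 1# + (n ℕ./ p ℕ.* p) · 1#              ≡⟨ ×-homo-+ 1# (n ℕ.% p) _ ⟨
      (n ℕ.% p ℕ.+ n ℕ./ p ℕ.* p) · 1#                   ≡⟨ cong (_· 1#) (ℕ.m≡m%n+[m/n]*n n p) ⟨
      n · 1#                                             ≡⟨ n≡0 ⟩
      0#                                                 ∎
    multiple≡0 : ∀ s d → d · 1# ≡ 0# → (s ℕ.* d) · 1# ≡ 0#
    multiple≡0 s d d≡0 = trans (×1-homo-* s d) (trans (cong (s · 1# *_) d≡0) (zeroʳ _))
    unit : ∀ {a b} → 1 ℕ.+ a ≡ b → a · 1# ≡ 0# → b · 1# ≡ 0# → ⊥
    unit refl a≡0 b≡0 = 0≢1 (trans (sym b≡0) (trans (cong (1# +_) a≡0) (+-identityʳ 1#)))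
    go : ∀ d → n ℕ.% p ≡ d → ⊥
    go zero    eq = p∤n (ℕ.m%n≡0⇒n∣m n p eq)
    go (suc d) eq = bezout (coprime-Bézout (prime⇒coprime p-prime (subst (ℕ._< p) eq (ℕ.m%n<n n p))))
      where
      d≡0 : suc d · 1# ≡ 0#
      d≡0 = subst (λ k → k · 1# ≡ 0#) eq n%p≡0
      bezout : Bézout.Identity 1 p (suc d) → ⊥
      bezout (Bézout.+- x y eq) = unit eq (multiple≡0 y (suc d) d≡0) (multiple≡0 x p p≡0)
      bezout (Bézout.-+ x y eq) = unit eq (multiple≡0 x p p≡0) (multiple≡0 y (suc d) d≡0)

  private
    isEven : ℕ → Bool
    isEven zero    = true
    isEven (suc n) = not (isEven n)

    digit : Bool → ℕ
    digit b = if b then t else 1 ℕ.+ 3 ℕ.* t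

    remainder : Bool → ℕ
    remainder b = if b then 1 else 3

    half eighth : ℕ → ℕ
    half zero      = 0
    half (suc n)   = half n ℕ.* p ℕ.+ (1 ℕ.+ 4 ℕ.* t)
    eighth zero    = 0
    eighth (suc n) = eighth n ℕ.* p ℕ.+ digit (isEven n)

    half≡ : ∀ n → suc (half n ℕ.+ half n) ≡ p ℕ.^ n
    half≡ zero    = refl
    half≡ (suc n) = begin
      suc (half (suc n) ℕ.+ half (suc n))                     ≡⟨ cong (λ p → suc ((half n ℕ.* p ℕ.+ (1 ℕ.+ 4 ℕ.* t)) ℕ.+ (half n ℕ.* p ℕ.+ (1 ℕ.+ 4 ℕ.* t)))) p≡ ⟩
      _                                                       ≡⟨ NS.solve 2 (λ H t → let open NS ; P = con 3 :+ t :* con 8 in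
                                                                   con 1 :+ ((H :* P :+ (con 1 :+ con 4 :* t)) :+ (H :* P :+ (con 1 :+ con 4 :* t))) := P :* (con 1 :+ (H :+ H))) refl (half n) t ⟩
      (3 ℕ.+ t ℕ.* 8) ℕ.* suc (half n ℕ.+ half n)             ≡⟨ cong₂ ℕ._*_ (sym p≡) (half≡ n) ⟩
      p ℕ.* p ℕ.^ n                                           ∎

    eighth≡ : ∀ n → 8 ℕ.* eighth n ℕ.+ remainder (isEven n) ≡ p ℕ.^ n
    eighth≡ zero    = refl
    eighth≡ (suc n) = begin
      8 ℕ.* (eighth n ℕ.* p ℕ.+ digit b) ℕ.+ remainder (not b)                   ≡⟨ cong (λ p → 8 ℕ.* (eighth n ℕ.* p ℕ.+ digit b) ℕ.+ remainder (not b)) p≡ ⟩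
      8 ℕ.* (eighth n ℕ.* (3 ℕ.+ t ℕ.* 8) ℕ.+ digit b) ℕ.+ remainder (not b)     ≡⟨ step b ⟩
      (3 ℕ.+ t ℕ.* 8) ℕ.* (8 ℕ.* eighth n ℕ.+ remainder b)                       ≡⟨ cong₂ ℕ._*_ (sym p≡) (eighth≡ n) ⟩
      p ℕ.* p ℕ.^ n                                                              ∎
      where
      b = isEven n
      step : ∀ b → 8 ℕ.* (eighth n ℕ.* (3 ℕ.+ t ℕ.* 8) ℕ.+ digit b) ℕ.+ remainder (not b) ≡ (3 ℕ.+ t ℕ.* 8) ℕ.* (8 ℕ.* eighth n ℕ.+ remainder b)
      step true  = NS.solve 2 (λ E t → let open NS ; P = con 3 :+ t :* con 8 in con 8 :* (E :* P :+ t) :+ con 3 := P :* (con 8 :* E :+ con 1)) refl (eighth n) t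
      step false = NS.solve 2 (λ E t → let open NS ; P = con 3 :+ t :* con 8 in con 8 :* (E :* P :+ (con 1 :+ con 3 :* t)) :+ con 1 := P :* (con 8 :* E :+ con 3)) refl (eighth n) t

    1+4t<p : 1 ℕ.+ 4 ℕ.* t ℕ.< p
    1+4t<p = ℕ.≤-trans (s≤s (ℕ.m≤m+n (1 ℕ.+ 4 ℕ.* t) (1 ℕ.+ 4 ℕ.* t)))
      (ℕ.≤-reflexive (trans (NS.solve 1 (λ t → let open NS in con 1 :+ ((con 1 :+ con 4 :* t) :+ (con 1 :+ con 4 :* t)) := con 3 :+ t :* con 8) refl t) (sym p≡)))

    digit≤ : ∀ b → digit b ℕ.≤ 1 ℕ.+ 4 ℕ.* t
    digit≤ true  = ℕ.≤-trans (ℕ.m≤n*m t 4) (ℕ.n≤1+n (4 ℕ.* t))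
    digit≤ false = s≤s (ℕ.*-monoˡ-≤ t {3} {4} (s≤s (s≤s (s≤s z≤n))))

    half-choose-eighth : ∀ n → (half n C eighth n) · 1# ≢ 0#
    half-choose-eighth zero    = λ eq → 0≢1 (sym (trans (sym (+-identityʳ 1#)) eq))
    half-choose-eighth (suc n) eq = *-≢0 (half-choose-eighth n)
      (·1≢0 (prime∤nCk p-prime (1 ℕ.+ 4 ℕ.* t) (digit b) (digit≤ b) 1+4t<p))
      (trans (sym (lucas (half n) (eighth n) 1+4t<p (ℕ.≤-<-trans (digit≤ b) 1+4t<p))) eq)
      where b = isEven n

    half≡M : half e ≡ M
    half≡M = ℕ.*-cancelˡ-≡ (half e) M 2 (trans (double (half e)) (trans (ℕ.suc-injective (trans (half≡ e) (sym q≡p^e))) (sym (double M))))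
      where
      double : ∀ n → 2 ℕ.* n ≡ n ℕ.+ n
      double n = cong (n ℕ.+_) (ℕ.+-identityʳ n)

    eighth≡h : eighth e ≡ h
    eighth≡h = go (isEven e) (trans (eighth≡ e) (trans (sym q≡p^e) (NS.solve 1 (λ h → let open NS in con 1 :+ ((con 1 :+ con 4 :* h) :+ (con 1 :+ con 4 :* h)) := con 8 :* h :+ con 3) refl h)))
      where
      mod8 : ∀ x r → (8 ℕ.* x ℕ.+ r) ℕ.% 8 ≡ r ℕ.% 8
      mod8 x r = trans (cong (ℕ._% 8) (trans (ℕ.+-comm (8 ℕ.* x) r) (cong (r ℕ.+_) (ℕ.*-comm 8 x)))) (ℕ.[m+kn]%n≡m%n r x 8)
      go : ∀ b → 8 ℕ.* eighth e ℕ.+ remainder b ≡ 8 ℕ.* h ℕ.+ 3 → eighth e ≡ h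
      go true  eq = contradiction (trans (sym (mod8 (eighth e) 1)) (trans (cong (ℕ._% 8) eq) (mod8 h 3))) λ ()
      go false eq = ℕ.*-cancelˡ-≡ (eighth e) h 8 (ℕ.+-cancelʳ-≡ 3 (8 ℕ.* eighth e) (8 ℕ.* h) eq)

  MCh≢0 : (M C h) · 1# ≢ 0#
  MCh≢0 = subst₂ (λ a b → (a C b) · 1# ≢ 0#) half≡M eighth≡h (half-choose-eighth e)

  private
    δ₀ : Fin 8 → ℤ
    δ₀ = oddClass 1ℤ 0ℤ 0ℤ 0ℤ

    s : L → ℤ
    s = onClass δ₀

  J : ℤ → L
  J i = ι (fromℤ i)

  J-+ : ∀ i j → J (i ℤ.+ j) ≡ J i L.+ J j
  J-+ i j = cong₂ _,_ (fromℤ-+ i j) (sym (+-identityʳ 0#))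

  J-* : ∀ i j → J (i ℤ.* j) ≡ J i L.* J j
  J-* i j = trans (cong ι (fromℤ-* i j)) (ι-* (fromℤ i) (fromℤ j))

  J-∑ : ∀ {A : Set} (xs : List A) f → J (Σℤ.∑ xs f) ≡ ΣL.∑ xs (J ∘ f)
  J-∑ []       f = refl
  J-∑ (x ∷ xs) f = trans (J-+ (f x) (Σℤ.∑ xs f)) (cong (J (f x) L.+_) (J-∑ xs f))

  J-∣ : ∀ {i} → ℤ.+ p ℤ.∣ i → J i ≡ L.0#
  J-∣ (ℤ.divides c refl) = cong ι (trans (fromℤ-* c (ℤ.+ p)) (trans (cong (fromℤ c *_) p≡0) (zeroʳ _)))

  private
    2i : L
    2i = 0# , 1# + 1#

    det-conjugates : ∀ u w → conjugate u L.* w L.- u L.* conjugate w ≡ 2i L.* ι (det u w)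
    det-conjugates (a , b) (c , d) = cong₂ _,_
      (KS.solve 4 (λ a b c d → let open KS in (a :* c :- (:- b) :* d) :- (a :* c :- b :* (:- d)) := con 0ℤ :* (a :* d :- b :* c) :- (con 1ℤ :+ con 1ℤ) :* con 0ℤ) refl a b c d)
      (KS.solve 4 (λ a b c d → let open KS in (a :* d :+ (:- b) :* c) :- (a :* (:- d) :+ b :* c) := con 0ℤ :* con 0ℤ :+ (con 1ℤ :+ con 1ℤ) :* (a :* d :- b :* c)) refl a b c d)

    w : K → L
    w x = 1# , x

    w≢0 : ∀ x → w x ≢ L.0#
    w≢0 x = point≢0 (just x)

    y : K → L
    y x = conjugate (w x) L.* (w x L-field.⁻¹)

    y*w : ∀ x → y x L.* w x ≡ conjugate (w x)
    y*w x = trans (L.*-assoc (conjugate (w x)) (w x L-field.⁻¹) (w x)) (trans (cong (conjugate (w x) L.*_) (trans (L.*-comm (w x L-field.⁻¹) (w x)) (L-field.*-inverse (w≢0 x)))) (L.*-identityʳ (conjugate (w x))))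

    y-injective : ∀ {x x′} → y x ≡ y x′ → x ≡ x′
    y-injective {x} {x′} eq = x-y≡0⇒x≡y (*-cancelˡ 1+1≢0 (begin
      (1# + 1#) * (x - x′)                                   ≡⟨ KS.solve 2 (λ a b → let open KS in (con 1ℤ :+ con 1ℤ) :* (a :- b) := (con 1ℤ :* a :+ (:- b) :* con 1ℤ) :- (con 1ℤ :* b :+ (:- a) :* con 1ℤ)) refl x x′ ⟩
      (1# * x + (- x′) * 1#) - (1# * x′ + (- x) * 1#)        ≡⟨ cong (_- (1# * x′ + (- x) * 1#)) (cong proj₂ cross) ⟨
      (1# * x′ + (- x) * 1#) - (1# * x′ + (- x) * 1#)        ≡⟨ -‿inverseʳ _ ⟩
      0#                                                     ≡⟨ zeroʳ _ ⟨
      (1# + 1#) * 0#                                         ∎))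
      where
      cross : conjugate (w x) L.* w x′ ≡ conjugate (w x′) L.* w x
      cross = begin
        conjugate (w x) L.* w x′        ≡⟨ cong (L._* w x′) (y*w x) ⟨
        (y x L.* w x) L.* w x′          ≡⟨ cong (λ t → (t L.* w x) L.* w x′) eq ⟩
        (y x′ L.* w x) L.* w x′         ≡⟨ LS.solve 3 (λ a b c → let open LS in (a :* b) :* c := (a :* c) :* b) refl (y x′) (w x) (w x′) ⟩
        (y x′ L.* w x′) L.* w x         ≡⟨ cong (L._* w x) (y*w x′) ⟩
        conjugate (w x′) L.* w x        ∎

    factor : ∀ u x → (L.- (u L.* y x) L.+ conjugate u) L.* w x ≡ 2i L.* ι (det u (w x))
    factor u x = begin
      (L.- (u L.* y x) L.+ conjugate u) L.* w x       ≡⟨ LS.solve 4 (λ u y v w → let open LS in (:- (u :* y) :+ v) :* w := v :* w :- u :* (y :* w)) refl u (y x) (conjugate u) (w x) ⟩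
      conjugate u L.* w x L.- u L.* (y x L.* w x)     ≡⟨ cong (λ t → conjugate u L.* w x L.- u L.* t) (y*w x) ⟩
      conjugate u L.* w x L.- u L.* conjugate (w x)   ≡⟨ det-conjugates u (w x) ⟩
      2i L.* ι (det u (w x))                          ∎

  open import Algebra.Properties.Semiring.Sum L.semiring using (sum; sum-cong-≋; sum-replicate-zero; *-distribˡ-sum)
  open import Algebra.Properties.CommutativeMonoid.Sum L.+-commutativeMonoid using (∑-distrib-+)
  open BinomialProperties L.commutativeSemiring using (binomialTerm) renaming (theorem to binomial-theorem)

  private
    ∑-sum : ∀ {A : Set} (xs : List A) n (f : A → Fin n → L) → ΣL.∑ xs (λ x → sum (f x)) ≡ sum (λ j → ΣL.∑ xs (λ x → f x j))
    ∑-sum []       n f = sym (sum-replicate-zero n)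
    ∑-sum (x ∷ xs) n f = trans (cong (sum (f x) L.+_) (∑-sum xs n f)) (sym (∑-distrib-+ (f x) (λ j → ΣL.∑ xs (λ x → f x j))))

    eval-tabulate : ∀ n (c : Fin n → L) z → Lf.eval (tabulate c) z ≡ sum (λ j → c j L.* z Lₖ.^ toℕ j)
    eval-tabulate zero    c z = refl
    eval-tabulate (suc n) c z = cong₂ L._+_ (sym (L.*-identityʳ (c Fin.zero))) (trans (cong (z L.*_) (eval-tabulate n (c ∘ Fin.suc) z))
      (trans (*-distribˡ-sum {n} z (λ j → c (Fin.suc j) L.* z Lₖ.^ toℕ j)) (sum-cong-≋ {n} (λ j → LS.solve 3 (λ z c y → let open LS in z :* (c :* y) := c :* (z :* y)) refl z (c (Fin.suc j)) (z Lₖ.^ toℕ j)))))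

    coefficient : L → Fin (suc M) → L
    coefficient u j = (M C toℕ j) Lₖ.· ((L.- u) Lₖ.^ toℕ j L.* conjugate u Lₖ.^ (M ℕ.∸ toℕ j))

    expand : ∀ u z → (L.- (u L.* z) L.+ conjugate u) Lₖ.^ M ≡ sum (λ j → coefficient u j L.* z Lₖ.^ toℕ j)
    expand u z = trans (binomial-theorem M (L.- (u L.* z)) (conjugate u)) (sum-cong-≋ (λ j → begin
      (M C toℕ j) Lₖ.· ((L.- (u L.* z)) Lₖ.^ toℕ j L.* v j)                 ≡⟨ cong (λ t → (M C toℕ j) Lₖ.· (t Lₖ.^ toℕ j L.* v j)) (Lₖ.-‿distribˡ-* u z) ⟩
      (M C toℕ j) Lₖ.· ((L.- u L.* z) Lₖ.^ toℕ j L.* v j)                   ≡⟨ cong (λ t → (M C toℕ j) Lₖ.· (t L.* v j)) (Lₖ.^-distrib-* (L.- u) z (toℕ j)) ⟩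
      (M C toℕ j) Lₖ.· ((L.- u) Lₖ.^ toℕ j L.* z Lₖ.^ toℕ j L.* v j)        ≡⟨ cong ((M C toℕ j) Lₖ.·_) (LS.solve 3 (λ a b c → let open LS in a :* b :* c := (a :* c) :* b) refl ((L.- u) Lₖ.^ toℕ j) (z Lₖ.^ toℕ j) (v j)) ⟩
      (M C toℕ j) Lₖ.· ((L.- u) Lₖ.^ toℕ j L.* v j L.* z Lₖ.^ toℕ j)        ≡⟨ Lₖ.×-assoc-* (M C toℕ j) ((L.- u) Lₖ.^ toℕ j L.* v j) (z Lₖ.^ toℕ j) ⟨
      coefficient u j L.* z Lₖ.^ toℕ j                                      ∎))
      where
      v : Fin (suc M) → L
      v j = conjugate u Lₖ.^ (M ℕ.∸ toℕ j)

    total : Fin (suc M) → L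
    total j = ΣL.∑ ℙ.elements (λ ℓ → J (s (point ℓ)) L.* coefficient (point ℓ) j)

  -- Comparing the coefficients of y^h in Σ s(u) (ū − u y)^M, which up to scaling is charSum s, at y = w̄/w.
  module _ (vanish : ∀ g → g ≢ L.0# → J (charSum s g) ≡ L.0#) where

    private
      eval-total : ∀ x → Lf.eval (tabulate total) (y x) ≡ L.0#
      eval-total x = trans (eval-tabulate (suc M) total (y x)) (trans (sym rearrange)
        ([ id , (λ w^M≡0 → contradiction w^M≡0 (Lf.^-≢0 M (w≢0 x))) ]′ (Lf.*≡0 scaled)))
        where
        P : L
        P = ΣL.∑ ℙ.elements (λ ℓ → J (s (point ℓ)) L.* (L.- (point ℓ L.* y x) L.+ conjugate (point ℓ)) Lₖ.^ M)
        rearrange : P ≡ sum (λ j → total j L.* y x Lₖ.^ toℕ j)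
        rearrange = begin
          P ≡⟨ ΣL.∑-cong ℙ.elements (λ ℓ → trans (cong (J (s (point ℓ)) L.*_) (expand (point ℓ) (y x))) (*-distribˡ-sum {suc M} (J (s (point ℓ))) (λ j → coefficient (point ℓ) j L.* y x Lₖ.^ toℕ j))) ⟩
          ΣL.∑ ℙ.elements (λ ℓ → sum (λ j → J (s (point ℓ)) L.* (coefficient (point ℓ) j L.* y x Lₖ.^ toℕ j))) ≡⟨ ∑-sum ℙ.elements (suc M) (λ ℓ j → J (s (point ℓ)) L.* (coefficient (point ℓ) j L.* y x Lₖ.^ toℕ j)) ⟩
          sum (λ j → ΣL.∑ ℙ.elements (λ ℓ → J (s (point ℓ)) L.* (coefficient (point ℓ) j L.* y x Lₖ.^ toℕ j))) ≡⟨ sum-cong-≋ {suc M} (λ j → trans (ΣL.∑-cong ℙ.elements (λ ℓ → sym (L.*-assoc (J (s (point ℓ))) (coefficient (point ℓ) j) (y x Lₖ.^ toℕ j))))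
                                                                                                                    (sym (ΣL.∑-*ʳ ℙ.elements (y x Lₖ.^ toℕ j) (λ ℓ → J (s (point ℓ)) L.* coefficient (point ℓ) j)))) ⟩
          sum (λ j → total j L.* y x Lₖ.^ toℕ j) ∎
        scaled : P L.* w x Lₖ.^ M ≡ L.0#
        scaled = begin
          P L.* w x Lₖ.^ M
            ≡⟨ ΣL.∑-*ʳ ℙ.elements (w x Lₖ.^ M) (λ ℓ → J (s (point ℓ)) L.* (L.- (point ℓ L.* y x) L.+ conjugate (point ℓ)) Lₖ.^ M) ⟩
          ΣL.∑ ℙ.elements (λ ℓ → J (s (point ℓ)) L.* (L.- (point ℓ L.* y x) L.+ conjugate (point ℓ)) Lₖ.^ M L.* w x Lₖ.^ M)
            ≡⟨ ΣL.∑-cong ℙ.elements (λ ℓ → begin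
                 J (s (point ℓ)) L.* (L.- (point ℓ L.* y x) L.+ conjugate (point ℓ)) Lₖ.^ M L.* w x Lₖ.^ M   ≡⟨ L.*-assoc (J (s (point ℓ))) ((L.- (point ℓ L.* y x) L.+ conjugate (point ℓ)) Lₖ.^ M) (w x Lₖ.^ M) ⟩
                 J (s (point ℓ)) L.* ((L.- (point ℓ L.* y x) L.+ conjugate (point ℓ)) Lₖ.^ M L.* w x Lₖ.^ M) ≡⟨ cong (J (s (point ℓ)) L.*_) (trans (sym (Lₖ.^-distrib-* (L.- (point ℓ L.* y x) L.+ conjugate (point ℓ)) (w x) M)) (trans (cong (Lₖ._^ M) (factor (point ℓ) x)) (Lₖ.^-distrib-* 2i (ι (det (point ℓ) (w x))) M))) ⟩
                 J (s (point ℓ)) L.* (2i Lₖ.^ M L.* ι (det (point ℓ) (w x)) Lₖ.^ M)                         ≡⟨ cong (λ t → J (s (point ℓ)) L.* (2i Lₖ.^ M L.* t)) (trans (ι-^ (det (point ℓ) (w x)) M) (cong ι (sym (fromℤ-η (det (point ℓ) (w x)))))) ⟩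
                 J (s (point ℓ)) L.* (2i Lₖ.^ M L.* J (η (det (point ℓ) (w x))))                            ≡⟨ LS.solve 3 (λ a b c → let open LS in a :* (b :* c) := b :* (a :* c)) refl (J (s (point ℓ))) (2i Lₖ.^ M) (J (η (det (point ℓ) (w x)))) ⟩
                 2i Lₖ.^ M L.* (J (s (point ℓ)) L.* J (η (det (point ℓ) (w x))))                            ≡⟨ cong (2i Lₖ.^ M L.*_) (J-* (s (point ℓ)) (η (det (point ℓ) (w x)))) ⟨
                 2i Lₖ.^ M L.* J (s (point ℓ) ℤ.* η (det (point ℓ) (w x)))                                  ∎) ⟩
          ΣL.∑ ℙ.elements (λ ℓ → 2i Lₖ.^ M L.* J (s (point ℓ) ℤ.* η (det (point ℓ) (w x))))
            ≡⟨ trans (cong (2i Lₖ.^ M L.*_) (J-∑ ℙ.elements (λ ℓ → s (point ℓ) ℤ.* η (det (point ℓ) (w x))))) (ΣL.∑-*ˡ ℙ.elements (2i Lₖ.^ M) (λ ℓ → J (s (point ℓ) ℤ.* η (det (point ℓ) (w x))))) ⟨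
          2i Lₖ.^ M L.* J (charSum s (w x))
            ≡⟨ cong (2i Lₖ.^ M L.*_) (vanish (w x) (w≢0 x)) ⟩
          2i Lₖ.^ M L.* L.0#
            ≡⟨ L.zeroʳ _ ⟩
          L.0# ∎

      total≡0 : ∀ j → total j ≡ L.0#
      total≡0 = All.tabulate⁻ (Lf.roots-bound (tabulate total) (map y elements) (Unique.map⁺ y-injective unique) enough
        (λ z∈ → let x , _ , z≡ = Mem.∈-map⁻ y z∈ in trans (cong (Lf.eval (tabulate total)) z≡) (eval-total x)))
        where
        enough : length (tabulate total) ℕ.≤ length (map y elements)
        enough = subst₂ ℕ._≤_ (sym (List.length-tabulate total)) (trans (sym size) (sym (List.length-map y elements))) (s≤s (ℕ.m≤m+n M M))

      h<1+M : h ℕ.< suc M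
      h<1+M = s≤s (ℕ.≤-trans (ℕ.m≤n*m h 4) (ℕ.n≤1+n _))

      coefficient-h : ∀ {u} → u ≢ L.0# → (L.- u) Lₖ.^ h L.* conjugate u Lₖ.^ (M ℕ.∸ h) ≡ -1L Lₖ.^ h L.* (ω Lₖ.^ toℕ (cl u)) Lₖ.^ 3
      coefficient-h {u} u≢0 = begin
        (L.- u) Lₖ.^ h L.* conjugate u Lₖ.^ (M ℕ.∸ h)            ≡⟨ cong₂ L._*_ (trans (cong (Lₖ._^ h) (LS.solve 1 (λ u → let open LS in :- u := (:- con 1ℤ) :* u) refl u)) (Lₖ.^-distrib-* -1L u h))
                                                                      (trans (cong₂ Lₖ._^_ (sym (frobenius-conjugate u)) M∸h) (Lₖ.^-assocʳ u q (1 ℕ.+ 3 ℕ.* h))) ⟩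
        -1L Lₖ.^ h L.* u Lₖ.^ h L.* u Lₖ.^ (q ℕ.* (1 ℕ.+ 3 ℕ.* h)) ≡⟨ L.*-assoc (-1L Lₖ.^ h) (u Lₖ.^ h) (u Lₖ.^ (q ℕ.* (1 ℕ.+ 3 ℕ.* h))) ⟩
        -1L Lₖ.^ h L.* (u Lₖ.^ h L.* u Lₖ.^ (q ℕ.* (1 ℕ.+ 3 ℕ.* h))) ≡⟨ cong (-1L Lₖ.^ h L.*_) (trans (sym (Lₖ.^-homo-* u h (q ℕ.* (1 ℕ.+ 3 ℕ.* h)))) (cong (u Lₖ.^_) exponent)) ⟩
        -1L Lₖ.^ h L.* u Lₖ.^ (k ℕ.* 3)                          ≡⟨ cong (-1L Lₖ.^ h L.*_) (trans (sym (Lₖ.^-assocʳ u k 3)) (cong (Lₖ._^ 3) (sym (ω^cl u≢0)))) ⟩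
        -1L Lₖ.^ h L.* (ω Lₖ.^ toℕ (cl u)) Lₖ.^ 3                ∎
        where
        M∸h : M ℕ.∸ h ≡ 1 ℕ.+ 3 ℕ.* h
        M∸h = trans (cong (ℕ._∸ h) (NS.solve 1 (λ h → let open NS in con 1 :+ con 4 :* h := con 1 :+ con 3 :* h :+ h) refl h)) (ℕ.m+n∸n≡m (1 ℕ.+ 3 ℕ.* h) h)
        exponent : h ℕ.+ q ℕ.* (1 ℕ.+ 3 ℕ.* h) ≡ k ℕ.* 3
        exponent = NS.solve 1 (λ h → let open NS in h :+ (con 1 :+ ((con 1 :+ con 4 :* h) :+ (con 1 :+ con 4 :* h))) :* (con 1 :+ con 3 :* h) := ((con 1 :+ con 4 :* h) :* (con 1 :+ con 2 :* h)) :* con 3) refl h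

      weight : ∀ j → J (δ₀ j) L.* (ω Lₖ.^ toℕ j) Lₖ.^ 3 ≡ J (δ₀ j ℤ.* δ₀ j)
      weight = ∀8
        (trans (cong (J 1ℤ L.*_) (L-1^ 3)) (L.*-identityʳ (J 1ℤ))) (L.zeroˡ ((ω Lₖ.^ 1) Lₖ.^ 3)) (L.zeroˡ ((ω Lₖ.^ 2) Lₖ.^ 3)) (L.zeroˡ ((ω Lₖ.^ 3) Lₖ.^ 3))
        (begin
          J ℤ.-1ℤ L.* (ω Lₖ.^ 4) Lₖ.^ 3    ≡⟨ cong₂ (λ a b → a L.* b Lₖ.^ 3) (trans (cong ι fromℤ--1) (ι-neg 1#)) ω^4 ⟩
          -1L L.* -1L Lₖ.^ 3               ≡⟨ LS.solve 0 (let open LS in (:- con 1ℤ) :* (:- con 1ℤ) :^ 3 := con 1ℤ) refl ⟩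
          L.1#                             ≡⟨ cong ι fromℤ-1 ⟨
          J 1ℤ                             ∎)
        (L.zeroˡ ((ω Lₖ.^ 5) Lₖ.^ 3)) (L.zeroˡ ((ω Lₖ.^ 6) Lₖ.^ 3)) (L.zeroˡ ((ω Lₖ.^ 7) Lₖ.^ 3))

      total-h : total (Fin.fromℕ< h<1+M) ≡ (M C h) Lₖ.· (-1L Lₖ.^ h L.* J (ℤ.+ m))
      total-h = begin
        total (Fin.fromℕ< h<1+M)
          ≡⟨ ΣL.∑-cong ℙ.elements (λ ℓ → term ℓ) ⟩
        ΣL.∑ ℙ.elements (λ ℓ → ((M C h) Lₖ.· (-1L Lₖ.^ h)) L.* J (δ₀ (cl (point ℓ)) ℤ.* δ₀ (cl (point ℓ))))
          ≡⟨ trans (cong (((M C h) Lₖ.· (-1L Lₖ.^ h)) L.*_) (J-∑ ℙ.elements (λ ℓ → δ₀ (cl (point ℓ)) ℤ.* δ₀ (cl (point ℓ))))) (ΣL.∑-*ˡ ℙ.elements ((M C h) Lₖ.· (-1L Lₖ.^ h)) (λ ℓ → J (δ₀ (cl (point ℓ)) ℤ.* δ₀ (cl (point ℓ))))) ⟨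
        ((M C h) Lₖ.· (-1L Lₖ.^ h)) L.* J (∑P (λ ℓ → δ₀ (cl (point ℓ)) ℤ.* δ₀ (cl (point ℓ))))
          ≡⟨ cong (λ t → ((M C h) Lₖ.· (-1L Lₖ.^ h)) L.* J t) (trans (∑P-class-average (λ j → δ₀ j ℤ.* δ₀ j) (∀8 refl refl refl refl refl refl refl refl)) (ℤ.*-identityʳ (ℤ.+ m))) ⟩
        ((M C h) Lₖ.· (-1L Lₖ.^ h)) L.* J (ℤ.+ m)
          ≡⟨ Lₖ.×-assoc-* (M C h) (-1L Lₖ.^ h) (J (ℤ.+ m)) ⟩
        (M C h) Lₖ.· (-1L Lₖ.^ h L.* J (ℤ.+ m)) ∎
        where
        term : ∀ ℓ → J (s (point ℓ)) L.* coefficient (point ℓ) (Fin.fromℕ< h<1+M) ≡ ((M C h) Lₖ.· (-1L Lₖ.^ h)) L.* J (δ₀ (cl (point ℓ)) ℤ.* δ₀ (cl (point ℓ)))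
        term ℓ = begin
          J (s u) L.* coefficient u (Fin.fromℕ< h<1+M)                       ≡⟨ cong₂ (λ a b → J a L.* ((M C b) Lₖ.· ((L.- u) Lₖ.^ b L.* conjugate u Lₖ.^ (M ℕ.∸ b)))) (onClass-≢0 δ₀ (point≢0 ℓ)) (Fin.toℕ-fromℕ< h<1+M) ⟩
          J (δ₀ (cl u)) L.* ((M C h) Lₖ.· ((L.- u) Lₖ.^ h L.* conjugate u Lₖ.^ (M ℕ.∸ h))) ≡⟨ cong (λ t → J (δ₀ (cl u)) L.* ((M C h) Lₖ.· t)) (coefficient-h (point≢0 ℓ)) ⟩
          J (δ₀ (cl u)) L.* ((M C h) Lₖ.· (-1L Lₖ.^ h L.* (ω Lₖ.^ toℕ (cl u)) Lₖ.^ 3)) ≡⟨ cong (J (δ₀ (cl u)) L.*_) (Lₖ.×-assoc-* (M C h) (-1L Lₖ.^ h) ((ω Lₖ.^ toℕ (cl u)) Lₖ.^ 3)) ⟨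
          J (δ₀ (cl u)) L.* (((M C h) Lₖ.· (-1L Lₖ.^ h)) L.* (ω Lₖ.^ toℕ (cl u)) Lₖ.^ 3) ≡⟨ LS.solve 3 (λ a b c → let open LS in a :* (b :* c) := b :* (a :* c)) refl (J (δ₀ (cl u))) ((M C h) Lₖ.· (-1L Lₖ.^ h)) ((ω Lₖ.^ toℕ (cl u)) Lₖ.^ 3) ⟩
          ((M C h) Lₖ.· (-1L Lₖ.^ h)) L.* (J (δ₀ (cl u)) L.* (ω Lₖ.^ toℕ (cl u)) Lₖ.^ 3) ≡⟨ cong (((M C h) Lₖ.· (-1L Lₖ.^ h)) L.*_) (weight (cl u)) ⟩
          ((M C h) Lₖ.· (-1L Lₖ.^ h)) L.* J (δ₀ (cl u) ℤ.* δ₀ (cl u))        ∎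
          where u = point ℓ

      m≢0 : m · 1# ≢ 0#
      m≢0 m≡0 = 0≢1 (sym (begin
        1#                          ≡⟨ +-identityʳ 1# ⟨
        1# + 0#                     ≡⟨ cong (1# +_) q≡0 ⟨
        suc q · 1#                  ≡⟨ cong (_· 1#) (NS.solve 1 (λ h → let open NS in con 2 :+ ((con 1 :+ con 4 :* h) :+ (con 1 :+ con 4 :* h)) := con 4 :* (con 1 :+ con 2 :* h)) refl h) ⟩
        (4 ℕ.* m) · 1#              ≡⟨ ×1-homo-* 4 m ⟩
        4 · 1# * (m · 1#)           ≡⟨ cong (4 · 1# *_) m≡0 ⟩
        4 · 1# * 0#                 ≡⟨ zeroʳ _ ⟩
        0#                          ∎))

    not-all-zero : ⊥
    not-all-zero = [ (λ eq → MCh≢0 (cong proj₁ (trans (sym (L-·1 (M C h))) eq)))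
                   , [ Lf.^-≢0 h (λ eq → -1≢0 (cong proj₁ eq)) , m≢0 ∘ cong proj₁ ]′ ∘ Lf.*≡0 ]′
      (Lf.*≡0 (trans (Lₖ.×-assoc-* (M C h) L.1# (-1L Lₖ.^ h L.* J (ℤ.+ m))) (trans (cong ((M C h) Lₖ.·_) (L.*-identityˡ (-1L Lₖ.^ h L.* J (ℤ.+ m)))) (trans (sym total-h) (total≡0 (Fin.fromℕ< h<1+M))))))
      where
      L-·1 : ∀ n → n Lₖ.· L.1# ≡ ι (n · 1#)
      L-·1 zero    = refl
      L-·1 (suc n) = trans (cong (L.1# L.+_) (L-·1 n)) (cong (1# + n · 1# ,_) (+-identityʳ 0#))

  coprime : ¬ ((ℤ.+ p ℤ.∣ β) × (ℤ.+ p ℤ.∣ α))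
  coprime (p∣β , p∣α) = not-all-zero λ g g≢0 → J-∣ (subst (ℤ.+ p ℤ.∣_) (sym (charSum≡ (oddClass-odd 1ℤ 0ℤ 0ℤ 0ℤ) g≢0))
    (ℤ.∣n⇒∣m*n (parity (cl g)) (ℤ.∣m∣n⇒∣m+n (ℤ.∣m⇒∣m*n (φ (cl g ⊞ 1F) ℤ.- φ (cl g ⊞ 3F)) p∣α) (ℤ.∣m⇒∣m*n (φ (cl g ⊞ 2F)) p∣β))))
    where φ = oddClass 1ℤ 0ℤ 0ℤ 0ℤ

module Convolution (𝕊 : Setting) where
  open Setting 𝕊
  open CharacterSums 𝕊 public
  open Field F using (_⁻¹; 0≢1; *-inverse)
  open CommutativeRing (Field.commutativeRing F) hiding (refl; sym; trans; zero)
  open RingKit (Field.commutativeRing F)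
  open FieldKit F 𝕂
  open Enumeration 𝕂
  open ≡.≡-Reasoning
  private
    module KS = Solver
    module ZS = ℤSolver

  PlusMinus : ℤ → Set
  PlusMinus i = i ≡ 1ℤ ⊎ i ≡ ℤ.-1ℤ

  -- Twice the indicator function of a set that meets each half-line in all or none of its points:
  -- t marks the lines that are full (1) or empty (-1), s the chosen half of the others,
  -- and κ records whether the origin belongs to the set.
  record Profile : Set where
    field
      κ     : ℤ
      t s   : L → ℤ
      t-0   : t L.0# ≡ 0ℤ
      s-0   : s L.0# ≡ 0ℤ
      t-•   : ∀ {x u} → x ≢ 0# → t (x • u) ≡ t u
      s-•   : ∀ {x u} → x ≢ 0# → s (x • u) ≡ η x ℤ.* s u
      unit  : ∀ {u} → u ≢ L.0# → (t u ≡ 0ℤ × PlusMinus (s u)) ⊎ (PlusMinus (t u) × s u ≡ 0ℤ)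

    ∑t : ℤ
    ∑t = ∑P (t ∘ point)

    spread : L → ℤ
    spread y = Σℤ.⟦ y 𝕃.≟ L.0# ⟧ ℤ.* ∑t ℤ.+ (t y ℤ.+ s y)

    doubled : L → ℤ
    doubled y = 1ℤ ℤ.+ (κ ℤ.* Σℤ.⟦ y 𝕃.≟ L.0# ⟧ ℤ.+ spread y)

    weight : Line → K → ℤ
    weight ℓ x = t (point ℓ) ℤ.+ η x ℤ.* s (point ℓ)

    spread-≢0 : ∀ {y} → y ≢ L.0# → spread y ≡ t y ℤ.+ s y
    spread-≢0 {y} y≢0 = trans (cong (λ b → b ℤ.* ∑t ℤ.+ (t y ℤ.+ s y)) (𝕃.if-≟-≢ y≢0)) (trans (cong (ℤ._+ (t y ℤ.+ s y)) (ℤ.*-zeroˡ ∑t)) (ℤ.+-identityˡ _))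

    spread-0 : spread L.0# ≡ ∑t
    spread-0 = trans (cong₂ (λ b c → b ℤ.* ∑t ℤ.+ c) (𝕃.if-≟-refl L.0#) (cong₂ ℤ._+_ t-0 s-0)) (ZS.solve 1 (λ x → let open ZS in con 1ℤ :* x :+ (con 0ℤ :+ con 0ℤ) := x) refl ∑t)

    ∑L-spread : ∀ G → ∑L (λ y → spread y ℤ.* G y) ≡ ∑P (λ ℓ → ∑K (λ x → weight ℓ x ℤ.* G (x • point ℓ)))
    ∑L-spread G = begin
      ∑L (λ y → spread y ℤ.* G y)
        ≡⟨ Σℤ.∑-cong 𝕃.elements (λ y → ZS.solve 4 (λ b T v g → let open ZS in (b :* T :+ v) :* g := b :* (T :* g) :+ v :* g) refl Σℤ.⟦ y 𝕃.≟ L.0# ⟧ ∑t (t y ℤ.+ s y) (G y)) ⟩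
      ∑L (λ y → Σℤ.⟦ y 𝕃.≟ L.0# ⟧ ℤ.* (∑t ℤ.* G y) ℤ.+ (t y ℤ.+ s y) ℤ.* G y)
        ≡⟨ Σℤ.∑-+ 𝕃.elements (λ y → Σℤ.⟦ y 𝕃.≟ L.0# ⟧ ℤ.* (∑t ℤ.* G y)) (λ y → (t y ℤ.+ s y) ℤ.* G y) ⟩
      ∑L (λ y → Σℤ.⟦ y 𝕃.≟ L.0# ⟧ ℤ.* (∑t ℤ.* G y)) ℤ.+ ∑L (λ y → (t y ℤ.+ s y) ℤ.* G y)
        ≡⟨ cong₂ ℤ._+_ (trans (Σℤ.∑-⟦≟⟧ 𝕃 L.0# (λ y → ∑t ℤ.* G y)) (Σℤ.∑-*ʳ ℙ.elements (G L.0#) (t ∘ point)))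
                       (trans (∑L-polar (λ y → (t y ℤ.+ s y) ℤ.* G y) (trans (cong (ℤ._* G L.0#) (cong₂ ℤ._+_ t-0 s-0)) (ℤ.*-zeroˡ (G L.0#))))
                              (Σℤ.∑-cong ℙ.elements (λ ℓ → Σℤ.∑-cong elements (λ x → nonzero-cong (λ x≢0 → cong (ℤ._* G (x • point ℓ)) (cong₂ ℤ._+_ (t-• x≢0) (s-• x≢0))))))) ⟩
      ∑P (λ ℓ → t (point ℓ) ℤ.* G L.0#) ℤ.+ ∑P (λ ℓ → ∑K (λ x → nonzero x ℤ.* (weight ℓ x ℤ.* G (x • point ℓ))))
        ≡⟨ Σℤ.∑-+ ℙ.elements (λ ℓ → t (point ℓ) ℤ.* G L.0#) (λ ℓ → ∑K (λ x → nonzero x ℤ.* (weight ℓ x ℤ.* G (x • point ℓ)))) ⟨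
      ∑P (λ ℓ → t (point ℓ) ℤ.* G L.0# ℤ.+ ∑K (λ x → nonzero x ℤ.* (weight ℓ x ℤ.* G (x • point ℓ))))
        ≡⟨ Σℤ.∑-cong ℙ.elements (λ ℓ → trans (cong (ℤ._+ ∑K (λ x → nonzero x ℤ.* (weight ℓ x ℤ.* G (x • point ℓ)))) (sym (origin ℓ))) (sym (∑K-split-0 (λ x → weight ℓ x ℤ.* G (x • point ℓ))))) ⟩
      ∑P (λ ℓ → ∑K (λ x → weight ℓ x ℤ.* G (x • point ℓ))) ∎
      where
      origin : ∀ ℓ → weight ℓ 0# ℤ.* G (0# • point ℓ) ≡ t (point ℓ) ℤ.* G L.0#
      origin ℓ = cong₂ ℤ._*_ (trans (cong (λ i → t (point ℓ) ℤ.+ i ℤ.* s (point ℓ)) η-0) (ZS.solve 2 (λ a b → let open ZS in a :+ con 0ℤ :* b := a) refl (t (point ℓ)) (s (point ℓ))))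
        (cong G (cong₂ _,_ (zeroˡ (proj₁ (point ℓ))) (zeroˡ (proj₂ (point ℓ)))))

    ∑K-weight : ∀ ℓ → ∑K (weight ℓ) ≡ ℤ.+ q ℤ.* t (point ℓ)
    ∑K-weight ℓ = begin
      ∑K (weight ℓ)                                                  ≡⟨ Σℤ.∑-+ elements (λ _ → t (point ℓ)) (λ x → η x ℤ.* s (point ℓ)) ⟩
      ∑K (λ _ → t (point ℓ)) ℤ.+ ∑K (λ x → η x ℤ.* s (point ℓ))      ≡⟨ cong₂ ℤ._+_ (∑K-constant (t (point ℓ))) (trans (sym (Σℤ.∑-*ʳ elements (s (point ℓ)) η)) (trans (cong (ℤ._* s (point ℓ)) ∑-η) (ℤ.*-zeroˡ (s (point ℓ))))) ⟩
      ℤ.+ q ℤ.* t (point ℓ) ℤ.+ 0ℤ                                   ≡⟨ ℤ.+-identityʳ _ ⟩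
      ℤ.+ q ℤ.* t (point ℓ)                                          ∎

    ∑L-spread-total : ∑L spread ≡ ℤ.+ q ℤ.* ∑t
    ∑L-spread-total = begin
      ∑L spread                                          ≡⟨ Σℤ.∑-cong 𝕃.elements (λ y → sym (ℤ.*-identityʳ (spread y))) ⟩
      ∑L (λ y → spread y ℤ.* 1ℤ)                         ≡⟨ ∑L-spread (λ _ → 1ℤ) ⟩
      ∑P (λ ℓ → ∑K (λ x → weight ℓ x ℤ.* 1ℤ))            ≡⟨ Σℤ.∑-cong ℙ.elements (λ ℓ → trans (Σℤ.∑-cong elements (λ x → ℤ.*-identityʳ (weight ℓ x))) (∑K-weight ℓ)) ⟩
      ∑P (λ ℓ → ℤ.+ q ℤ.* t (point ℓ))                   ≡⟨ Σℤ.∑-*ˡ ℙ.elements (ℤ.+ q) (t ∘ point) ⟨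
      ℤ.+ q ℤ.* ∑t                                       ∎

    ∑L-1 : ∑L (λ _ → 1ℤ) ≡ ℤ.+ q ℤ.* ℤ.+ q
    ∑L-1 = trans (∑L≡∑K∑K (λ _ → 1ℤ)) (trans (Σℤ.∑-cong elements (λ _ → trans (∑K-constant 1ℤ) (ℤ.*-identityʳ (ℤ.+ q)))) (∑K-constant (ℤ.+ q)))

    total : ℤ
    total = ℤ.+ q ℤ.* ℤ.+ q ℤ.+ (κ ℤ.+ ℤ.+ q ℤ.* ∑t)

    ∑L-doubled : ∑L doubled ≡ total
    ∑L-doubled = trans (Σℤ.∑-+ 𝕃.elements (λ _ → 1ℤ) (λ y → κ ℤ.* Σℤ.⟦ y 𝕃.≟ L.0# ⟧ ℤ.+ spread y)) (cong₂ ℤ._+_ ∑L-1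
      (trans (Σℤ.∑-+ 𝕃.elements (λ y → κ ℤ.* Σℤ.⟦ y 𝕃.≟ L.0# ⟧) spread) (cong₂ ℤ._+_
        (trans (Σℤ.∑-cong 𝕃.elements (λ y → ℤ.*-comm κ Σℤ.⟦ y 𝕃.≟ L.0# ⟧)) (Σℤ.∑-⟦≟⟧ 𝕃 L.0# (λ _ → κ)))
        ∑L-spread-total)))

  open Profile using (κ; t; s; ∑t; t-•; s-•; spread; doubled; total; weight; unit)

  -1•≡neg : ∀ u → - 1# • u ≡ L.- u
  -1•≡neg (a , b) = cong₂ _,_ (neg a) (neg b)
    where
    neg : ∀ a → - 1# * a ≡ - a
    neg = KS.solve 1 (λ a → let open KS in (:- con 1ℤ) :* a := :- a) refl

  neg-≢0 : ∀ {u} → u ≢ L.0# → L.- u ≢ L.0#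
  neg-≢0 {u} u≢0 eq = •-≢0 -1≢0 u≢0 (trans (-1•≡neg u) eq)

  t-neg : ∀ P u → t P (L.- u) ≡ t P u
  t-neg P u = trans (cong (t P) (sym (-1•≡neg u))) (t-• P -1≢0)

  s-neg : ∀ P u → s P (L.- u) ≡ ℤ.- s P u
  s-neg P u = trans (cong (s P) (sym (-1•≡neg u))) (trans (s-• P -1≢0) (trans (cong (ℤ._* s P u) η--1) (ℤ.-1*i≡-i (s P u))))

  direction : ∀ g → g ≢ L.0# → ∃ λ ℓ → ∃ λ γ → γ ≢ 0# × g ≡ γ • point ℓ
  direction (a , b) g≢0 = go (a ≟ 0#)
    where
    go : Dec (a ≡ 0#) → ∃ λ ℓ → ∃ λ γ → γ ≢ 0# × (a , b) ≡ γ • point ℓ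
    go (yes a≡0) = nothing , b , (λ b≡0 → g≢0 (cong₂ _,_ a≡0 b≡0)) , cong₂ _,_ (trans a≡0 (sym (zeroʳ b))) (sym (*-identityʳ b))
    go (no a≢0)  = just (a ⁻¹ * b) , a , a≢0 , cong₂ _,_ (sym (*-identityʳ a)) (sym (a[a⁻¹y]≡y a≢0 b))

  module _ (P P′ : Profile) {g : L} (g≢0 : g ≢ L.0#) where

    private
      ℓ₀ : Line
      ℓ₀ = proj₁ (direction g g≢0)
      γ : K
      γ = proj₁ (proj₂ (direction g g≢0))
      γ≢0 : γ ≢ 0#
      γ≢0 = proj₁ (proj₂ (proj₂ (direction g g≢0)))
      g≡ : g ≡ γ • point ℓ₀
      g≡ = proj₂ (proj₂ (proj₂ (direction g g≢0)))

      T T′ S S′ : Line → ℤ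
      T  = t P ∘ point
      T′ = t P′ ∘ point
      S  = s P ∘ point
      S′ = s P′ ∘ point
      χ : Line → ℤ
      χ ℓ = η (det g (point ℓ))
      D : Line → Line → ℤ
      D ℓ ℓ′ = η (det (point ℓ) (point ℓ′))

    incidence : Line → Line → ℤ
    incidence ℓ ℓ′ = ∑K (λ x → ∑K (λ y → weight P ℓ x ℤ.* weight P′ ℓ′ y ℤ.* Σℤ.⟦ (x • point ℓ) 𝕃.≟ (y • point ℓ′ L.+ g) ⟧))

    generic : Line → Line → ℤ
    generic ℓ ℓ′ = T ℓ ℤ.* T′ ℓ′ ℤ.+ S ℓ ℤ.* χ ℓ ℤ.* (S′ ℓ′ ℤ.* χ ℓ′) ℤ.+ (S ℓ ℤ.* (T′ ℓ′ ℤ.* χ ℓ′) ℤ.+ T ℓ ℤ.* χ ℓ ℤ.* S′ ℓ′) ℤ.* D ℓ ℓ′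

    extra : Line → ℤ
    extra ℓ = Σℤ.⟦ ℓ ℙ.≟ ℓ₀ ⟧ ℤ.* (ℤ.+ q ℤ.* (T ℓ ℤ.* T′ ℓ)) ℤ.- (T ℓ ℤ.* T′ ℓ ℤ.+ S ℓ ℤ.* S′ ℓ)

    private
      delta-cong : ∀ {A B : Set} (𝔸 : Enumeration A) (𝔹 : Enumeration B) {a a′ b b′} → (a ≡ a′ → b ≡ b′) → (b ≡ b′ → a ≡ a′) →
                   Σℤ.⟦ Enumeration._≟_ 𝔸 a a′ ⟧ ≡ Σℤ.⟦ Enumeration._≟_ 𝔹 b b′ ⟧
      delta-cong 𝔸 𝔹 {a} {a′} {b} {b′} to from = go (Enumeration._≟_ 𝔸 a a′) (Enumeration._≟_ 𝔹 b b′)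
        where
        go : (d : Dec (a ≡ a′)) (d′ : Dec (b ≡ b′)) → Σℤ.⟦ d ⟧ ≡ Σℤ.⟦ d′ ⟧
        go (yes _) (yes _) = refl
        go (yes e) (no ¬e) = contradiction (to e) ¬e
        go (no ¬e) (yes e) = contradiction (from e) ¬e
        go (no _)  (no _)  = refl

      incidence-≢ : ∀ {ℓ ℓ′} → ℓ ≢ ℓ′ → incidence ℓ ℓ′ ≡ generic ℓ ℓ′
      incidence-≢ {ℓ} {ℓ′} ℓ≢ = begin
        incidence ℓ ℓ′
          ≡⟨ ∑L≡∑K∑K (λ c → ω′ c ℤ.* Σℤ.⟦ (proj₁ c • u) 𝕃.≟ (proj₂ c • v L.+ g) ⟧) ⟨
        ∑L (λ c → ω′ c ℤ.* Σℤ.⟦ (proj₁ c • u) 𝕃.≟ (proj₂ c • v L.+ g) ⟧)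
          ≡⟨ Σℤ.∑-cong 𝕃.elements (λ c → trans (ℤ.*-comm (ω′ c) _) (cong (ℤ._* ω′ c) (delta-cong 𝕃 𝕃 (to c) (from c)))) ⟩
        ∑L (λ c → Σℤ.⟦ c 𝕃.≟ c₀ ⟧ ℤ.* ω′ c)
          ≡⟨ Σℤ.∑-⟦≟⟧ 𝕃 c₀ ω′ ⟩
        ω′ c₀
          ≡⟨ cong₂ (λ a b → (T ℓ ℤ.+ a ℤ.* S ℓ) ℤ.* (T′ ℓ′ ℤ.+ b ℤ.* S′ ℓ′)) (η-coefficient v) (η-coefficient u) ⟩
        (T ℓ ℤ.+ χ ℓ′ ℤ.* D ℓ ℓ′ ℤ.* S ℓ) ℤ.* (T′ ℓ′ ℤ.+ χ ℓ ℤ.* D ℓ ℓ′ ℤ.* S′ ℓ′)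
          ≡⟨ ZS.solve 7 (λ T S T′ S′ a b d → let open ZS in (T :+ b :* d :* S) :* (T′ :+ a :* d :* S′) := T :* T′ :+ S :* a :* (S′ :* b) :* (d :* d) :+ (S :* (T′ :* b) :+ T :* a :* S′) :* d)
               refl (T ℓ) (S ℓ) (T′ ℓ′) (S′ ℓ′) (χ ℓ) (χ ℓ′) (D ℓ ℓ′) ⟩
        T ℓ ℤ.* T′ ℓ′ ℤ.+ S ℓ ℤ.* χ ℓ ℤ.* (S′ ℓ′ ℤ.* χ ℓ′) ℤ.* (D ℓ ℓ′ ℤ.* D ℓ ℓ′) ℤ.+ (S ℓ ℤ.* (T′ ℓ′ ℤ.* χ ℓ′) ℤ.+ T ℓ ℤ.* χ ℓ ℤ.* S′ ℓ′) ℤ.* D ℓ ℓ′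
          ≡⟨ cong (λ x → T ℓ ℤ.* T′ ℓ′ ℤ.+ x ℤ.+ (S ℓ ℤ.* (T′ ℓ′ ℤ.* χ ℓ′) ℤ.+ T ℓ ℤ.* χ ℓ ℤ.* S′ ℓ′) ℤ.* D ℓ ℓ′)
               (trans (cong (λ d → S ℓ ℤ.* χ ℓ ℤ.* (S′ ℓ′ ℤ.* χ ℓ′) ℤ.* d) (η-square D≢0)) (ℤ.*-identityʳ _)) ⟩
        generic ℓ ℓ′ ∎
        where
        u v : L
        u = point ℓ
        v = point ℓ′
        D≢0 : det u v ≢ 0#
        D≢0 = det-point ℓ≢
        ω′ : L → ℤ
        ω′ c = weight P ℓ (proj₁ c) ℤ.* weight P′ ℓ′ (proj₂ c)
        c₀ : L
        c₀ = coefficients u v D≢0 g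
        η-coefficient : ∀ w → η (det g w * det u v ⁻¹) ≡ η (det g w) ℤ.* D ℓ ℓ′
        η-coefficient w = trans (η-* (det g w) (det u v ⁻¹)) (cong (λ t → η (det g w) ℤ.* t) (η-⁻¹ D≢0))
        to : ∀ c → proj₁ c • u ≡ proj₂ c • v L.+ g → c ≡ c₀
        to c eq = trans (sym (coefficients-combination u v D≢0 c)) (cong (coefficients u v D≢0)
          (trans (cong (L._- (proj₂ c • v)) eq) (Lₖ.Solver.solve 2 (λ x g → let open Lₖ.Solver in (x :+ g) :- x := g) refl (proj₂ c • v) g)))
        from : ∀ c → c ≡ c₀ → proj₁ c • u ≡ proj₂ c • v L.+ g
        from c refl = trans (Lₖ.Solver.solve 2 (λ x y → let open Lₖ.Solver in y := x :+ (y :- x)) refl (proj₂ c₀ • v) (proj₁ c₀ • u))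
          (cong (proj₂ c₀ • v L.+_) (combination-coefficients u v D≢0 g))

      χ-ℓ₀ : χ ℓ₀ ≡ 0ℤ
      χ-ℓ₀ = trans (cong η (trans (cong (λ g → det g (point ℓ₀)) g≡) (trans (det-•ˡ γ (point ℓ₀) (point ℓ₀)) (trans (cong (γ *_) (det-self (point ℓ₀))) (zeroʳ γ))))) η-0

      det-g≢0 : ∀ {ℓ} → ℓ ≢ ℓ₀ → det g (point ℓ) ≢ 0#
      det-g≢0 {ℓ} ℓ≢ = subst (_≢ 0#) (sym (trans (cong (λ g → det g (point ℓ)) g≡) (det-•ˡ γ (point ℓ₀) (point ℓ)))) (*-≢0 γ≢0 (det-point (ℓ≢ ∘ sym)))

      D-self : ∀ ℓ → D ℓ ℓ ≡ 0ℤ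
      D-self ℓ = trans (cong η (det-self (point ℓ))) η-0

      generic-self : ∀ ℓ → generic ℓ ℓ ≡ T ℓ ℤ.* T′ ℓ ℤ.+ S ℓ ℤ.* S′ ℓ ℤ.* (χ ℓ ℤ.* χ ℓ)
      generic-self ℓ = trans (cong (λ d → T ℓ ℤ.* T′ ℓ ℤ.+ S ℓ ℤ.* χ ℓ ℤ.* (S′ ℓ ℤ.* χ ℓ) ℤ.+ (S ℓ ℤ.* (T′ ℓ ℤ.* χ ℓ) ℤ.+ T ℓ ℤ.* χ ℓ ℤ.* S′ ℓ) ℤ.* d) (D-self ℓ))
        (ZS.solve 5 (λ T S T′ S′ a → let open ZS in T :* T′ :+ S :* a :* (S′ :* a) :+ (S :* (T′ :* a) :+ T :* a :* S′) :* con 0ℤ := T :* T′ :+ S :* S′ :* (a :* a)) refl (T ℓ) (S ℓ) (T′ ℓ) (S′ ℓ) (χ ℓ))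

      •-+ : ∀ x y u → (x + y) • u ≡ x • u L.+ y • u
      •-+ x y (a , b) = cong₂ _,_ (distribʳ a x y) (distribʳ b x y)

      •-cancel : ∀ {x y} ℓ → x • point ℓ ≡ y • point ℓ → x ≡ y
      •-cancel {x} {y} nothing  eq = trans (sym (*-identityʳ x)) (trans (cong proj₂ eq) (*-identityʳ y))
      •-cancel {x} {y} (just _) eq = trans (sym (*-identityʳ x)) (trans (cong proj₁ eq) (*-identityʳ y))

      incidence-far : ∀ {ℓ} → ℓ ≢ ℓ₀ → incidence ℓ ℓ ≡ 0ℤ
      incidence-far {ℓ} ℓ≢ = trans (Σℤ.∑-cong elements (λ x → trans (Σℤ.∑-cong elements (λ y →
          trans (cong (λ d → weight P ℓ x ℤ.* weight P′ ℓ y ℤ.* d) (𝕃.if-≟-≢ (disjoint x y))) (ℤ.*-zeroʳ (weight P ℓ x ℤ.* weight P′ ℓ y)))) (Σℤ.∑-0 elements))) (Σℤ.∑-0 elements)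
        where
        u = point ℓ
        disjoint : ∀ x y → x • u ≢ y • u L.+ g
        disjoint x y eq = det-g≢0 ℓ≢ (trans (cong (λ g → det g u) (trans (Lₖ.Solver.solve 2 (λ x g → let open Lₖ.Solver in g := (x :+ g) :- x) refl (y • u) g) (cong (L._- (y • u)) (sym eq))))
          (KS.solve 4 (λ x y a b → let open KS in (x :* a :- y :* a) :* b :- (x :* b :- y :* b) :* a := con 0ℤ) refl x y (proj₁ u) (proj₂ u)))

      incidence-ℓ₀ : incidence ℓ₀ ℓ₀ ≡ ℤ.+ q ℤ.* (T ℓ₀ ℤ.* T′ ℓ₀) ℤ.- S ℓ₀ ℤ.* S′ ℓ₀
      incidence-ℓ₀ = begin
        incidence ℓ₀ ℓ₀
          ≡⟨ Σℤ.∑-swap elements elements (λ x y → weight P ℓ₀ x ℤ.* weight P′ ℓ₀ y ℤ.* Σℤ.⟦ (x • u) 𝕃.≟ (y • u L.+ g) ⟧) ⟩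
        ∑K (λ y → ∑K (λ x → weight P ℓ₀ x ℤ.* weight P′ ℓ₀ y ℤ.* Σℤ.⟦ (x • u) 𝕃.≟ (y • u L.+ g) ⟧))
          ≡⟨ Σℤ.∑-cong elements (λ y → trans (Σℤ.∑-cong elements (λ x → trans (ℤ.*-comm (weight P ℓ₀ x ℤ.* weight P′ ℓ₀ y) _) (cong (ℤ._* (weight P ℓ₀ x ℤ.* weight P′ ℓ₀ y)) (delta-cong 𝕃 𝕂 (to x y) (from x y)))))
               (Σℤ.∑-⟦≟⟧ 𝕂 (y + γ) (λ x → weight P ℓ₀ x ℤ.* weight P′ ℓ₀ y))) ⟩
        ∑K (λ y → (a ℤ.+ η (y + γ) ℤ.* b) ℤ.* (a′ ℤ.+ η y ℤ.* b′))
          ≡⟨ Σℤ.∑-cong elements (λ y → ZS.solve 6 (λ a b a′ b′ x y → let open ZS in (a :+ x :* b) :* (a′ :+ y :* b′) := (a :* a′ :+ y :* x :* (b :* b′)) :+ (y :* (a :* b′) :+ x :* (b :* a′))) refl a b a′ b′ (η (y + γ)) (η y)) ⟩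
        ∑K (λ y → (a ℤ.* a′ ℤ.+ η y ℤ.* η (y + γ) ℤ.* (b ℤ.* b′)) ℤ.+ (η y ℤ.* (a ℤ.* b′) ℤ.+ η (y + γ) ℤ.* (b ℤ.* a′)))
          ≡⟨ trans (Σℤ.∑-+ elements (λ y → a ℤ.* a′ ℤ.+ η y ℤ.* η (y + γ) ℤ.* (b ℤ.* b′)) (λ y → η y ℤ.* (a ℤ.* b′) ℤ.+ η (y + γ) ℤ.* (b ℤ.* a′)))
               (cong₂ ℤ._+_ (Σℤ.∑-+ elements (λ _ → a ℤ.* a′) (λ y → η y ℤ.* η (y + γ) ℤ.* (b ℤ.* b′))) (Σℤ.∑-+ elements (λ y → η y ℤ.* (a ℤ.* b′)) (λ y → η (y + γ) ℤ.* (b ℤ.* a′)))) ⟩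
        (∑K (λ _ → a ℤ.* a′) ℤ.+ ∑K (λ y → η y ℤ.* η (y + γ) ℤ.* (b ℤ.* b′))) ℤ.+ (∑K (λ y → η y ℤ.* (a ℤ.* b′)) ℤ.+ ∑K (λ y → η (y + γ) ℤ.* (b ℤ.* a′)))
          ≡⟨ cong₂ ℤ._+_ (cong₂ ℤ._+_ (∑K-constant (a ℤ.* a′)) (pull (λ y → η y ℤ.* η (y + γ)) (b ℤ.* b′) (jacobi γ≢0))) (cong₂ ℤ._+_ (pull η (a ℤ.* b′) ∑-η) (pull (λ y → η (y + γ)) (b ℤ.* a′) shifted)) ⟩
        (ℤ.+ q ℤ.* (a ℤ.* a′) ℤ.+ ℤ.-1ℤ ℤ.* (b ℤ.* b′)) ℤ.+ (0ℤ ℤ.* (a ℤ.* b′) ℤ.+ 0ℤ ℤ.* (b ℤ.* a′))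
          ≡⟨ ZS.solve 5 (λ q a b a′ b′ → let open ZS in (q :* (a :* a′) :+ (:- con 1ℤ) :* (b :* b′)) :+ (con 0ℤ :* (a :* b′) :+ con 0ℤ :* (b :* a′)) := q :* (a :* a′) :- b :* b′) refl (ℤ.+ q) a b a′ b′ ⟩
        ℤ.+ q ℤ.* (a ℤ.* a′) ℤ.- b ℤ.* b′ ∎
        where
        u = point ℓ₀
        a = T ℓ₀
        a′ = T′ ℓ₀
        b = S ℓ₀
        b′ = S′ ℓ₀
        sum≡ : ∀ y → y • u L.+ g ≡ (y + γ) • u
        sum≡ y = trans (cong (y • u L.+_) g≡) (sym (•-+ y γ u))
        to : ∀ x y → x • u ≡ y • u L.+ g → x ≡ y + γ
        to x y eq = •-cancel ℓ₀ (trans eq (sum≡ y))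
        from : ∀ x y → x ≡ y + γ → x • u ≡ y • u L.+ g
        from x y eq = trans (cong (_• u) eq) (sym (sum≡ y))
        pull : ∀ f c {i} → ∑K f ≡ i → ∑K (λ y → f y ℤ.* c) ≡ i ℤ.* c
        pull f c eq = trans (sym (Σℤ.∑-*ʳ elements c f)) (cong (ℤ._* c) eq)
        shifted : ∑K (λ y → η (y + γ)) ≡ 0ℤ
        shifted = trans (Σℤ.∑-cong elements (λ y → cong η (trans (+-comm y γ) (cong (γ +_) (sym (*-identityˡ y)))))) (trans (sym (∑-affine γ (0≢1 ∘ sym) η)) ∑-η)

      incidence-self : ∀ ℓ → Dec (ℓ ≡ ℓ₀) → incidence ℓ ℓ ≡ generic ℓ ℓ ℤ.+ extra ℓ
      incidence-self ℓ (yes refl) = trans incidence-ℓ₀ (sym (trans (cong₂ (λ x y → x ℤ.+ (y ℤ.* (ℤ.+ q ℤ.* (T ℓ ℤ.* T′ ℓ)) ℤ.- (T ℓ ℤ.* T′ ℓ ℤ.+ S ℓ ℤ.* S′ ℓ)))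
          (trans (generic-self ℓ) (cong (λ x → T ℓ ℤ.* T′ ℓ ℤ.+ S ℓ ℤ.* S′ ℓ ℤ.* (x ℤ.* x)) χ-ℓ₀)) (ℙ.if-≟-refl ℓ))
        (ZS.solve 3 (λ q tt ss → let open ZS in (tt :+ ss :* (con 0ℤ :* con 0ℤ)) :+ (con 1ℤ :* (q :* tt) :- (tt :+ ss)) := q :* tt :- ss) refl (ℤ.+ q) (T ℓ ℤ.* T′ ℓ) (S ℓ ℤ.* S′ ℓ))))
      incidence-self ℓ (no ℓ≢) = trans (incidence-far ℓ≢) (sym (trans (cong₂ (λ x y → x ℤ.+ (y ℤ.* (ℤ.+ q ℤ.* (T ℓ ℤ.* T′ ℓ)) ℤ.- (T ℓ ℤ.* T′ ℓ ℤ.+ S ℓ ℤ.* S′ ℓ)))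
          (trans (generic-self ℓ) (cong (λ x → T ℓ ℤ.* T′ ℓ ℤ.+ S ℓ ℤ.* S′ ℓ ℤ.* x) (η-square (det-g≢0 ℓ≢)))) (ℙ.if-≟-≢ ℓ≢))
        (ZS.solve 3 (λ q tt ss → let open ZS in (tt :+ ss :* con 1ℤ) :+ (con 0ℤ :* (q :* tt) :- (tt :+ ss)) := con 0ℤ) refl (ℤ.+ q) (T ℓ ℤ.* T′ ℓ) (S ℓ ℤ.* S′ ℓ))))

      incidence≡ : ∀ ℓ ℓ′ → Dec (ℓ′ ≡ ℓ) → incidence ℓ ℓ′ ≡ generic ℓ ℓ′ ℤ.+ Σℤ.⟦ ℓ′ ℙ.≟ ℓ ⟧ ℤ.* extra ℓ′
      incidence≡ ℓ ℓ′ (yes refl) = trans (incidence-self ℓ (ℓ ℙ.≟ ℓ₀)) (cong (λ t → generic ℓ ℓ ℤ.+ t) (sym (trans (cong (ℤ._* extra ℓ) (ℙ.if-≟-refl ℓ)) (ℤ.*-identityˡ (extra ℓ)))))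
      incidence≡ ℓ ℓ′ (no ℓ′≢ℓ) = trans (incidence-≢ (ℓ′≢ℓ ∘ sym)) (sym (trans (cong (λ x → generic ℓ ℓ′ ℤ.+ x ℤ.* extra ℓ′) (ℙ.if-≟-≢ ℓ′≢ℓ))
        (trans (cong (λ t → generic ℓ ℓ′ ℤ.+ t) (ℤ.*-zeroˡ (extra ℓ′))) (ℤ.+-identityʳ (generic ℓ ℓ′)))))

    diagonal : ℤ
    diagonal = ∑P (λ ℓ → T ℓ ℤ.* T′ ℓ ℤ.+ S ℓ ℤ.* S′ ℓ)

    cross : ℤ
    cross = ∑P (λ ℓ → ∑P (λ ℓ′ → (S ℓ ℤ.* (T′ ℓ′ ℤ.* χ ℓ′) ℤ.+ T ℓ ℤ.* χ ℓ ℤ.* S′ ℓ′) ℤ.* D ℓ ℓ′))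

    private
      χ-sum : ∀ (Q : Profile) → ∑P (λ ℓ → s Q (point ℓ) ℤ.* χ ℓ) ≡ ℤ.- charSum (s Q) g
      χ-sum Q = trans (Σℤ.∑-cong ℙ.elements (λ ℓ → trans (cong (λ x → s Q (point ℓ) ℤ.* x) (trans (cong η (det-swap g (point ℓ))) (η-neg (det (point ℓ) g)))) (sym (ℤ.neg-distribʳ-* (s Q (point ℓ)) (η (det (point ℓ) g))))))
        (Σℤ.∑-neg ℙ.elements (λ ℓ → s Q (point ℓ) ℤ.* η (det (point ℓ) g)))

    spread-correlation : ∑L (λ y → spread P (y L.+ g) ℤ.* spread P′ y) ≡
      ∑t P ℤ.* ∑t P′ ℤ.+ charSum (s P) g ℤ.* charSum (s P′) g ℤ.+ cross ℤ.+ (ℤ.+ q ℤ.* (t P g ℤ.* t P′ g) ℤ.- diagonal)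
    spread-correlation = begin
      ∑L (λ y → spread P (y L.+ g) ℤ.* spread P′ y)
        ≡⟨ Σℤ.∑-cong 𝕃.elements (λ y → ℤ.*-comm (spread P (y L.+ g)) (spread P′ y)) ⟩
      ∑L (λ y → spread P′ y ℤ.* spread P (y L.+ g))
        ≡⟨ Profile.∑L-spread P′ (λ y → spread P (y L.+ g)) ⟩
      ∑P (λ ℓ′ → ∑K (λ y → weight P′ ℓ′ y ℤ.* spread P (y • point ℓ′ L.+ g)))
        ≡⟨ Σℤ.∑-cong ℙ.elements (λ ℓ′ → Σℤ.∑-cong elements (λ y → trans (cong (λ z → weight P′ ℓ′ y ℤ.* z) (resolve (y • point ℓ′ L.+ g)))
             (trans (Σℤ.∑-*ˡ ℙ.elements (weight P′ ℓ′ y) (λ ℓ → ∑K (λ x → weight P ℓ x ℤ.* Σℤ.⟦ (x • point ℓ) 𝕃.≟ (y • point ℓ′ L.+ g) ⟧)))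
               (Σℤ.∑-cong ℙ.elements (λ ℓ → trans (Σℤ.∑-*ˡ elements (weight P′ ℓ′ y) (λ x → weight P ℓ x ℤ.* Σℤ.⟦ (x • point ℓ) 𝕃.≟ (y • point ℓ′ L.+ g) ⟧))
                 (Σℤ.∑-cong elements (λ x → ZS.solve 3 (λ a b c → let open ZS in a :* (b :* c) := b :* a :* c) refl (weight P′ ℓ′ y) (weight P ℓ x) Σℤ.⟦ (x • point ℓ) 𝕃.≟ (y • point ℓ′ L.+ g) ⟧)))))) ) ⟩
      ∑P (λ ℓ′ → ∑K (λ y → ∑P (λ ℓ → ∑K (λ x → I ℓ ℓ′ x y))))
        ≡⟨ Σℤ.∑-cong ℙ.elements (λ ℓ′ → Σℤ.∑-swap elements ℙ.elements (λ y ℓ → ∑K (λ x → I ℓ ℓ′ x y))) ⟩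
      ∑P (λ ℓ′ → ∑P (λ ℓ → ∑K (λ y → ∑K (λ x → I ℓ ℓ′ x y))))
        ≡⟨ Σℤ.∑-swap ℙ.elements ℙ.elements (λ ℓ′ ℓ → ∑K (λ y → ∑K (λ x → I ℓ ℓ′ x y))) ⟩
      ∑P (λ ℓ → ∑P (λ ℓ′ → ∑K (λ y → ∑K (λ x → I ℓ ℓ′ x y))))
        ≡⟨ Σℤ.∑-cong ℙ.elements (λ ℓ → Σℤ.∑-cong ℙ.elements (λ ℓ′ → trans (Σℤ.∑-swap elements elements (λ y x → I ℓ ℓ′ x y)) (incidence≡ ℓ ℓ′ (ℓ′ ℙ.≟ ℓ)))) ⟩
      ∑P (λ ℓ → ∑P (λ ℓ′ → generic ℓ ℓ′ ℤ.+ Σℤ.⟦ ℓ′ ℙ.≟ ℓ ⟧ ℤ.* extra ℓ′))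
        ≡⟨ Σℤ.∑-cong ℙ.elements (λ ℓ → trans (Σℤ.∑-+ ℙ.elements (generic ℓ) (λ ℓ′ → Σℤ.⟦ ℓ′ ℙ.≟ ℓ ⟧ ℤ.* extra ℓ′)) (cong (λ z → ∑P (generic ℓ) ℤ.+ z) (Σℤ.∑-⟦≟⟧ ℙ ℓ extra))) ⟩
      ∑P (λ ℓ → ∑P (generic ℓ) ℤ.+ extra ℓ)
        ≡⟨ Σℤ.∑-+ ℙ.elements (λ ℓ → ∑P (generic ℓ)) extra ⟩
      ∑P (λ ℓ → ∑P (generic ℓ)) ℤ.+ ∑P extra
        ≡⟨ cong₂ ℤ._+_ ∑generic ∑extra ⟩
      (∑t P ℤ.* ∑t P′ ℤ.+ charSum (s P) g ℤ.* charSum (s P′) g ℤ.+ cross) ℤ.+ (ℤ.+ q ℤ.* (t P g ℤ.* t P′ g) ℤ.- diagonal) ∎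
      where
      I : Line → Line → K → K → ℤ
      I ℓ ℓ′ x y = weight P ℓ x ℤ.* weight P′ ℓ′ y ℤ.* Σℤ.⟦ (x • point ℓ) 𝕃.≟ (y • point ℓ′ L.+ g) ⟧
      resolve : ∀ z → spread P z ≡ ∑P (λ ℓ → ∑K (λ x → weight P ℓ x ℤ.* Σℤ.⟦ (x • point ℓ) 𝕃.≟ z ⟧))
      resolve z = trans (sym (Σℤ.∑-⟦≟⟧ 𝕃 z (spread P))) (trans (Σℤ.∑-cong 𝕃.elements (λ y → ℤ.*-comm Σℤ.⟦ y 𝕃.≟ z ⟧ (spread P y))) (Profile.∑L-spread P (λ y → Σℤ.⟦ y 𝕃.≟ z ⟧)))
      a₁ a₂ a₃ : Line → Line → ℤ
      a₁ ℓ ℓ′ = T ℓ ℤ.* T′ ℓ′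
      a₂ ℓ ℓ′ = S ℓ ℤ.* χ ℓ ℤ.* (S′ ℓ′ ℤ.* χ ℓ′)
      a₃ ℓ ℓ′ = (S ℓ ℤ.* (T′ ℓ′ ℤ.* χ ℓ′) ℤ.+ T ℓ ℤ.* χ ℓ ℤ.* S′ ℓ′) ℤ.* D ℓ ℓ′
      ∑generic : ∑P (λ ℓ → ∑P (generic ℓ)) ≡ ∑t P ℤ.* ∑t P′ ℤ.+ charSum (s P) g ℤ.* charSum (s P′) g ℤ.+ cross
      ∑generic = begin
        ∑P (λ ℓ → ∑P (generic ℓ))
          ≡⟨ Σℤ.∑-cong ℙ.elements (λ ℓ → trans (Σℤ.∑-+ ℙ.elements (λ ℓ′ → a₁ ℓ ℓ′ ℤ.+ a₂ ℓ ℓ′) (a₃ ℓ)) (cong (ℤ._+ ∑P (a₃ ℓ)) (Σℤ.∑-+ ℙ.elements (a₁ ℓ) (a₂ ℓ)))) ⟩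
        ∑P (λ ℓ → ∑P (a₁ ℓ) ℤ.+ ∑P (a₂ ℓ) ℤ.+ ∑P (a₃ ℓ))
          ≡⟨ trans (Σℤ.∑-+ ℙ.elements (λ ℓ → ∑P (a₁ ℓ) ℤ.+ ∑P (a₂ ℓ)) (λ ℓ → ∑P (a₃ ℓ))) (cong (ℤ._+ cross) (Σℤ.∑-+ ℙ.elements (λ ℓ → ∑P (a₁ ℓ)) (λ ℓ → ∑P (a₂ ℓ)))) ⟩
        ∑P (λ ℓ → ∑P (a₁ ℓ)) ℤ.+ ∑P (λ ℓ → ∑P (a₂ ℓ)) ℤ.+ cross
          ≡⟨ cong₂ (λ x y → x ℤ.+ y ℤ.+ cross) (sym (Σℤ.∑-*-∑ ℙ.elements ℙ.elements T T′)) (trans (sym (Σℤ.∑-*-∑ ℙ.elements ℙ.elements (λ ℓ → S ℓ ℤ.* χ ℓ) (λ ℓ → S′ ℓ ℤ.* χ ℓ)))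
               (trans (cong₂ ℤ._*_ (χ-sum P) (χ-sum P′)) (ZS.solve 2 (λ a b → let open ZS in (:- a) :* (:- b) := a :* b) refl (charSum (s P) g) (charSum (s P′) g)))) ⟩
        ∑t P ℤ.* ∑t P′ ℤ.+ charSum (s P) g ℤ.* charSum (s P′) g ℤ.+ cross ∎
      ∑extra : ∑P extra ≡ ℤ.+ q ℤ.* (t P g ℤ.* t P′ g) ℤ.- diagonal
      ∑extra = trans (Σℤ.∑-+ ℙ.elements (λ ℓ → Σℤ.⟦ ℓ ℙ.≟ ℓ₀ ⟧ ℤ.* (ℤ.+ q ℤ.* (T ℓ ℤ.* T′ ℓ))) (λ ℓ → ℤ.- (T ℓ ℤ.* T′ ℓ ℤ.+ S ℓ ℤ.* S′ ℓ)))
        (cong₂ ℤ._+_ (trans (Σℤ.∑-⟦≟⟧ ℙ ℓ₀ (λ ℓ → ℤ.+ q ℤ.* (T ℓ ℤ.* T′ ℓ))) (cong₂ (λ a b → ℤ.+ q ℤ.* (a ℤ.* b)) (t-g P) (t-g P′)))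
                     (Σℤ.∑-neg ℙ.elements (λ ℓ → T ℓ ℤ.* T′ ℓ ℤ.+ S ℓ ℤ.* S′ ℓ)))
        where
        t-g : ∀ (Q : Profile) → t Q (point ℓ₀) ≡ t Q g
        t-g Q = sym (trans (cong (t Q) g≡) (t-• Q γ≢0))

  cross-antisymmetric : ∀ P P′ {g} (g≢0 : g ≢ L.0#) → cross P′ P g≢0 ≡ ℤ.- cross P P′ g≢0
  cross-antisymmetric P P′ {g} g≢0 = trans (Σℤ.∑-swap ℙ.elements ℙ.elements (term P′ P)) (trans
    (Σℤ.∑-cong ℙ.elements (λ ℓ → trans (Σℤ.∑-cong ℙ.elements (λ ℓ′ → flip ℓ ℓ′)) (Σℤ.∑-neg ℙ.elements (term P P′ ℓ)))) (Σℤ.∑-neg ℙ.elements (λ ℓ → ∑P (term P P′ ℓ))))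
    where
    χ : Line → ℤ
    χ ℓ = η (det g (point ℓ))
    term : Profile → Profile → Line → Line → ℤ
    term P P′ ℓ ℓ′ = (s P (point ℓ) ℤ.* (t P′ (point ℓ′) ℤ.* χ ℓ′) ℤ.+ t P (point ℓ) ℤ.* χ ℓ ℤ.* s P′ (point ℓ′)) ℤ.* η (det (point ℓ) (point ℓ′))
    flip : ∀ ℓ ℓ′ → term P′ P ℓ′ ℓ ≡ ℤ.- term P P′ ℓ ℓ′
    flip ℓ ℓ′ = trans (cong (λ d → (s P′ (point ℓ′) ℤ.* (t P (point ℓ) ℤ.* χ ℓ) ℤ.+ t P′ (point ℓ′) ℤ.* χ ℓ′ ℤ.* s P (point ℓ)) ℤ.* d) (trans (cong η (det-swap (point ℓ′) (point ℓ))) (η-neg (det (point ℓ) (point ℓ′)))))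
      (ZS.solve 7 (λ s t s′ t′ x x′ d → let open ZS in (s′ :* (t :* x) :+ t′ :* x′ :* s) :* (:- d) := :- ((s :* (t′ :* x′) :+ t :* x :* s′) :* d)) refl
        (s P (point ℓ)) (t P (point ℓ)) (s P′ (point ℓ′)) (t P′ (point ℓ′)) (χ ℓ) (χ ℓ′) (η (det (point ℓ) (point ℓ′))))

  correlate : (L → ℤ) → (L → ℤ) → L → ℤ
  correlate f f′ g = ∑L (λ y → f (y L.+ g) ℤ.* f′ y)

  translate : ∀ g f → ∑L (λ y → f (y L.+ g)) ≡ ∑L f
  translate g f = sym (Σℤ.∑-bijection 𝕃 𝕃 (L._+ g) (L._- g)
    (λ y → Lₖ.Solver.solve 2 (λ y g → let open Lₖ.Solver in (y :+ g) :- g := y) refl y g)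
    (λ y → Lₖ.Solver.solve 2 (λ y g → let open Lₖ.Solver in (y :- g) :+ g := y) refl y g) f)

  correlate-doubled : ∀ P P′ {g} → g ≢ L.0# → correlate (doubled P) (doubled P′) g ≡
    total P ℤ.+ total P′ ℤ.- ℤ.+ q ℤ.* ℤ.+ q ℤ.+ (κ P ℤ.* spread P′ (L.- g) ℤ.+ κ P′ ℤ.* spread P g) ℤ.+ ∑L (λ y → spread P (y L.+ g) ℤ.* spread P′ y)
  correlate-doubled P P′ {g} g≢0 = begin
    correlate (doubled P) (doubled P′) g
      ≡⟨ Σℤ.∑-cong 𝕃.elements (λ y → trans (ZS.solve 6 (λ k d f k′ d′ f′ → let open ZS ; F = con 1ℤ :+ (k :* d :+ f) ; F′ = con 1ℤ :+ (k′ :* d′ :+ f′) in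
           F :* F′ := (F :+ F′ :+ (:- con 1ℤ)) :+ (d :* (k :* f′) :+ d′ :* (k′ :* f)) :+ (f :* f′ :+ d :* (k :* (k′ :* d′)))) refl (κ P) (δ (y L.+ g)) (spread P (y L.+ g)) (κ P′) (δ y) (spread P′ y))
           (cong₂ ℤ._+_ (cong (λ z → (doubled P (y L.+ g) ℤ.+ doubled P′ y ℤ.+ ℤ.-1ℤ) ℤ.+ z) (cong (λ z → z ℤ.* (κ P ℤ.* spread P′ y) ℤ.+ δ y ℤ.* (κ P′ ℤ.* spread P (y L.+ g))) (δ-shift y)))
             (trans (cong (λ z → spread P (y L.+ g) ℤ.* spread P′ y ℤ.+ z) (no-collision y)) (ℤ.+-identityʳ _)))) ⟩
    ∑L (λ y → (b₁ y ℤ.+ b₂ y ℤ.+ b₃ y) ℤ.+ (b₄ y ℤ.+ b₅ y) ℤ.+ b₆ y)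
      ≡⟨ trans (Σℤ.∑-+ 𝕃.elements (λ y → (b₁ y ℤ.+ b₂ y ℤ.+ b₃ y) ℤ.+ (b₄ y ℤ.+ b₅ y)) b₆) (cong (ℤ._+ ∑L b₆)
           (trans (Σℤ.∑-+ 𝕃.elements (λ y → b₁ y ℤ.+ b₂ y ℤ.+ b₃ y) (λ y → b₄ y ℤ.+ b₅ y)) (cong₂ ℤ._+_
             (trans (Σℤ.∑-+ 𝕃.elements (λ y → b₁ y ℤ.+ b₂ y) b₃) (cong (ℤ._+ ∑L b₃) (Σℤ.∑-+ 𝕃.elements b₁ b₂))) (Σℤ.∑-+ 𝕃.elements b₄ b₅)))) ⟩
    (∑L b₁ ℤ.+ ∑L b₂ ℤ.+ ∑L b₃) ℤ.+ (∑L b₄ ℤ.+ ∑L b₅) ℤ.+ ∑L b₆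
      ≡⟨ cong (ℤ._+ ∑L b₆) (cong₂ ℤ._+_ (cong₂ ℤ._+_ (cong₂ ℤ._+_ (trans (translate g (doubled P)) (Profile.∑L-doubled P)) (Profile.∑L-doubled P′)) ∑b₃)
           (cong₂ ℤ._+_ (Σℤ.∑-⟦≟⟧ 𝕃 (L.- g) (λ y → κ P ℤ.* spread P′ y)) (trans (Σℤ.∑-⟦≟⟧ 𝕃 L.0# (λ y → κ P′ ℤ.* spread P (y L.+ g))) (cong (λ z → κ P′ ℤ.* spread P z) (L.+-identityˡ g))))) ⟩
    total P ℤ.+ total P′ ℤ.- ℤ.+ q ℤ.* ℤ.+ q ℤ.+ (κ P ℤ.* spread P′ (L.- g) ℤ.+ κ P′ ℤ.* spread P g) ℤ.+ ∑L b₆ ∎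
    where
    δ : L → ℤ
    δ y = Σℤ.⟦ y 𝕃.≟ L.0# ⟧
    b₁ b₂ b₃ b₄ b₅ b₆ : L → ℤ
    b₁ y = doubled P (y L.+ g)
    b₂ y = doubled P′ y
    b₃ y = ℤ.-1ℤ
    b₄ y = Σℤ.⟦ y 𝕃.≟ (L.- g) ⟧ ℤ.* (κ P ℤ.* spread P′ y)
    b₅ y = δ y ℤ.* (κ P′ ℤ.* spread P (y L.+ g))
    b₆ y = spread P (y L.+ g) ℤ.* spread P′ y
    ∑b₃ : ∑L b₃ ≡ ℤ.- (ℤ.+ q ℤ.* ℤ.+ q)
    ∑b₃ = trans (Σℤ.∑-neg 𝕃.elements (λ _ → 1ℤ)) (cong ℤ.-_ (Profile.∑L-1 P))
    to : ∀ y → y L.+ g ≡ L.0# → y ≡ L.- g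
    to y eq = trans (Lₖ.Solver.solve 2 (λ y g → let open Lₖ.Solver in y := (y :+ g) :- g) refl y g) (trans (cong (L._- g) eq) (L.+-identityˡ (L.- g)))
    from : ∀ y → y ≡ L.- g → y L.+ g ≡ L.0#
    from y refl = L.-‿inverseˡ g
    δ-shift : ∀ y → δ (y L.+ g) ≡ Σℤ.⟦ y 𝕃.≟ (L.- g) ⟧
    δ-shift y = go ((y L.+ g) 𝕃.≟ L.0#) (y 𝕃.≟ (L.- g))
      where
      go : (d : Dec (y L.+ g ≡ L.0#)) (d′ : Dec (y ≡ L.- g)) → Σℤ.⟦ d ⟧ ≡ Σℤ.⟦ d′ ⟧
      go (yes _) (yes _) = refl
      go (yes e) (no ¬e) = contradiction (to y e) ¬e
      go (no ¬e) (yes e) = contradiction (from y e) ¬e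
      go (no _)  (no _)  = refl
    no-collision : ∀ y → δ (y L.+ g) ℤ.* (κ P ℤ.* (κ P′ ℤ.* δ y)) ≡ 0ℤ
    no-collision y = go (y 𝕃.≟ L.0#)
      where
      go : Dec (y ≡ L.0#) → δ (y L.+ g) ℤ.* (κ P ℤ.* (κ P′ ℤ.* δ y)) ≡ 0ℤ
      go (yes refl) = trans (cong (ℤ._* (κ P ℤ.* (κ P′ ℤ.* δ L.0#))) (trans (cong δ (L.+-identityˡ g)) (𝕃.if-≟-≢ g≢0))) (ℤ.*-zeroˡ (κ P ℤ.* (κ P′ ℤ.* δ L.0#)))
      go (no y≢0) = trans (cong (λ z → δ (y L.+ g) ℤ.* (κ P ℤ.* (κ P′ ℤ.* z))) (𝕃.if-≟-≢ y≢0)) (ZS.solve 3 (λ a b c → let open ZS in a :* (b :* (c :* con 0ℤ)) := con 0ℤ) refl (δ (y L.+ g)) (κ P) (κ P′))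

  common : Profile → Profile → ℤ
  common P P′ = ∑P (λ ℓ → t P (point ℓ) ℤ.* t P′ (point ℓ) ℤ.+ s P (point ℓ) ℤ.* s P′ (point ℓ))

  symmetricCorrelation : Profile → Profile → L → ℤ
  symmetricCorrelation P P′ g = total P ℤ.+ total P′ ℤ.- ℤ.+ q ℤ.* ℤ.+ q ℤ.+ (κ P ℤ.* t P′ g ℤ.+ κ P′ ℤ.* t P g)
    ℤ.+ (∑t P ℤ.* ∑t P′ ℤ.+ charSum (s P) g ℤ.* charSum (s P′) g ℤ.+ (ℤ.+ q ℤ.* (t P g ℤ.* t P′ g) ℤ.- common P P′))

  common-comm : ∀ P P′ → common P P′ ≡ common P′ P
  common-comm P P′ = Σℤ.∑-cong ℙ.elements (λ ℓ → cong₂ ℤ._+_ (ℤ.*-comm (t P (point ℓ)) (t P′ (point ℓ))) (ℤ.*-comm (s P (point ℓ)) (s P′ (point ℓ))))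

  correlate-symmetric : ∀ P P′ {g} → g ≢ L.0# →
    correlate (doubled P) (doubled P′) g ℤ.+ correlate (doubled P′) (doubled P) g ≡ symmetricCorrelation P P′ g ℤ.+ symmetricCorrelation P P′ g
  correlate-symmetric P P′ {g} g≢0 = trans (cong₂ ℤ._+_ (expanded P P′) (expanded P′ P))
    (trans (cong₂ (λ x y → (total P ℤ.+ total P′ ℤ.- Q ℤ.+ (κ P ℤ.* (t P′ g ℤ.- s P′ g) ℤ.+ κ P′ ℤ.* (t P g ℤ.+ s P g)) ℤ.+ (∑t P ℤ.* ∑t P′ ℤ.+ c P ℤ.* c P′ ℤ.+ cross P P′ g≢0 ℤ.+ (ℤ.+ q ℤ.* (t P g ℤ.* t P′ g) ℤ.- common P P′)))
        ℤ.+ (total P′ ℤ.+ total P ℤ.- Q ℤ.+ (κ P′ ℤ.* (t P g ℤ.- s P g) ℤ.+ κ P ℤ.* (t P′ g ℤ.+ s P′ g)) ℤ.+ (∑t P′ ℤ.* ∑t P ℤ.+ c P′ ℤ.* c P ℤ.+ x ℤ.+ (ℤ.+ q ℤ.* (t P′ g ℤ.* t P g) ℤ.- y))))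
      (cross-antisymmetric P P′ g≢0) (common-comm P′ P))
    (solve 16 (λ T T′ Q k k′ t t′ s s′ u u′ c c′ x q o →
        (T :+ T′ :- Q :+ (k :* (t′ :- s′) :+ k′ :* (t :+ s)) :+ (u :* u′ :+ c :* c′ :+ x :+ (q :* (t :* t′) :- o)))
        :+ (T′ :+ T :- Q :+ (k′ :* (t :- s) :+ k :* (t′ :+ s′)) :+ (u′ :* u :+ c′ :* c :+ (:- x) :+ (q :* (t′ :* t) :- o)))
        := (T :+ T′ :- Q :+ (k :* t′ :+ k′ :* t) :+ (u :* u′ :+ c :* c′ :+ (q :* (t :* t′) :- o)))
        :+ (T :+ T′ :- Q :+ (k :* t′ :+ k′ :* t) :+ (u :* u′ :+ c :* c′ :+ (q :* (t :* t′) :- o)))) refl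
      (total P) (total P′) Q (κ P) (κ P′) (t P g) (t P′ g) (s P g) (s P′ g) (∑t P) (∑t P′) (c P) (c P′) (cross P P′ g≢0) (ℤ.+ q) (common P P′)))
    where
    open ZS
    Q : ℤ
    Q = ℤ.+ q ℤ.* ℤ.+ q
    c : Profile → ℤ
    c P = charSum (s P) g
    expanded : ∀ P P′ → correlate (doubled P) (doubled P′) g ≡ total P ℤ.+ total P′ ℤ.- Q ℤ.+ (κ P ℤ.* (t P′ g ℤ.- s P′ g) ℤ.+ κ P′ ℤ.* (t P g ℤ.+ s P g))
      ℤ.+ (∑t P ℤ.* ∑t P′ ℤ.+ c P ℤ.* c P′ ℤ.+ cross P P′ g≢0 ℤ.+ (ℤ.+ q ℤ.* (t P g ℤ.* t P′ g) ℤ.- common P P′))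
    expanded P P′ = trans (correlate-doubled P P′ g≢0) (cong₂ (λ x y → total P ℤ.+ total P′ ℤ.- Q ℤ.+ x ℤ.+ y)
      (cong₂ (λ x y → κ P ℤ.* x ℤ.+ κ P′ ℤ.* y) (trans (Profile.spread-≢0 P′ (neg-≢0 g≢0)) (cong₂ ℤ._+_ (t-neg P′ g) (s-neg P′ g))) (Profile.spread-≢0 P g≢0)) (spread-correlation P P′ g≢0))

  correlate-self : ∀ P {g} → g ≢ L.0# → correlate (doubled P) (doubled P) g ≡ symmetricCorrelation P P g
  correlate-self P {g} g≢0 = ℤ.*-cancelˡ-≡ (ℤ.+ 2) _ _ (trans (double (correlate (doubled P) (doubled P) g)) (trans (correlate-symmetric P P g≢0) (sym (double (symmetricCorrelation P P g)))))
    where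
    double : ∀ i → ℤ.+ 2 ℤ.* i ≡ i ℤ.+ i
    double = ZS.solve 1 (λ i → let open ZS in con (ℤ.+ 2) :* i := i :+ i) refl

  origin : Profile → ℤ
  origin P = 1ℤ ℤ.+ (κ P ℤ.+ ∑t P)

  doubled-0 : ∀ P → doubled P L.0# ≡ origin P
  doubled-0 P = cong₂ (λ x y → 1ℤ ℤ.+ (x ℤ.+ y)) (trans (cong (λ b → κ P ℤ.* b) (𝕃.if-≟-refl L.0#)) (ℤ.*-identityʳ (κ P))) (Profile.spread-0 P)

  doubled-≢0 : ∀ P {y} → y ≢ L.0# → doubled P y ≡ 1ℤ ℤ.+ (t P y ℤ.+ s P y)
  doubled-≢0 P {y} y≢0 = cong (λ z → 1ℤ ℤ.+ z) (trans (cong₂ (λ b z → κ P ℤ.* b ℤ.+ z) (𝕃.if-≟-≢ y≢0) (Profile.spread-≢0 P y≢0)) (trans (cong (ℤ._+ (t P y ℤ.+ s P y)) (ℤ.*-zeroʳ (κ P))) (ℤ.+-identityˡ (t P y ℤ.+ s P y))))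

  correlate-0 : ∀ P P′ → correlate (doubled P) (doubled P′) L.0# ≡ origin P ℤ.* origin P′ ℤ.+ q-1 ℤ.* (ℤ.+ 4 ℤ.* ℤ.+ m ℤ.+ ∑t P ℤ.+ ∑t P′ ℤ.+ common P P′)
  correlate-0 P P′ = begin
    ∑L (λ y → doubled P (y L.+ L.0#) ℤ.* doubled P′ y)
      ≡⟨ Σℤ.∑-cong 𝕃.elements (λ y → trans (cong (λ z → doubled P z ℤ.* doubled P′ y) (L.+-identityʳ y)) (split y (y 𝕃.≟ L.0#))) ⟩
    ∑L (λ y → Σℤ.⟦ y 𝕃.≟ L.0# ⟧ ℤ.* (origin P ℤ.* origin P′) ℤ.+ G y)
      ≡⟨ Σℤ.∑-+ 𝕃.elements (λ y → Σℤ.⟦ y 𝕃.≟ L.0# ⟧ ℤ.* (origin P ℤ.* origin P′)) G ⟩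
    ∑L (λ y → Σℤ.⟦ y 𝕃.≟ L.0# ⟧ ℤ.* (origin P ℤ.* origin P′)) ℤ.+ ∑L G
      ≡⟨ cong₂ ℤ._+_ (Σℤ.∑-⟦≟⟧ 𝕃 L.0# (λ _ → origin P ℤ.* origin P′)) (∑L-polar G (onL-0 (λ y → (1ℤ ℤ.+ (t P y ℤ.+ s P y)) ℤ.* (1ℤ ℤ.+ (t P′ y ℤ.+ s P′ y))))) ⟩
    origin P ℤ.* origin P′ ℤ.+ ∑P (λ ℓ → ∑K (λ x → nonzero x ℤ.* G (x • point ℓ)))
      ≡⟨ cong (λ z → origin P ℤ.* origin P′ ℤ.+ z) (trans (Σℤ.∑-cong ℙ.elements line) (sym (Σℤ.∑-*ˡ ℙ.elements q-1 (λ ℓ → 1ℤ ℤ.+ T ℓ ℤ.+ T′ ℓ ℤ.+ o ℓ)))) ⟩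
    origin P ℤ.* origin P′ ℤ.+ q-1 ℤ.* ∑P (λ ℓ → 1ℤ ℤ.+ T ℓ ℤ.+ T′ ℓ ℤ.+ o ℓ)
      ≡⟨ cong (λ z → origin P ℤ.* origin P′ ℤ.+ q-1 ℤ.* z) (trans (Σℤ.∑-+ ℙ.elements (λ ℓ → 1ℤ ℤ.+ T ℓ ℤ.+ T′ ℓ) o) (cong (ℤ._+ common P P′)
           (trans (Σℤ.∑-+ ℙ.elements (λ ℓ → 1ℤ ℤ.+ T ℓ) T′) (cong (ℤ._+ ∑t P′) (trans (Σℤ.∑-+ ℙ.elements (λ _ → 1ℤ) T) (cong (ℤ._+ ∑t P) (trans (∑P-constant 1ℤ) (cong (λ z → ℤ.+ 4 ℤ.* z) (ℤ.*-identityʳ (ℤ.+ m)))))))))) ⟩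
    origin P ℤ.* origin P′ ℤ.+ q-1 ℤ.* (ℤ.+ 4 ℤ.* ℤ.+ m ℤ.+ ∑t P ℤ.+ ∑t P′ ℤ.+ common P P′) ∎
    where
    T T′ o : Line → ℤ
    T = t P ∘ point
    T′ = t P′ ∘ point
    o ℓ = t P (point ℓ) ℤ.* t P′ (point ℓ) ℤ.+ s P (point ℓ) ℤ.* s P′ (point ℓ)
    onL : (L → ℤ) → L → ℤ
    onL f y = if does (y 𝕃.≟ L.0#) then 0ℤ else f y
    onL-0 : ∀ f → onL f L.0# ≡ 0ℤ
    onL-0 f = 𝕃.if-≟-refl L.0#
    G : L → ℤ
    G = onL (λ y → (1ℤ ℤ.+ (t P y ℤ.+ s P y)) ℤ.* (1ℤ ℤ.+ (t P′ y ℤ.+ s P′ y)))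
    split : ∀ y → Dec (y ≡ L.0#) → doubled P y ℤ.* doubled P′ y ≡ Σℤ.⟦ y 𝕃.≟ L.0# ⟧ ℤ.* (origin P ℤ.* origin P′) ℤ.+ G y
    split y (yes refl) = trans (cong₂ ℤ._*_ (doubled-0 P) (doubled-0 P′)) (sym (trans (cong₂ (λ b g → b ℤ.* (origin P ℤ.* origin P′) ℤ.+ g) (𝕃.if-≟-refl L.0#) (𝕃.if-≟-refl L.0#)) (trans (ℤ.+-identityʳ _) (ℤ.*-identityˡ (origin P ℤ.* origin P′)))))
    split y (no y≢0) = trans (cong₂ ℤ._*_ (doubled-≢0 P y≢0) (doubled-≢0 P′ y≢0)) (sym (trans (cong₂ (λ b g → b ℤ.* (origin P ℤ.* origin P′) ℤ.+ g) (𝕃.if-≟-≢ y≢0) (𝕃.if-≟-≢ y≢0)) (trans (cong (ℤ._+ r) (ℤ.*-zeroˡ (origin P ℤ.* origin P′))) (ℤ.+-identityˡ r))))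
      where r = (1ℤ ℤ.+ (t P y ℤ.+ s P y)) ℤ.* (1ℤ ℤ.+ (t P′ y ℤ.+ s P′ y))
    line : ∀ ℓ → ∑K (λ x → nonzero x ℤ.* G (x • point ℓ)) ≡ q-1 ℤ.* (1ℤ ℤ.+ T ℓ ℤ.+ T′ ℓ ℤ.+ o ℓ)
    line ℓ = begin
      ∑K (λ x → nonzero x ℤ.* G (x • u))
        ≡⟨ Σℤ.∑-cong elements (λ x → trans (nonzero-cong (at x)) (distribute x (x ≟ 0#))) ⟩
      ∑K (λ x → nonzero x ℤ.* (1ℤ ℤ.+ T ℓ ℤ.+ T′ ℓ ℤ.+ o ℓ) ℤ.+ η x ℤ.* c)
        ≡⟨ Σℤ.∑-+ elements (λ x → nonzero x ℤ.* (1ℤ ℤ.+ T ℓ ℤ.+ T′ ℓ ℤ.+ o ℓ)) (λ x → η x ℤ.* c) ⟩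
      ∑K (λ x → nonzero x ℤ.* (1ℤ ℤ.+ T ℓ ℤ.+ T′ ℓ ℤ.+ o ℓ)) ℤ.+ ∑K (λ x → η x ℤ.* c)
        ≡⟨ cong₂ ℤ._+_ (trans (sym (Σℤ.∑-*ʳ elements (1ℤ ℤ.+ T ℓ ℤ.+ T′ ℓ ℤ.+ o ℓ) nonzero)) (cong (ℤ._* (1ℤ ℤ.+ T ℓ ℤ.+ T′ ℓ ℤ.+ o ℓ)) ∑K-nonzero))
                       (trans (sym (Σℤ.∑-*ʳ elements c η)) (trans (cong (ℤ._* c) ∑-η) (ℤ.*-zeroˡ c))) ⟩
      q-1 ℤ.* (1ℤ ℤ.+ T ℓ ℤ.+ T′ ℓ ℤ.+ o ℓ) ℤ.+ 0ℤ
        ≡⟨ ℤ.+-identityʳ _ ⟩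
      q-1 ℤ.* (1ℤ ℤ.+ T ℓ ℤ.+ T′ ℓ ℤ.+ o ℓ) ∎
      where
      u = point ℓ
      S = s P u
      S′ = s P′ u
      c = S ℤ.* (1ℤ ℤ.+ T′ ℓ) ℤ.+ S′ ℤ.* (1ℤ ℤ.+ T ℓ)
      at : ∀ x → x ≢ 0# → G (x • u) ≡ (1ℤ ℤ.+ (T ℓ ℤ.+ η x ℤ.* S)) ℤ.* (1ℤ ℤ.+ (T′ ℓ ℤ.+ η x ℤ.* S′))
      at x x≢0 = trans (𝕃.if-≟-≢ (•-≢0 x≢0 (point≢0 ℓ))) (cong₂ (λ a b → (1ℤ ℤ.+ a) ℤ.* (1ℤ ℤ.+ b)) (cong₂ ℤ._+_ (t-• P x≢0) (s-• P x≢0)) (cong₂ ℤ._+_ (t-• P′ x≢0) (s-• P′ x≢0)))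
      distribute : ∀ x → Dec (x ≡ 0#) → nonzero x ℤ.* ((1ℤ ℤ.+ (T ℓ ℤ.+ η x ℤ.* S)) ℤ.* (1ℤ ℤ.+ (T′ ℓ ℤ.+ η x ℤ.* S′))) ≡ nonzero x ℤ.* (1ℤ ℤ.+ T ℓ ℤ.+ T′ ℓ ℤ.+ o ℓ) ℤ.+ η x ℤ.* c
      distribute x (yes refl) = trans (cong (ℤ._* ((1ℤ ℤ.+ (T ℓ ℤ.+ η 0# ℤ.* S)) ℤ.* (1ℤ ℤ.+ (T′ ℓ ℤ.+ η 0# ℤ.* S′)))) nonzero-0) (trans (ℤ.*-zeroˡ ((1ℤ ℤ.+ (T ℓ ℤ.+ η 0# ℤ.* S)) ℤ.* (1ℤ ℤ.+ (T′ ℓ ℤ.+ η 0# ℤ.* S′))))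
        (sym (trans (cong₂ (λ a b → a ℤ.* (1ℤ ℤ.+ T ℓ ℤ.+ T′ ℓ ℤ.+ o ℓ) ℤ.+ b ℤ.* c) nonzero-0 η-0) (ZS.solve 2 (λ a b → let open ZS in con 0ℤ :* a :+ con 0ℤ :* b := con 0ℤ) refl (1ℤ ℤ.+ T ℓ ℤ.+ T′ ℓ ℤ.+ o ℓ) c))))
      distribute x (no x≢0) = trans (cong (ℤ._* ((1ℤ ℤ.+ (T ℓ ℤ.+ η x ℤ.* S)) ℤ.* (1ℤ ℤ.+ (T′ ℓ ℤ.+ η x ℤ.* S′)))) (nonzero-≢0 x≢0))
        (trans (ZS.solve 5 (λ a b a′ b′ e → let open ZS in con 1ℤ :* ((con 1ℤ :+ (a :+ e :* b)) :* (con 1ℤ :+ (a′ :+ e :* b′))) := (con 1ℤ :+ a :+ a′ :+ (a :* a′ :+ (e :* e) :* (b :* b′))) :+ e :* (b :* (con 1ℤ :+ a′) :+ b′ :* (con 1ℤ :+ a))) refl (T ℓ) S (T′ ℓ) S′ (η x))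
        (cong (ℤ._+ η x ℤ.* c) (trans (cong (λ e → 1ℤ ℤ.+ T ℓ ℤ.+ T′ ℓ ℤ.+ (T ℓ ℤ.* T′ ℓ ℤ.+ e)) (trans (cong (ℤ._* (S ℤ.* S′)) (η-square x≢0)) (ℤ.*-identityˡ (S ℤ.* S′))))
          (sym (trans (cong (ℤ._* (1ℤ ℤ.+ T ℓ ℤ.+ T′ ℓ ℤ.+ o ℓ)) (nonzero-≢0 x≢0)) (ℤ.*-identityˡ (1ℤ ℤ.+ T ℓ ℤ.+ T′ ℓ ℤ.+ o ℓ)))))))

module Blocks (𝕊 : Setting) (σ : ℤ) (σ-unit : σ ≡ 1ℤ ⊎ σ ≡ ℤ.-1ℤ)
  (four : (CharacterSums.β 𝕊 ℤ.- σ ℤ.* CharacterSums.α 𝕊) ℤ.* (CharacterSums.β 𝕊 ℤ.- σ ℤ.* CharacterSums.α 𝕊) ≡ ℤ.+ 4) where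
  open Setting 𝕊
  open Convolution 𝕊 public
  open Profile using (κ; t; s; ∑t; t-•; s-•; spread; doubled; total; weight; unit)
  open Field F using (_⁻¹; 0≢1; *-inverse)
  open CommutativeRing (Field.commutativeRing F) hiding (refl; sym; trans; zero)
  open RingKit (Field.commutativeRing F)
  open FieldKit F 𝕂
  open Enumeration 𝕂
  open ≡.≡-Reasoning
  private
    module KS = Solver
    module ZS = ℤSolver

  evenClass : ℤ → ℤ → ℤ → ℤ → Fin 8 → ℤ
  evenClass a b c d = ∀8 a b c d a b c d

  evenClass-even : ∀ a b c d → Even (evenClass a b c d)
  evenClass-even a b c d = ∀8 refl refl refl refl refl refl refl refl

  private
    e₀ : Fin 8 → ℤ
    e₀ = evenClass 1ℤ 0ℤ 0ℤ 0ℤ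

    e₀-even : Even e₀
    e₀-even = evenClass-even 1ℤ 0ℤ 0ℤ 0ℤ

  -- A sign on the lines of class 0 that conjugation reverses, except on the real line: it sums to 1.
  balance : L → ℤ
  balance u = η (proj₁ u * proj₂ u) ℤ.+ Σℤ.⟦ proj₂ u ≟ 0# ⟧

  t₀ : L → ℤ
  t₀ u = onClass e₀ u ℤ.* balance u

  t₀-0 : t₀ L.0# ≡ 0ℤ
  t₀-0 = trans (cong (ℤ._* balance L.0#) (onClass-0 e₀)) (ℤ.*-zeroˡ (balance L.0#))

  t₀-homogeneous : Homogeneous t₀
  t₀-homogeneous {x} {a , b} x≢0 = cong₂ ℤ._*_ (onClass-even e₀-even {x} {a , b} x≢0) (cong₂ ℤ._+_
    (trans (cong η (KS.solve 3 (λ x a b → let open KS in (x :* a) :* (x :* b) := (x :* x) :* (a :* b)) refl x a b)) (trans (η-* (x * x) (a * b)) (trans (cong (ℤ._* η (a * b)) (η-sq x≢0)) (ℤ.*-identityˡ _))))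
    (same ((x * b) ≟ 0#) (b ≟ 0#)))
    where
    same : (d : Dec (x * b ≡ 0#)) (d′ : Dec (b ≡ 0#)) → Σℤ.⟦ d ⟧ ≡ Σℤ.⟦ d′ ⟧
    same (yes _) (yes _) = refl
    same (yes e) (no b≢0) = contradiction e (*-≢0 x≢0 b≢0)
    same (no ¬e) (yes b≡0) = contradiction (trans (cong (x *_) b≡0) (zeroʳ x)) ¬e
    same (no _)  (no _)  = refl

  imaginary-class : ∀ j → j ⊞ j ≡ 4F → e₀ j ≡ 0ℤ
  imaginary-class = ∀8 (λ ()) (λ _ → refl) (λ _ → refl) (λ _ → refl) (λ ()) (λ _ → refl) (λ _ → refl) (λ _ → refl)

  balance-unit : ∀ {u} → u ≢ L.0# → e₀ (cl u) ≡ 1ℤ → PlusMinus (balance u)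
  balance-unit {a , b} u≢0 e₀≡1 = go (a ≟ 0#) (b ≟ 0#)
    where
    go : Dec (a ≡ 0#) → Dec (b ≡ 0#) → PlusMinus (balance (a , b))
    go _ (yes refl) = inj₁ (cong₂ ℤ._+_ (trans (cong η (zeroʳ a)) η-0) (if-≟-refl 0#))
    go (yes refl) (no b≢0) = contradiction (trans (sym e₀≡1) (imaginary-class _ (cl-imaginary b≢0))) λ ()
    go (no a≢0) (no b≢0) = [ inj₁ ∘ trans at , inj₂ ∘ trans at ]′ (η-≢0 (*-≢0 a≢0 b≢0))
      where
      at : balance (a , b) ≡ η (a * b)
      at = trans (cong (λ z → η (a * b) ℤ.+ z) (if-≟-≢ b≢0)) (ℤ.+-identityʳ _)

  ∑P-t₀ : ∑P (t₀ ∘ point) ≡ 1ℤ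
  ∑P-t₀ = begin
    ∑P (t₀ ∘ point)
      ≡⟨ ∑P≡ (t₀ ∘ point) ⟩
    t₀ (0# , 1#) ℤ.+ ∑K (λ y → t₀ (1# , y))
      ≡⟨ cong₂ ℤ._+_ (trans (cong (ℤ._* balance (0# , 1#)) (trans (onClass-≢0 e₀ (point≢0 nothing)) (imaginary-class _ (cl-imaginary (0≢1 ∘ sym))))) (ℤ.*-zeroˡ (balance (0# , 1#))))
           (trans (Σℤ.∑-cong elements (λ y → trans (cong (ℤ._* balance (1# , y)) (onClass-≢0 e₀ (point≢0 (just y)))) (ZS.solve 3 (λ e n d → let open ZS in e :* (n :+ d) := e :* n :+ d :* e) refl (E y) (η (1# * y)) Σℤ.⟦ y ≟ 0# ⟧)))
           (Σℤ.∑-+ elements (λ y → E y ℤ.* η (1# * y)) (λ y → Σℤ.⟦ y ≟ 0# ⟧ ℤ.* E y))) ⟩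
    0ℤ ℤ.+ (∑K (λ y → E y ℤ.* η (1# * y)) ℤ.+ ∑K (λ y → Σℤ.⟦ y ≟ 0# ⟧ ℤ.* E y))
      ≡⟨ cong (λ z → 0ℤ ℤ.+ z) (cong₂ ℤ._+_ (∑-odd (λ y → E y ℤ.* η (1# * y)) odd) (trans (Σℤ.∑-⟦≟⟧ 𝕂 0# E) (cong e₀ (cl-ι+ (0≢1 ∘ sym) η-1)))) ⟩
    1ℤ ∎
    where
    E : K → ℤ
    E y = e₀ (cl (1# , y))
    triple-even : ∀ j → e₀ (triple j) ≡ e₀ j
    triple-even = ∀8 refl refl refl refl refl refl refl refl
    odd : ∀ y → E (- y) ℤ.* η (1# * - y) ≡ ℤ.- (E y ℤ.* η (1# * y))
    odd y = trans (cong₂ ℤ._*_ (trans (cong e₀ (cl-conjugate (point≢0 (just y)))) (triple-even (cl (1# , y))))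
                               (trans (cong η (KS.solve 1 (λ y → let open KS in con 1ℤ :* (:- y) := :- (con 1ℤ :* y)) refl y)) (η-neg (1# * y))))
                  (sym (ℤ.neg-distribʳ-* (E y) (η (1# * y))))

  PlusMinus-neg : ∀ {i} → PlusMinus i → PlusMinus (ℤ.- i)
  PlusMinus-neg (inj₁ refl) = inj₂ refl
  PlusMinus-neg (inj₂ refl) = inj₁ refl

  PlusMinus-* : ∀ {i j} → PlusMinus i → PlusMinus j → PlusMinus (i ℤ.* j)
  PlusMinus-* (inj₁ refl) (inj₁ refl) = inj₁ refl
  PlusMinus-* (inj₁ refl) (inj₂ refl) = inj₂ refl
  PlusMinus-* (inj₂ refl) (inj₁ refl) = inj₂ refl
  PlusMinus-* (inj₂ refl) (inj₂ refl) = inj₁ refl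

  rotated : ℕ → L → ℤ
  rotated n u = t₀ (ζ Lₖ.^ n L.* u)

  ζ^≢0 : ∀ n → ζ Lₖ.^ n ≢ L.0#
  ζ^≢0 n = Lf.^-≢0 n ζ≢0

  cl-rotate : ∀ n {u} → u ≢ L.0# → cl (ζ Lₖ.^ n L.* u) ≡ (n ℕ.mod 8) ⊞ cl u
  cl-rotate n {u} u≢0 = trans (cl-* (ζ^≢0 n) u≢0) (cong (_⊞ cl u) (cl-ζ^ n))

  Complementary : ℕ → (Fin 8 → ℤ) → Set
  Complementary n ε = ∀ j → (e₀ ((n ℕ.mod 8) ⊞ j) ≡ 0ℤ × PlusMinus (ε j)) ⊎ (e₀ ((n ℕ.mod 8) ⊞ j) ≡ 1ℤ × ε j ≡ 0ℤ)

  halfProfile : ∀ n i → PlusMinus i → ∀ ε → Odd ε → Complementary n ε → Profile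
  halfProfile n i i± ε odd compl = record
    { κ    = 0ℤ
    ; t    = λ u → i ℤ.* rotated n u
    ; s    = onClass ε
    ; t-0  = trans (cong (λ z → i ℤ.* z) (trans (cong t₀ (L.zeroʳ (ζ Lₖ.^ n))) t₀-0)) (ℤ.*-zeroʳ i)
    ; s-0  = onClass-0 ε
    ; t-•  = λ {x} {u} x≢0 → cong (λ z → i ℤ.* z) (trans (cong t₀ (*-• (ζ Lₖ.^ n) x u)) (t₀-homogeneous x≢0))
    ; s-•  = onClass-odd odd
    ; unit = unit′
    }
    where
    class : ∀ u → u ≢ L.0# → rotated n u ≡ e₀ ((n ℕ.mod 8) ⊞ cl u) ℤ.* balance (ζ Lₖ.^ n L.* u)
    class u u≢0 = cong (ℤ._* balance (ζ Lₖ.^ n L.* u)) (trans (onClass-≢0 e₀ {ζ Lₖ.^ n L.* u} (Lf.*-≢0 {ζ Lₖ.^ n} {u} (ζ^≢0 n) u≢0)) (cong e₀ (cl-rotate n {u} u≢0)))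
    unit′ : ∀ {u} → u ≢ L.0# → (i ℤ.* rotated n u ≡ 0ℤ × PlusMinus (onClass ε u)) ⊎ (PlusMinus (i ℤ.* rotated n u) × onClass ε u ≡ 0ℤ)
    unit′ {u} u≢0 = go (compl (cl u))
      where
      b : ℤ
      b = balance (ζ Lₖ.^ n L.* u)
      go : (e₀ ((n ℕ.mod 8) ⊞ cl u) ≡ 0ℤ × PlusMinus (ε (cl u))) ⊎ (e₀ ((n ℕ.mod 8) ⊞ cl u) ≡ 1ℤ × ε (cl u) ≡ 0ℤ) →
           (i ℤ.* rotated n u ≡ 0ℤ × PlusMinus (onClass ε u)) ⊎ (PlusMinus (i ℤ.* rotated n u) × onClass ε u ≡ 0ℤ)
      go (inj₁ (e≡0 , ε±)) = inj₁ ( trans (cong (λ z → i ℤ.* z) (trans (class u u≢0) (trans (cong (ℤ._* b) e≡0) (ℤ.*-zeroˡ b)))) (ℤ.*-zeroʳ i)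
                                  , subst PlusMinus (sym (onClass-≢0 ε {u} u≢0)) ε± )
      go (inj₂ (e≡1 , ε≡0)) = inj₂ ( subst PlusMinus (cong (λ z → i ℤ.* z) (sym (trans (class u u≢0) (trans (cong (ℤ._* b) e≡1) (ℤ.*-identityˡ b))))) (PlusMinus-* {i} {b} i± b±)
                                   , trans (onClass-≢0 ε {u} u≢0) ε≡0 )
        where
        b± : PlusMinus b
        b± = balance-unit {ζ Lₖ.^ n L.* u} (Lf.*-≢0 {ζ Lₖ.^ n} {u} (ζ^≢0 n) u≢0) (trans (cong e₀ (cl-rotate n {u} u≢0)) e≡1)

  ∑t-half : ∀ n i i± ε odd compl → ∑t (halfProfile n i i± ε odd compl) ≡ i
  ∑t-half n i i± ε odd compl = trans (sym (Σℤ.∑-*ˡ ℙ.elements i (λ ℓ → rotated n (point ℓ))))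
    (trans (cong (λ z → i ℤ.* z) (trans (sym (∑P-rotate (ζ^≢0 n) t₀ t₀-0 t₀-homogeneous)) ∑P-t₀)) (ℤ.*-identityʳ i))

  lineProfile : ∀ k φ → Even φ → (∀ j → PlusMinus (φ j)) → Profile
  lineProfile k φ even φ± = record
    { κ    = k
    ; t    = onClass φ
    ; s    = onClass (oddClass 0ℤ 0ℤ 0ℤ 0ℤ)
    ; t-0  = onClass-0 φ
    ; s-0  = onClass-0 (oddClass 0ℤ 0ℤ 0ℤ 0ℤ)
    ; t-•  = onClass-even even
    ; s-•  = onClass-odd (oddClass-odd 0ℤ 0ℤ 0ℤ 0ℤ)
    ; unit = λ {u} u≢0 → inj₂ (subst PlusMinus (sym (onClass-≢0 φ u≢0)) (φ± (cl u)) , trans (onClass-≢0 (oddClass 0ℤ 0ℤ 0ℤ 0ℤ) u≢0) (∀8 {λ j → oddClass 0ℤ 0ℤ 0ℤ 0ℤ j ≡ 0ℤ} refl refl refl refl refl refl refl refl (cl u)))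
    }

  private
    σ± : PlusMinus σ
    σ± = σ-unit
    -σ± : PlusMinus (ℤ.- σ)
    -σ± = PlusMinus-neg σ-unit

    ε₁ ε₁′ ε₂ ε₂′ ε₀ : Fin 8 → ℤ
    ε₁  = oddClass 0ℤ σ 1ℤ (ℤ.- σ)
    ε₁′ = oddClass 1ℤ (ℤ.- σ) 0ℤ (ℤ.- σ)
    ε₂  = oddClass 1ℤ 0ℤ 1ℤ σ
    ε₂′ = oddClass 1ℤ σ ℤ.-1ℤ 0ℤ
    ε₀  = oddClass 0ℤ 0ℤ 0ℤ 0ℤ

    τ -τ : Fin 8 → ℤ
    τ  = evenClass ℤ.-1ℤ 1ℤ 1ℤ ℤ.-1ℤ
    -τ = evenClass 1ℤ ℤ.-1ℤ ℤ.-1ℤ 1ℤ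

    half : ∀ {e i} → e ≡ 0ℤ → PlusMinus i → (e ≡ 0ℤ × PlusMinus i) ⊎ (e ≡ 1ℤ × i ≡ 0ℤ)
    half e i = inj₁ (e , i)

    full : (1ℤ ≡ 0ℤ × PlusMinus 0ℤ) ⊎ (1ℤ ≡ 1ℤ × 0ℤ ≡ 0ℤ)
    full = inj₂ (refl , refl)

    one : PlusMinus 1ℤ
    one = inj₁ refl

    minus-one : PlusMinus ℤ.-1ℤ
    minus-one = inj₂ refl

    σ±″ : PlusMinus (ℤ.- (ℤ.- σ))
    σ±″ = PlusMinus-neg -σ±

  private
    complementary₁ : Complementary 0 ε₁
    complementary₁ = ∀8 full (half refl σ±) (half refl one) (half refl -σ±) full (half refl -σ±) (half refl minus-one) (half refl σ±″)

    complementary₁′ : Complementary 6 ε₁′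
    complementary₁′ = ∀8 (half refl one) (half refl -σ±) full (half refl -σ±) (half refl minus-one) (half refl σ±″) full (half refl σ±″)

    complementary₂ : Complementary 7 ε₂
    complementary₂ = ∀8 (half refl one) full (half refl one) (half refl σ±) (half refl minus-one) full (half refl minus-one) (half refl -σ±)

    complementary₂′ : Complementary 5 ε₂′
    complementary₂′ = ∀8 (half refl one) (half refl σ±) (half refl minus-one) full (half refl minus-one) (half refl -σ±) (half refl one) full

  P₁ P₁′ P₂ P₂′ P₃ P₃′ P₄ : Profile
  P₁  = halfProfile 0 1ℤ one ε₁ (oddClass-odd 0ℤ σ 1ℤ (ℤ.- σ)) complementary₁
  P₁′ = halfProfile 6 ℤ.-1ℤ minus-one ε₁′ (oddClass-odd 1ℤ (ℤ.- σ) 0ℤ (ℤ.- σ)) complementary₁′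
  P₂  = halfProfile 7 1ℤ one ε₂ (oddClass-odd 1ℤ 0ℤ 1ℤ σ) complementary₂
  P₂′ = halfProfile 5 ℤ.-1ℤ minus-one ε₂′ (oddClass-odd 1ℤ σ ℤ.-1ℤ 0ℤ) complementary₂′
  P₃  = lineProfile 1ℤ τ (evenClass-even ℤ.-1ℤ 1ℤ 1ℤ ℤ.-1ℤ) (∀8 minus-one one one minus-one minus-one one one minus-one)
  P₃′ = lineProfile ℤ.-1ℤ -τ (evenClass-even 1ℤ ℤ.-1ℤ ℤ.-1ℤ 1ℤ) (∀8 one minus-one minus-one one one minus-one minus-one one)
  P₄  = lineProfile ℤ.-1ℤ τ (evenClass-even ℤ.-1ℤ 1ℤ 1ℤ ℤ.-1ℤ) (∀8 minus-one one one minus-one minus-one one one minus-one)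

  unit-square : ∀ P {u} → u ≢ L.0# → t P u ℤ.* t P u ℤ.+ s P u ℤ.* s P u ≡ 1ℤ
  unit-square P {u} u≢0 = [ (λ (t≡0 , s±) → cong₂ ℤ._+_ (cong (λ z → z ℤ.* z) t≡0) (square s±)) , (λ (t± , s≡0) → cong₂ ℤ._+_ (square t±) (cong (λ z → z ℤ.* z) s≡0)) ]′ (unit P u≢0)
    where
    square : ∀ {i} → PlusMinus i → i ℤ.* i ≡ 1ℤ
    square (inj₁ refl) = refl
    square (inj₂ refl) = refl

  1+q≡4m : ℤ.+ 4 ℤ.* ℤ.+ m ≡ 1ℤ ℤ.+ ℤ.+ q
  1+q≡4m = trans (sym (trans (∑P-constant 1ℤ) (cong (λ z → ℤ.+ 4 ℤ.* z) (ℤ.*-identityʳ (ℤ.+ m))))) (trans (∑P≡ (λ _ → 1ℤ)) (cong (λ z → 1ℤ ℤ.+ z) (trans (∑K-constant 1ℤ) (ℤ.*-identityʳ (ℤ.+ q)))))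

  common-self : ∀ P → common P P ≡ 1ℤ ℤ.+ ℤ.+ q
  common-self P = trans (Σℤ.∑-cong ℙ.elements (λ ℓ → unit-square P (point≢0 ℓ))) (trans (∑P-constant 1ℤ) (trans (cong (λ z → ℤ.+ 4 ℤ.* z) (ℤ.*-identityʳ (ℤ.+ m))) 1+q≡4m))

  common-classes : ∀ P P′ φ → Even φ → (∀ {u} → u ≢ L.0# → t P u ℤ.* t P′ u ℤ.+ s P u ℤ.* s P′ u ≡ φ (cl u)) → common P P′ ≡ ℤ.+ m ℤ.* (φ 0F ℤ.+ φ 1F ℤ.+ φ 2F ℤ.+ φ 3F)
  common-classes P P′ φ even eq = trans (Σℤ.∑-cong ℙ.elements (λ ℓ → eq (point≢0 ℓ))) (∑P-class-average φ even)

  rotated-disjoint : ∀ n n′ i i′ → (∀ j → e₀ ((n ℕ.mod 8) ⊞ j) ℤ.* e₀ ((n′ ℕ.mod 8) ⊞ j) ≡ 0ℤ) → ∀ {u} → u ≢ L.0# → (i ℤ.* rotated n u) ℤ.* (i′ ℤ.* rotated n′ u) ≡ 0ℤ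
  rotated-disjoint n n′ i i′ disjoint {u} u≢0 = trans
    (ZS.solve 6 (λ i i′ a a′ b b′ → let open ZS in (i :* (a :* b)) :* (i′ :* (a′ :* b′)) := (a :* a′) :* (i :* b :* (i′ :* b′))) refl i i′ (a n) (a n′) (b n) (b n′))
    (trans (cong (ℤ._* (i ℤ.* b n ℤ.* (i′ ℤ.* b n′))) (trans (cong₂ ℤ._*_ (class n) (class n′)) (disjoint (cl u)))) (ℤ.*-zeroˡ (i ℤ.* b n ℤ.* (i′ ℤ.* b n′))))
    where
    a b : ℕ → ℤ
    a n = onClass e₀ (ζ Lₖ.^ n L.* u)
    b n = balance (ζ Lₖ.^ n L.* u)
    class : ∀ n → a n ≡ e₀ ((n ℕ.mod 8) ⊞ cl u)
    class n = trans (onClass-≢0 e₀ {ζ Lₖ.^ n L.* u} (Lf.*-≢0 {ζ Lₖ.^ n} {u} (ζ^≢0 n) u≢0)) (cong e₀ (cl-rotate n {u} u≢0))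

  private
    0+ : ∀ {u} (ε ε′ : Fin 8 → ℤ) {x} → u ≢ L.0# → x ≡ 0ℤ → x ℤ.+ onClass ε u ℤ.* onClass ε′ u ≡ ε (cl u) ℤ.* ε′ (cl u)
    0+ ε ε′ u≢0 x≡0 = trans (cong₂ (λ x y → x ℤ.+ y) x≡0 (cong₂ ℤ._*_ (onClass-≢0 ε u≢0) (onClass-≢0 ε′ u≢0))) (ℤ.+-identityˡ _)

    odd*odd : ∀ {ε ε′} → Odd ε → Odd ε′ → Even (λ j → ε j ℤ.* ε′ j)
    odd*odd {ε} {ε′} odd odd′ j = trans (cong₂ ℤ._*_ (odd j) (odd′ j)) (ZS.solve 2 (λ a b → let open ZS in (:- a) :* (:- b) := a :* b) refl (ε j) (ε′ j))

  P₁-disjoint : ∀ {u} → u ≢ L.0# → t P₁ u ℤ.* t P₁′ u ≡ 0ℤ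
  P₁-disjoint = rotated-disjoint 0 6 1ℤ ℤ.-1ℤ (∀8 refl refl refl refl refl refl refl refl)

  P₂-disjoint : ∀ {u} → u ≢ L.0# → t P₂ u ℤ.* t P₂′ u ≡ 0ℤ
  P₂-disjoint = rotated-disjoint 7 5 1ℤ ℤ.-1ℤ (∀8 refl refl refl refl refl refl refl refl)

  common₁ : common P₁ P₁′ ≡ 0ℤ
  common₁ = trans (common-classes P₁ P₁′ (λ j → ε₁ j ℤ.* ε₁′ j) (odd*odd {ε₁} {ε₁′} (oddClass-odd 0ℤ σ 1ℤ (ℤ.- σ)) (oddClass-odd 1ℤ (ℤ.- σ) 0ℤ (ℤ.- σ))) (λ u≢0 → 0+ ε₁ ε₁′ u≢0 (P₁-disjoint u≢0)))
    (ZS.solve 2 (λ m σ → let open ZS in m :* (con 0ℤ :* con 1ℤ :+ σ :* (:- σ) :+ con 1ℤ :* con 0ℤ :+ (:- σ) :* (:- σ)) := con 0ℤ) refl (ℤ.+ m) σ)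

  common₂ : common P₂ P₂′ ≡ 0ℤ
  common₂ = trans (common-classes P₂ P₂′ (λ j → ε₂ j ℤ.* ε₂′ j) (odd*odd {ε₂} {ε₂′} (oddClass-odd 1ℤ 0ℤ 1ℤ σ) (oddClass-odd 1ℤ σ ℤ.-1ℤ 0ℤ)) (λ u≢0 → 0+ ε₂ ε₂′ u≢0 (P₂-disjoint u≢0)))
    (ZS.solve 2 (λ m σ → let open ZS in m :* (con 1ℤ :* con 1ℤ :+ con 0ℤ :* σ :+ con 1ℤ :* con ℤ.-1ℤ :+ σ :* con 0ℤ) := con 0ℤ) refl (ℤ.+ m) σ)

  common₃ : common P₃ P₃′ ≡ ℤ.- (1ℤ ℤ.+ ℤ.+ q)
  common₃ = trans (common-classes P₃ P₃′ (λ _ → ℤ.-1ℤ) (λ _ → refl) (λ {u} u≢0 → trans (cong₂ ℤ._+_ (cong₂ ℤ._*_ (onClass-≢0 τ u≢0) (onClass-≢0 -τ u≢0)) (cong₂ ℤ._*_ (onClass-≢0 ε₀ u≢0) (onClass-≢0 ε₀ u≢0)))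
      (∀8 {λ j → τ j ℤ.* -τ j ℤ.+ ε₀ j ℤ.* ε₀ j ≡ ℤ.-1ℤ} refl refl refl refl refl refl refl refl (cl u))))
    (trans (ZS.solve 1 (λ m → let open ZS in m :* con (ℤ.- (ℤ.+ 4)) := :- (con (ℤ.+ 4) :* m)) refl (ℤ.+ m)) (cong ℤ.-_ 1+q≡4m))

  selfTerm : Profile → L → ℤ
  selfTerm P g = ℤ.+ q ℤ.* ℤ.+ q ℤ.+ (ℤ.+ 2 ℤ.* (κ P ℤ.+ ℤ.+ q ℤ.* ∑t P) ℤ.+ ℤ.+ 2 ℤ.* (κ P ℤ.* t P g)) ℤ.+ (∑t P ℤ.* ∑t P ℤ.+ (charSum (s P) g ℤ.* charSum (s P) g ℤ.- ℤ.+ q ℤ.* (s P g ℤ.* s P g)) ℤ.- 1ℤ)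

  symmetricCorrelation-self : ∀ P {g} → g ≢ L.0# → symmetricCorrelation P P g ≡ selfTerm P g
  symmetricCorrelation-self P {g} g≢0 = trans
    (cong₂ (λ o tt → total P ℤ.+ total P ℤ.- ℤ.+ q ℤ.* ℤ.+ q ℤ.+ (κ P ℤ.* t P g ℤ.+ κ P ℤ.* t P g) ℤ.+ (∑t P ℤ.* ∑t P ℤ.+ charSum (s P) g ℤ.* charSum (s P) g ℤ.+ (ℤ.+ q ℤ.* tt ℤ.- o))) (common-self P) tt≡)
    (ZS.solve 6 (λ q k u t c ss → let open ZS in
      (q :* q :+ (k :+ q :* u)) :+ (q :* q :+ (k :+ q :* u)) :- q :* q :+ (k :* t :+ k :* t) :+ (u :* u :+ c :* c :+ (q :* (con 1ℤ :- ss) :- (con 1ℤ :+ q)))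
      := q :* q :+ (con (ℤ.+ 2) :* (k :+ q :* u) :+ con (ℤ.+ 2) :* (k :* t)) :+ (u :* u :+ (c :* c :- q :* ss) :- con 1ℤ)) refl (ℤ.+ q) (κ P) (∑t P) (t P g) (charSum (s P) g) (s P g ℤ.* s P g))
    where
    tt≡ : t P g ℤ.* t P g ≡ 1ℤ ℤ.- s P g ℤ.* s P g
    tt≡ = trans (ZS.solve 2 (λ a b → let open ZS in a := (a :+ b) :- b) refl (t P g ℤ.* t P g) (s P g ℤ.* s P g)) (cong (ℤ._- s P g ℤ.* s P g) (unit-square P g≢0))

  private
    value : (Fin 8 → ℤ) → Fin 8 → ℤ
    value = charValue

    polyValue : (Fin 8 → ℤ) → Fin 8 → ZS.Polynomial 2 → ZS.Polynomial 2 → ZS.Polynomial 2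
    polyValue ε j a b = con (parity j) :* (a :* (con (ε (j ⊞ 1F)) :- con (ε (j ⊞ 3F))) :+ b :* con (ε (j ⊞ 2F)))
      where open ZS

    E₁ E₁′ E₂ E₂′ : ℤ → Fin 8 → ℤ
    E₁ σ  = oddClass 0ℤ σ 1ℤ (ℤ.- σ)
    E₁′ σ = oddClass 1ℤ (ℤ.- σ) 0ℤ (ℤ.- σ)
    E₂ σ  = oddClass 1ℤ 0ℤ 1ℤ σ
    E₂′ σ = oddClass 1ℤ σ ℤ.-1ℤ 0ℤ

    squaresPoly productsPoly : ℤ → Fin 8 → ZS.Polynomial 2 → ZS.Polynomial 2 → ZS.Polynomial 2 × ZS.Polynomial 2
    squaresPoly σ j a b = (V₁ :* V₁ :+ V₁′ :* V₁′ :+ V₂ :* V₂ :+ V₂′ :* V₂′) := con (ℤ.+ 3) :* (b :* b :+ con (ℤ.+ 2) :* (a :* a))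
      where
      open ZS
      V₁ = polyValue (E₁ σ) j a b
      V₁′ = polyValue (E₁′ σ) j a b
      V₂ = polyValue (E₂ σ) j a b
      V₂′ = polyValue (E₂′ σ) j a b
    productsPoly σ j a b = (V₁ :* V₁′ :+ V₂ :* V₂′) := con (τ j) :* ((b :- con σ :* a) :* (b :- con σ :* a))
      where
      open ZS
      V₁ = polyValue (E₁ σ) j a b
      V₁′ = polyValue (E₁′ σ) j a b
      V₂ = polyValue (E₂ σ) j a b
      V₂′ = polyValue (E₂′ σ) j a b

    Squares Products : ℤ → Fin 8 → Set
    Squares σ j = value (E₁ σ) j ℤ.* value (E₁ σ) j ℤ.+ value (E₁′ σ) j ℤ.* value (E₁′ σ) j ℤ.+ value (E₂ σ) j ℤ.* value (E₂ σ) j ℤ.+ value (E₂′ σ) j ℤ.* value (E₂′ σ) j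
      ≡ ℤ.+ 3 ℤ.* (β ℤ.* β ℤ.+ ℤ.+ 2 ℤ.* (α ℤ.* α))
    Products σ j = value (E₁ σ) j ℤ.* value (E₁′ σ) j ℤ.+ value (E₂ σ) j ℤ.* value (E₂′ σ) j ≡ τ j ℤ.* ((β ℤ.- σ ℤ.* α) ℤ.* (β ℤ.- σ ℤ.* α))

  private
    squares+ : ∀ j → Squares 1ℤ j
    squares+ 0F = ZS.solve 2 (squaresPoly 1ℤ 0F) refl α β
    squares+ 1F = ZS.solve 2 (squaresPoly 1ℤ 1F) refl α β
    squares+ 2F = ZS.solve 2 (squaresPoly 1ℤ 2F) refl α β
    squares+ 3F = ZS.solve 2 (squaresPoly 1ℤ 3F) refl α β
    squares+ 4F = ZS.solve 2 (squaresPoly 1ℤ 4F) refl α β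
    squares+ 5F = ZS.solve 2 (squaresPoly 1ℤ 5F) refl α β
    squares+ 6F = ZS.solve 2 (squaresPoly 1ℤ 6F) refl α β
    squares+ 7F = ZS.solve 2 (squaresPoly 1ℤ 7F) refl α β

    squares- : ∀ j → Squares ℤ.-1ℤ j
    squares- 0F = ZS.solve 2 (squaresPoly ℤ.-1ℤ 0F) refl α β
    squares- 1F = ZS.solve 2 (squaresPoly ℤ.-1ℤ 1F) refl α β
    squares- 2F = ZS.solve 2 (squaresPoly ℤ.-1ℤ 2F) refl α β
    squares- 3F = ZS.solve 2 (squaresPoly ℤ.-1ℤ 3F) refl α β
    squares- 4F = ZS.solve 2 (squaresPoly ℤ.-1ℤ 4F) refl α β
    squares- 5F = ZS.solve 2 (squaresPoly ℤ.-1ℤ 5F) refl α β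
    squares- 6F = ZS.solve 2 (squaresPoly ℤ.-1ℤ 6F) refl α β
    squares- 7F = ZS.solve 2 (squaresPoly ℤ.-1ℤ 7F) refl α β

  squares : ∀ j → Squares σ j
  squares j = go σ-unit
    where
    go : σ ≡ 1ℤ ⊎ σ ≡ ℤ.-1ℤ → Squares σ j
    go (inj₁ σ≡) = subst (λ σ → Squares σ j) (sym σ≡) (squares+ j)
    go (inj₂ σ≡) = subst (λ σ → Squares σ j) (sym σ≡) (squares- j)

  private
    products+ : ∀ j → Products 1ℤ j
    products+ 0F = ZS.solve 2 (productsPoly 1ℤ 0F) refl α β
    products+ 1F = ZS.solve 2 (productsPoly 1ℤ 1F) refl α β
    products+ 2F = ZS.solve 2 (productsPoly 1ℤ 2F) refl α β
    products+ 3F = ZS.solve 2 (productsPoly 1ℤ 3F) refl α β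
    products+ 4F = ZS.solve 2 (productsPoly 1ℤ 4F) refl α β
    products+ 5F = ZS.solve 2 (productsPoly 1ℤ 5F) refl α β
    products+ 6F = ZS.solve 2 (productsPoly 1ℤ 6F) refl α β
    products+ 7F = ZS.solve 2 (productsPoly 1ℤ 7F) refl α β

    products- : ∀ j → Products ℤ.-1ℤ j
    products- 0F = ZS.solve 2 (productsPoly ℤ.-1ℤ 0F) refl α β
    products- 1F = ZS.solve 2 (productsPoly ℤ.-1ℤ 1F) refl α β
    products- 2F = ZS.solve 2 (productsPoly ℤ.-1ℤ 2F) refl α β
    products- 3F = ZS.solve 2 (productsPoly ℤ.-1ℤ 3F) refl α β
    products- 4F = ZS.solve 2 (productsPoly ℤ.-1ℤ 4F) refl α β
    products- 5F = ZS.solve 2 (productsPoly ℤ.-1ℤ 5F) refl α β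
    products- 6F = ZS.solve 2 (productsPoly ℤ.-1ℤ 6F) refl α β
    products- 7F = ZS.solve 2 (productsPoly ℤ.-1ℤ 7F) refl α β

  products : ∀ j → Products σ j
  products j = go σ-unit
    where
    go : σ ≡ 1ℤ ⊎ σ ≡ ℤ.-1ℤ → Products σ j
    go (inj₁ σ≡) = subst (λ σ → Products σ j) (sym σ≡) (products+ j)
    go (inj₂ σ≡) = subst (λ σ → Products σ j) (sym σ≡) (products- j)

  private
    Q : ℤ
    Q = ℤ.+ q

    j₃ : ℤ → ℤ → ℤ → ℤ → ℤ
    j₃ a b c d = a ℤ.* a ℤ.+ b ℤ.* b ℤ.+ c ℤ.* c ℤ.+ d ℤ.* d

    ε-squares : ∀ j → j₃ (ε₁ j) (ε₁′ j) (ε₂ j) (ε₂′ j) ≡ ℤ.+ 3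
    ε-squares j = [ (λ σ≡ → subst (Three j) (sym σ≡) (plus j)) , (λ σ≡ → subst (Three j) (sym σ≡) (minus j)) ]′ σ-unit
      where
      Three : Fin 8 → ℤ → Set
      Three j σ = j₃ (E₁ σ j) (E₁′ σ j) (E₂ σ j) (E₂′ σ j) ≡ ℤ.+ 3
      plus : ∀ j → Three j 1ℤ
      plus = ∀8 refl refl refl refl refl refl refl refl
      minus : ∀ j → Three j ℤ.-1ℤ
      minus = ∀8 refl refl refl refl refl refl refl refl

    ε₀≡0 : ∀ j → ε₀ j ≡ 0ℤ
    ε₀≡0 = ∀8 refl refl refl refl refl refl refl refl

    charSum-ε₀ : ∀ {g} → g ≢ L.0# → charSum (onClass ε₀) g ≡ 0ℤ
    charSum-ε₀ {g} g≢0 = trans (charSum≡ {ε₀} (oddClass-odd 0ℤ 0ℤ 0ℤ 0ℤ) g≢0)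
      (trans (cong₂ (λ x y → parity (cl g) ℤ.* (α ℤ.* x ℤ.+ β ℤ.* y)) (cong₂ ℤ._-_ (ε₀≡0 (cl g ⊞ 1F)) (ε₀≡0 (cl g ⊞ 3F))) (ε₀≡0 (cl g ⊞ 2F)))
        (ZS.solve 3 (λ s a b → let open ZS in s :* (a :* con 0ℤ :+ b :* con 0ℤ) := con 0ℤ) refl (parity (cl g)) α β))

    value₁ : ∀ {g} → g ≢ L.0# → charSum (onClass ε₁) g ≡ value ε₁ (cl g)
    value₁ = charSum≡ {ε₁} (oddClass-odd 0ℤ σ 1ℤ (ℤ.- σ))
    value₁′ : ∀ {g} → g ≢ L.0# → charSum (onClass ε₁′) g ≡ value ε₁′ (cl g)
    value₁′ = charSum≡ {ε₁′} (oddClass-odd 1ℤ (ℤ.- σ) 0ℤ (ℤ.- σ))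
    value₂ : ∀ {g} → g ≢ L.0# → charSum (onClass ε₂) g ≡ value ε₂ (cl g)
    value₂ = charSum≡ {ε₂} (oddClass-odd 1ℤ 0ℤ 1ℤ σ)
    value₂′ : ∀ {g} → g ≢ L.0# → charSum (onClass ε₂′) g ≡ value ε₂′ (cl g)
    value₂′ = charSum≡ {ε₂′} (oddClass-odd 1ℤ σ ℤ.-1ℤ 0ℤ)

    ∑t₁ : ∑t P₁ ≡ 1ℤ
    ∑t₁ = ∑t-half 0 1ℤ one ε₁ (oddClass-odd 0ℤ σ 1ℤ (ℤ.- σ)) complementary₁
    ∑t₁′ : ∑t P₁′ ≡ ℤ.-1ℤ
    ∑t₁′ = ∑t-half 6 ℤ.-1ℤ minus-one ε₁′ (oddClass-odd 1ℤ (ℤ.- σ) 0ℤ (ℤ.- σ)) complementary₁′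
    ∑t₂ : ∑t P₂ ≡ 1ℤ
    ∑t₂ = ∑t-half 7 1ℤ one ε₂ (oddClass-odd 1ℤ 0ℤ 1ℤ σ) complementary₂
    ∑t₂′ : ∑t P₂′ ≡ ℤ.-1ℤ
    ∑t₂′ = ∑t-half 5 ℤ.-1ℤ minus-one ε₂′ (oddClass-odd 1ℤ σ ℤ.-1ℤ 0ℤ) complementary₂′
    ∑t₃ : ∑t P₃ ≡ 0ℤ
    ∑t₃ = trans (∑P-class τ) (trans (∑P-class-average τ (evenClass-even ℤ.-1ℤ 1ℤ 1ℤ ℤ.-1ℤ)) (ℤ.*-zeroʳ (ℤ.+ m)))
    ∑t₃′ : ∑t P₃′ ≡ 0ℤ
    ∑t₃′ = trans (∑P-class -τ) (trans (∑P-class-average -τ (evenClass-even 1ℤ ℤ.-1ℤ ℤ.-1ℤ 1ℤ)) (ℤ.*-zeroʳ (ℤ.+ m)))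

    halfTerm : ∀ P {g} u V e → κ P ≡ 0ℤ → ∑t P ≡ u → charSum (s P) g ≡ V → s P g ≡ e → selfTerm P g ≡ Q ℤ.* Q ℤ.+ ℤ.+ 2 ℤ.* (Q ℤ.* u) ℤ.+ (u ℤ.* u ℤ.+ (V ℤ.* V ℤ.- Q ℤ.* (e ℤ.* e)) ℤ.- 1ℤ)
    halfTerm P {g} u V e κ≡ refl refl refl = trans (cong (λ k → Q ℤ.* Q ℤ.+ (ℤ.+ 2 ℤ.* (k ℤ.+ Q ℤ.* u) ℤ.+ ℤ.+ 2 ℤ.* (k ℤ.* t P g)) ℤ.+ (u ℤ.* u ℤ.+ (V ℤ.* V ℤ.- Q ℤ.* (e ℤ.* e)) ℤ.- 1ℤ)) κ≡)
      (ZS.solve 4 (λ q u t r → let open ZS in q :* q :+ (con (ℤ.+ 2) :* (con 0ℤ :+ q :* u) :+ con (ℤ.+ 2) :* (con 0ℤ :* t)) :+ r := q :* q :+ con (ℤ.+ 2) :* (q :* u) :+ r) refl Q u (t P g) (u ℤ.* u ℤ.+ (V ℤ.* V ℤ.- Q ℤ.* (e ℤ.* e)) ℤ.- 1ℤ))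

    lineTerm : ∀ P {g} k x → κ P ≡ k → ∑t P ≡ 0ℤ → charSum (s P) g ≡ 0ℤ → s P g ≡ 0ℤ → t P g ≡ x → selfTerm P g ≡ Q ℤ.* Q ℤ.+ ℤ.+ 2 ℤ.* (k ℤ.* (1ℤ ℤ.+ x)) ℤ.- 1ℤ
    lineTerm P {g} k x refl u≡0 V≡0 e≡0 refl = trans (cong₂ (λ u (V , e) → Q ℤ.* Q ℤ.+ (ℤ.+ 2 ℤ.* (k ℤ.+ Q ℤ.* u) ℤ.+ ℤ.+ 2 ℤ.* (k ℤ.* x)) ℤ.+ (u ℤ.* u ℤ.+ (V ℤ.* V ℤ.- Q ℤ.* (e ℤ.* e)) ℤ.- 1ℤ)) u≡0 (cong₂ _,_ V≡0 e≡0))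
      (ZS.solve 3 (λ q k x → let open ZS in q :* q :+ (con (ℤ.+ 2) :* (k :+ q :* con 0ℤ) :+ con (ℤ.+ 2) :* (k :* x)) :+ (con 0ℤ :* con 0ℤ :+ (con 0ℤ :* con 0ℤ :- q :* (con 0ℤ :* con 0ℤ)) :- con 1ℤ)
        := q :* q :+ con (ℤ.+ 2) :* (k :* (con 1ℤ :+ x)) :- con 1ℤ) refl Q k x)

    -τ≡ : ∀ j → -τ j ≡ ℤ.- τ j
    -τ≡ = ∀8 refl refl refl refl refl refl refl refl

    s-line : ∀ {g} → g ≢ L.0# → onClass ε₀ g ≡ 0ℤ
    s-line {g} g≢0 = trans (onClass-≢0 ε₀ g≢0) (ε₀≡0 (cl g))

    t₃′ : ∀ {g} → g ≢ L.0# → t P₃′ g ≡ ℤ.- τ (cl g)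
    t₃′ {g} g≢0 = trans (onClass-≢0 -τ g≢0) (-τ≡ (cl g))

  target : ℤ
  target = ℤ.+ 8 ℤ.* (Q ℤ.* Q) ℤ.- ℤ.+ 8

  blocks : List (Profile × Profile)
  blocks = (P₁ , P₁′) ∷ (P₂ , P₂′) ∷ (P₃ , P₃′) ∷ (P₄ , P₄) ∷ []

  corr : Profile → Profile → L → ℤ
  corr P P′ = correlate (doubled P) (doubled P′)

  within-parts : ∀ {g} → g ≢ L.0# → Σℤ.∑ blocks (λ (P , P′) → corr P P g ℤ.+ corr P′ P′ g) ≡ target
  within-parts {g} g≢0 = begin
    Σℤ.∑ blocks (λ (P , P′) → corr P P g ℤ.+ corr P′ P′ g)
      ≡⟨ cong₂ ℤ._+_ (cong₂ ℤ._+_ (by P₁ (halfTerm P₁ 1ℤ V₁ e₁ refl ∑t₁ (value₁ g≢0) (onClass-≢0 ε₁ g≢0))) (by P₁′ (halfTerm P₁′ ℤ.-1ℤ V₁′ e₁′ refl ∑t₁′ (value₁′ g≢0) (onClass-≢0 ε₁′ g≢0))))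
        (cong₂ ℤ._+_ (cong₂ ℤ._+_ (by P₂ (halfTerm P₂ 1ℤ V₂ e₂ refl ∑t₂ (value₂ g≢0) (onClass-≢0 ε₂ g≢0))) (by P₂′ (halfTerm P₂′ ℤ.-1ℤ V₂′ e₂′ refl ∑t₂′ (value₂′ g≢0) (onClass-≢0 ε₂′ g≢0))))
        (cong₂ ℤ._+_ (cong₂ ℤ._+_ (by P₃ (lineTerm P₃ 1ℤ x refl ∑t₃ (charSum-ε₀ g≢0) (s-line g≢0) (onClass-≢0 τ g≢0))) (by P₃′ (lineTerm P₃′ ℤ.-1ℤ (ℤ.- x) refl ∑t₃′ (charSum-ε₀ g≢0) (s-line g≢0) (t₃′ g≢0))))
        (cong (ℤ._+ 0ℤ) (cong₂ ℤ._+_ p₄ p₄)))) ⟩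
    (H 1ℤ V₁ e₁ ℤ.+ H ℤ.-1ℤ V₁′ e₁′) ℤ.+ ((H 1ℤ V₂ e₂ ℤ.+ H ℤ.-1ℤ V₂′ e₂′) ℤ.+ ((N 1ℤ x ℤ.+ N ℤ.-1ℤ (ℤ.- x)) ℤ.+ ((N ℤ.-1ℤ x ℤ.+ N ℤ.-1ℤ x) ℤ.+ 0ℤ)))
      ≡⟨ ZS.solve 10 (λ q x v₁ v₁′ v₂ v₂′ e₁ e₁′ e₂ e₂′ → let
           open ZS
           H = λ u v e → q :* q :+ con (ℤ.+ 2) :* (q :* u) :+ (u :* u :+ (v :* v :- q :* (e :* e)) :- con 1ℤ)
           N = λ k x → q :* q :+ con (ℤ.+ 2) :* (k :* (con 1ℤ :+ x)) :- con 1ℤ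
           in (H (con 1ℤ) v₁ e₁ :+ H (con ℤ.-1ℤ) v₁′ e₁′) :+ ((H (con 1ℤ) v₂ e₂ :+ H (con ℤ.-1ℤ) v₂′ e₂′) :+ ((N (con 1ℤ) x :+ N (con ℤ.-1ℤ) (:- x)) :+ ((N (con ℤ.-1ℤ) x :+ N (con ℤ.-1ℤ) x) :+ con 0ℤ)))
           := (con (ℤ.+ 8) :* (q :* q) :- con (ℤ.+ 8)) :+ ((v₁ :* v₁ :+ v₁′ :* v₁′ :+ v₂ :* v₂ :+ v₂′ :* v₂′) :- q :* (e₁ :* e₁ :+ e₁′ :* e₁′ :+ e₂ :* e₂ :+ e₂′ :* e₂′)))
           refl Q x V₁ V₁′ V₂ V₂′ e₁ e₁′ e₂ e₂′ ⟩
    target ℤ.+ (j₃ V₁ V₁′ V₂ V₂′ ℤ.- Q ℤ.* j₃ e₁ e₁′ e₂ e₂′)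
      ≡⟨ cong₂ (λ a b → target ℤ.+ (a ℤ.- Q ℤ.* b)) (trans (squares (cl g)) (cong (λ z → ℤ.+ 3 ℤ.* z) (sym q≡β²+2α²))) (ε-squares (cl g)) ⟩
    target ℤ.+ (ℤ.+ 3 ℤ.* Q ℤ.- Q ℤ.* ℤ.+ 3)
      ≡⟨ ZS.solve 2 (λ t q → let open ZS in t :+ (con (ℤ.+ 3) :* q :- q :* con (ℤ.+ 3)) := t) refl target Q ⟩
    target ∎
    where
    x = τ (cl g)
    V₁ = value ε₁ (cl g)
    V₁′ = value ε₁′ (cl g)
    V₂ = value ε₂ (cl g)
    V₂′ = value ε₂′ (cl g)
    e₁ = ε₁ (cl g)
    e₁′ = ε₁′ (cl g)
    e₂ = ε₂ (cl g)
    e₂′ = ε₂′ (cl g)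
    H : ℤ → ℤ → ℤ → ℤ
    H u V e = Q ℤ.* Q ℤ.+ ℤ.+ 2 ℤ.* (Q ℤ.* u) ℤ.+ (u ℤ.* u ℤ.+ (V ℤ.* V ℤ.- Q ℤ.* (e ℤ.* e)) ℤ.- 1ℤ)
    N : ℤ → ℤ → ℤ
    N k x = Q ℤ.* Q ℤ.+ ℤ.+ 2 ℤ.* (k ℤ.* (1ℤ ℤ.+ x)) ℤ.- 1ℤ
    by : ∀ P {r} → selfTerm P g ≡ r → corr P P g ≡ r
    by P eq = trans (correlate-self P g≢0) (trans (symmetricCorrelation-self P g≢0) eq)
    p₄ : corr P₄ P₄ g ≡ N ℤ.-1ℤ x
    p₄ = by P₄ (lineTerm P₄ ℤ.-1ℤ x refl ∑t₃ (charSum-ε₀ g≢0) (s-line g≢0) (onClass-≢0 τ g≢0))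

  private
    S : ℤ → ℤ → ℤ → ℤ → ℤ → ℤ → ℤ → ℤ → ℤ → ℤ
    S k k′ u u′ x x′ v xx o = (Q ℤ.* Q ℤ.+ (k ℤ.+ Q ℤ.* u)) ℤ.+ (Q ℤ.* Q ℤ.+ (k′ ℤ.+ Q ℤ.* u′)) ℤ.- Q ℤ.* Q ℤ.+ (k ℤ.* x′ ℤ.+ k′ ℤ.* x)
      ℤ.+ (u ℤ.* u′ ℤ.+ v ℤ.+ (Q ℤ.* xx ℤ.- o))

    pairTerm : ∀ P P′ {g} u u′ x x′ v v′ xx o → ∑t P ≡ u → ∑t P′ ≡ u′ → t P g ≡ x → t P′ g ≡ x′ → charSum (s P) g ≡ v → charSum (s P′) g ≡ v′ →
      t P g ℤ.* t P′ g ≡ xx → common P P′ ≡ o → symmetricCorrelation P P′ g ≡ S (κ P) (κ P′) u u′ x x′ (v ℤ.* v′) xx o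
    pairTerm P P′ u u′ x x′ v v′ xx o refl refl refl refl refl refl refl refl = refl

  across-parts : ∀ {g} → g ≢ L.0# → Σℤ.∑ blocks (λ (P , P′) → corr P P′ g ℤ.+ corr P′ P g) ≡ target
  across-parts {g} g≢0 = begin
    Σℤ.∑ blocks (λ (P , P′) → corr P P′ g ℤ.+ corr P′ P g)
      ≡⟨ Σℤ.∑-cong blocks (λ (P , P′) → correlate-symmetric P P′ g≢0) ⟩
    Σℤ.∑ blocks (λ (P , P′) → symmetricCorrelation P P′ g ℤ.+ symmetricCorrelation P P′ g)
      ≡⟨ cong₂ ℤ._+_ (d s₁) (cong₂ ℤ._+_ (d s₂) (cong₂ ℤ._+_ (d s₃) (cong (ℤ._+ 0ℤ) (d s₄)))) ⟩
    (A₁ ℤ.+ A₁) ℤ.+ ((A₂ ℤ.+ A₂) ℤ.+ ((A₃ ℤ.+ A₃) ℤ.+ ((A₄ ℤ.+ A₄) ℤ.+ 0ℤ)))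
      ≡⟨ ZS.solve 8 (λ q x y₁ y₁′ y₂ y₂′ v w → let
           open ZS
           S = λ k k′ u u′ x x′ v xx o → (q :* q :+ (k :+ q :* u)) :+ (q :* q :+ (k′ :+ q :* u′)) :- q :* q :+ (k :* x′ :+ k′ :* x) :+ (u :* u′ :+ v :+ (q :* xx :- o))
           A₁ = S (con 0ℤ) (con 0ℤ) (con 1ℤ) (con ℤ.-1ℤ) y₁ y₁′ v (con 0ℤ) (con 0ℤ)
           A₂ = S (con 0ℤ) (con 0ℤ) (con 1ℤ) (con ℤ.-1ℤ) y₂ y₂′ w (con 0ℤ) (con 0ℤ)
           A₃ = S (con 1ℤ) (con ℤ.-1ℤ) (con 0ℤ) (con 0ℤ) x (:- x) (con 0ℤ :* con 0ℤ) (:- (x :* x)) (:- (con 1ℤ :+ q))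
           A₄ = S (con ℤ.-1ℤ) (con ℤ.-1ℤ) (con 0ℤ) (con 0ℤ) x x (con 0ℤ :* con 0ℤ) (x :* x) (con 1ℤ :+ q)
           in (A₁ :+ A₁) :+ ((A₂ :+ A₂) :+ ((A₃ :+ A₃) :+ ((A₄ :+ A₄) :+ con 0ℤ))) := (con (ℤ.+ 8) :* (q :* q) :- con (ℤ.+ 8)) :+ con (ℤ.+ 2) :* ((v :+ w) :- con (ℤ.+ 4) :* x))
           refl Q x (t P₁ g) (t P₁′ g) (t P₂ g) (t P₂′ g) (V₁ ℤ.* V₁′) (V₂ ℤ.* V₂′) ⟩
    target ℤ.+ ℤ.+ 2 ℤ.* ((V₁ ℤ.* V₁′ ℤ.+ V₂ ℤ.* V₂′) ℤ.- ℤ.+ 4 ℤ.* x)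
      ≡⟨ cong (λ z → target ℤ.+ ℤ.+ 2 ℤ.* (z ℤ.- ℤ.+ 4 ℤ.* x)) (trans (products (cl g)) (cong (λ z → x ℤ.* z) four)) ⟩
    target ℤ.+ ℤ.+ 2 ℤ.* (x ℤ.* ℤ.+ 4 ℤ.- ℤ.+ 4 ℤ.* x)
      ≡⟨ ZS.solve 2 (λ t x → let open ZS in t :+ con (ℤ.+ 2) :* (x :* con (ℤ.+ 4) :- con (ℤ.+ 4) :* x) := t) refl target x ⟩
    target ∎
    where
    x = τ (cl g)
    V₁ = value ε₁ (cl g)
    V₁′ = value ε₁′ (cl g)
    V₂ = value ε₂ (cl g)
    V₂′ = value ε₂′ (cl g)
    A₁ = S 0ℤ 0ℤ 1ℤ ℤ.-1ℤ (t P₁ g) (t P₁′ g) (V₁ ℤ.* V₁′) 0ℤ 0ℤ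
    A₂ = S 0ℤ 0ℤ 1ℤ ℤ.-1ℤ (t P₂ g) (t P₂′ g) (V₂ ℤ.* V₂′) 0ℤ 0ℤ
    A₃ = S 1ℤ ℤ.-1ℤ 0ℤ 0ℤ x (ℤ.- x) (0ℤ ℤ.* 0ℤ) (ℤ.- (x ℤ.* x)) (ℤ.- (1ℤ ℤ.+ Q))
    A₄ = S ℤ.-1ℤ ℤ.-1ℤ 0ℤ 0ℤ x x (0ℤ ℤ.* 0ℤ) (x ℤ.* x) (1ℤ ℤ.+ Q)
    d : ∀ {a b} → a ≡ b → a ℤ.+ a ≡ b ℤ.+ b
    d = cong (λ z → z ℤ.+ z)
    tτ : onClass τ g ≡ x
    tτ = onClass-≢0 τ g≢0
    s₁ : symmetricCorrelation P₁ P₁′ g ≡ A₁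
    s₁ = pairTerm P₁ P₁′ 1ℤ ℤ.-1ℤ (t P₁ g) (t P₁′ g) V₁ V₁′ 0ℤ 0ℤ ∑t₁ ∑t₁′ refl refl (value₁ g≢0) (value₁′ g≢0) (P₁-disjoint g≢0) common₁
    s₂ : symmetricCorrelation P₂ P₂′ g ≡ A₂
    s₂ = pairTerm P₂ P₂′ 1ℤ ℤ.-1ℤ (t P₂ g) (t P₂′ g) V₂ V₂′ 0ℤ 0ℤ ∑t₂ ∑t₂′ refl refl (value₂ g≢0) (value₂′ g≢0) (P₂-disjoint g≢0) common₂
    s₃ : symmetricCorrelation P₃ P₃′ g ≡ A₃
    s₃ = pairTerm P₃ P₃′ 0ℤ 0ℤ x (ℤ.- x) 0ℤ 0ℤ (ℤ.- (x ℤ.* x)) (ℤ.- (1ℤ ℤ.+ Q)) ∑t₃ ∑t₃′ tτ (t₃′ g≢0) (charSum-ε₀ g≢0) (charSum-ε₀ g≢0)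
           (trans (cong₂ ℤ._*_ tτ (t₃′ g≢0)) (sym (ℤ.neg-distribʳ-* x x))) common₃
    s₄ : symmetricCorrelation P₄ P₄ g ≡ A₄
    s₄ = pairTerm P₄ P₄ 0ℤ 0ℤ x x 0ℤ 0ℤ (x ℤ.* x) (1ℤ ℤ.+ Q) ∑t₃ ∑t₃ tτ tτ (charSum-ε₀ g≢0) (charSum-ε₀ g≢0) (cong (λ z → z ℤ.* z) tτ) (common-self P₄)

  across-parts-0 : Σℤ.∑ blocks (λ (P , P′) → corr P P′ L.0# ℤ.+ corr P′ P L.0#) ≡ target
  across-parts-0 = trans (cong₂ ℤ._+_ (both P₁ P₁′ common₁ ∑t₁ ∑t₁′) (cong₂ ℤ._+_ (both P₂ P₂′ common₂ ∑t₂ ∑t₂′)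
      (cong₂ ℤ._+_ (both P₃ P₃′ common₃ ∑t₃ ∑t₃′) (cong (ℤ._+ 0ℤ) (both P₄ P₄ (common-self P₄) ∑t₃ ∑t₃)))))
    (ZS.solve 1 (λ r → let
      open ZS
      q = con 1ℤ :+ r
      Z = λ k k′ u u′ o → (con 1ℤ :+ (k :+ u)) :* (con 1ℤ :+ (k′ :+ u′)) :+ r :* ((con 1ℤ :+ q) :+ u :+ u′ :+ o)
      B = λ k k′ u u′ o → Z k k′ u u′ o :+ Z k′ k u′ u o
      in B (con 0ℤ) (con 0ℤ) (con 1ℤ) (con ℤ.-1ℤ) (con 0ℤ) :+ (B (con 0ℤ) (con 0ℤ) (con 1ℤ) (con ℤ.-1ℤ) (con 0ℤ) :+ (B (con 1ℤ) (con ℤ.-1ℤ) (con 0ℤ) (con 0ℤ) (:- (con 1ℤ :+ q)) :+ (B (con ℤ.-1ℤ) (con ℤ.-1ℤ) (con 0ℤ) (con 0ℤ) (con 1ℤ :+ q) :+ con 0ℤ)))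
      := con (ℤ.+ 8) :* (q :* q) :- con (ℤ.+ 8)) refl q-1)
    where
    Z : ℤ → ℤ → ℤ → ℤ → ℤ → ℤ
    Z k k′ u u′ o = (1ℤ ℤ.+ (k ℤ.+ u)) ℤ.* (1ℤ ℤ.+ (k′ ℤ.+ u′)) ℤ.+ q-1 ℤ.* ((1ℤ ℤ.+ Q) ℤ.+ u ℤ.+ u′ ℤ.+ o)
    single : ∀ P P′ {u u′ o} → common P P′ ≡ o → ∑t P ≡ u → ∑t P′ ≡ u′ → corr P P′ L.0# ≡ Z (κ P) (κ P′) u u′ o
    single P P′ refl refl refl = trans (correlate-0 P P′) (cong (λ z → origin P ℤ.* origin P′ ℤ.+ q-1 ℤ.* (z ℤ.+ ∑t P ℤ.+ ∑t P′ ℤ.+ common P P′)) 1+q≡4m)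
    both : ∀ P P′ {u u′ o} → common P P′ ≡ o → ∑t P ≡ u → ∑t P′ ≡ u′ → corr P P′ L.0# ℤ.+ corr P′ P L.0# ≡ Z (κ P) (κ P′) u u′ o ℤ.+ Z (κ P′) (κ P) u′ u o
    both P P′ c≡ u≡ u′≡ = cong₂ ℤ._+_ (single P P′ c≡ u≡ u′≡) (single P′ P (trans (common-comm P′ P) c≡) u′≡ u≡)

  Binary : ℤ → Set
  Binary i = i ≡ 0ℤ ⊎ i ≡ ℤ.+ 2

  1+PlusMinus : ∀ {i} → PlusMinus i → Binary (1ℤ ℤ.+ i)
  1+PlusMinus (inj₁ refl) = inj₂ refl
  1+PlusMinus (inj₂ refl) = inj₁ refl

  doubled-binary : ∀ P → Binary (origin P) → ∀ y → Binary (doubled P y)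
  doubled-binary P origin-binary y = go (y 𝕃.≟ L.0#)
    where
    go : Dec (y ≡ L.0#) → Binary (doubled P y)
    go (yes refl) = subst Binary (sym (doubled-0 P)) origin-binary
    go (no y≢0)   = subst Binary (sym (doubled-≢0 P y≢0)) (1+PlusMinus {t P y ℤ.+ s P y} (sign (unit P y≢0)))
      where
      sign : (t P y ≡ 0ℤ × PlusMinus (s P y)) ⊎ (PlusMinus (t P y) × s P y ≡ 0ℤ) → PlusMinus (t P y ℤ.+ s P y)
      sign (inj₁ (t≡0 , s±)) = subst PlusMinus (sym (trans (cong (ℤ._+ s P y) t≡0) (ℤ.+-identityˡ (s P y)))) s±
      sign (inj₂ (t± , s≡0)) = subst PlusMinus (sym (trans (cong (λ z → t P y ℤ.+ z) s≡0) (ℤ.+-identityʳ (t P y)))) t±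

  origins-binary : All (λ (P , P′) → Binary (origin P) × Binary (origin P′)) blocks
  origins-binary = (inj₂ (plus 0ℤ ∑t₁) , inj₁ (plus 0ℤ ∑t₁′)) ∷ (inj₂ (plus 0ℤ ∑t₂) , inj₁ (plus 0ℤ ∑t₂′)) ∷ (inj₂ (plus 1ℤ ∑t₃) , inj₁ (plus ℤ.-1ℤ ∑t₃′)) ∷ (inj₁ (plus ℤ.-1ℤ ∑t₃) , inj₁ (plus ℤ.-1ℤ ∑t₃)) ∷ []
    where
    plus : ∀ k {u v} → u ≡ v → 1ℤ ℤ.+ (k ℤ.+ u) ≡ 1ℤ ℤ.+ (k ℤ.+ v)
    plus k = cong (λ z → 1ℤ ℤ.+ (k ℤ.+ z))

  totals : map (λ (P , P′) → total P ℤ.+ total P′) blocks ≡ ℤ.+ 2 ℤ.* (Q ℤ.* Q) ∷ ℤ.+ 2 ℤ.* (Q ℤ.* Q) ∷ ℤ.+ 2 ℤ.* (Q ℤ.* Q) ∷ ℤ.+ 2 ℤ.* (Q ℤ.* Q) ℤ.- ℤ.+ 2 ∷ []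
  totals = cong₂ _∷_ (trans (tot 0ℤ 0ℤ ∑t₁ ∑t₁′) (solve 1 (λ q → (q :* q :+ (con 0ℤ :+ q :* con 1ℤ)) :+ (q :* q :+ (con 0ℤ :+ q :* con ℤ.-1ℤ)) := con (ℤ.+ 2) :* (q :* q)) refl Q))
    (cong₂ _∷_ (trans (tot 0ℤ 0ℤ ∑t₂ ∑t₂′) (solve 1 (λ q → (q :* q :+ (con 0ℤ :+ q :* con 1ℤ)) :+ (q :* q :+ (con 0ℤ :+ q :* con ℤ.-1ℤ)) := con (ℤ.+ 2) :* (q :* q)) refl Q))
    (cong₂ _∷_ (trans (tot 1ℤ ℤ.-1ℤ ∑t₃ ∑t₃′) (solve 1 (λ q → (q :* q :+ (con 1ℤ :+ q :* con 0ℤ)) :+ (q :* q :+ (con ℤ.-1ℤ :+ q :* con 0ℤ)) := con (ℤ.+ 2) :* (q :* q)) refl Q))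
    (cong (_∷ []) (trans (tot ℤ.-1ℤ ℤ.-1ℤ ∑t₃ ∑t₃) (solve 1 (λ q → (q :* q :+ (con ℤ.-1ℤ :+ q :* con 0ℤ)) :+ (q :* q :+ (con ℤ.-1ℤ :+ q :* con 0ℤ)) := con (ℤ.+ 2) :* (q :* q) :- con (ℤ.+ 2)) refl Q)))))
    where
    open ZS
    tot : ∀ k k′ {u v u′ v′} → u ≡ v → u′ ≡ v′ → (Q ℤ.* Q ℤ.+ (k ℤ.+ Q ℤ.* u)) ℤ.+ (Q ℤ.* Q ℤ.+ (k′ ℤ.+ Q ℤ.* u′)) ≡ (Q ℤ.* Q ℤ.+ (k ℤ.+ Q ℤ.* v)) ℤ.+ (Q ℤ.* Q ℤ.+ (k′ ℤ.+ Q ℤ.* v′))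
    tot k k′ refl refl = refl
open import Defs

module Counting where
  open RingSums ℤ.+-*-commutativeRing

  length≡∑ : ∀ {A : Set} (xs : List A) → ℤ.+ length xs ≡ ∑ xs (λ _ → 1ℤ)
  length≡∑ []       = refl
  length≡∑ (x ∷ xs) = cong (λ z → 1ℤ ℤ.+ z) (length≡∑ xs)

  ∑-filter : ∀ {A : Set} {P : A → Set} (P? : ∀ x → Dec (P x)) (xs : List A) f → ∑ (filter P? xs) f ≡ ∑ xs (λ x → ⟦ P? x ⟧ ℤ.* f x)
  ∑-filter P? []       f = refl
  ∑-filter P? (x ∷ xs) f with does (P? x)
  ... | true  = cong₂ ℤ._+_ (sym (ℤ.*-identityˡ (f x))) (∑-filter P? xs f)
  ... | false = trans (∑-filter P? xs f) (sym (trans (cong (λ z → z ℤ.+ ∑ xs (λ x → ⟦ P? x ⟧ ℤ.* f x)) (ℤ.*-zeroˡ (f x))) (ℤ.+-identityˡ _)))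

  length-filter : ∀ {A : Set} {P : A → Set} (P? : ∀ x → Dec (P x)) (xs : List A) → ℤ.+ length (filter P? xs) ≡ ∑ xs (λ x → ⟦ P? x ⟧)
  length-filter P? xs = trans (length≡∑ (filter P? xs)) (trans (∑-filter P? xs (λ _ → 1ℤ)) (∑-cong xs (λ x → ℤ.*-identityʳ ⟦ P? x ⟧)))

  ⟦⟧-cong : ∀ {P Q : Set} → (P → Q) → (Q → P) → (d : Dec P) (d′ : Dec Q) → ⟦ d ⟧ ≡ ⟦ d′ ⟧
  ⟦⟧-cong to from (yes _) (yes _) = refl
  ⟦⟧-cong to from (yes p) (no ¬q) = contradiction (to p) ¬q
  ⟦⟧-cong to from (no ¬p) (yes q) = contradiction (from q) ¬p
  ⟦⟧-cong to from (no _)  (no _)  = refl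

  ⟦⟧-× : ∀ {P Q : Set} (d : Dec P) (d′ : Dec Q) → ⟦ d ×-dec d′ ⟧ ≡ ⟦ d ⟧ ℤ.* ⟦ d′ ⟧
  ⟦⟧-× (yes _) (yes _) = refl
  ⟦⟧-× (yes _) (no _)  = refl
  ⟦⟧-× (no _)  (yes _) = refl
  ⟦⟧-× (no _)  (no _)  = refl

subℤₚ-self : ∀ {p} (x : Fin p) → toℕ (subℤₚ x x) ≡ 0
subℤₚ-self {suc k} x = trans (Fin.toℕ-fromℕ< (ℕ.m%n<n (toℕ x ℕ.+ (suc k ℕ.∸ toℕ x)) (suc k)))
  (trans (cong (ℕ._% suc k) (ℕ.m+[n∸m]≡n (ℕ.<⇒≤ (Fin.toℕ<n x)))) (ℕ.n%n≡0 (suc k)))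

zipWith-subℤₚ-self : ∀ {p n} (u : Vec (Fin p) n) → VecAll.All (λ x → toℕ x ≡ 0) (Vec.zipWith subℤₚ u u)
zipWith-subℤₚ-self []      = VecAll.[]
zipWith-subℤₚ-self (x ∷ u) = subℤₚ-self x VecAll.∷ zipWith-subℤₚ-self u

module Assembly (p₁ e h : ℕ) (p-prime : Prime (suc p₁)) (1≤e : 1 ℕ.≤ e) (GF : GaloisField (suc p₁) e) (p^e≡ : suc p₁ ℕ.^ e ≡ 8 ℕ.* h ℕ.+ 3) where

  private
    p : ℕ
    p = suc p₁

    K : Set
    K = Vec (Fin p) e

    F : Field K
    F = GaloisField.baseField GF

    module F = Field F
    module FK = RingKit F.commutativeRing

    q≡p^e : suc ((1 ℕ.+ 4 ℕ.* h) ℕ.+ (1 ℕ.+ 4 ℕ.* h)) ≡ p ℕ.^ e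
    q≡p^e = trans (ℕ.+-*-Solver.solve 1 (λ h → let open ℕ.+-*-Solver in con 1 :+ ((con 1 :+ con 4 :* h) :+ (con 1 :+ con 4 :* h)) := con 8 :* h :+ con 3) refl h) (sym p^e≡)

    multiple≡0 : ∀ n → p ℕ.∣ n → n FK.· F.1# ≡ F.0#
    multiple≡0 n p∣n = Characteristic.∣⇒≈0 F.commutativeRing p p-prime (GaloisField.characteristic GF) p∣n

    p∣p^ : ∀ e → 1 ℕ.≤ e → p ℕ.∣ p ℕ.^ e
    p∣p^ (suc e) _ = ℕ.m∣m*n (p ℕ.^ e)

  𝕊 : Setting
  𝕊 = record
    { F = F ; 𝕂 = Vec-enumeration (Fin-enumeration p) e ; h = h
    ; size = trans (length-Vec-elements (allFin p) e) (trans (cong (ℕ._^ e) (List.length-tabulate id)) (sym q≡p^e))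
    ; q≡0 = multiple≡0 _ (subst (p ℕ.∣_) (sym q≡p^e) (p∣p^ e 1≤e))
    ; p = p ; p-prime = p-prime ; p≡0 = GaloisField.characteristic GF ; e = e ; q≡p^e = q≡p^e }

  module Count (σ : ℤ) (σ-unit : σ ≡ 1ℤ ⊎ σ ≡ ℤ.-1ℤ)
    (four : (CharacterSums.β 𝕊 ℤ.- σ ℤ.* CharacterSums.α 𝕊) ℤ.* (CharacterSums.β 𝕊 ℤ.- σ ℤ.* CharacterSums.α 𝕊) ≡ ℤ.+ 4) where
    open Blocks 𝕊 σ σ-unit four
    open Counting
    open Profile using (doubled; total)
    open ≡.≡-Reasoning

    private
      V : Set
      V = Vec (Fin p) (e ℕ.+ e)

      𝕍 : Enumeration V
      𝕍 = Vec-enumeration (Fin-enumeration p) (e ℕ.+ e)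
      module 𝕍 = Enumeration 𝕍

      Γ : Set
      Γ = G p (e ℕ.+ e)

      elementsΓ : List Γ
      elementsΓ = cartesianProduct (allFin 2) 𝕍.elements

      φ : V → L
      φ v = Vec.take e v , Vec.drop e v

      φ⁻¹ : L → V
      φ⁻¹ (a , b) = a Vec.++ b

      φ⁻¹-φ : ∀ v → φ⁻¹ (φ v) ≡ v
      φ⁻¹-φ v = Vec.take++drop≡id e v

      φ-φ⁻¹ : ∀ z → φ (φ⁻¹ z) ≡ z
      φ-φ⁻¹ (a , b) = let l , r = Vec.++-injective (Vec.take e (a Vec.++ b)) a (Vec.take++drop≡id e (a Vec.++ b)) in cong₂ _,_ l r

      φ-injective : ∀ {v w} → φ v ≡ φ w → v ≡ w
      φ-injective {v} {w} eq = trans (sym (φ⁻¹-φ v)) (trans (cong φ⁻¹ eq) (φ⁻¹-φ w))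

      φ-sub : ∀ v w → φ (Vec.zipWith subℤₚ v w) ≡ φ v L.- φ w
      φ-sub v w = cong₂ _,_
        (trans (Vec.take-zipWith subℤₚ v w) (GaloisField.zipWith-subℤₚ GF (Vec.take e v) (Vec.take e w)))
        (trans (Vec.drop-zipWith subℤₚ v w) (GaloisField.zipWith-subℤₚ GF (Vec.drop e v) (Vec.drop e w)))

      ∑V : (V → ℤ) → ℤ
      ∑V = Σℤ.∑ 𝕍.elements

      ∑V-φ : ∀ f → ∑V (f ∘ φ) ≡ ∑L f
      ∑V-φ f = sym (Σℤ.∑-bijection 𝕍 𝕃 φ φ⁻¹ φ⁻¹-φ φ-φ⁻¹ f)

    -- The two functions of a pair describe the parts of a block in the two cosets of 𝔽_{q²}.
    part : Profile × Profile → Fin 2 → Profile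
    part (P , P′) 0F = P
    part (P , P′) 1F = P′

    member? : ∀ B (x : Γ) → Dec (doubled (part B (proj₁ x)) (φ (proj₂ x)) ≡ ℤ.+ 2)
    member? B (a , v) = doubled (part B a) (φ v) ℤ.≟ ℤ.+ 2

    block : Profile × Profile → List Γ
    block B = filter (member? B) elementsΓ

    elementsΓ-unique : Unique elementsΓ
    elementsΓ-unique = Unique.cartesianProduct⁺ (Unique.allFin⁺ 2) 𝕍.unique

    block-unique : ∀ B → Unique (block B)
    block-unique B = Unique.filter⁺ (member? B) elementsΓ-unique

    BinaryPair : Profile × Profile → Set
    BinaryPair (P , P′) = Binary (origin P) × Binary (origin P′)

    private
      χ : Profile → L → ℤ
      χ P z = Σℤ.⟦ doubled P z ℤ.≟ ℤ.+ 2 ⟧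

      2χ : ∀ P → Binary (origin P) → ∀ z → ℤ.+ 2 ℤ.* χ P z ≡ doubled P z
      2χ P bin z = go (doubled-binary P bin z)
        where
        go : Binary (doubled P z) → ℤ.+ 2 ℤ.* χ P z ≡ doubled P z
        go (inj₁ ≡0) = trans (cong (λ i → ℤ.+ 2 ℤ.* Σℤ.⟦ i ℤ.≟ ℤ.+ 2 ⟧) ≡0) (sym ≡0)
        go (inj₂ ≡2) = trans (cong (λ i → ℤ.+ 2 ℤ.* Σℤ.⟦ i ℤ.≟ ℤ.+ 2 ⟧) ≡2) (sym ≡2)

      4χχ : ∀ P P′ → Binary (origin P) → Binary (origin P′) → ∀ g → ℤ.+ 4 ℤ.* ∑L (λ y → χ P (y L.+ g) ℤ.* χ P′ y) ≡ corr P P′ g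
      4χχ P P′ bin bin′ g = trans (Σℤ.∑-*ˡ 𝕃.elements (ℤ.+ 4) (λ y → χ P (y L.+ g) ℤ.* χ P′ y)) (Σℤ.∑-cong 𝕃.elements (λ y →
        trans (ℤSolver.solve 2 (λ a b → let open ℤSolver in con (ℤ.+ 4) :* (a :* b) := (con (ℤ.+ 2) :* a) :* (con (ℤ.+ 2) :* b)) refl (χ P (y L.+ g)) (χ P′ y))
              (cong₂ ℤ._*_ (2χ P bin (y L.+ g)) (2χ P′ bin′ y))))

    double-length : ∀ P P′ → BinaryPair (P , P′) → ℤ.+ 2 ℤ.* ℤ.+ length (block (P , P′)) ≡ total P ℤ.+ total P′
    double-length P P′ (bin , bin′) = begin
      ℤ.+ 2 ℤ.* ℤ.+ length (block (P , P′))
        ≡⟨ cong (λ z → ℤ.+ 2 ℤ.* z) (trans (length-filter (member? (P , P′)) elementsΓ) (Σℤ.∑-× (allFin 2) 𝕍.elements (λ x → Σℤ.⟦ member? (P , P′) x ⟧))) ⟩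
      ℤ.+ 2 ℤ.* (∑V (χ P ∘ φ) ℤ.+ (∑V (χ P′ ∘ φ) ℤ.+ 0ℤ))
        ≡⟨ cong₂ (λ a b → ℤ.+ 2 ℤ.* (a ℤ.+ (b ℤ.+ 0ℤ))) (∑V-φ (χ P)) (∑V-φ (χ P′)) ⟩
      ℤ.+ 2 ℤ.* (∑L (χ P) ℤ.+ (∑L (χ P′) ℤ.+ 0ℤ))
        ≡⟨ ℤSolver.solve 2 (λ a b → let open ℤSolver in con (ℤ.+ 2) :* (a :+ (b :+ con 0ℤ)) := con (ℤ.+ 2) :* a :+ con (ℤ.+ 2) :* b) refl (∑L (χ P)) (∑L (χ P′)) ⟩
      ℤ.+ 2 ℤ.* ∑L (χ P) ℤ.+ ℤ.+ 2 ℤ.* ∑L (χ P′)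
        ≡⟨ cong₂ ℤ._+_ (whole P bin) (whole P′ bin′) ⟩
      total P ℤ.+ total P′ ∎
      where
      whole : ∀ P → Binary (origin P) → ℤ.+ 2 ℤ.* ∑L (χ P) ≡ total P
      whole P bin = trans (Σℤ.∑-*ˡ 𝕃.elements (ℤ.+ 2) (χ P)) (trans (Σℤ.∑-cong 𝕃.elements (2χ P bin)) (Profile.∑L-doubled P))

    module _ (h : Fin 2) (v : V) (nonzero : ¬ isZero (h , v)) where
      private
        g : L
        g = φ v

      isZero-self : ∀ (x : Γ) → isZero (x −G x)
      isZero-self (a , w) = subℤₚ-self a , zipWith-subℤₚ-self w

      difference-dec : ∀ (x y : Γ) →
        Σℤ.⟦ ¬? (x ≟G y) ×-dec ((x −G y) ≟G (h , v)) ⟧ ≡ Σℤ.⟦ subℤₚ (proj₁ x) (proj₁ y) Fin.≟ h ⟧ ℤ.* Σℤ.⟦ φ (proj₂ x) 𝕃.≟ (φ (proj₂ y) L.+ g) ⟧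
      difference-dec x@(a , w) y@(b , w′) = trans
        (⟦⟧-cong to from (¬? (x ≟G y) ×-dec ((x −G y) ≟G (h , v))) ((subℤₚ a b Fin.≟ h) ×-dec (φ w 𝕃.≟ (φ w′ L.+ g))))
        (⟦⟧-× (subℤₚ a b Fin.≟ h) (φ w 𝕃.≟ (φ w′ L.+ g)))
        where
        to : x ≢ y × (x −G y) ≡ (h , v) → subℤₚ a b ≡ h × φ w ≡ φ w′ L.+ g
        to (_ , eq) = cong proj₁ eq , trans (Lₖ.Solver.solve 2 (λ x y → let open Lₖ.Solver in x := y :+ (x :- y)) refl (φ w) (φ w′))
          (cong (λ z → φ w′ L.+ z) (trans (sym (φ-sub w w′)) (cong (φ ∘ proj₂) eq)))
        from : subℤₚ a b ≡ h × φ w ≡ φ w′ L.+ g → x ≢ y × (x −G y) ≡ (h , v)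
        from (a-b , w≡) = (λ { refl → nonzero (subst isZero difference (isZero-self x)) }) , difference
          where
          difference : (x −G y) ≡ (h , v)
          difference = cong₂ _,_ a-b (φ-injective (trans (φ-sub w w′) (trans (cong (L._- φ w′) w≡) (Lₖ.Solver.solve 2 (λ x y → let open Lₖ.Solver in (x :+ y) :- x := y) refl (φ w′) g))))

      pairCount : Profile → Profile → ℤ
      pairCount P P′ = ∑L (λ y → χ P (y L.+ g) ℤ.* χ P′ y)

      private
        ∑VV : ∀ P P′ → ∑V (λ w → χ P (φ w) ℤ.* ∑V (λ w′ → χ P′ (φ w′) ℤ.* Σℤ.⟦ φ w 𝕃.≟ (φ w′ L.+ g) ⟧)) ≡ pairCount P P′
        ∑VV P P′ = begin
          ∑V (λ w → χ P (φ w) ℤ.* ∑V (λ w′ → χ P′ (φ w′) ℤ.* Σℤ.⟦ φ w 𝕃.≟ (φ w′ L.+ g) ⟧))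
            ≡⟨ trans (Σℤ.∑-cong 𝕍.elements (λ w → cong (λ z → χ P (φ w) ℤ.* z) (∑V-φ (λ y → χ P′ y ℤ.* Σℤ.⟦ φ w 𝕃.≟ (y L.+ g) ⟧)))) (∑V-φ (λ x → χ P x ℤ.* ∑L (λ y → χ P′ y ℤ.* Σℤ.⟦ x 𝕃.≟ (y L.+ g) ⟧))) ⟩
          ∑L (λ x → χ P x ℤ.* ∑L (λ y → χ P′ y ℤ.* Σℤ.⟦ x 𝕃.≟ (y L.+ g) ⟧))
            ≡⟨ Σℤ.∑-cong 𝕃.elements (λ x → trans (Σℤ.∑-*ˡ 𝕃.elements (χ P x) (λ y → χ P′ y ℤ.* Σℤ.⟦ x 𝕃.≟ (y L.+ g) ⟧))
                 (Σℤ.∑-cong 𝕃.elements (λ y → ℤSolver.solve 3 (λ a b d → let open ℤSolver in a :* (b :* d) := d :* (a :* b)) refl (χ P x) (χ P′ y) Σℤ.⟦ x 𝕃.≟ (y L.+ g) ⟧))) ⟩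
          ∑L (λ x → ∑L (λ y → Σℤ.⟦ x 𝕃.≟ (y L.+ g) ⟧ ℤ.* (χ P x ℤ.* χ P′ y)))
            ≡⟨ Σℤ.∑-swap 𝕃.elements 𝕃.elements (λ x y → Σℤ.⟦ x 𝕃.≟ (y L.+ g) ⟧ ℤ.* (χ P x ℤ.* χ P′ y)) ⟩
          ∑L (λ y → ∑L (λ x → Σℤ.⟦ x 𝕃.≟ (y L.+ g) ⟧ ℤ.* (χ P x ℤ.* χ P′ y)))
            ≡⟨ Σℤ.∑-cong 𝕃.elements (λ y → Σℤ.∑-⟦≟⟧ 𝕃 (y L.+ g) (λ x → χ P x ℤ.* χ P′ y)) ⟩
          pairCount P P′ ∎

      δ : Fin 2 → Fin 2 → ℤ
      δ a b = Σℤ.⟦ subℤₚ a b Fin.≟ h ⟧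

      countDiff≡ : ∀ B → ℤ.+ countDiff (block B) (h , v) ≡
        Σℤ.∑ (allFin 2) (λ a → Σℤ.∑ (allFin 2) (λ b → δ a b ℤ.* pairCount (part B a) (part B b)))
      countDiff≡ B = begin
        ℤ.+ countDiff (block B) (h , v)
          ≡⟨ trans (length-filter dec (cartesianProduct (block B) (block B))) (Σℤ.∑-× (block B) (block B) (λ xy → Σℤ.⟦ dec xy ⟧)) ⟩
        Σℤ.∑ (block B) (λ x → Σℤ.∑ (block B) (λ y → Σℤ.⟦ dec (x , y) ⟧))
          ≡⟨ trans (∑-filter (member? B) elementsΓ (λ x → Σℤ.∑ (block B) (λ y → Σℤ.⟦ dec (x , y) ⟧)))
               (Σℤ.∑-cong elementsΓ (λ x → cong (λ z → Σℤ.⟦ member? B x ⟧ ℤ.* z) (∑-filter (member? B) elementsΓ (λ y → Σℤ.⟦ dec (x , y) ⟧)))) ⟩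
        Σℤ.∑ elementsΓ (λ x → μ x ℤ.* Σℤ.∑ elementsΓ (λ y → μ y ℤ.* Σℤ.⟦ dec (x , y) ⟧))
          ≡⟨ Σℤ.∑-× (allFin 2) 𝕍.elements (λ x → μ x ℤ.* Σℤ.∑ elementsΓ (λ y → μ y ℤ.* Σℤ.⟦ dec (x , y) ⟧)) ⟩
        Σℤ.∑ (allFin 2) (λ a → ∑V (λ w → μ (a , w) ℤ.* Σℤ.∑ elementsΓ (λ y → μ y ℤ.* Σℤ.⟦ dec ((a , w) , y) ⟧)))
          ≡⟨ Σℤ.∑-cong (allFin 2) (λ a → trans (Σℤ.∑-cong 𝕍.elements (λ w → inner a w))
               (Σℤ.∑-swap 𝕍.elements (allFin 2) (λ w b → δ a b ℤ.* (μ (a , w) ℤ.* ∑V (λ w′ → μ (b , w′) ℤ.* Σℤ.⟦ φ w 𝕃.≟ (φ w′ L.+ g) ⟧))))) ⟩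
        Σℤ.∑ (allFin 2) (λ a → Σℤ.∑ (allFin 2) (λ b → ∑V (λ w → δ a b ℤ.* (μ (a , w) ℤ.* ∑V (λ w′ → μ (b , w′) ℤ.* Σℤ.⟦ φ w 𝕃.≟ (φ w′ L.+ g) ⟧)))))
          ≡⟨ Σℤ.∑-cong (allFin 2) (λ a → Σℤ.∑-cong (allFin 2) (λ b → trans (sym (Σℤ.∑-*ˡ 𝕍.elements (δ a b) (λ w → μ (a , w) ℤ.* ∑V (λ w′ → μ (b , w′) ℤ.* Σℤ.⟦ φ w 𝕃.≟ (φ w′ L.+ g) ⟧))))
               (cong (λ z → δ a b ℤ.* z) (∑VV (part B a) (part B b))))) ⟩
        Σℤ.∑ (allFin 2) (λ a → Σℤ.∑ (allFin 2) (λ b → δ a b ℤ.* pairCount (part B a) (part B b))) ∎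
        where
        μ : Γ → ℤ
        μ x = Σℤ.⟦ member? B x ⟧
        dec : ∀ (xy : Γ × Γ) → Dec (¬ (proj₁ xy ≡ proj₂ xy) × ((proj₁ xy −G proj₂ xy) ≡ (h , v)))
        dec xy = ¬? (proj₁ xy ≟G proj₂ xy) ×-dec ((proj₁ xy −G proj₂ xy) ≟G (h , v))
        inner : ∀ a w → μ (a , w) ℤ.* Σℤ.∑ elementsΓ (λ y → μ y ℤ.* Σℤ.⟦ dec ((a , w) , y) ⟧) ≡
          Σℤ.∑ (allFin 2) (λ b → δ a b ℤ.* (μ (a , w) ℤ.* ∑V (λ w′ → μ (b , w′) ℤ.* Σℤ.⟦ φ w 𝕃.≟ (φ w′ L.+ g) ⟧)))
        inner a w = trans (cong (λ z → μ (a , w) ℤ.* z) (Σℤ.∑-× (allFin 2) 𝕍.elements (λ y → μ y ℤ.* Σℤ.⟦ dec ((a , w) , y) ⟧)))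
          (trans (Σℤ.∑-*ˡ (allFin 2) (μ (a , w)) (λ b → ∑V (λ w′ → μ (b , w′) ℤ.* Σℤ.⟦ dec ((a , w) , (b , w′)) ⟧))) (Σℤ.∑-cong (allFin 2) (λ b →
            trans (cong (λ z → μ (a , w) ℤ.* z) (trans (Σℤ.∑-cong 𝕍.elements (λ w′ → trans (cong (λ z → μ (b , w′) ℤ.* z) (difference-dec (a , w) (b , w′)))
                (ℤSolver.solve 3 (λ x y z → let open ℤSolver in x :* (y :* z) := y :* (x :* z)) refl (μ (b , w′)) (δ a b) Σℤ.⟦ φ w 𝕃.≟ (φ w′ L.+ g) ⟧)))
                (sym (Σℤ.∑-*ˡ 𝕍.elements (δ a b) (λ w′ → μ (b , w′) ℤ.* Σℤ.⟦ φ w 𝕃.≟ (φ w′ L.+ g) ⟧)))))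
              (ℤSolver.solve 3 (λ x y z → let open ℤSolver in x :* (y :* z) := y :* (x :* z)) refl (μ (a , w)) (δ a b) (∑V (λ w′ → μ (b , w′) ℤ.* Σℤ.⟦ φ w 𝕃.≟ (φ w′ L.+ g) ⟧))))))

    private
      φ≢0 : ∀ v → ¬ isZero (0F , v) → φ v ≢ L.0#
      φ≢0 v nonzero φv≡0 = nonzero (refl , subst (VecAll.All (λ x → toℕ x ≡ 0)) (φ-injective (trans (φ-sub v v) (trans (L.-‿inverseʳ (φ v)) (sym φv≡0)))) (zipWith-subℤₚ-self v))

      4-count : ∀ h v (nonzero : ¬ isZero (h , v)) P P′ → BinaryPair (P , P′) → ℤ.+ 4 ℤ.* ℤ.+ countDiff (block (P , P′)) (h , v) ≡
        (δ h v nonzero 0F 0F ℤ.* corr P P (φ v) ℤ.+ δ h v nonzero 0F 1F ℤ.* corr P P′ (φ v)) ℤ.+ (δ h v nonzero 1F 0F ℤ.* corr P′ P (φ v) ℤ.+ δ h v nonzero 1F 1F ℤ.* corr P′ P′ (φ v))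
      4-count h v nonzero P P′ (bin , bin′) = trans (cong (λ z → ℤ.+ 4 ℤ.* z) (countDiff≡ h v nonzero (P , P′)))
        (trans (ℤSolver.solve 8 (λ a b c d w x y z → let open ℤSolver in con (ℤ.+ 4) :* ((a :* w :+ (b :* x :+ con 0ℤ)) :+ ((c :* y :+ (d :* z :+ con 0ℤ)) :+ con 0ℤ))
            := (a :* (con (ℤ.+ 4) :* w) :+ b :* (con (ℤ.+ 4) :* x)) :+ (c :* (con (ℤ.+ 4) :* y) :+ d :* (con (ℤ.+ 4) :* z))) refl
            (δ′ 0F 0F) (δ′ 0F 1F) (δ′ 1F 0F) (δ′ 1F 1F) (c P P) (c P P′) (c P′ P) (c P′ P′))
          (cong₂ ℤ._+_ (cong₂ (λ x y → δ′ 0F 0F ℤ.* x ℤ.+ δ′ 0F 1F ℤ.* y) (4χχ P P bin bin (φ v)) (4χχ P P′ bin bin′ (φ v)))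
                       (cong₂ (λ x y → δ′ 1F 0F ℤ.* x ℤ.+ δ′ 1F 1F ℤ.* y) (4χχ P′ P bin′ bin (φ v)) (4χχ P′ P′ bin′ bin′ (φ v)))))
        where
        δ′ = δ h v nonzero
        c = pairCount h v nonzero

      ∑-binary : ∀ (f g : Profile × Profile → ℤ) Bs → All BinaryPair Bs → (∀ {B} → BinaryPair B → f B ≡ g B) → Σℤ.∑ Bs f ≡ Σℤ.∑ Bs g
      ∑-binary f g []       []           eq = refl
      ∑-binary f g (B ∷ Bs) (bin ∷ bins) eq = cong₂ ℤ._+_ (eq bin) (∑-binary f g Bs bins eq)

      sum-count : ∀ x → ℤ.+ ListAction.sum (map (λ B → countDiff B x) (map block blocks)) ≡ Σℤ.∑ blocks (λ B → ℤ.+ countDiff (block B) x)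
      sum-count x = go blocks
        where
        go : ∀ Bs → ℤ.+ ListAction.sum (map (λ B → countDiff B x) (map block Bs)) ≡ Σℤ.∑ Bs (λ B → ℤ.+ countDiff (block B) x)
        go []       = refl
        go (B ∷ Bs) = cong (λ z → ℤ.+ countDiff (block B) x ℤ.+ z) (go Bs)

      4-total : ∀ x → ¬ isZero x → ℤ.+ 4 ℤ.* Σℤ.∑ blocks (λ B → ℤ.+ countDiff (block B) x) ≡ target
      4-total (0F , v) nonzero = trans (Σℤ.∑-*ˡ blocks (ℤ.+ 4) (λ B → ℤ.+ countDiff (block B) (0F , v))) (trans
        (∑-binary _ (λ (P , P′) → corr P P (φ v) ℤ.+ corr P′ P′ (φ v)) blocks origins-binary (λ {B} bin → trans (4-count 0F v nonzero (proj₁ B) (proj₂ B) bin)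
          (ℤSolver.solve 4 (λ w x y z → let open ℤSolver in (con 1ℤ :* w :+ con 0ℤ :* x) :+ (con 0ℤ :* y :+ con 1ℤ :* z) := w :+ z) refl
            (corr (proj₁ B) (proj₁ B) (φ v)) (corr (proj₁ B) (proj₂ B) (φ v)) (corr (proj₂ B) (proj₁ B) (φ v)) (corr (proj₂ B) (proj₂ B) (φ v)))))
        (within-parts (φ≢0 v nonzero)))
      4-total (1F , v) nonzero = trans (Σℤ.∑-*ˡ blocks (ℤ.+ 4) (λ B → ℤ.+ countDiff (block B) (1F , v))) (trans
        (∑-binary _ (λ (P , P′) → corr P P′ (φ v) ℤ.+ corr P′ P (φ v)) blocks origins-binary (λ {B} bin → trans (4-count 1F v nonzero (proj₁ B) (proj₂ B) bin)
          (ℤSolver.solve 4 (λ w x y z → let open ℤSolver in (con 0ℤ :* w :+ con 1ℤ :* x) :+ (con 1ℤ :* y :+ con 0ℤ :* z) := x :+ y) refl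
            (corr (proj₁ B) (proj₁ B) (φ v)) (corr (proj₁ B) (proj₂ B) (φ v)) (corr (proj₂ B) (proj₁ B) (φ v)) (corr (proj₂ B) (proj₂ B) (φ v)))))
        (across (φ v 𝕃.≟ L.0#)))
        where
        across : Dec (φ v ≡ L.0#) → Σℤ.∑ blocks (λ (P , P′) → corr P P′ (φ v) ℤ.+ corr P′ P (φ v)) ≡ target
        across (yes φv≡0) = trans (cong (λ g → Σℤ.∑ blocks (λ (P , P′) → corr P P′ g ℤ.+ corr P′ P g)) φv≡0) across-parts-0
        across (no φv≢0)  = across-parts φv≢0

      n : ℕ
      n = p ℕ.^ e ℕ.* p ℕ.^ e

      Q²≡n : ℤ.+ q ℤ.* ℤ.+ q ≡ ℤ.+ n
      Q²≡n = trans (cong (λ k → ℤ.+ k ℤ.* ℤ.+ k) q≡p^e) (sym (ℤ.pos-* (p ℕ.^ e) (p ℕ.^ e)))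

      1≤n : 1 ℕ.≤ n
      1≤n = ℕ.>-nonZero⁻¹ n {{ℕ.m*n≢0 (p ℕ.^ e) (p ℕ.^ e) {{ℕ.m^n≢0 p e}} {{ℕ.m^n≢0 p e}}}}

      ∸-ℤ : ∀ {a b} → b ℕ.≤ a → ℤ.+ (a ℕ.∸ b) ≡ ℤ.+ a ℤ.- ℤ.+ b
      ∸-ℤ {a} {b} b≤a = trans (sym (ℤ.⊖-≥ b≤a)) (sym (ℤ.m-n≡m⊖n a b))

      λ≡ : ∀ x → ¬ isZero x → ListAction.sum (map (λ B → countDiff B x) (map block blocks)) ≡ 2 ℕ.* n ℕ.∸ 2
      λ≡ x nonzero = ℤ.+-injective (ℤ.*-cancelˡ-≡ (ℤ.+ 4) _ _ (begin
        ℤ.+ 4 ℤ.* ℤ.+ ListAction.sum (map (λ B → countDiff B x) (map block blocks))   ≡⟨ cong (λ z → ℤ.+ 4 ℤ.* z) (sum-count x) ⟩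
        ℤ.+ 4 ℤ.* Σℤ.∑ blocks (λ B → ℤ.+ countDiff (block B) x)            ≡⟨ 4-total x nonzero ⟩
        ℤ.+ 8 ℤ.* (ℤ.+ q ℤ.* ℤ.+ q) ℤ.- ℤ.+ 8                              ≡⟨ cong (λ z → ℤ.+ 8 ℤ.* z ℤ.- ℤ.+ 8) Q²≡n ⟩
        ℤ.+ 8 ℤ.* ℤ.+ n ℤ.- ℤ.+ 8                                          ≡⟨ ℤSolver.solve 1 (λ n → let open ℤSolver in con (ℤ.+ 8) :* n :- con (ℤ.+ 8) := con (ℤ.+ 4) :* (con (ℤ.+ 2) :* n :- con (ℤ.+ 2))) refl (ℤ.+ n) ⟩
        ℤ.+ 4 ℤ.* (ℤ.+ 2 ℤ.* ℤ.+ n ℤ.- ℤ.+ 2)                              ≡⟨ cong (λ z → ℤ.+ 4 ℤ.* z) (trans (cong (ℤ._- ℤ.+ 2) (sym (ℤ.pos-* 2 n))) (sym (∸-ℤ (ℕ.*-monoʳ-≤ 2 1≤n)))) ⟩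
        ℤ.+ 4 ℤ.* ℤ.+ (2 ℕ.* n ℕ.∸ 2)                                      ∎))

      length≡ : ∀ {P P′ k} → BinaryPair (P , P′) → total P ℤ.+ total P′ ≡ ℤ.+ 2 ℤ.* ℤ.+ k → length (block (P , P′)) ≡ k
      length≡ {P} {P′} bin eq = ℤ.+-injective (ℤ.*-cancelˡ-≡ (ℤ.+ 2) _ _ (trans (double-length P P′ bin) eq))

      2Q² : ℤ.+ 2 ℤ.* (ℤ.+ q ℤ.* ℤ.+ q) ≡ ℤ.+ 2 ℤ.* ℤ.+ n
      2Q² = cong (λ z → ℤ.+ 2 ℤ.* z) Q²≡n

      2Q²-2 : ℤ.+ 2 ℤ.* (ℤ.+ q ℤ.* ℤ.+ q) ℤ.- ℤ.+ 2 ≡ ℤ.+ 2 ℤ.* ℤ.+ (n ℕ.∸ 1)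
      2Q²-2 = trans (cong (ℤ._- ℤ.+ 2) 2Q²) (trans (ℤSolver.solve 1 (λ n → let open ℤSolver in con (ℤ.+ 2) :* n :- con (ℤ.+ 2) := con (ℤ.+ 2) :* (n :- con 1ℤ)) refl (ℤ.+ n)) (cong (λ z → ℤ.+ 2 ℤ.* z) (sym (∸-ℤ 1≤n))))

      lengths : ∀ {a b c d} → map (λ (P , P′) → total P ℤ.+ total P′) blocks ≡ ℤ.+ 2 ℤ.* ℤ.+ a ∷ ℤ.+ 2 ℤ.* ℤ.+ b ∷ ℤ.+ 2 ℤ.* ℤ.+ c ∷ ℤ.+ 2 ℤ.* ℤ.+ d ∷ [] →
        All BinaryPair blocks → map length (map block blocks) ≡ a ∷ b ∷ c ∷ d ∷ []
      lengths eq (b₁ ∷ b₂ ∷ b₃ ∷ b₄ ∷ []) =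
        cong₂ _∷_ (length≡ b₁ (List.∷-injectiveˡ eq)) (cong₂ _∷_ (length≡ b₂ (List.∷-injectiveˡ (List.∷-injectiveʳ eq)))
        (cong₂ _∷_ (length≡ b₃ (List.∷-injectiveˡ (List.∷-injectiveʳ (List.∷-injectiveʳ eq))))
        (cong (_∷ []) (length≡ b₄ (List.∷-injectiveˡ (List.∷-injectiveʳ (List.∷-injectiveʳ (List.∷-injectiveʳ eq))))))))

    family : IsDifferenceFamily {p} {e ℕ.+ e} (map block blocks) (n ∷ n ∷ n ∷ n ℕ.∸ 1 ∷ []) (2 ℕ.* n ℕ.∸ 2)
    family = block-unique _ ∷ block-unique _ ∷ block-unique _ ∷ block-unique _ ∷ []
           , lengths (trans totals (cong₂ _∷_ 2Q² (cong₂ _∷_ 2Q² (cong₂ _∷_ 2Q² (cong (_∷ []) 2Q²-2))))) origins-binary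
           , λ≡

  private
    module C = CharacterSums 𝕊
    module PP = Primitivity 𝕊

  Result : Set
  Result = ∃[ Bs ] IsDifferenceFamily {p} {e ℕ.+ e} Bs
    (p ℕ.^ e ℕ.* p ℕ.^ e ∷ p ℕ.^ e ℕ.* p ℕ.^ e ∷ p ℕ.^ e ℕ.* p ℕ.^ e ∷ p ℕ.^ e ℕ.* p ℕ.^ e ℕ.∸ 1 ∷ [])
    (2 ℕ.* (p ℕ.^ e ℕ.* p ℕ.^ e) ℕ.∸ 2)

  difference-family : ∀ c → ℤ.+ (p ℕ.^ e) ≡ (ℤ.+ 12 ℤ.* c ℤ.* c) ℤ.+ (ℤ.+ 4 ℤ.* c) ℤ.+ ℤ.+ 3 → Result
  difference-family c eq = [ with-sign 1ℤ (inj₁ refl) ∘ trans (ℤS.solve 2 (λ a b → let open ℤS in (b :- con 1ℤ :* a) :* (b :- con 1ℤ :* a) := (a :- b) :* (a :- b)) refl C.α C.β)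
                           , with-sign ℤ.-1ℤ (inj₂ refl) ∘ trans (ℤS.solve 2 (λ a b → let open ℤS in (b :- con ℤ.-1ℤ :* a) :* (b :- con ℤ.-1ℤ :* a) := (a :+ b) :* (a :+ b)) refl C.α C.β) ]′
    (PrimitiveRepresentation.difference-or-sum p e p-prime PP.p∤2 1≤e {C.β} {C.α} {ℤ.+ 2 ℤ.* c ℤ.- 1ℤ} {ℤ.+ 2 ℤ.* c ℤ.+ 1ℤ}
      (trans (cong ℤ.+_ (sym q≡p^e)) C.q≡β²+2α²)
      (trans eq (ℤS.solve 1 (λ c → let open ℤS in con (ℤ.+ 12) :* c :* c :+ con (ℤ.+ 4) :* c :+ con (ℤ.+ 3)
        := (con (ℤ.+ 2) :* c :- con 1ℤ) :* (con (ℤ.+ 2) :* c :- con 1ℤ) :+ con (ℤ.+ 2) :* ((con (ℤ.+ 2) :* c :+ con 1ℤ) :* (con (ℤ.+ 2) :* c :+ con 1ℤ))) refl c))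
      PP.coprime
      (ℤS.solve 1 (λ c → let open ℤS in (con (ℤ.+ 2) :* c :+ con 1ℤ) :- (con (ℤ.+ 2) :* c :- con 1ℤ) := con (ℤ.+ 2)) refl c))
    where
    module ℤS = RingKit.Solver ℤ.+-*-commutativeRing
    with-sign : ∀ σ → σ ≡ 1ℤ ⊎ σ ≡ ℤ.-1ℤ → (C.β ℤ.- σ ℤ.* C.α) ℤ.* (C.β ℤ.- σ ℤ.* C.α) ≡ ℤ.+ 4 → Result
    with-sign σ σ-unit four = _ , Count.family σ σ-unit four

eighth-of : ∀ n c → ℤ.+ n ≡ (ℤ.+ 12 ℤ.* c ℤ.* c) ℤ.+ (ℤ.+ 4 ℤ.* c) ℤ.+ ℤ.+ 3 → ∃ λ h → n ≡ 8 ℕ.* h ℕ.+ 3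
eighth-of n c eq = nonnegative (parity-case (c ℤ.%ℕ 2) refl (ℤ.n%ℕd<d c 2))
  where
  module ℤS = RingKit.Solver ℤ.+-*-commutativeRing
  d : ℤ
  d = c ℤ./ℕ 2
  parity-case : ∀ r → c ℤ.%ℕ 2 ≡ r → r ℕ.< 2 → ∃ λ x → ℤ.+ n ≡ ℤ.+ 8 ℤ.* x ℤ.+ ℤ.+ 3
  parity-case 0 r≡ _ = ℤ.+ 6 ℤ.* d ℤ.* d ℤ.+ d , trans eq (trans (cong (λ c → (ℤ.+ 12 ℤ.* c ℤ.* c) ℤ.+ (ℤ.+ 4 ℤ.* c) ℤ.+ ℤ.+ 3) (trans (ℤ.a≡a%ℕn+[a/ℕn]*n c 2) (cong (λ r → ℤ.+ r ℤ.+ d ℤ.* ℤ.+ 2) r≡)))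
    (ℤS.solve 1 (λ d → let open ℤS ; c = con 0ℤ :+ d :* con (ℤ.+ 2) in con (ℤ.+ 12) :* c :* c :+ con (ℤ.+ 4) :* c :+ con (ℤ.+ 3) := con (ℤ.+ 8) :* (con (ℤ.+ 6) :* d :* d :+ d) :+ con (ℤ.+ 3)) refl d))
  parity-case 1 r≡ _ = ℤ.+ 6 ℤ.* d ℤ.* d ℤ.+ ℤ.+ 7 ℤ.* d ℤ.+ ℤ.+ 2 , trans eq (trans (cong (λ c → (ℤ.+ 12 ℤ.* c ℤ.* c) ℤ.+ (ℤ.+ 4 ℤ.* c) ℤ.+ ℤ.+ 3) (trans (ℤ.a≡a%ℕn+[a/ℕn]*n c 2) (cong (λ r → ℤ.+ r ℤ.+ d ℤ.* ℤ.+ 2) r≡)))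
    (ℤS.solve 1 (λ d → let open ℤS ; c = con 1ℤ :+ d :* con (ℤ.+ 2) in con (ℤ.+ 12) :* c :* c :+ con (ℤ.+ 4) :* c :+ con (ℤ.+ 3) := con (ℤ.+ 8) :* (con (ℤ.+ 6) :* d :* d :+ con (ℤ.+ 7) :* d :+ con (ℤ.+ 2)) :+ con (ℤ.+ 3)) refl d))
  parity-case (suc (suc _)) _ (s≤s (s≤s ()))
  nonnegative : (∃ λ x → ℤ.+ n ≡ ℤ.+ 8 ℤ.* x ℤ.+ ℤ.+ 3) → ∃ λ h → n ≡ 8 ℕ.* h ℕ.+ 3
  nonnegative (ℤ.+ h , eq) = h , ℤ.+-injective (trans eq (cong (ℤ._+ ℤ.+ 3) (sym (ℤ.pos-* 8 h))))
  nonnegative (-[1+ x ] , eq) = contradiction (ℤ.+-injective {n ℕ.+ (8 ℕ.* x ℕ.+ 5)} {0} (begin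
    ℤ.+ n ℤ.+ ℤ.+ (8 ℕ.* x ℕ.+ 5)                                      ≡⟨ cong₂ ℤ._+_ eq (cong (ℤ._+ ℤ.+ 5) (ℤ.pos-* 8 x)) ⟩
    (ℤ.+ 8 ℤ.* -[1+ x ] ℤ.+ ℤ.+ 3) ℤ.+ (ℤ.+ 8 ℤ.* ℤ.+ x ℤ.+ ℤ.+ 5)     ≡⟨ cong (λ y → (ℤ.+ 8 ℤ.* y ℤ.+ ℤ.+ 3) ℤ.+ (ℤ.+ 8 ℤ.* ℤ.+ x ℤ.+ ℤ.+ 5)) (ℤ.neg-distrib-+ 1ℤ (ℤ.+ x)) ⟩
    (ℤ.+ 8 ℤ.* (ℤ.-1ℤ ℤ.- ℤ.+ x) ℤ.+ ℤ.+ 3) ℤ.+ (ℤ.+ 8 ℤ.* ℤ.+ x ℤ.+ ℤ.+ 5) ≡⟨ ℤS.solve 1 (λ x → let open ℤS in (con (ℤ.+ 8) :* (con ℤ.-1ℤ :- x) :+ con (ℤ.+ 3)) :+ (con (ℤ.+ 8) :* x :+ con (ℤ.+ 5)) := con 0ℤ) refl (ℤ.+ x) ⟩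
    0ℤ                                                                 ∎))
    (λ eq → contradiction (ℕ.m+n≡0⇒n≡0 (8 ℕ.* x) (ℕ.m+n≡0⇒n≡0 n eq)) λ ())
    where open ≡.≡-Reasoning

open import Data.Nat using (_*_; _^_; _∸_; _≤_)
open import Data.Integer using (+_) renaming (_+_ to _+ℤ_; _*_ to _*ℤ_)

theorem1p2 : (p e : ℕ) → Prime p → 1 ≤ e → (c : ℤ) →
    + (p ^ e) ≡ (+ 12 *ℤ c *ℤ c) +ℤ (+ 4 *ℤ c) +ℤ + 3 →
    ∃[ Bs ] IsDifferenceFamily {p} {2 * e} Bs
    ((p ^ e) * (p ^ e) ∷ (p ^ e) * (p ^ e) ∷ (p ^ e) * (p ^ e) ∷ (p ^ e) * (p ^ e) ∸ 1 ∷ [])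
    (2 * ((p ^ e) * (p ^ e)) ∸ 2)
theorem1p2 zero     e p-prime _   c eq = contradiction refl (ℕ.≢-nonZero⁻¹ 0 {{prime⇒nonZero p-prime}})
theorem1p2 (suc p₁) e p-prime 1≤e c eq = subst
  (λ m → ∃[ Bs ] IsDifferenceFamily {suc p₁} {m} Bs (n ∷ n ∷ n ∷ n ∸ 1 ∷ []) (2 * n ∸ 2))
  (cong (e ℕ.+_) (sym (ℕ.+-identityʳ e)))
  (let h , p^e≡ = eighth-of (suc p₁ ^ e) c eq in Assembly.difference-family p₁ e h p-prime 1≤e (galois-field p-prime 1≤e) p^e≡ c eq)
  where n = (suc p₁ ^ e) * (suc p₁ ^ e)
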